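{- Each of the following constructions yields a safe base graph: (i) a safe split-and-glue of a safe base graph $G$ whose ear is the double butterfly (equipped with a safe ear cover, with gluing vertices $a_1',b_1',a_2',b_2'$ identified with $a_1,b_1,a_2,b_2$ respectively); (ii) a $k$-sum of a safe base graph and an independent graph, for any $k\ge 0$; (iii) a Henneberg-I extension on a safe base graph.
   Context: All graphs are finite and simple. Rank and independence refer to the 3-dimensional generic rigidity matroid $\mathcal{R}_3$; $\mathrm{rank}(G)$ is the rank of $E(G)$, $G$ is independent if $\mathrm{rank}(G)=|E(G)|$. For a set $F$ of vertex pairs, $G_F=G\cup F$ is $G$ with the pairs of $F$ having both endpoints in $V(G)$ added as edges; $G_F[X]$ is its induced subgraph on $X$. 2-thin covers: a 2-thin cover of $G$ is a collection $\mathcal X=\{X_1,\dots,X_k\}$ of subsets (clusters) of $V(G)$ with $|X_i|\ge 2$, $|X_i\cap X_j|\le 2$, $X_i\not\subset X_j$ for $i\ne j$, such that both endpoints of each edge lie in some cluster. Its shared set $S(\mathcal X)$ is the set of pairs $\{u,v\}$ equal to $X_i\cap X_j$ for some $i\ne j$; $\mathcal X$ is independent if the graph formed by $S(\mathcal X)$ is independent. $d(\mathcal X,e)$ is the number of clusters containing both endpoints of $e$. For a set $K$ of pairs, $IE_K(G,\mathcal X)=\sum_i\mathrm{rank}(G_{S(\mathcal X)\cup K}[X_i])-\sum_{e\in S(\mathcal X)\cup K}(d(\mathcal X,e)-1)$, $IE(G,\mathcal X)=IE_\emptyset(G,\mathcal X)$. Nonedge-split of a nonedge $(a,b)$: add new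 vertices $a_1,a_2$ whose neighbourhoods partition $N(a)$, new vertices $b_1,b_2$ whose neighbourhoods partition $N(b)$, delete $a,b$; result $G^s$. A safe nonedge-split on $(G,\mathcal X)$ is a nonedge-split of a nonedge $(a,b)$ with $\{a,b\}\in S(\mathcal X)$ such that, with $X_i'=(X_i\setminus\{a,b\})\cup W_i$ where $W_i$ is the set of vertices of $\{a_1,a_2,b_1,b_2\}$ adjacent in $G^s$ to some vertex of $X_i$: (S1) whenever $X_i$ contains both endpoints of some pair of $S(\mathcal X)$ that is a nonedge of $G$, neither $\{a_1,a_2\}$ nor $\{b_1,b_2\}$ is a subset of $X_i'$; (S2) if $X_i\cap X_j=\{a,u\}$ with $u\ne b$ and $(a,u)$ a nonedge of $G$, then $X_i'\cap\{a_1,a_2\}=X_j'\cap\{a_1,a_2\}$, and symmetrically for $b,b_1,b_2$. The safe split cover $\mathcal X^s$ of $G^s$ consists of those $X_i'$ of size greater than two containing neither $\{a_1,a_2\}$ nor $\{b_1,b_2\}$, together with the endpoint pairs of the edges of $G^s$ not contained in any of these sets. A key gluing pair of $G^s$ is a pair of distinct vertices of $\{a_1,a_2,b_1,b_2\}$ contained in some cluster of $\mathcal X^s$. A safe base graph is an independent graph $G$ with an independent 2-thin cover $\mathcal X$ such that $\mathrm{rank}(G)=IE(G,\mathcal X)$ and $S(\mathcal X)$ contains a nonedge $(a,b)$ of $G$ that can be split by a safe nonedge-split on $(G,\mathcal X)$. A safe ear is a graph $H$ with an independent 2-thin cover $\mathcal X^H$ (safe ear cover) and a set of gluing vertices such that,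 calling a key gluing pair of $H$ any pair of distinct gluing vertices in a common cluster of $\mathcal X^H$ and $K_H$ their set: (E1) each cluster contains at most two gluing vertices; (E2) $S(\mathcal X^H)\cup F$ is independent, $F$ the set of all pairs of distinct gluing vertices; (E3) $\mathrm{rank}(H)=IE_{K_H}(H,\mathcal X^H)-1$. A safe split-and-glue of $G$ and a vertex-disjoint safe ear $H$: a safe nonedge-split on $(G,\mathcal X)$ yielding $G^s$, then $G^s:H$ is formed by bijectively identifying gluing vertices of $G^s$ (a subset of $\{a_1,a_2,b_1,b_2\}$ containing all endpoints of key gluing pairs) with the gluing vertices of $H$ so that key gluing pairs correspond bijectively. The double butterfly is the graph on vertices $a_1',b_1',a_2',b_2',u,v,c,c'$ whose sixteen edges are: $u$ and $v$ each joined to $a_1',b_1',a_2',b_2'$; $c$ joined to $a_1',b_1',u,v$; $c'$ joined to $a_2',b_2',u,v$. $k$-sum: choose complete subgraphs on $k$ vertices in each of two vertex-disjoint graphs and identify them via a vertex bijection, replacing multiple edges by single edges. Henneberg-I extension: add a new vertex adjacent to three existing vertices. -}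

module Defs where

open import Data.Nat using (ℕ; zero; suc; _≤_; _<ᵇ_)
open import Data.Bool using (Bool; true; false; _∧_; _∨_; not; _xor_; T; if_then_else_)
open import Data.Fin using (Fin; zero; suc; toℕ; _≟_)
open import Data.List using (List; length; lookup)
open import Data.List.Relation.Unary.All using (All)
open import Data.Product using (Σ; ∃; _×_; _,_; proj₁; proj₂)
open import Data.Sum using (_⊎_)
open import Relation.Nullary using (¬_)
open import Relation.Nullary.Decidable using (⌊_⌋)
open import Relation.Binary.PropositionalEquality using (_≡_; _≢_; refl)
open import Function.Definitions using (Injective)
open import Data.Rational as ℚ using (ℚ; 0ℚ)
open import Data.Integer as ℤ using (ℤ; +_; 0ℤ; 1ℤ)

_==_ : ∀ {n} → Fin n → Fin n → Bool
x == y = ⌊ x ≟ y ⌋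

anyF : ∀ {n} → (Fin n → Bool) → Bool
anyF {zero}  f = false
anyF {suc n} f = f zero ∨ anyF (λ i → f (suc i))

allF : ∀ {n} → (Fin n → Bool) → Bool
allF {zero}  f = true
allF {suc n} f = f zero ∧ allF (λ i → f (suc i))

countF : ∀ {n} → (Fin n → Bool) → ℕ
countF {zero}  f = 0
countF {suc n} f = (if f zero then 1 else 0) Data.Nat.+ countF (λ i → f (suc i))

sumℕ : ∀ {n} → (Fin n → ℕ) → ℕ
sumℕ {zero}  f = 0
sumℕ {suc n} f = f zero Data.Nat.+ sumℕ (λ i → f (suc i))

sumℤ : ∀ {n} → (Fin n → ℤ) → ℤ
sumℤ {zero}  f = 0ℤ
sumℤ {suc n} f = f zero ℤ.+ sumℤ (λ i → f (suc i))

sumℚ : ∀ {n} → (Fin n → ℚ) → ℚ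
sumℚ {zero}  f = 0ℚ
sumℚ {suc n} f = f zero ℚ.+ sumℚ (λ i → f (suc i))

sumPairs : ∀ {n} → (Fin n → Fin n → ℤ) → ℤ
sumPairs f = sumℤ (λ u → sumℤ (λ v → if toℕ u <ᵇ toℕ v then f u v else 0ℤ))

-- a set of (unordered) vertex pairs, as a Boolean predicate on Fin n
PairSet : ℕ → Set
PairSet n = Fin n → Fin n → Bool

numPairs : ∀ {n} → PairSet n → ℕ
numPairs E = sumℕ (λ u → countF (λ v → (toℕ u <ᵇ toℕ v) ∧ E u v))

record Graph (n : ℕ) : Set where
  field
    adj : Fin n → Fin n → Bool
    sym : ∀ u v → adj u v ≡ adj v u
    irr : ∀ u → adj u u ≡ false
open Graph public

-- The 3-dimensional generic rigidity matroid.
-- A list L of vertex pairs is independent iff for some placement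
-- p : Fin n → ℚ³ the rows of the rigidity matrix indexed by L are linearly
-- independent.  (Generic rank = maximum rank over all placements, and the
-- maximum is attained at rational points, which are Zariski dense.)

Placement : ℕ → Set
Placement n = Fin n → Fin 3 → ℚ

rigRow : ∀ {n} → Placement n → Fin n × Fin n → Fin n → Fin 3 → ℚ
rigRow p (u , v) w c =
  if w == u then p u c ℚ.- p v c
  else if w == v then p v c ℚ.- p u c
  else 0ℚ

IndepList : ∀ {n} → List (Fin n × Fin n) → Set
IndepList {n} L =
  Σ (Placement n) λ p →
    (coef : Fin (length L) → ℚ) →
    (∀ (w : Fin n) (c : Fin 3) → sumℚ (λ e → coef e ℚ.* rigRow p (lookup L e) w c) ≡ 0ℚ) →
    ∀ e → coef e ≡ 0ℚ

InSet : ∀ {n} → PairSet n → Fin n × Fin n → Set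
InSet E (u , v) = T (E u v)

HasRank : ∀ {n} → PairSet n → ℕ → Set
HasRank {n} E r =
  (Σ (List (Fin n × Fin n)) λ L → All (InSet E) L × IndepList L × length L ≡ r) ×
  (∀ (L : List (Fin n × Fin n)) → All (InSet E) L → IndepList L → length L ≤ r)

IndepPairs : ∀ {n} → PairSet n → Set
IndepPairs E = HasRank E (numPairs E)

IndependentGraph : ∀ {n} → Graph n → Set
IndependentGraph G = IndepPairs (adj G)

record Cover (n : ℕ) : Set where
  field
    k : ℕ
    X : Fin k → Fin n → Bool
open Cover public

inter : ∀ {n} → (Fin n → Bool) → (Fin n → Bool) → Fin n → Bool
inter A B w = A w ∧ B w

record TwoThin {n} (G : Graph n) (𝒳 : Cover n) : Set where
  field
    size≥2   : ∀ i → 2 ≤ countF (X 𝒳 i)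
    thin     : ∀ i j → i ≢ j → countF (inter (X 𝒳 i) (X 𝒳 j)) ≤ 2
    noSubset : ∀ i j → i ≢ j → ¬ (∀ w → T (X 𝒳 i w) → T (X 𝒳 j w))
    covers   : ∀ u v → T (adj G u v) → ∃ λ i → T (X 𝒳 i u) × T (X 𝒳 i v)

sameSet : ∀ {n} → (Fin n → Bool) → (Fin n → Bool) → Bool
sameSet A B = allF (λ w → not (A w xor B w))

pairOf : ∀ {n} → Fin n → Fin n → Fin n → Bool
pairOf u v w = (w == u) ∨ (w == v)

Shared : ∀ {n} → Cover n → PairSet n
Shared 𝒳 u v =
  not (u == v) ∧
  anyF (λ i → anyF (λ j → not (i == j) ∧ sameSet (inter (X 𝒳 i) (X 𝒳 j)) (pairOf u v)))

dcount : ∀ {n} → Cover n → Fin n → Fin n → ℕ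
dcount 𝒳 u v = countF (λ i → X 𝒳 i u ∧ X 𝒳 i v)

IndepCover : ∀ {n} → Cover n → Set
IndepCover 𝒳 = IndepPairs (Shared 𝒳)

IEIs : ∀ {n} → Graph n → (𝒳 : Cover n) → PairSet n → ℤ → Set
IEIs G 𝒳 K z =
  Σ (Fin (k 𝒳) → ℕ) λ rs →
    (∀ i → HasRank (λ u v → X 𝒳 i u ∧ X 𝒳 i v ∧ (adj G u v ∨ Shared 𝒳 u v ∨ K u v)) (rs i)) ×
    (z ≡ sumℤ (λ i → + rs i) ℤ.-
         sumPairs (λ u v → if Shared 𝒳 u v ∨ K u v then + dcount 𝒳 u v ℤ.- 1ℤ else 0ℤ))

emptyPairs : ∀ {n} → PairSet n
emptyPairs u v = false

-- Nonedge-splits (described relationally).  G^s : Graph m; φ sends each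
-- vertex of G other than a,b to its copy in G^s; a1,a2,b1,b2 are the new vertices.

record NonedgeSplit {n m} (G : Graph n) (a b : Fin n) (Gs : Graph m)
                    (φ : Fin n → Fin m) (a1 a2 b1 b2 : Fin m) : Set where
  Old : Fin n → Set
  Old x = x ≢ a × x ≢ b
  New : Fin m → Set
  New y = y ≡ a1 ⊎ y ≡ a2 ⊎ y ≡ b1 ⊎ y ≡ b2
  field
    a≢b      : a ≢ b
    nonedge  : adj G a b ≡ false
    a1≢a2    : a1 ≢ a2
    a1≢b1    : a1 ≢ b1
    a1≢b2    : a1 ≢ b2
    a2≢b1    : a2 ≢ b1
    a2≢b2    : a2 ≢ b2
    b1≢b2    : b1 ≢ b2
    φ-inj    : ∀ x y → Old x → Old y → φ x ≡ φ y → x ≡ y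
    φ-old    : ∀ x → Old x → ¬ New (φ x)
    onto     : ∀ y → New y ⊎ ∃ λ x → Old x × φ x ≡ y
    adjOld   : ∀ x y → Old x → Old y → adj Gs (φ x) (φ y) ≡ adj G x y
    adjNew   : ∀ y z → New y → New z → adj Gs y z ≡ false
    unionA   : ∀ x → Old x → (adj Gs a1 (φ x) ∨ adj Gs a2 (φ x)) ≡ adj G a x
    disjA    : ∀ x → Old x → (adj Gs a1 (φ x) ∧ adj Gs a2 (φ x)) ≡ false
    nonempA1 : ∃ λ x → Old x × T (adj Gs a1 (φ x))
    nonempA2 : ∃ λ x → Old x × T (adj Gs a2 (φ x))
    unionB   : ∀ x → Old x → (adj Gs b1 (φ x) ∨ adj Gs b2 (φ x)) ≡ adj G b x
    disjB    : ∀ x → Old x → (adj Gs b1 (φ x) ∧ adj Gs b2 (φ x)) ≡ false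
    nonempB1 : ∃ λ x → Old x × T (adj Gs b1 (φ x))
    nonempB2 : ∃ λ x → Old x × T (adj Gs b2 (φ x))

InSplit : ∀ {n m} (G : Graph n) (𝒳 : Cover n) (a b : Fin n) (Gs : Graph m)
          (φ : Fin n → Fin m) (a1 a2 b1 b2 : Fin m) → Fin (k 𝒳) → Fin m → Set
InSplit G 𝒳 a b Gs φ a1 a2 b1 b2 i y =
  (∃ λ x → x ≢ a × x ≢ b × T (X 𝒳 i x) × φ x ≡ y) ⊎
  ((y ≡ a1 ⊎ y ≡ a2 ⊎ y ≡ b1 ⊎ y ≡ b2) ×
   ∃ λ x → x ≢ a × x ≢ b × T (X 𝒳 i x) × T (adj Gs y (φ x)))

record SafeSplit {n m} (G : Graph n) (𝒳 : Cover n) (a b : Fin n) (Gs : Graph m)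
                 (φ : Fin n → Fin m) (a1 a2 b1 b2 : Fin m) : Set where
  X' : Fin (k 𝒳) → Fin m → Set
  X' = InSplit G 𝒳 a b Gs φ a1 a2 b1 b2
  field
    split  : NonedgeSplit G a b Gs φ a1 a2 b1 b2
    shared : T (Shared 𝒳 a b)
    S1 : ∀ i u v → T (Shared 𝒳 u v) → adj G u v ≡ false → T (X 𝒳 i u) → T (X 𝒳 i v) →
         ¬ (X' i a1 × X' i a2) × ¬ (X' i b1 × X' i b2)
    S2a : ∀ i j u → i ≢ j → u ≢ a → u ≢ b → adj G a u ≡ false →
          (∀ w → inter (X 𝒳 i) (X 𝒳 j) w ≡ pairOf a u w) →
          ∀ w → (w ≡ a1 ⊎ w ≡ a2) → (X' i w → X' j w) × (X' j w → X' i w)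
    S2b : ∀ i j u → i ≢ j → u ≢ b → u ≢ a → adj G b u ≡ false →
          (∀ w → inter (X 𝒳 i) (X 𝒳 j) w ≡ pairOf b u w) →
          ∀ w → (w ≡ b1 ⊎ w ≡ b2) → (X' i w → X' j w) × (X' j w → X' i w)

BigCluster : ∀ {n m} (G : Graph n) (𝒳 : Cover n) (a b : Fin n) (Gs : Graph m)
             (φ : Fin n → Fin m) (a1 a2 b1 b2 : Fin m) → Fin (k 𝒳) → Set
BigCluster G 𝒳 a b Gs φ a1 a2 b1 b2 i =
  (∃ λ y₁ → ∃ λ y₂ → ∃ λ y₃ → y₁ ≢ y₂ × y₁ ≢ y₃ × y₂ ≢ y₃ × X' i y₁ × X' i y₂ × X' i y₃) ×
  ¬ (X' i a1 × X' i a2) × ¬ (X' i b1 × X' i b2)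
  where X' = InSplit G 𝒳 a b Gs φ a1 a2 b1 b2

-- {p,q} lies in a common cluster of the safe split cover 𝒳^s
-- (clusters: the big X_i', and endpoint pairs of edges not in any of them)
KeyPairSplit : ∀ {n m} (G : Graph n) (𝒳 : Cover n) (a b : Fin n) (Gs : Graph m)
               (φ : Fin n → Fin m) (a1 a2 b1 b2 : Fin m) → Fin m → Fin m → Set
KeyPairSplit G 𝒳 a b Gs φ a1 a2 b1 b2 p q =
  p ≢ q × (InBig ⊎ (T (adj Gs p q) × ¬ InBig))
  where
  X' = InSplit G 𝒳 a b Gs φ a1 a2 b1 b2
  InBig = ∃ λ i → BigCluster G 𝒳 a b Gs φ a1 a2 b1 b2 i × X' i p × X' i q

record BaseWith {n} (G : Graph n) (𝒳 : Cover n) : Set where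
  field
    indepG   : IndependentGraph G
    twoThin  : TwoThin G 𝒳
    indep𝒳   : IndepCover 𝒳
    rank=IE  : ∃ λ r → HasRank (adj G) r × IEIs G 𝒳 emptyPairs (+ r)

HasSafeSplit : ∀ {n} → Graph n → Cover n → Set
HasSafeSplit {n} G 𝒳 =
  ∃ λ a → ∃ λ b → adj G a b ≡ false × T (Shared 𝒳 a b) ×
  ∃ λ m → Σ (Graph m) λ Gs → Σ (Fin n → Fin m) λ φ →
  ∃ λ a1 → ∃ λ a2 → ∃ λ b1 → ∃ λ b2 → SafeSplit G 𝒳 a b Gs φ a1 a2 b1 b2

SafeBase : ∀ {n} → Graph n → Set
SafeBase {n} G = Σ (Cover n) λ 𝒳 → BaseWith G 𝒳 × HasSafeSplit G 𝒳

KeyPairsEar : ∀ {h} → Cover h → (Fin h → Bool) → PairSet h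
KeyPairsEar 𝒳 gl u v = not (u == v) ∧ gl u ∧ gl v ∧ anyF (λ i → X 𝒳 i u ∧ X 𝒳 i v)

allGluePairs : ∀ {h} → (Fin h → Bool) → PairSet h
allGluePairs gl u v = not (u == v) ∧ gl u ∧ gl v

record SafeEarCover {h} (H : Graph h) (𝒳 : Cover h) (gl : Fin h → Bool) : Set where
  field
    twoThin : TwoThin H 𝒳
    indep𝒳  : IndepCover 𝒳
    E1 : ∀ i → countF (λ w → X 𝒳 i w ∧ gl w) ≤ 2
    E2 : IndepPairs (λ u v → Shared 𝒳 u v ∨ allGluePairs gl u v)
    E3 : ∃ λ r → ∃ λ z → HasRank (adj H) r × IEIs H 𝒳 (KeyPairsEar 𝒳 gl) z × + r ≡ z ℤ.- 1ℤ

-- The double butterfly on Fin 8: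
-- 0 = a1', 1 = b1', 2 = a2', 3 = b2', 4 = u, 5 = v, 6 = c, 7 = c'

dbEdge : ℕ → ℕ → Bool
dbEdge 4 0 = true
dbEdge 4 1 = true
dbEdge 4 2 = true
dbEdge 4 3 = true
dbEdge 5 0 = true
dbEdge 5 1 = true
dbEdge 5 2 = true
dbEdge 5 3 = true
dbEdge 6 0 = true
dbEdge 6 1 = true
dbEdge 6 4 = true
dbEdge 6 5 = true
dbEdge 7 2 = true
dbEdge 7 3 = true
dbEdge 7 4 = true
dbEdge 7 5 = true
dbEdge _ _ = false

dbAdj : Fin 8 → Fin 8 → Bool
dbAdj x y = dbEdge (toℕ x) (toℕ y) ∨ dbEdge (toℕ y) (toℕ x)

dbSym : ∀ u v → dbAdj u v ≡ dbAdj v u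
dbSym u v = Data.Bool.Properties.∨-comm (dbEdge (toℕ u) (toℕ v)) (dbEdge (toℕ v) (toℕ u))
  where import Data.Bool.Properties

dbIrr : ∀ u → dbAdj u u ≡ false
dbIrr zero = refl
dbIrr (suc zero) = refl
dbIrr (suc (suc zero)) = refl
dbIrr (suc (suc (suc zero))) = refl
dbIrr (suc (suc (suc (suc zero)))) = refl
dbIrr (suc (suc (suc (suc (suc zero))))) = refl
dbIrr (suc (suc (suc (suc (suc (suc zero)))))) = refl
dbIrr (suc (suc (suc (suc (suc (suc (suc zero))))))) = refl

DoubleButterfly : Graph 8
DoubleButterfly = record { adj = dbAdj ; sym = dbSym ; irr = dbIrr }

dbGlue : Fin 8 → Bool
dbGlue x = toℕ x <ᵇ 4

EdgeVia : ∀ {n N} → (Fin n → Fin N) → Graph n → Fin N → Fin N → Set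
EdgeVia f G z w = ∃ λ x → ∃ λ y → f x ≡ z × f y ≡ w × T (adj G x y)

-- G' is the union of the images of G₁ and G₂ under f₁, f₂ (injective,
-- jointly surjective); the overlap is constrained separately.
record UnionVia {n₁ n₂ N} (G₁ : Graph n₁) (G₂ : Graph n₂) (G' : Graph N)
                (f₁ : Fin n₁ → Fin N) (f₂ : Fin n₂ → Fin N) : Set where
  field
    inj₁  : Injective _≡_ _≡_ f₁
    inj₂  : Injective _≡_ _≡_ f₂
    onto  : ∀ z → (∃ λ x → f₁ x ≡ z) ⊎ (∃ λ y → f₂ y ≡ z)
    edges⇒ : ∀ z w → T (adj G' z w) → EdgeVia f₁ G₁ z w ⊎ EdgeVia f₂ G₂ z w
    ⇒edges : ∀ z w → EdgeVia f₁ G₁ z w ⊎ EdgeVia f₂ G₂ z w → T (adj G' z w)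

glueMap : ∀ {m} → Fin m → Fin m → Fin m → Fin m → Fin 8 → Fin m
glueMap a1 b1 a2 b2 zero = a1
glueMap a1 b1 a2 b2 (suc zero) = b1
glueMap a1 b1 a2 b2 (suc (suc zero)) = a2
glueMap a1 b1 a2 b2 (suc (suc (suc _))) = b2

record GlueDB {m N} (Gs : Graph m) (a1 a2 b1 b2 : Fin m) (G' : Graph N)
              (ψ : Fin m → Fin N) (χ : Fin 8 → Fin N) : Set where
  field
    union    : UnionVia Gs DoubleButterfly G' ψ χ
    identify : ∀ y → T (dbGlue y) → ψ (glueMap a1 b1 a2 b2 y) ≡ χ y
    meet     : ∀ x y → ψ x ≡ χ y → T (dbGlue y) × x ≡ glueMap a1 b1 a2 b2 y

record KSum {n₁ n₂ N} (k : ℕ) (G₁ : Graph n₁) (G₂ : Graph n₂) (G' : Graph N)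
            (f₁ : Fin n₁ → Fin N) (f₂ : Fin n₂ → Fin N) : Set where
  field
    union   : UnionVia G₁ G₂ G' f₁ f₂
    ι₁      : Fin k → Fin n₁
    ι₂      : Fin k → Fin n₂
    ι₁-inj  : Injective _≡_ _≡_ ι₁
    ι₂-inj  : Injective _≡_ _≡_ ι₂
    clique₁ : ∀ s t → s ≢ t → T (adj G₁ (ι₁ s) (ι₁ t))
    clique₂ : ∀ s t → s ≢ t → T (adj G₂ (ι₂ s) (ι₂ t))
    glued   : ∀ t → f₁ (ι₁ t) ≡ f₂ (ι₂ t)
    meet    : ∀ x y → f₁ x ≡ f₂ y → ∃ λ t → x ≡ ι₁ t × y ≡ ι₂ t

record Henneberg1 {n N} (G : Graph n) (G' : Graph N) (f : Fin n → Fin N) (w : Fin N) : Set where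
  field
    f-inj  : Injective _≡_ _≡_ f
    f≢w    : ∀ x → f x ≢ w
    onto   : ∀ z → (∃ λ x → f x ≡ z) ⊎ z ≡ w
    adjOld : ∀ x y → adj G' (f x) (f y) ≡ adj G x y
    nbrs   : ∃ λ x₁ → ∃ λ x₂ → ∃ λ x₃ → x₁ ≢ x₂ × x₁ ≢ x₃ × x₂ ≢ x₃ ×
             (∀ z → (T (adj G' w z) → z ≡ f x₁ ⊎ z ≡ f x₂ ⊎ z ≡ f x₃) ×
                    (z ≡ f x₁ ⊎ z ≡ f x₂ ⊎ z ≡ f x₃ → T (adj G' w z)))

{-# OPTIONS --safe #-}

-- Generic rank facts are obtained at rational placements: placements good for finitely many
-- independence conditions exist by moving along a line and avoiding the zeros of minors. For
-- (ii) and (iii) every edge missed by the given clusters becomes a cluster of its own, which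
-- leaves rank = IE. For (i), identifying a₁ with a₂, b₁ with b₂ and c with c′ folds the glued
-- graph onto G with one wing attached, so it is independent. Lifting the clusters of G through
-- the split bounds the rank of Gs with its key pairs K by |E(Gs)| + |K| - 1, and (E3) leaves
-- only one key pair or the two pairs a₁b₁, a₂b₂. The glued graph is then covered by V(Gs)
-- together with, respectively, the triangle on the key pair and u, or the two wings; the key
-- pair a₁b₁, say, is a shared nonedge and is split by separating its neighbours in Gs from
-- those in the ear.

module Submission where

open import Defs renaming (sym to adj-sym)
open import Data.Nat as ℕ using (ℕ; zero; suc; z≤n; s≤s; _<ᵇ_)
import Data.Nat.Properties as ℕₚ
open import Data.Integer as ℤ using (ℤ; 0ℤ; 1ℤ)
import Data.Integer.Properties as ℤₚ
import Data.Integer.Solver as ℤSolver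
import Data.Nat.Solver as ℕSolver
import Data.Rational.Unnormalised as ℚᵘ
import Data.Rational.Unnormalised.Properties as ℚᵘₚ
import Data.Rational as ℚ
import Data.Nat.Coprimality as Coprime
open import Data.Rational using (ℚ)
import Data.Rational.Properties as ℚₚ
open import Data.Fin using (Fin; zero; suc; toℕ; _≟_; punchIn; punchOut; splitAt; join; _↑ˡ_; _↑ʳ_)
import Data.Fin.Properties as Finₚ
open import Data.Bool using (Bool; true; false; _∧_; _∨_; not; _xor_; T; if_then_else_)
import Data.Bool.Properties as Boolₚ
open import Data.List using (List; []; _∷_; _++_; length; lookup; map; concat; filterᵇ; allFin; cartesianProduct; tabulate; take)
open import Data.Maybe using (Maybe; just; nothing)
import Data.List.Properties as Listₚ
open import Data.List.Membership.Propositional using (_∈_)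
import Data.List.Membership.Propositional.Properties as Memₚ
open import Data.List.Relation.Unary.Any as Any using (here; there)
import Data.List.Relation.Unary.Any.Properties as Anyₚ
open import Data.List.Relation.Unary.All as All using (All; []; _∷_)
import Data.List.Relation.Unary.All.Properties as Allₚ
open import Data.List.Relation.Binary.Sublist.Propositional using (_⊆_; []; _∷_; _∷ʳ_; ⊆-refl)
import Data.List.Relation.Binary.Sublist.Propositional.Properties as Subₚ
open import Data.List.Relation.Unary.Unique.Propositional using (Unique)
import Data.List.Relation.Unary.Unique.Propositional.Properties as Uniqueₚ
import Data.List.Relation.Unary.AllPairs as AllPairs
open import Data.Product using (∃; _×_; _,_; proj₁; proj₂; swap; uncurry)
open import Data.Sum using (_⊎_; inj₁; inj₂; [_,_]′)
import Data.Sum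
import Data.Product.Properties as Productₚ
open import Data.Empty using (⊥; ⊥-elim)
open import Data.Unit using (⊤; tt)
open import Relation.Nullary using (¬_; Dec; yes; no)
open import Relation.Nullary.Decidable using (⌊_⌋; dec⇒maybe; toWitness; ¬?; _×-dec_; _⊎-dec_; _→-dec_; map′)
open import Relation.Binary.Definitions using (tri<; tri≈; tri>)
open import Relation.Binary.PropositionalEquality using (_≡_; _≢_; refl; sym; trans; cong; cong₂; subst; subst₂)
open import Function using (_∘_; id; case_of_)
open import Function.Definitions using (Injective)
open import Level using (0ℓ)
open import Algebra using (CommutativeRing; IsCommutativeRing)
open import Tactic.RingSolver using (solve-∀)
open import Tactic.RingSolver.Core.AlmostCommutativeRing using (AlmostCommutativeRing; fromCommutativeRing)

infixl 6 _+_ _-_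
infixl 7 _*_
infix 8 -_

-- The field operations of ℚ are made opaque: unification then treats them as
-- rigid, and no rational arithmetic is ever unfolded.
opaque
  0# 1# : ℚ
  0# = ℚ.0ℚ
  1# = ℚ.1ℚ

  _+_ _*_ : ℚ → ℚ → ℚ
  _+_ = ℚ._+_
  _*_ = ℚ._*_

  -_ : ℚ → ℚ
  -_ = ℚ.-_

_-_ : ℚ → ℚ → ℚ
x - y = x + - y

opaque
  unfolding _+_

  isRing : IsCommutativeRing _≡_ _+_ _*_ -_ 0# 1#
  isRing = ℚₚ.+-*-isCommutativeRing

  1≢0 : 1# ≢ 0#
  1≢0 = ℚₚ.1≢0

  inverse : ∀ a → a ≢ 0# → ∃ λ b → b * a ≡ 1#
  inverse a a≢0 = (ℚ.1/ a) {{ℚ.≢-nonZero a≢0}} , ℚₚ.*-inverseˡ a {{ℚ.≢-nonZero a≢0}}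

ℚ-commutativeRing : CommutativeRing 0ℓ 0ℓ
ℚ-commutativeRing = record { isCommutativeRing = isRing }

open CommutativeRing ℚ-commutativeRing
  using (+-identityˡ; +-identityʳ; +-assoc; +-comm; *-identityˡ; *-identityʳ; *-assoc; *-comm; zeroˡ; zeroʳ; -‿inverseˡ; -‿inverseʳ) public

ℚ-ring : AlmostCommutativeRing 0ℓ 0ℓ
ℚ-ring = fromCommutativeRing ℚ-commutativeRing (λ x → dec⇒maybe (0# ℚₚ.≟ x))

-- Linear algebra over ℚ

∑ : ∀ {k} → (Fin k → ℚ) → ℚ
∑ {zero}  f = 0#
∑ {suc k} f = f zero + ∑ (f ∘ suc)

opaque
  unfolding _+_ isRing

  lin-step : ∀ x a b s t → (x * a + b) + (x * s + t) ≡ x * (a + s) + (b + t)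
  lin-step = solve-∀ ℚ-ring

∑-cong : ∀ {k} {f g : Fin k → ℚ} → (∀ i → f i ≡ g i) → ∑ f ≡ ∑ g
∑-cong {zero}  e = refl
∑-cong {suc k} e = cong₂ _+_ (e zero) (∑-cong (e ∘ suc))

∑-0 : ∀ {k} {f : Fin k → ℚ} → (∀ i → f i ≡ 0#) → ∑ f ≡ 0#
∑-0 {zero}  e = refl
∑-0 {suc k} e = trans (cong₂ _+_ (e zero) (∑-0 (e ∘ suc))) (+-identityˡ 0#)

∑-lin : ∀ {k} x (f g : Fin k → ℚ) → ∑ (λ i → x * f i + g i) ≡ x * ∑ f + ∑ g
∑-lin {zero}  x f g = sym (trans (+-identityʳ _) (zeroʳ x))
∑-lin {suc k} x f g =
  trans (cong (x * f zero + g zero +_) (∑-lin x (f ∘ suc) (g ∘ suc))) (lin-step x _ _ _ _)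

∑-* : ∀ {k} x (f : Fin k → ℚ) → ∑ (λ i → x * f i) ≡ x * ∑ f
∑-* {k} x f = trans (∑-cong (λ i → sym (+-identityʳ (x * f i))))
  (trans (∑-lin x f (λ _ → 0#)) (trans (cong (x * ∑ f +_) (∑-0 {k} {f = λ _ → 0#} (λ _ → refl))) (+-identityʳ _)))

∑-swap : ∀ {k l} (f : Fin k → Fin l → ℚ) →
  ∑ (λ i → ∑ (f i)) ≡ ∑ (λ j → ∑ (λ i → f i j))
∑-swap {zero} {l} f = sym (∑-0 {l} {f = λ _ → 0#} (λ _ → refl))
∑-swap {suc k} f = trans (cong (∑ (f zero) +_) (∑-swap (f ∘ suc)))
  (trans (cong (_+ ∑ s) (sym (*-identityˡ (∑ (f zero)))))
  (trans (sym (∑-lin 1# (f zero) s)) (∑-cong (λ j → cong (_+ s j) (*-identityˡ (f zero j))))))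
  where s : _ → ℚ
        s j = ∑ (λ i → f (suc i) j)

x*y≡0⇒y≡0 : ∀ {a b} → a ≢ 0# → a * b ≡ 0# → b ≡ 0#
x*y≡0⇒y≡0 {a} {b} a≢0 e with inverse a a≢0
... | c , ca≡1 = trans (sym (*-identityˡ b)) (trans (cong (_* b) (sym ca≡1))
  (trans (*-assoc c a b) (trans (cong (c *_) e) (zeroʳ c))))

x*y≢0 : ∀ {a b} → a ≢ 0# → b ≢ 0# → a * b ≢ 0#
x*y≢0 a≢0 b≢0 e = b≢0 (x*y≡0⇒y≡0 a≢0 e)

+-cancel-0 : ∀ a b → a + b ≡ 0# → a ≡ - b
+-cancel-0 a b e = trans (l a b) (trans (cong (_+ - b) e) (+-identityˡ (- b)))
  where
  opaque
    unfolding _+_ isRing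
    l : ∀ a b → a ≡ (a + b) + - b
    l = solve-∀ ℚ-ring

div : ∀ a b → a ≢ 0# → ∃ λ x → x * a ≡ b
div a b a≢0 with inverse a a≢0
... | c , ca≡1 = b * c , trans (*-assoc b c a) (trans (cong (b *_) ca≡1) (*-identityʳ b))

comb : ∀ {k} {I : Set} → (Fin k → I → ℚ) → (Fin k → ℚ) → I → ℚ
comb v x i = ∑ (λ e → x e * v e i)

LI : ∀ {k} {I : Set} → (Fin k → I → ℚ) → Set
LI v = ∀ x → (∀ i → comb v x i ≡ 0#) → ∀ e → x e ≡ 0#

Dependent : ∀ {k} {I : Set} → (Fin k → I → ℚ) → Set
Dependent v = ∃ λ x → (∀ i → comb v x i ≡ 0#) × ∃ λ e → x e ≢ 0#

Span : ∀ {k} {I : Set} → (Fin k → I → ℚ) → (I → ℚ) → Set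
Span v w = ∃ λ x → ∀ i → w i ≡ comb v x i

Searchable : Set → Set
Searchable I = (f : I → ℚ) → (∃ λ i → f i ≢ 0#) ⊎ (∀ i → f i ≡ 0#)

search-Fin : ∀ {n} → Searchable (Fin n)
search-Fin {zero}  f = inj₂ λ ()
search-Fin {suc n} f with f zero ℚₚ.≟ 0#
... | no ne = inj₁ (zero , ne)
... | yes e with search-Fin (f ∘ suc)
...   | inj₁ (i , ne) = inj₁ (suc i , ne)
...   | inj₂ a = inj₂ λ { zero → e ; (suc i) → a i }

search-× : ∀ {I m} → Searchable I → Searchable (I × Fin m)
search-× {I} {m} sI f = go (collect g)
  where
  g : Fin m → I → ℚ
  g j i = f (i , j)
  collect : ∀ {l} (h : Fin l → I → ℚ) → (∃ λ j → ∃ λ i → h j i ≢ 0#) ⊎ (∀ j i → h j i ≡ 0#)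
  collect {zero} h = inj₂ λ ()
  collect {suc l} h with sI (h zero)
  ... | inj₁ (i , ne) = inj₁ (zero , i , ne)
  ... | inj₂ a with collect (h ∘ suc)
  ...   | inj₁ (j , i , ne) = inj₁ (suc j , i , ne)
  ...   | inj₂ b = inj₂ λ { zero → a ; (suc j) → b j }
  go : (∃ λ j → ∃ λ i → g j i ≢ 0#) ⊎ (∀ j i → g j i ≡ 0#) → (∃ λ i → f i ≢ 0#) ⊎ (∀ i → f i ≡ 0#)
  go (inj₁ (j , i , ne)) = inj₁ ((i , j) , ne)
  go (inj₂ a) = inj₂ λ { (i , j) → a j i }

-- One step of fraction-free Gaussian elimination with pivot v zero c.
elim : ∀ {k} {I : Set} → (Fin (suc k) → I → ℚ) → I → Fin k → I → ℚ
elim v c e i = v zero c * v (suc e) i - v (suc e) c * v zero i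

comb-elim : ∀ {k} {I : Set} (v : Fin (suc k) → I → ℚ) c y i →
  comb (elim v c) y i ≡ v zero c * comb (v ∘ suc) y i - comb (v ∘ suc) y c * v zero i
comb-elim {k} v c y i = trans (∑-cong (λ e → alg (y e) (v zero c) (v (suc e) i) (v (suc e) c) (v zero i)))
  (trans (∑-lin {k} (v zero c) _ _) (trans (cong (v zero c * comb (v ∘ suc) y i +_) (∑-* {k} (- v zero i) _))
    (fin (v zero c) (comb (v ∘ suc) y i) (comb (v ∘ suc) y c) (v zero i))))
  where
  opaque
    unfolding _+_ isRing
    alg : ∀ y a b d g → y * (a * b - d * g) ≡ a * (y * b) + (- g) * (y * d)
    alg = solve-∀ ℚ-ring
  opaque
    unfolding _+_ isRing
    fin : ∀ a s t g → a * s + (- g) * t ≡ a * s - t * g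
    fin = solve-∀ ℚ-ring

unelim : ∀ {k} {I : Set} (v : Fin (suc k) → I → ℚ) → I → (Fin k → ℚ) → Fin (suc k) → ℚ
unelim v c y zero    = - comb (v ∘ suc) y c
unelim v c y (suc e) = v zero c * y e

comb-unelim : ∀ {k} {I : Set} (v : Fin (suc k) → I → ℚ) c y i → comb v (unelim v c y) i ≡ comb (elim v c) y i
comb-unelim {k} v c y i = trans
  (cong ((- comb (v ∘ suc) y c) * v zero i +_)
    (trans (∑-cong (λ e → *-assoc (v zero c) (y e) (v (suc e) i))) (∑-* {k} (v zero c) _)))
  (trans (alg (comb (v ∘ suc) y c) (v zero i) (v zero c) (comb (v ∘ suc) y i)) (sym (comb-elim v c y i)))
  where
  opaque
    unfolding _+_ isRing
    alg : ∀ t g a s → (- t) * g + a * s ≡ a * s - t * g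
    alg = solve-∀ ℚ-ring

LI-elim : ∀ {k} {I : Set} (v : Fin (suc k) → I → ℚ) c → v zero c ≢ 0# → LI v → LI (elim v c)
LI-elim v c ne li y z e =
  x*y≡0⇒y≡0 ne (li (unelim v c y) (λ i → trans (comb-unelim v c y i) (z i)) (suc e))

LI-unelim : ∀ {k} {I : Set} (v : Fin (suc k) → I → ℚ) c → v zero c ≢ 0# → LI (elim v c) → LI v
LI-unelim {k} v c ne li x z = all
  where
  rest : ∀ i → comb (v ∘ suc) (x ∘ suc) i ≡ - (x zero * v zero i)
  rest i = +-cancel-0 _ _ (trans (+-comm _ (x zero * v zero i)) (z i))
  opaque
    unfolding _+_ isRing
    alg : ∀ a b x → a * (- (x * b)) - (- (x * a)) * b ≡ 0#
    alg = solve-∀ ℚ-ring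
  tail : ∀ e → x (suc e) ≡ 0#
  tail = li (x ∘ suc) λ i → trans (comb-elim v c (x ∘ suc) i)
    (trans (cong₂ (λ s t → v zero c * s - t * v zero i) (rest i) (rest c)) (alg (v zero c) (v zero i) (x zero)))
  head0 : v zero c * x zero ≡ 0#
  head0 = trans (*-comm (v zero c) (x zero)) (trans (sym (+-identityʳ _))
    (trans (cong (x zero * v zero c +_) (sym (∑-0 (λ e → trans (cong (_* v (suc e) c) (tail e)) (zeroˡ _))))) (z c)))
  all : ∀ e → x e ≡ 0#
  all zero = x*y≡0⇒y≡0 ne head0
  all (suc e) = tail e

zero-dependent : ∀ {k} {I : Set} (v : Fin (suc k) → I → ℚ) → (∀ i → v zero i ≡ 0#) → Dependent v
zero-dependent v z = x , (λ i → trans (cong₂ _+_ (trans (*-identityˡ _) (z i)) (∑-0 (λ e → zeroˡ (v (suc e) i))))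
  (+-identityˡ 0#)) , zero , 1≢0
  where x : _ → ℚ
        x zero = 1#
        x (suc e) = 0#

LI? : ∀ {k} {I : Set} → Searchable I → (v : Fin k → I → ℚ) → LI v ⊎ Dependent v
LI? {zero}  s v = inj₁ λ x _ ()
LI? {suc k} s v with s (v zero)
... | inj₂ z = inj₂ (zero-dependent v z)
... | inj₁ (c , ne) with LI? s (elim v c)
...   | inj₁ li = inj₁ (LI-unelim v c ne li)
...   | inj₂ (y , z , e , ye) = inj₂ (unelim v c y , (λ i → trans (comb-unelim v c y i) (z i)) , suc e , x*y≢0 ne ye)

LI⇒¬Dependent : ∀ {k} {I : Set} {v : Fin k → I → ℚ} → LI v → ¬ Dependent v
LI⇒¬Dependent li (x , z , e , ne) = ne (li x z e)

LI-dim : ∀ {k t} (v : Fin k → Fin t → ℚ) → LI v → k ℕ.≤ t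
LI-dim {zero} v li = z≤n
LI-dim {suc k} {t} v li with search-Fin (v zero)
... | inj₂ z = ⊥-elim (LI⇒¬Dependent {v = v} li (zero-dependent v z))
LI-dim {suc k} {suc t} v li | inj₁ (c , ne) = s≤s (LI-dim (λ e → elim v c e ∘ punchIn c) li′)
  where
  col-c : ∀ e → elim v c e c ≡ 0#
  col-c e = l (v zero c) (v (suc e) c)
    where
    opaque
      unfolding _+_ isRing
      l : ∀ a b → a * b - b * a ≡ 0#
      l = solve-∀ ℚ-ring
  li′ : LI (λ e → elim v c e ∘ punchIn c)
  li′ x z = LI-elim v c ne li x λ j → case c ≟ j of λ
    { (yes refl) → ∑-0 (λ e → trans (cong (x e *_) (col-c e)) (zeroʳ (x e)))
    ; (no c≢j) → subst (λ j → comb (elim v c) x j ≡ 0#) (Finₚ.punchIn-punchOut c≢j) (z (punchOut c≢j)) }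

LI-steinitz : ∀ {l t} {I : Set} {u : Fin l → I → ℚ} {v : Fin t → I → ℚ} → LI u → (∀ e → Span v (u e)) → l ℕ.≤ t
LI-steinitz {l} {t} {u = u} {v} li sp = LI-dim M λ x z → li x λ i →
  trans (∑-cong (λ e → trans (cong (x e *_) (proj₂ (sp e) i)) (sym (∑-* {t} (x e) _))))
  (trans (∑-swap {l} {t} _) (∑-0 λ j →
    trans (∑-cong (λ e → alg (x e) (M e j) (v j i)))
    (trans (∑-* (v j i) (λ e → x e * M e j)) (trans (cong (v j i *_) (z j)) (zeroʳ (v j i))))))
  where
  M : _ → _ → ℚ
  M e = proj₁ (sp e)
  opaque
    unfolding _+_ isRing
    alg : ∀ x m w → x * (m * w) ≡ w * (x * m)
    alg = solve-∀ ℚ-ring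

record Linear {I J : Set} (f : (I → ℚ) → (J → ℚ)) : Set where
  field
    resp : ∀ {v w} → (∀ i → v i ≡ w i) → ∀ j → f v j ≡ f w j
    lin  : ∀ x v w j → f (λ i → x * v i + w i) j ≡ x * f v j + f w j

  map-0 : ∀ j → f (λ _ → 0#) j ≡ 0#
  map-0 j = trans (resp {w = λ i → (- 1#) * 0# + 0#} (λ i → sym (alg 0#)) j)
    (trans (lin (- 1#) (λ _ → 0#) (λ _ → 0#) j) (alg (f (λ _ → 0#) j)))
    where
    opaque
      unfolding _+_ isRing
      alg : ∀ a → (- 1#) * a + a ≡ 0#
      alg = solve-∀ ℚ-ring

  map-comb : ∀ {k} (v : Fin k → I → ℚ) x j → f (comb v x) j ≡ comb (f ∘ v) x j
  map-comb {zero}  v x j = map-0 j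
  map-comb {suc k} v x j = trans (lin (x zero) (v zero) (comb (v ∘ suc) (x ∘ suc)) j)
    (cong (x zero * f (v zero) j +_) (map-comb (v ∘ suc) (x ∘ suc) j))

  LI-image : ∀ {k} {v : Fin k → I → ℚ} → LI (f ∘ v) → LI v
  LI-image {v = v} li x z = li x λ j → trans (sym (map-comb v x j)) (trans (resp z j) (map-0 j))

  Span-image : ∀ {k} {v : Fin k → I → ℚ} {w} → Span v w → Span (f ∘ v) (f w)
  Span-image {v = v} (x , e) = x , λ j → trans (resp e j) (map-comb v x j)

consF : ∀ {k} → ℚ → (Fin k → ℚ) → Fin (suc k) → ℚ
consF x y zero = x
consF x y (suc e) = y e

module _ {A I : Set} where

  record InSpan (r : A → I → ℚ) (L : List A) (v : I → ℚ) : Set where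
    constructor inSpan
    field span : Span (r ∘ lookup L) v

  record Indep (r : A → I → ℚ) (L : List A) : Set where
    constructor mkIndep
    field indep : LI (r ∘ lookup L)

  open InSpan public
  open Indep public

  module _ {r : A → I → ℚ} where

    span-cong : ∀ {L v w} → (∀ i → v i ≡ w i) → InSpan r L v → InSpan r L w
    span-cong e (inSpan (x , z)) = inSpan (x , λ i → trans (sym (e i)) (z i))

    span-0 : ∀ {L v} → (∀ i → v i ≡ 0#) → InSpan r L v
    span-0 {L} z = inSpan ((λ _ → 0#) , λ i → trans (z i) (sym (∑-0 {length L} (λ e → zeroˡ _))))

    span-lin : ∀ {L v w} x → InSpan r L v → InSpan r L w → InSpan r L (λ i → x * v i + w i)
    span-lin {L} {v} {w} x (inSpan (y , ey)) (inSpan (z , ez)) = inSpan ((λ e → x * y e + z e) , λ i →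
      trans (cong₂ (λ s t → x * s + t) (ey i) (ez i))
      (trans (sym (∑-lin {length L} x (λ e → y e * r (lookup L e) i) (λ e → z e * r (lookup L e) i)))
        (∑-cong {length L} (λ e → alg x (y e) (z e) (r (lookup L e) i)))))
      where
      opaque
        unfolding _+_ isRing
        alg : ∀ x y z a → x * (y * a) + z * a ≡ (x * y + z) * a
        alg = solve-∀ ℚ-ring

    span-nil : ∀ {v} → InSpan r [] v → ∀ i → v i ≡ 0#
    span-nil (inSpan (x , z)) = z

    span-cons⁻ : ∀ {a L v} → InSpan r (a ∷ L) v → ∃ λ x → ∃ λ w → InSpan r L w × (∀ i → v i ≡ x * r a i + w i)
    span-cons⁻ {a} {L} (inSpan (x , z)) = x zero , _ , inSpan (x ∘ suc , λ i → refl) , z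

    span-cons⁺ : ∀ {a L v w} x → InSpan r L w → (∀ i → v i ≡ x * r a i + w i) → InSpan r (a ∷ L) v
    span-cons⁺ {a} x (inSpan (y , ey)) z = inSpan (consF x y , λ i → trans (z i) (cong (x * r a i +_) (ey i)))

    span-weaken : ∀ {a L v} → InSpan r L v → InSpan r (a ∷ L) v
    span-weaken {a} {v = v} sp = span-cons⁺ 0# sp λ i → sym (alg (r a i) (v i))
      where
      opaque
        unfolding _+_ isRing
        alg : ∀ a b → 0# * a + b ≡ b
        alg = solve-∀ ℚ-ring

    span-∈ : ∀ {a L} → a ∈ L → InSpan r L (r a)
    span-∈ {a} {_ ∷ L} (here refl) = span-cons⁺ 1# (span-0 {L} {λ _ → 0#} (λ _ → refl)) λ i → sym (alg (r a i))
      where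
      opaque
        unfolding _+_ isRing
        alg : ∀ a → 1# * a + 0# ≡ a
        alg = solve-∀ ℚ-ring
    span-∈ {L = _ ∷ L} (there m) = span-weaken {L = L} (span-∈ m)

    indep-[] : Indep r []
    indep-[] = mkIndep λ x z ()

    indep-tail : ∀ {a L} → Indep r (a ∷ L) → Indep r L
    indep-tail {a} {L} (mkIndep li) = mkIndep λ x z e → li (consF 0# x) (λ i → trans (cong₂ _+_ (zeroˡ (r a i)) (z i)) (+-identityˡ 0#)) (suc e)

    indep-head : ∀ {a L} → Indep r (a ∷ L) → ¬ InSpan r L (r a)
    indep-head {a} {L} (mkIndep li) (inSpan (x , z)) = 1≢0 (trans (sym (neg (1#)))
      (trans (cong -_ (li (consF (- 1#) x) (λ i → trans (cong ((- 1#) * r a i +_) (sym (z i))) (alg (r a i))) zero)) neg0))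
      where
      opaque
        unfolding _+_ isRing
        alg : ∀ a → (- 1#) * a + a ≡ 0#
        alg = solve-∀ ℚ-ring
        neg : ∀ a → - (- a) ≡ a
        neg = solve-∀ ℚ-ring
        neg0 : - 0# ≡ 0#
        neg0 = refl

    indep-cons : ∀ {a L} → ¬ InSpan r L (r a) → Indep r L → Indep r (a ∷ L)
    indep-cons {a} {L} nsp (mkIndep li) = mkIndep all
      where
      opaque
        unfolding _+_ isRing
        alg : ∀ d x a s → d * x ≡ 1# → x * a ≡ - s → a ≡ (- d) * s + 0#
        alg d x a s e1 e2 = trans (sym (*-identityˡ a)) (trans (cong (_* a) (sym e1))
          (trans (*-assoc d x a) (trans (cong (d *_) e2) (l d s))))
          where l : ∀ d s → d * (- s) ≡ (- d) * s + 0#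
                l = solve-∀ ℚ-ring
      all : ∀ x → (∀ i → comb (r ∘ lookup (a ∷ L)) x i ≡ 0#) → ∀ e → x e ≡ 0#
      all x z = coeff≡0
        where
        rest : I → ℚ
        rest = comb (r ∘ lookup L) (x ∘ suc)
        head≡0 : x zero ≡ 0#
        head≡0 with x zero ℚₚ.≟ 0#
        ... | yes e = e
        ... | no ne with inverse (x zero) ne
        ...   | d , e1 = ⊥-elim (nsp (span-cong (λ i → sym (alg d (x zero) (r a i) (rest i) e1 (+-cancel-0 _ _ (z i))))
                  (span-lin {v = rest} {w = λ _ → 0#} (- d) (inSpan (x ∘ suc , λ i → refl)) (span-0 (λ _ → refl)))))
        coeff≡0 : ∀ e → x e ≡ 0#
        coeff≡0 zero = head≡0
        coeff≡0 (suc e) = li (x ∘ suc) (λ i → trans (sym (trans (cong (λ t → t * r a i + rest i) head≡0)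
          (trans (cong (_+ rest i) (zeroˡ (r a i))) (+-identityˡ (rest i))))) (z i)) e

    indep-⊆ : ∀ {M L} → M ⊆ L → Indep r L → Indep r M
    span-⊆ : ∀ {M L v} → M ⊆ L → InSpan r M v → InSpan r L v
    span-⊆ [] sp = sp
    span-⊆ {L = _ ∷ L} (y ∷ʳ s) sp = span-weaken {L = L} (span-⊆ s sp)
    span-⊆ {L = a ∷ L} (refl ∷ s) sp with span-cons⁻ sp
    ... | x , w , sw , e = span-cons⁺ x (span-⊆ s sw) e
    indep-⊆ [] li = li
    indep-⊆ (y ∷ʳ s) li = indep-⊆ s (indep-tail li)
    indep-⊆ (refl ∷ s) li = indep-cons (λ sp → indep-head li (span-⊆ s sp)) (indep-⊆ s (indep-tail li))

    opaque
      extend? : Searchable I → ∀ {L} → Indep r L → ∀ a → InSpan r L (r a) ⊎ Indep r (a ∷ L)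
      extend? s {L} li a with LI? s (r ∘ lookup (a ∷ L))
      ... | inj₁ li′ = inj₂ (mkIndep li′)
      ... | inj₂ (x , z , e , ne) with x zero ℚₚ.≟ 0#
      ...   | no x0 with inverse (x zero) x0
      ...     | d , e1 = inj₁ (inSpan ((λ e → (- d) * x (suc e)) , λ i →
                  trans (alg d (x zero) (r a i) _ e1 (+-cancel-0 _ _ (z i)))
                  (trans (sym (∑-* {length L} (- d) (λ e → x (suc e) * r (lookup L e) i)))
                    (∑-cong {length L} (λ e → sym (*-assoc (- d) (x (suc e)) (r (lookup L e) i)))))))
        where
        opaque
          unfolding _+_ isRing
          alg : ∀ d x a s → d * x ≡ 1# → x * a ≡ - s → a ≡ (- d) * s
          alg d x a s e1 e2 = trans (sym (*-identityˡ a)) (trans (cong (_* a) (sym e1))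
            (trans (*-assoc d x a) (trans (cong (d *_) e2) (l d s))))
            where l : ∀ d s → d * (- s) ≡ (- d) * s
                  l = solve-∀ ℚ-ring
      extend? s {L} li a | inj₂ (x , z , zero , ne) | yes x0 = ⊥-elim (ne x0)
      extend? s {L} li a | inj₂ (x , z , suc e , ne) | yes x0 = ⊥-elim (ne (indep li (x ∘ suc)
        (λ i → trans (sym (trans (cong (λ t → t * r a i + comb (r ∘ lookup L) (x ∘ suc) i) x0)
          (trans (cong (_+ comb (r ∘ lookup L) (x ∘ suc) i) (zeroˡ (r a i))) (+-identityˡ _)))) (z i)) e))

span-trans : ∀ {A B I : Set} {r : A → I → ℚ} {s : B → I → ℚ} {L T v} →
  (∀ {a} → a ∈ L → InSpan s T (r a)) → InSpan r L v → InSpan s T v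
span-trans {r = r} {s} {[]} {T} h sp = span-0 {r = s} {T} (span-nil {r = r} sp)
span-trans {r = r} {s} {a ∷ L} {T} h sp with span-cons⁻ {r = r} {a} {L} sp
... | x , w , sw , e = span-cong {r = s} {T} (λ i → sym (e i))
  (span-lin {r = s} {T} x (h (here refl)) (span-trans {r = r} {s} {L} {T} (h ∘ there) sw))

span-image : ∀ {A I J : Set} {f : (I → ℚ) → (J → ℚ)} → Linear f → ∀ {r : A → I → ℚ} {L v} →
  InSpan r L v → InSpan (f ∘ r) L (f v)
span-image lf (inSpan sp) = inSpan (Linear.Span-image lf sp)

indep-image : ∀ {A I J : Set} {f : (I → ℚ) → (J → ℚ)} → Linear f → ∀ {r : A → I → ℚ} {L} →
  Indep (f ∘ r) L → Indep r L
indep-image lf (mkIndep li) = mkIndep (Linear.LI-image lf li)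

steinitz : ∀ {A B I : Set} {r : A → I → ℚ} {s : B → I → ℚ} {L T} →
  Indep r L → (∀ {a} → a ∈ L → InSpan s T (r a)) → length L ℕ.≤ length T
steinitz {L = L} (mkIndep li) h = LI-steinitz li (λ e → span (h (Memₚ.∈-lookup {xs = L} e)))

module _ {A B I : Set} {r : A → I → ℚ} {s : B → I → ℚ} (g : A → B) where

  span-map : (∀ a i → r a i ≡ s (g a) i) → ∀ {L v} → InSpan r L v → InSpan s (map g L) v
  span-map h {L} {v} = span-trans {r = r} {s} {L} {map g L} λ {a} m →
    span-cong {r = s} {map g L} (λ i → sym (h a i)) (span-∈ {r = s} (Memₚ.∈-map⁺ g m))

  span-unmap : (∀ a i → r a i ≡ s (g a) i) → ∀ {L v} → InSpan s (map g L) v → InSpan r L v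
  span-unmap h {L} {v} = span-trans {r = s} {r} {map g L} {L} λ {b} m →
    case Memₚ.∈-map⁻ g m of λ { (a , ma , refl) → span-cong {r = r} {L} (h a) (span-∈ {r = r} ma) }

  indep-map : (∀ a i → r a i ≡ s (g a) i) → ∀ {L} → Indep r L → Indep s (map g L)
  indep-map h {[]} li = indep-[] {r = s}
  indep-map h {a ∷ L} li = indep-cons {r = s} {g a} {map g L}
    (λ sp → indep-head {r = r} {a} {L} li (span-cong {r = r} {L} (λ i → sym (h a i)) (span-unmap h {L} sp)))
    (indep-map h {L} (indep-tail {r = r} {a} {L} li))

  indep-unmap : (∀ a i → r a i ≡ s (g a) i) → ∀ {L} → Indep s (map g L) → Indep r L
  indep-unmap h {[]} li = indep-[] {r = r}
  indep-unmap h {a ∷ L} li = indep-cons {r = r} {a} {L}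
    (λ sp → indep-head {r = s} {g a} {map g L} li (span-cong {r = s} {map g L} (h a) (span-map h {L} sp)))
    (indep-unmap h {L} (indep-tail {r = s} {g a} {map g L} li))

indep-modulo : ∀ {A B I J : Set} {f : (I → ℚ) → (J → ℚ)} → Linear f →
  ∀ {r : A → I → ℚ} {s : B → J → ℚ} (g : A → B) → ∀ S {L M} →
  (∀ {a} → a ∈ S → ∀ j → f (r a) j ≡ s (g a) j) → (∀ {a} → a ∈ L → InSpan s M (f (r a))) →
  Indep s (map g S ++ M) → Indep r L → Indep r (S ++ L)
indep-modulo lf g [] _ _ _ li = li
indep-modulo {f = f} lf {r} {s} g (a ∷ S) {L} {M} hS hL liM liL =
  indep-cons {r = r} {a} {S ++ L} (λ sp → indep-head {r = s} {g a} {map g S ++ M} liM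
    (span-cong {r = s} {map g S ++ M} (hS (here refl))
      (span-trans {r = f ∘ r} {s} {S ++ L} {map g S ++ M} img (span-image lf {r} {S ++ L} sp))))
    (indep-modulo lf {r} {s} g S {L} {M} (hS ∘ there) hL (indep-tail {r = s} {g a} {map g S ++ M} liM) liL)
  where
  img : ∀ {b} → b ∈ S ++ L → InSpan s (map g S ++ M) (f (r b))
  img {b} m with Memₚ.∈-++⁻ S m
  ... | inj₁ mS = span-cong {r = s} {map g S ++ M} (λ j → sym (hS (there mS) j)) (span-∈ {r = s} (Memₚ.∈-++⁺ˡ (Memₚ.∈-map⁺ g mS)))
  ... | inj₂ mL = span-trans {r = s} {s} {M} {map g S ++ M} (λ mM → span-∈ {r = s} (Memₚ.∈-++⁺ʳ (map g S) mM)) (hL mL)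

module _ {A I : Set} {r : A → I → ℚ} where

  span-mono : ∀ {L M v} → (∀ {a} → a ∈ L → a ∈ M) → InSpan r L v → InSpan r M v
  span-mono {L} {M} h = span-trans {r = r} {r} {L} {M} (λ m → span-∈ {r = r} (h m))

  span-++⁻ : ∀ S {L v} → InSpan r (S ++ L) v →
    ∃ λ s → ∃ λ l → InSpan r S s × InSpan r L l × (∀ i → v i ≡ s i + l i)
  span-++⁻ [] {L} {v} sp = (λ _ → 0#) , v , span-0 {r = r} {[]} (λ _ → refl) , sp , λ i → sym (+-identityˡ (v i))
  span-++⁻ (a ∷ S) {L} {v} sp with span-cons⁻ {r = r} {a} {S ++ L} sp
  ... | x , w , sw , e with span-++⁻ S {L} sw
  ...   | s , l , ss , sl , e′ = (λ i → x * r a i + s i) , l , span-cons⁺ {r = r} {a} {S} x ss (λ i → refl) , sl ,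
    λ i → trans (e i) (trans (cong (x * r a i +_) (e′ i)) (sym (+-assoc (x * r a i) (s i) (l i))))

  opaque
    unfolding _+_ isRing
    solve-pivot : ∀ d x a s v → d * x ≡ 1# → v ≡ x * a + s → a ≡ d * v + (- d) * s
    solve-pivot d x a s v e1 e2 = trans (sym (*-identityˡ a)) (trans (cong (_* a) (sym e1))
      (trans (l d x a s) (cong (λ v → d * v + (- d) * s) (sym e2))))
      where l : ∀ d x a s → d * x * a ≡ d * (x * a + s) + (- d) * s
            l = solve-∀ ℚ-ring
    sub-add : ∀ a s l → a ≡ s + l → l ≡ 1# * a + (- 1#) * s
    sub-add a s l e = trans (m s l) (cong (λ a → 1# * a + (- 1#) * s) (sym e))
      where m : ∀ s l → l ≡ 1# * (s + l) + (- 1#) * s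
            m = solve-∀ ℚ-ring

  span-scale : ∀ {L v} x → InSpan r L v → InSpan r L (λ i → x * v i)
  span-scale {L} {v} x sp = span-cong {r = r} {L} (λ i → +-identityʳ (x * v i))
    (span-lin {r = r} {L} {w = λ _ → 0#} x sp (span-0 {r = r} {L} (λ _ → refl)))

  span-disjoint⇒indep : ∀ S {L} → Indep r S → Indep r L →
    (∀ v → InSpan r S v → InSpan r L v → ∀ i → v i ≡ 0#) → Indep r (S ++ L)
  span-disjoint⇒indep [] liS liL h = liL
  span-disjoint⇒indep (a ∷ S) {L} liS liL h = indep-cons {r = r} {a} {S ++ L} bad
    (span-disjoint⇒indep S {L} (indep-tail {r = r} {a} {S} liS) liL
      (λ v sS sL → h v (span-weaken {r = r} {a} {S} sS) sL))
    where
    bad : ¬ InSpan r (S ++ L) (r a)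
    bad sp with span-++⁻ S {L} sp
    ... | s , l , ss , sl , e = indep-head {r = r} {a} {S} liS
      (span-cong {r = r} {S} (λ i → sym (trans (e i) (trans (cong (s i +_) (l≡0 i)) (+-identityʳ (s i))))) ss)
      where
      l≡0 : ∀ i → l i ≡ 0#
      l≡0 = h l (span-cong {r = r} {a ∷ S} (λ i → sym (sub-add (r a i) (s i) (l i) (e i)))
        (span-lin {r = r} {a ∷ S} 1# (span-∈ {r = r} (here refl)) (span-scale (- 1#) (span-weaken {r = r} {a} {S} ss)))) sl

  indep⇒span-disjoint : ∀ S {L} → Indep r (S ++ L) → ∀ {v} → InSpan r S v → InSpan r L v → ∀ i → v i ≡ 0#
  indep⇒span-disjoint [] li sS sL = span-nil {r = r} sS
  indep⇒span-disjoint (a ∷ S) {L} li {v} sS sL with span-cons⁻ {r = r} {a} {S} sS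
  ... | x , w , sw , e with x ℚₚ.≟ 0#
  ...   | yes x≡0 = λ i → trans (v≡w i) (indep⇒span-disjoint S {L} (indep-tail {r = r} {a} {S ++ L} li) sw
            (span-cong {r = r} {L} v≡w sL) i)
    where
    v≡w : ∀ i → v i ≡ w i
    v≡w i = trans (e i) (trans (cong (λ x → x * r a i + w i) x≡0) (trans (cong (_+ w i) (zeroˡ (r a i))) (+-identityˡ (w i))))
  ...   | no x≢0 with inverse x x≢0
  ...     | d , dx = ⊥-elim (indep-head {r = r} {a} {S ++ L} li
    (span-cong {r = r} {S ++ L} (λ i → sym (solve-pivot d x (r a i) (w i) (v i) dx (e i)))
      (span-lin {r = r} {S ++ L} d (span-mono {L} (Memₚ.∈-++⁺ʳ S) sL) (span-scale (- d) (span-mono {S} Memₚ.∈-++⁺ˡ sw)))))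

  opaque
    extend : Searchable I → ∀ E {T} → Indep r T →
      ∃ λ B → B ⊆ E × Indep r (B ++ T) × (∀ {a} → a ∈ E → InSpan r (B ++ T) (r a)) ×
              (Indep r (E ++ T) ⊎ length B ℕ.< length E)
    extend s [] {T} li = [] , [] , li , (λ ()) , inj₁ li
    extend s (a ∷ E) {T} li with extend s E {T} li
    ... | B , B⊆E , liB , sp , full with extend? {r = r} s {B ++ T} liB a
    ...   | inj₁ in-span = B , a ∷ʳ B⊆E , liB , (λ { (here refl) → in-span ; (there m) → sp m }) , inj₂ (s≤s (Subₚ.length-mono-≤ B⊆E))
    ...   | inj₂ li′ = a ∷ B , refl ∷ B⊆E , li′ ,
            (λ { (here refl) → span-∈ {r = r} (here refl) ; (there m) → span-weaken {r = r} {a} {B ++ T} (sp m) }) ,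
            full′ full
      where
      full′ : Indep r (E ++ T) ⊎ length B ℕ.< length E → Indep r (a ∷ E ++ T) ⊎ suc (length B) ℕ.< suc (length E)
      full′ (inj₂ lt) = inj₂ (s≤s lt)
      full′ (inj₁ liE) = inj₁ (indep-cons {r = r} {a} {E ++ T} (λ spa → indep-head {r = r} {a} {B ++ T} li′
        (span-trans {r = r} {r} {E ++ T} {B ++ T} (λ m → [ sp , (λ mT → span-∈ {r = r} (Memₚ.∈-++⁺ʳ B mT)) ]′ (Memₚ.∈-++⁻ E m)) spa)) liE)

  indep-of-length : Searchable I → ∀ {L T} → Indep r L → (∀ {a} → a ∈ L → InSpan r T (r a)) →
    length T ℕ.≤ length L → Indep r T
  indep-of-length s {L} {T} li sp le with extend s T {[]} (indep-[] {r = r})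
  ... | B , B⊆T , liB , spB , inj₁ liT = subst (Indep r) (Listₚ.++-identityʳ T) liT
  ... | B , B⊆T , liB , spB , inj₂ lt = ⊥-elim (ℕₚ.<⇒≱ lt (ℕₚ.≤-trans le
    (subst (λ z → length L ℕ.≤ length z) (Listₚ.++-identityʳ B)
      (steinitz {r = r} {r} {L} {B ++ []} li (λ m → span-trans {r = r} {r} {T} {B ++ []} spB (sp m))))))

-- Polynomials over ℚ, as coefficient lists

eval : List ℚ → ℚ → ℚ
eval []       t = 0#
eval (c ∷ cs) t = c + t * eval cs t

ι : ℕ → ℚ
ι n = ℚ.mkℚ (ℤ.+ n) 0 (Coprime.sym (Coprime.1-coprimeTo n))

q≤ι∣↥q∣ : ∀ q → q ℚ.≤ ι (ℤ.∣ ℚ.↥ q ∣)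
q≤ι∣↥q∣ (ℚ.mkℚ a d c) = ℚ.*≤* (ℤₚ.≤-trans (ℤₚ.≤-reflexive (ℤₚ.*-identityʳ a)) (ℤₚ.≤-trans (a≤∣a∣ a)
  (ℤₚ.≤-trans (ℤₚ.≤-reflexive (sym (ℤₚ.*-identityʳ (ℤ.+ ℤ.∣ a ∣))))
    (ℤₚ.*-monoˡ-≤-nonNeg (ℤ.+ ℤ.∣ a ∣) (ℤ.+≤+ (s≤s z≤n))))))
  where
  a≤∣a∣ : ∀ a → a ℤ.≤ ℤ.+ ℤ.∣ a ∣
  a≤∣a∣ (ℤ.+ n) = ℤₚ.≤-refl
  a≤∣a∣ ℤ.-[1+ n ] = ℤ.-≤+

ι-mono : ∀ {m n} → m ℕ.≤ n → ι m ℚ.≤ ι n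
ι-mono m≤n = ℚ.*≤* (ℤₚ.*-monoʳ-≤-nonNeg 1ℤ (ℤ.+≤+ m≤n))

opaque
  unfolding _+_ isRing

  archimedean : ∀ q δ → 0# ℚ.< δ → ∃ λ K → ∀ {n} → K ℕ.≤ n → q ℚ.≤ ι n * δ
  archimedean q δ δ>0 = ℤ.∣ ℚ.↥ r ∣ , λ {n} K≤n → subst (ℚ._≤ ι n ℚ.* δ) r*δ≡q
    (ℚₚ.*-monoʳ-≤-nonNeg δ {{ℚ.nonNegative (ℚₚ.<⇒≤ δ>0)}} (ℚₚ.≤-trans (q≤ι∣↥q∣ r) (ι-mono K≤n)))
    where
    δ≢0 : δ ≢ 0#
    δ≢0 e = ℚₚ.<⇒≢ δ>0 (sym e)
    r : ℚ
    r = proj₁ (div δ q δ≢0)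
    r*δ≡q : r ℚ.* δ ≡ q
    r*δ≡q = proj₂ (div δ q δ≢0)

  growth : ∀ cs → (∀ t → eval cs t ≡ 0#) ⊎
    ∃ λ δ → 0# ℚ.< δ × ∃ λ N → ∀ {n} → N ℕ.≤ n → δ ℚ.≤ ℚ.∣ eval cs (ι n) ∣
  growth [] = inj₁ λ t → refl
  growth (c ∷ cs) with growth cs
  ... | inj₁ z with c ℚₚ.≟ 0#
  ...   | yes c≡0 = inj₁ λ t → trans (cong₂ _+_ c≡0 (trans (cong (t *_) (z t)) (zeroʳ t))) (+-identityˡ 0#)
  ...   | no c≢0 = inj₂ (ℚ.∣ c ∣ , ℚₚ.≰⇒> (λ le → c≢0 (ℚₚ.∣p∣≡0⇒p≡0 c (ℚₚ.≤-antisym le (ℚₚ.0≤∣p∣ c)))) , 0 , λ {n} _ →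
            ℚₚ.≤-reflexive (cong ℚ.∣_∣ (sym (trans (cong (c +_) (trans (cong (ι n *_) (z (ι n))) (zeroʳ (ι n)))) (+-identityʳ c)))))
  growth (c ∷ cs) | inj₂ (δ , δ>0 , N , big) with archimedean (ℚ.∣ c ∣ + δ) δ δ>0
  ... | K , large = inj₂ (δ , δ>0 , N ℕ.⊔ K , λ {n} le → bound n (eval cs (ι n)) (big (ℕₚ.≤-trans (ℕₚ.m≤m⊔n N K) le))
                     (large (ℕₚ.≤-trans (ℕₚ.m≤n⊔m N K) le)))
    where
    alg : ∀ c m → m ≡ (c + m) + - c
    alg = solve-∀ ℚ-ring
    alg₂ : ∀ a d → - a + (a + d) ≡ d
    alg₂ = solve-∀ ℚ-ring
    alg₃ : ∀ a d → - a + (d + a) ≡ d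
    alg₃ = solve-∀ ℚ-ring
    bound : ∀ n g → δ ℚ.≤ ℚ.∣ g ∣ → ℚ.∣ c ∣ + δ ℚ.≤ ι n * δ → δ ℚ.≤ ℚ.∣ c + ι n * g ∣
    bound n g δ≤g le = subst₂ ℚ._≤_ (alg₂ ℚ.∣ c ∣ δ) (alg₃ ℚ.∣ c ∣ ℚ.∣ c + ι n * g ∣) (ℚₚ.+-monoʳ-≤ (- ℚ.∣ c ∣) chain)
      where
      chain : ℚ.∣ c ∣ + δ ℚ.≤ ℚ.∣ c + ι n * g ∣ + ℚ.∣ c ∣
      chain = ℚₚ.≤-trans le (ℚₚ.≤-trans (ℚₚ.*-monoˡ-≤-nonNeg (ι n) δ≤g)
        (ℚₚ.≤-trans (ℚₚ.≤-reflexive (trans (sym (ℚₚ.∣p*q∣≡∣p∣*∣q∣ (ι n) g)) (cong ℚ.∣_∣ (alg c (ι n * g)))))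
        (ℚₚ.≤-trans (ℚₚ.∣p+q∣≤∣p∣+∣q∣ (c + ι n * g) (- c)) (ℚₚ.≤-reflexive (cong (ℚ.∣ c + ι n * g ∣ +_) (ℚₚ.∣-p∣≡∣p∣ c))))))

  nonzero-of-≥ : ∀ {δ x} → 0# ℚ.< δ → δ ℚ.≤ ℚ.∣ x ∣ → x ≢ 0#
  nonzero-of-≥ δ>0 le refl = ℚₚ.<⇒≢ (ℚₚ.<-≤-trans δ>0 le) refl

IsPoly : (ℚ → ℚ) → Set
IsPoly f = ∃ λ cs → ∀ t → f t ≡ eval cs t

Eventually : (ℚ → Set) → Set
Eventually P = ∃ λ N → ∀ {n} → N ℕ.≤ n → P (ι n)

eventually-× : ∀ {P Q} → Eventually P → Eventually Q → Eventually (λ t → P t × Q t)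
eventually-× (M , p) (N , q) = M ℕ.⊔ N , λ le → p (ℕₚ.≤-trans (ℕₚ.m≤m⊔n M N) le) , q (ℕₚ.≤-trans (ℕₚ.m≤n⊔m M N) le)

eventually-⇒ : ∀ {P Q : ℚ → Set} → (∀ t → P t → Q t) → Eventually P → Eventually Q
eventually-⇒ h (N , p) = N , λ le → h _ (p le)

poly-eventually≢0 : ∀ {f} → IsPoly f → ∀ {t₀} → f t₀ ≢ 0# → Eventually (λ t → f t ≢ 0#)
poly-eventually≢0 (cs , e) {t₀} ne with growth cs
... | inj₁ z = ⊥-elim (ne (trans (e t₀) (z t₀)))
... | inj₂ (δ , δ>0 , N , big) = N , λ {n} le z → nonzero-of-≥ δ>0 (big le) (trans (sym (e (ι n))) z)

poly-affine : ∀ a b → IsPoly (λ t → a + t * b)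
poly-affine a b = a ∷ b ∷ [] , λ t → sym (alg a b t)
  where
  opaque
    unfolding _+_ isRing
    alg : ∀ a b t → a + t * (b + t * 0#) ≡ a + t * b
    alg = solve-∀ ℚ-ring

poly-lin : ∀ {f g} x → IsPoly f → IsPoly g → IsPoly (λ t → x * f t + g t)
poly-lin x (as , ea) (bs , eb) = go as bs , λ t → trans (cong₂ (λ a b → x * a + b) (ea t) (eb t)) (sym (go-eval as bs t))
  where
  opaque
    unfolding _+_ isRing
    l₀ : ∀ x b → b ≡ x * 0# + b
    l₀ = solve-∀ ℚ-ring
    l₁ : ∀ x a t s → x * a + t * (x * s + 0#) ≡ x * (a + t * s) + 0#
    l₁ = solve-∀ ℚ-ring
    l₂ : ∀ x a b t s r → x * a + b + t * (x * s + r) ≡ x * (a + t * s) + (b + t * r)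
    l₂ = solve-∀ ℚ-ring
  go : List ℚ → List ℚ → List ℚ
  go [] bs = bs
  go (a ∷ as) [] = x * a ∷ go as []
  go (a ∷ as) (b ∷ bs) = x * a + b ∷ go as bs
  go-eval : ∀ as bs t → eval (go as bs) t ≡ x * eval as t + eval bs t
  go-eval [] bs t = l₀ x (eval bs t)
  go-eval (a ∷ as) [] t = trans (cong (λ s → x * a + t * s) (go-eval as [] t)) (l₁ x a t (eval as t))
  go-eval (a ∷ as) (b ∷ bs) t = trans (cong (λ s → x * a + b + t * s) (go-eval as bs t)) (l₂ x a b t (eval as t) (eval bs t))

poly-0 : IsPoly (λ _ → 0#)
poly-0 = [] , λ t → refl

poly-resp : ∀ {f g} → (∀ t → g t ≡ f t) → IsPoly f → IsPoly g
poly-resp e (cs , h) = cs , λ t → trans (e t) (h t)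

poly-* : ∀ {f g} → IsPoly f → IsPoly g → IsPoly (λ t → f t * g t)
poly-* {g = g} (as , ea) pg = poly-resp (λ t → cong (_* g t) (ea t)) (go as)
  where
  opaque
    unfolding _+_ isRing
    l₁ : ∀ a t s r → (a + t * s) * r ≡ a * r + (0# + t * (s * r))
    l₁ = solve-∀ ℚ-ring
  shift : ∀ {h} → IsPoly h → IsPoly (λ t → 0# + t * h t)
  shift (cs , e) = 0# ∷ cs , λ t → cong (λ s → 0# + t * s) (e t)
  go : ∀ as → IsPoly (λ t → eval as t * g t)
  go [] = poly-resp (λ t → zeroˡ (g t)) poly-0
  go (a ∷ as) = poly-resp (λ t → l₁ a t (eval as t) (g t)) (poly-lin a pg (shift (go as)))

poly-sub : ∀ {f g} → IsPoly f → IsPoly g → IsPoly (λ t → f t - g t)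
poly-sub {f} {g} pf pg = poly-resp (λ t → alg (f t) (g t)) (poly-lin (- 1#) pg pf)
  where
  opaque
    unfolding _+_ isRing
    alg : ∀ a b → a - b ≡ (- 1#) * b + a
    alg = solve-∀ ℚ-ring

eventually-LI : ∀ {k} {I : Set} → Searchable I → (v : ℚ → Fin k → I → ℚ) → (∀ e i → IsPoly (λ t → v t e i)) →
  ∀ {t₀} → LI (v t₀) → Eventually (λ t → LI (v t))
eventually-LI {zero} s v pv li = 0 , λ _ x z ()
eventually-LI {suc k} s v pv {t₀} li with s (v t₀ zero)
... | inj₂ z = ⊥-elim (LI⇒¬Dependent {v = v t₀} li (zero-dependent (v t₀) z))
... | inj₁ (c , ne) = eventually-⇒
  {P = λ t → v t zero c ≢ 0# × LI (elim (v t) c)} {Q = λ t → LI (v t)} (λ t (ne′ , li′) → LI-unelim (v t) c ne′ li′)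
  (eventually-× {P = λ t → v t zero c ≢ 0#} {Q = λ t → LI (elim (v t) c)} (poly-eventually≢0 (pv zero c) ne)
    (eventually-LI s (λ t → elim (v t) c)
      (λ e i → poly-sub (poly-* (pv zero c) (pv (suc e) i)) (poly-* (pv (suc e) c) (pv zero i)))
      (LI-elim (v t₀) c ne li)))

-- Rows of the rigidity matrix

Pair : ℕ → Set
Pair n = Fin n × Fin n

δ : ∀ {n} → Fin n → Fin n → ℚ
δ u w = if w == u then 1# else 0#

row : ∀ {n} → Placement n → Pair n → Fin n × Fin 3 → ℚ
row p (u , v) (w , c) = (p u c - p v c) * (δ u w - δ v w)

IndepAt : ∀ {n} → Placement n → List (Pair n) → Set
IndepAt p = Indep (row p)

SpanAt : ∀ {n} → Placement n → List (Pair n) → Pair n → Set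
SpanAt p L e = InSpan (row p) L (row p e)

record Independent {n} (L : List (Pair n)) : Set where
  constructor independent
  field
    placement : Placement n
    indepAt   : IndepAt placement L

search-coord : ∀ {n} → Searchable (Fin n × Fin 3)
search-coord = search-× search-Fin

opaque
  unfolding _+_ isRing

  rigRow≡row : ∀ {n} (p : Placement n) e w c → rigRow p e w c ≡ row p e (w , c)
  rigRow≡row p (u , v) w c with w ≟ u | w ≟ v
  ... | yes refl | yes refl = l (p u c)
    where l : ∀ a → a - a ≡ (a - a) * (1# - 1#)
          l = solve-∀ ℚ-ring
  ... | yes refl | no _ = l (p u c) (p v c)
    where l : ∀ a b → a - b ≡ (a - b) * (1# - 0#)
          l = solve-∀ ℚ-ring
  ... | no _ | yes refl = l (p u c) (p v c)
    where l : ∀ a b → b - a ≡ (a - b) * (0# - 1#)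
          l = solve-∀ ℚ-ring
  ... | no _ | no _ = l (p u c) (p v c)
    where l : ∀ a b → 0# ≡ (a - b) * (0# - 0#)
          l = solve-∀ ℚ-ring

  sumℚ≡∑ : ∀ {k} (f : Fin k → ℚ) → sumℚ f ≡ ∑ f
  sumℚ≡∑ {zero} f = refl
  sumℚ≡∑ {suc k} f = cong (f zero +_) (sumℚ≡∑ (f ∘ suc))

  rig-comb : ∀ {n} (p : Placement n) L x w c →
    sumℚ (λ e → x e ℚ.* rigRow p (lookup L e) w c) ≡ comb (row p ∘ lookup L) x (w , c)
  rig-comb p L x w c = trans (sumℚ≡∑ {length L} _) (∑-cong {length L} (λ e → cong (x e *_) (rigRow≡row p (lookup L e) w c)))

  from-IndepList : ∀ {n} (L : List (Pair n)) → IndepList L → Independent L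
  from-IndepList L (p , h) = independent p (mkIndep λ x z → h x (λ w c → trans (rig-comb p L x w c) (z (w , c))))

  to-IndepList : ∀ {n} (L : List (Pair n)) → Independent L → IndepList L
  to-IndepList L (independent p (mkIndep h)) = p , λ x z → h x (λ { (w , c) → trans (sym (rig-comb p L x w c)) (z w c) })

indep-resp : ∀ {A I : Set} {r s : A → I → ℚ} → (∀ a i → r a i ≡ s a i) → ∀ {L} → Indep r L → Indep s L
indep-resp h {L} (mkIndep li) = mkIndep λ x z → li x λ i → trans (∑-cong {length L} λ e → cong (x e *_) (h (lookup L e) i)) (z i)

-- Finitely many independence conditions hold simultaneously: join a placement good for all
-- but one of them to one good for the last, and move far along the line.
line : ∀ {n} → Placement n → Placement n → ℚ → Placement n
line p q t w c = p w c + t * (q w c - p w c)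

line-indep : ∀ {n} (p q : Placement n) {t₀ L} → IndepAt (line p q t₀) L → Eventually (λ t → IndepAt (line p q t) L)
line-indep p q {L = L} (mkIndep li) = eventually-⇒ {P = λ t → LI (row (line p q t) ∘ lookup L)} {Q = λ t → IndepAt (line p q t) L} (λ t → mkIndep)
  (eventually-LI search-coord (λ t → row (line p q t) ∘ lookup L) (λ e → entry (lookup L e)) li)
  where
  opaque
    unfolding _+_ isRing
    alg : ∀ a b a′ b′ d t → ((a + t * (a′ - a)) - (b + t * (b′ - b))) * d ≡ (a - b) * d + t * (((a′ - a) - (b′ - b)) * d)
    alg = solve-∀ ℚ-ring
  entry : ∀ e i → IsPoly (λ t → row (line p q t) e i)
  entry (u , v) (w , c) = poly-resp (alg (p u c) (p v c) (q u c) (q v c) (δ u w - δ v w)) (poly-affine _ _)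

opaque
  generic : ∀ {n} (Ls : List (List (Pair n))) → All Independent Ls → ∃ λ p → All (IndepAt p) Ls
  generic [] [] = (λ _ _ → 0#) , []
  generic (L ∷ Ls) (h ∷ hs) with h | generic Ls hs
  ... | independent q iq | p , ips = finish (eventually-× {P = λ t → IndepAt (line p q t) L} {Q = λ t → All (IndepAt (line p q t)) Ls}
      (line-indep p q (indep-resp at-1 iq)) (many ips))
    where
    opaque
      unfolding _+_ isRing
      l₀ : ∀ a b → a ≡ a + 0# * (b - a)
      l₀ = solve-∀ ℚ-ring
      l₁ : ∀ a b → b ≡ a + 1# * (b - a)
      l₁ = solve-∀ ℚ-ring
    at-0 : ∀ e i → row p e i ≡ row (line p q 0#) e i
    at-0 (u , v) (w , c) = cong₂ (λ a b → (a - b) * (δ u w - δ v w)) (l₀ (p u c) (q u c)) (l₀ (p v c) (q v c))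
    at-1 : ∀ e i → row q e i ≡ row (line p q 1#) e i
    at-1 (u , v) (w , c) = cong₂ (λ a b → (a - b) * (δ u w - δ v w)) (l₁ (p u c) (q u c)) (l₁ (p v c) (q v c))
    many : ∀ {Ls} → All (IndepAt p) Ls → Eventually (λ t → All (IndepAt (line p q t)) Ls)
    many [] = 0 , λ _ → []
    many {M ∷ Ms} (i ∷ is) = eventually-⇒ {P = λ t → IndepAt (line p q t) M × All (IndepAt (line p q t)) Ms}
      {Q = λ t → All (IndepAt (line p q t)) (M ∷ Ms)} (λ t (a , as) → a ∷ as)
      (eventually-× {P = λ t → IndepAt (line p q t) M} {Q = λ t → All (IndepAt (line p q t)) Ms}
        (line-indep p q (indep-resp at-0 i)) (many is))
    finish : Eventually (λ t → IndepAt (line p q t) L × All (IndepAt (line p q t)) Ls) → ∃ λ p → All (IndepAt p) (L ∷ Ls)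
    finish (N , h) = line p q (ι N) , proj₁ (h ℕₚ.≤-refl) ∷ proj₂ (h ℕₚ.≤-refl)

∑-single : ∀ {k} (z : Fin k) (f : Fin k → ℚ) → (∀ y → y ≢ z → f y ≡ 0#) → ∑ f ≡ f z
∑-single zero f h = trans (cong (f zero +_) (∑-0 (λ i → h (suc i) λ ()))) (+-identityʳ (f zero))
∑-single (suc z) f h = trans (cong₂ _+_ (h zero λ ()) (∑-single z (f ∘ suc) (λ y ne → h (suc y) (ne ∘ Finₚ.suc-injective)))) (+-identityˡ (f (suc z)))

δ-≡ : ∀ {n} (u : Fin n) → δ u u ≡ 1#
δ-≡ u with u ≟ u
... | yes _ = refl
... | no ne = ⊥-elim (ne refl)

δ-≢ : ∀ {n} {u w : Fin n} → w ≢ u → δ u w ≡ 0#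
δ-≢ {u = u} {w} ne with w ≟ u
... | yes e = ⊥-elim (ne e)
... | no _ = refl

δ-inj : ∀ {m n} {f : Fin m → Fin n} → Injective _≡_ _≡_ f → ∀ u w → δ (f u) (f w) ≡ δ u w
δ-inj {f = f} inj u w = case w ≟ u of λ
  { (yes refl) → trans (δ-≡ (f u)) (sym (δ-≡ u))
  ; (no ne) → trans (δ-≢ (ne ∘ inj)) (sym (δ-≢ ne)) }

opaque
  unfolding _+_ isRing
  row-swap : ∀ {n} (p : Placement n) u v i → row p (u , v) i ≡ row p (v , u) i
  row-swap p u v (w , c) = l (p u c) (p v c) (δ u w) (δ v w)
    where l : ∀ a b d e → (a - b) * (d - e) ≡ (b - a) * (e - d)
          l = solve-∀ ℚ-ring

  row-at : ∀ a b → (a - b) * (1# - 0#) ≡ a - b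
  row-at = solve-∀ ℚ-ring
  row-off : ∀ a b → (a - b) * (0# - 0#) ≡ 0#
  row-off = solve-∀ ℚ-ring
  push-term : ∀ g d a b → g * (d * (a - b)) ≡ d * (a * g) + (- d) * (b * g)
  push-term = solve-∀ ℚ-ring
  push-sum : ∀ d a b → d * a + (- d) * b ≡ d * (a - b)
  push-sum = solve-∀ ℚ-ring
  mul-lin : ∀ g x a b → g * (x * a + b) ≡ x * (g * a) + g * b
  mul-lin = solve-∀ ℚ-ring

map² : ∀ {m n} → (Fin m → Fin n) → Pair m → Pair n
map² f (u , v) = f u , f v

∑-δ : ∀ {n} (z : Fin n) (f : Fin n → ℚ) → ∑ (λ y → δ z y * f y) ≡ f z
∑-δ z f = trans (∑-single z _ (λ y ne → trans (cong (_* f y) (δ-≢ ne)) (zeroˡ (f y))))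
  (trans (cong (_* f z) (δ-≡ z)) (*-identityˡ (f z)))

push : ∀ {m n} → (Fin m → Fin n) → (Fin m × Fin 3 → ℚ) → Fin n × Fin 3 → ℚ
push π v (x , c) = ∑ (λ y → δ (π y) x * v (y , c))

push-linear : ∀ {m n} (π : Fin m → Fin n) → Linear (push π)
push-linear {m} π = record
  { resp = λ { e (x , c) → ∑-cong (λ y → cong (δ (π y) x *_) (e (y , c))) }
  ; lin = λ { a v w (x , c) → trans (∑-cong (λ y → mul-lin (δ (π y) x) a (v (y , c)) (w (y , c)))) (∑-lin {m} a _ _) } }

push-row : ∀ {m n} (π : Fin m → Fin n) p e i → push π (row (p ∘ π) e) i ≡ row p (map² π e) i
push-row {m} π p (u , v) (x , c) =
  trans (∑-cong (λ y → push-term (δ (π y) x) d (δ u y) (δ v y)))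
  (trans (∑-lin {m} d _ _)
  (trans (cong₂ (λ a b → d * a + b) (∑-δ u (λ y → δ (π y) x)) (trans (∑-* {m} (- d) _) (cong ((- d) *_) (∑-δ v (λ y → δ (π y) x)))))
    (push-sum d (δ (π u) x) (δ (π v) x))))
  where
  d : ℚ
  d = p (π u) c - p (π v) c

indep-fold : ∀ {m n} (π : Fin m → Fin n) p {L} → IndepAt p (map (map² π) L) → IndepAt (p ∘ π) L
indep-fold π p {L} li = indep-image (push-linear π) (indep-unmap (map² π) (push-row π p) li)

pull-linear : ∀ {m n} (f : Fin m → Fin n) → Linear {Fin n × Fin 3} {Fin m × Fin 3} (λ v i → v (f (proj₁ i) , proj₂ i))
pull-linear f = record { resp = λ e i → e _ ; lin = λ x v w i → refl }

pull-row : ∀ {m n} {f : Fin m → Fin n} → Injective _≡_ _≡_ f → ∀ q e i →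
  row (q ∘ f) e i ≡ row q (map² f e) (f (proj₁ i) , proj₂ i)
pull-row {f = f} inj q (u , v) (w , c) = cong₂ (λ a b → (q (f u) c - q (f v) c) * (a - b)) (sym (δ-inj inj u w)) (sym (δ-inj inj v w))

indep-embed : ∀ {m n} {f : Fin m → Fin n} → Injective _≡_ _≡_ f → ∀ q {L} → IndepAt (q ∘ f) L → IndepAt q (map (map² f) L)
indep-embed {f = f} inj q li = indep-image (pull-linear f) (indep-map (map² f) (pull-row inj q) li)

extend-placement : ∀ {m n} {f : Fin m → Fin n} → Injective _≡_ _≡_ f → (p : Placement m) →
  ∃ λ q → ∀ x → q (f x) ≡ p x
extend-placement {f = f} inj p = q , q-f
  where
  q : Placement _
  q z with Finₚ.any? (λ x → f x ≟ z)
  ... | yes (x , _) = p x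
  ... | no _ = λ _ → 0#
  q-f : ∀ x → q (f x) ≡ p x
  q-f x with Finₚ.any? (λ y → f y ≟ f x)
  ... | yes (y , e) = cong p (inj e)
  ... | no none = ⊥-elim (none (x , refl))

row-resp : ∀ {n} {p q : Placement n} → (∀ x → p x ≡ q x) → ∀ e i → row p e i ≡ row q e i
row-resp h (u , v) (w , c) = cong₂ (λ a b → (a c - b c) * (δ u w - δ v w)) (h u) (h v)

independent-embed : ∀ {m n} {f : Fin m → Fin n} → Injective _≡_ _≡_ f → ∀ {L} → Independent L → Independent (map (map² f) L)
independent-embed {f = f} inj (independent p li) with extend-placement inj p
... | q , q-f = independent q (indep-embed inj q (indep-resp (row-resp (λ x → sym (q-f x))) li))

independent-fold : ∀ {m n} (π : Fin m → Fin n) {L} → Independent (map (map² π) L) → Independent L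
independent-fold π (independent p li) = independent (p ∘ π) (indep-fold π p li)

independent-⊆ : ∀ {n} {M L : List (Pair n)} → M ⊆ L → Independent L → Independent M
independent-⊆ s (independent p li) = independent p (indep-⊆ s li)

-- Stars and Henneberg extensions

clique : ∀ {n} → List (Fin n) → List (Pair n)
clique [] = []
clique (y ∷ ys) = map (y ,_) ys ++ clique ys

Avoids : ∀ {n} → Fin n → Pair n → Set
Avoids w (u , v) = u ≢ w × v ≢ w

dir : ∀ {n} → Placement n → Fin n → Fin n → Fin 3 → ℚ
dir q w x c = q w c - q x c

star-indep : ∀ {n} (q : Placement n) {w xs L} → Indep (dir q w) xs → All (_≢ w) xs → All (Avoids w) L →
  IndepAt q L → IndepAt q (map (w ,_) xs ++ L)
star-indep q {w} {xs} {L} li xs≢w avoid liL = indep-modulo restrict-linear {row q} {dir q w} proj₂ (map (w ,_) xs) {L} {[]}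
  (λ m c → case Memₚ.∈-map⁻ (w ,_) m of λ { (x , mx , refl) → at-w x c (All.lookup xs≢w mx) })
  (λ m → span-0 (λ c → off-w m c))
  (subst (Indep (dir q w)) (sym (trans (Listₚ.++-identityʳ _) (trans (sym (Listₚ.map-∘ xs)) (Listₚ.map-id xs)))) li) liL
  where
  restrict-linear : Linear (λ v c → v (w , c))
  restrict-linear = record { resp = λ e c → e _ ; lin = λ x v u c → refl }
  at-w : ∀ x c → x ≢ w → row q (w , x) (w , c) ≡ dir q w x c
  at-w x c x≢w = trans (cong₂ (λ a b → dir q w x c * (a - b)) (δ-≡ w) (δ-≢ (x≢w ∘ sym))) (row-at (q w c) (q x c))
  off-w : ∀ {e} → e ∈ L → ∀ c → row q e (w , c) ≡ 0#
  off-w {u , v} m c with All.lookup avoid m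
  ... | u≢w , v≢w = trans (cong₂ (λ a b → dir q u v c * (a - b)) (δ-≢ (u≢w ∘ sym)) (δ-≢ (v≢w ∘ sym))) (row-off (q u c) (q v c))

-- An affine dependence λ of the points yields the stress λᵢ λⱼ on the complete graph.
module _ {n} (p : Placement n) where

  private
    Σx Σp Σδ Σpδ : (ys : List (Fin n)) → (Fin (length ys) → ℚ) → Fin n × Fin 3 → ℚ
    Σx  ys x i = ∑ x
    Σp  ys x (w , c) = ∑ (λ e → x e * p (lookup ys e) c)
    Σδ  ys x (w , c) = ∑ (λ e → x e * δ (lookup ys e) w)
    Σpδ ys x (w , c) = ∑ (λ e → x e * (p (lookup ys e) c * δ (lookup ys e) w))

    stress : (ys : List (Fin n)) → (Fin (length ys) → ℚ) → Fin n × Fin 3 → ℚ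
    stress ys x i = Σx ys x i * Σpδ ys x i - Σp ys x i * Σδ ys x i

    star : (y : Fin n) (ys : List (Fin n)) → ℚ → (Fin (length ys) → ℚ) → Fin n × Fin 3 → ℚ
    star y ys l x i = l * comb (λ e → row p (y , lookup ys e)) x i

    opaque
      unfolding _+_ isRing
      term : ∀ x a b d e → x * ((a - b) * (d - e)) ≡ (a * d) * x + ((- d) * (x * b) + ((- a) * (x * e) + x * (b * e)))
      term = solve-∀ ℚ-ring
      expand : ∀ l a d X P D W → (l + X) * (l * (a * d) + W) - (l * a + P) * (l * d + D) ≡
        1# * (l * ((a * d) * X + ((- d) * P + ((- a) * D + W)))) + (X * W - P * D)
      expand = solve-∀ ℚ-ring

    stress-cons : ∀ y ys x i → stress (y ∷ ys) x i ≡ 1# * star y ys (x zero) (x ∘ suc) i + stress ys (x ∘ suc) i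
    stress-cons y ys x i@(w , c) = trans (expand (x zero) (p y c) (δ y w) (Σx ys x′ i) (Σp ys x′ i) (Σδ ys x′ i) (Σpδ ys x′ i))
      (cong (λ s → 1# * (x zero * s) + stress ys x′ i) (sym
        (trans (∑-cong (λ e → term (x′ e) (p y c) (p (lookup ys e) c) (δ y w) (δ (lookup ys e) w)))
        (trans (∑-lin {length ys} (p y c * δ y w) _ _) (cong (p y c * δ y w * Σx ys x′ i +_)
        (trans (∑-lin {length ys} (- δ y w) _ _) (cong ((- δ y w) * Σp ys x′ i +_)
        (∑-lin {length ys} (- p y c) _ _))))))))
      where x′ : Fin (length ys) → ℚ
            x′ = x ∘ suc

    star-span : ∀ y ys l x → InSpan (row p) (map (y ,_) ys) (star y ys l x)
    star-span y ys l x = span-map {r = λ z → row p (y , z)} (y ,_) (λ _ _ → refl) (span-scale l (inSpan (x , λ i → refl)))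

    stress-span : ∀ ys x → InSpan (row p) (clique ys) (stress ys x)
    stress-span [] x = span-0 λ i → l
      where
      opaque
        unfolding _+_ isRing
        l : 0# * 0# - 0# * 0# ≡ 0#
        l = refl
    stress-span (y ∷ ys) x = span-cong (λ i → sym (stress-cons y ys x i))
      (span-lin 1# (span-mono Memₚ.∈-++⁺ˡ (star-span y ys (x zero) (x ∘ suc)))
                   (span-mono (Memₚ.∈-++⁺ʳ (map (y ,_) ys)) (stress-span ys (x ∘ suc))))

  affinely-independent : ∀ ys → IndepAt p (clique ys) → (x : Fin (length ys) → ℚ) →
    ∑ x ≡ 0# → (∀ c → ∑ (λ e → x e * p (lookup ys e) c) ≡ 0#) → ∀ e → x e ≡ 0#
  affinely-independent (y ∷ ys) li x x≡0 p≡0 = all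
    where
    opaque
      unfolding _+_ isRing
      zz : ∀ a b → 0# * a - 0# * b ≡ 0#
      zz = solve-∀ ℚ-ring
      neg : ∀ a b → 1# * a + b ≡ 0# → (- 1#) * b ≡ a
      neg a b e = trans (l a b) (trans (cong (λ s → a - s) e) (l₂ a))
        where l : ∀ a b → (- 1#) * b ≡ a - (1# * a + b)
              l = solve-∀ ℚ-ring
              l₂ : ∀ a → a - 0# ≡ a
              l₂ = solve-∀ ℚ-ring
    stress≡0 : ∀ i → stress (y ∷ ys) x i ≡ 0#
    stress≡0 (w , c) = trans (cong₂ (λ a b → a * Σpδ (y ∷ ys) x (w , c) - b * Σδ (y ∷ ys) x (w , c)) x≡0 (p≡0 c)) (zz _ _)
    star≡0 : ∀ i → star y ys (x zero) (x ∘ suc) i ≡ 0#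
    star≡0 = indep⇒span-disjoint (map (y ,_) ys) li (star-span y ys (x zero) (x ∘ suc))
      (span-cong (λ i → neg _ _ (trans (sym (stress-cons y ys x i)) (stress≡0 i))) (span-scale (- 1#) (stress-span ys (x ∘ suc))))
    star-li : Indep (λ z → row p (y , z)) ys
    star-li = indep-unmap (y ,_) (λ _ _ → refl) (indep-⊆ (Subₚ.++⁺ʳ (clique ys) ⊆-refl) li)
    head≡0 : x zero ≡ 0#
    head≡0 with x zero ℚₚ.≟ 0#
    ... | yes e = e
    ... | no ne = trans (sym (+-identityʳ (x zero))) (trans (cong (x zero +_) (sym (∑-0
            (indep star-li (x ∘ suc) (λ i → x*y≡0⇒y≡0 ne (star≡0 i)))))) x≡0)
    tail-0 : ∀ {a b} → x zero * a + b ≡ 0# → b ≡ 0#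
    tail-0 {a} {b} e = trans (sym (trans (cong (λ z → z * a + b) head≡0) (trans (cong (_+ b) (zeroˡ a)) (+-identityˡ b)))) e
    tail-0′ : ∀ {b} → x zero + b ≡ 0# → b ≡ 0#
    tail-0′ {b} e = trans (sym (trans (cong (_+ b) head≡0) (+-identityˡ b))) e
    all : ∀ e → x e ≡ 0#
    all zero = head≡0
    all (suc e) = affinely-independent ys (indep-⊆ (Subₚ.++⁺ˡ (map (y ,_) ys) ⊆-refl) li) (x ∘ suc)
      (tail-0′ x≡0) (λ c → tail-0 (p≡0 c)) e

  clique⇒dir : ∀ {w xs} → IndepAt p (clique (w ∷ xs)) → Indep (dir p w) xs
  clique⇒dir {w} {xs} li = mkIndep λ x z e → affinely-independent (w ∷ xs) li (consF (- ∑ x) x) (-‿inverseˡ (∑ x))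
    (λ c → trans (cong ((- ∑ x) * p w c +_) (refl {x = ∑ (λ e → x e * p (lookup xs e) c)})) (sum x z c)) (suc e)
    where
    opaque
      unfolding _+_ isRing
      t : ∀ x a b → x * (a - b) ≡ a * x + (- 1#) * (x * b)
      t = solve-∀ ℚ-ring
      u : ∀ a X P → a * X + (- 1#) * P ≡ 0# → (- X) * a + P ≡ 0#
      u a X P e = trans (l a X P) (trans (cong -_ e) refl)
        where l : ∀ a X P → (- X) * a + P ≡ - (a * X + (- 1#) * P)
              l = solve-∀ ℚ-ring
    sum : ∀ x → (∀ c → comb (dir p w ∘ lookup xs) x c ≡ 0#) → ∀ c → (- ∑ x) * p w c + ∑ (λ e → x e * p (lookup xs e) c) ≡ 0#
    sum x z c = u (p w c) (∑ x) _ (trans (sym (trans (∑-cong (λ e → t (x e) (p w c) (p (lookup xs e) c)))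
      (trans (∑-lin {length xs} (p w c) _ _) (cong (p w c * ∑ x +_) (∑-* {length xs} (- 1#) _))))) (z c))

  star-extend : ∀ {w xs L} → IndepAt p (clique (w ∷ xs)) → All (_≢ w) xs → All (Avoids w) L →
    IndepAt p L → IndepAt p (map (w ,_) xs ++ L)
  star-extend li = star-indep p (clique⇒dir li)

opaque
  unfolding _+_ isRing
  coef₃¹ : ∀ a b c → a * (0# - 1#) + (b * (0# - 0#) + (c * (0# - 0#) + 0#)) ≡ 0# → a ≡ 0#
  coef₃¹ a b c e = trans (l a b c) (cong -_ e)
    where l : ∀ a b c → a ≡ - (a * (0# - 1#) + (b * (0# - 0#) + (c * (0# - 0#) + 0#)))
          l = solve-∀ ℚ-ring
  coef₃² : ∀ a b c → a * (0# - 0#) + (b * (0# - 1#) + (c * (0# - 0#) + 0#)) ≡ 0# → b ≡ 0#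
  coef₃² a b c e = trans (l a b c) (cong -_ e)
    where l : ∀ a b c → b ≡ - (a * (0# - 0#) + (b * (0# - 1#) + (c * (0# - 0#) + 0#)))
          l = solve-∀ ℚ-ring
  coef₃³ : ∀ a b c → a * (0# - 0#) + (b * (0# - 0#) + (c * (0# - 1#) + 0#)) ≡ 0# → c ≡ 0#
  coef₃³ a b c e = trans (l a b c) (cong -_ e)
    where l : ∀ a b c → c ≡ - (a * (0# - 0#) + (b * (0# - 0#) + (c * (0# - 1#) + 0#)))
          l = solve-∀ ℚ-ring
  coef₂¹ : ∀ a b → a * (0# - 1#) + (b * (0# - 0#) + 0#) ≡ 0# → a ≡ 0#
  coef₂¹ a b e = trans (l a b) (cong -_ e)
    where l : ∀ a b → a ≡ - (a * (0# - 1#) + (b * (0# - 0#) + 0#))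
          l = solve-∀ ℚ-ring
  coef₂² : ∀ a b → a * (0# - 0#) + (b * (0# - 1#) + 0#) ≡ 0# → b ≡ 0#
  coef₂² a b e = trans (l a b) (cong -_ e)
    where l : ∀ a b → b ≡ - (a * (0# - 0#) + (b * (0# - 1#) + 0#))
          l = solve-∀ ℚ-ring
  coef₁¹ : ∀ a → a * (0# - 1#) + 0# ≡ 0# → a ≡ 0#
  coef₁¹ a e = trans (l a) (cong -_ e)
    where l : ∀ a → a ≡ - (a * (0# - 1#) + 0#)
          l = solve-∀ ℚ-ring

pattern 0f = zero
pattern 1f = suc zero
pattern 2f = suc (suc zero)
pattern 3f = suc (suc (suc zero))
pattern 4f = suc (suc (suc (suc zero)))
pattern 5f = suc (suc (suc (suc (suc zero))))
pattern 6f = suc (suc (suc (suc (suc (suc zero)))))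
pattern 7f = suc (suc (suc (suc (suc (suc (suc zero))))))

-- Placed at the origin and the three unit vectors.
tetrahedron : Independent {4} (clique (0f ∷ 1f ∷ 2f ∷ 3f ∷ []))
tetrahedron = independent p
  (star-indep p {0f} {1f ∷ 2f ∷ 3f ∷ []} d₀ ((λ ()) ∷ (λ ()) ∷ (λ ()) ∷ [])
    (((λ ()) , λ ()) ∷ ((λ ()) , λ ()) ∷ ((λ ()) , λ ()) ∷ [])
  (star-indep p {1f} {2f ∷ 3f ∷ []} d₁ ((λ ()) ∷ (λ ()) ∷ []) (((λ ()) , λ ()) ∷ [])
  (star-indep p {2f} {3f ∷ []} d₂ ((λ ()) ∷ []) [] indep-[])))
  where
  p : Placement 4
  p zero c = 0#
  p (suc i) c = δ i c
  d₀ : Indep (dir p 0f) (1f ∷ 2f ∷ 3f ∷ [])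
  d₀ = mkIndep λ x z → λ
    { 0f → coef₃¹ (x 0f) (x 1f) (x 2f) (z 0f)
    ; 1f → coef₃² (x 0f) (x 1f) (x 2f) (z 1f)
    ; 2f → coef₃³ (x 0f) (x 1f) (x 2f) (z 2f) }
  d₁ : Indep (dir p 1f) (2f ∷ 3f ∷ [])
  d₁ = mkIndep λ x z → λ
    { 0f → coef₂¹ (x 0f) (x 1f) (z 1f)
    ; 1f → coef₂² (x 0f) (x 1f) (z 2f) }
  d₂ : Indep (dir p 2f) (3f ∷ [])
  d₂ = mkIndep λ x z → λ { 0f → coef₁¹ (x 0f) (z 2f) }

lookup-injective : ∀ {A : Set} {xs : List A} → Unique xs → Injective _≡_ _≡_ (lookup xs)
lookup-injective (_ AllPairs.∷ _) {zero} {zero} e = refl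
lookup-injective (px AllPairs.∷ _) {zero} {suc j} e = ⊥-elim (All.lookup px (Memₚ.∈-lookup j) e)
lookup-injective (px AllPairs.∷ _) {suc i} {zero} e = ⊥-elim (All.lookup px (Memₚ.∈-lookup i) (sym e))
lookup-injective (_ AllPairs.∷ u) {suc i} {suc j} e = cong suc (lookup-injective u e)

clique-independent : ∀ {n} {ys : List (Fin n)} → Unique ys → length ys ℕ.≤ 4 → Independent (clique ys)
clique-independent {ys = []} u le = independent (λ _ _ → 0#) indep-[]
clique-independent {ys = y ∷ []} u le = independent (λ _ _ → 0#) indep-[]
clique-independent {ys = _ ∷ _ ∷ []} u le = independent-embed (lookup-injective u)
  (independent-fold {2} {4} (λ i → suc (suc i)) {clique (0f ∷ 1f ∷ [])} (independent-⊆ (Subₚ.++⁺ˡ (map (0f ,_) (1f ∷ 2f ∷ 3f ∷ []) ++ map (1f ,_) (2f ∷ 3f ∷ [])) ⊆-refl) tetrahedron))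
clique-independent {ys = _ ∷ _ ∷ _ ∷ []} u le = independent-embed (lookup-injective u)
  (independent-fold {3} {4} suc {clique (0f ∷ 1f ∷ 2f ∷ [])} (independent-⊆ (Subₚ.++⁺ˡ (map (0f ,_) (1f ∷ 2f ∷ 3f ∷ [])) ⊆-refl) tetrahedron))
clique-independent {ys = _ ∷ _ ∷ _ ∷ _ ∷ []} u le = independent-embed (lookup-injective u) tetrahedron
clique-independent {ys = _ ∷ _ ∷ _ ∷ _ ∷ _ ∷ _} u (s≤s (s≤s (s≤s (s≤s ()))))

henneberg : ∀ {n} {w : Fin n} {xs L} → Unique (w ∷ xs) → length xs ℕ.≤ 3 → All (Avoids w) L →
  Independent L → Independent (map (w ,_) xs ++ L)
henneberg {w = w} {xs} {L} u@(w≢xs AllPairs.∷ _) le avoid h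
  with generic (clique (w ∷ xs) ∷ L ∷ []) (clique-independent u (s≤s le) ∷ (h ∷ []))
... | p , (liK ∷ (liL ∷ [])) = independent p (star-extend p liK (All.map (λ ne e → ne (sym e)) w≢xs) avoid liL)

Star : ℕ → Set
Star n = Fin n × List (Fin n)

stars : ∀ {n} → List (Star n) → List (Pair n) → List (Pair n)
stars [] L = L
stars ((w , xs) ∷ r) L = map (w ,_) xs ++ stars r L

-- A reverse elimination order in which every vertex has at most three later neighbours.
Degenerate : ∀ {n} → List (Star n) → List (Pair n) → Set
Degenerate [] L = ⊤
Degenerate ((w , xs) ∷ r) L = Unique (w ∷ xs) × length xs ℕ.≤ 3 × All (Avoids w) (stars r L) × Degenerate r L

degenerate? : ∀ {n} r (L : List (Pair n)) → Dec (Degenerate r L)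
degenerate? [] L = yes tt
degenerate? {n} ((w , xs) ∷ r) L = unique ×-dec ((length xs ℕₚ.≤? 3) ×-dec (avoids ×-dec degenerate? r L))
  where
  unique : Dec (Unique (w ∷ xs))
  unique = AllPairs.allPairs? (λ x y → ¬? (x ≟ y)) (w ∷ xs)
  avoids : Dec (All (Avoids w) (stars r L))
  avoids = All.all? (λ (u , v) → ¬? (u ≟ w) ×-dec ¬? (v ≟ w)) (stars r L)

stars-independent : ∀ {n} r {L : List (Pair n)} → Degenerate r L → Independent L → Independent (stars r L)
stars-independent [] _ h = h
stars-independent ((w , xs) ∷ r) (u , le , avoid , d) h = henneberg u le avoid (stars-independent r d h)

[]-independent : ∀ {n} → Independent {n} []
[]-independent = independent (λ _ _ → 0#) indep-[]

-- Ranks of pair sets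

T∧⁺ : ∀ {a b} → T a → T b → T (a ∧ b)
T∧⁺ {true} {true} _ _ = tt

T∧ˡ : ∀ {a b} → T (a ∧ b) → T a
T∧ˡ {true} _ = tt

T∧ʳ : ∀ {a b} → T (a ∧ b) → T b
T∧ʳ {true} {true} _ = tt

T∨⁺ˡ : ∀ {a b} → T a → T (a ∨ b)
T∨⁺ˡ {true} _ = tt

T∨⁺ʳ : ∀ {a b} → T b → T (a ∨ b)
T∨⁺ʳ {true} _ = tt
T∨⁺ʳ {false} t = t

T∨⁻ : ∀ {a b} → T (a ∨ b) → T a ⊎ T b
T∨⁻ {true} _ = inj₁ tt
T∨⁻ {false} t = inj₂ t

T-ext : ∀ {a b} → (T a → T b) → (T b → T a) → a ≡ b
T-ext {true} {true} f g = refl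
T-ext {true} {false} f g = ⊥-elim (f tt)
T-ext {false} {true} f g = ⊥-elim (g tt)
T-ext {false} {false} f g = refl

T⇒≡ : ∀ {a} → T a → a ≡ true
T⇒≡ {true} _ = refl

≡⇒T : ∀ {a} → a ≡ true → T a
≡⇒T refl = tt

¬T⇒≡ : ∀ {a} → ¬ T a → a ≡ false
¬T⇒≡ {true} h = ⊥-elim (h tt)
¬T⇒≡ {false} h = refl

≡⇒¬T : ∀ {a} → a ≡ false → ¬ T a
≡⇒¬T refl ()

Symm : ∀ {n} → PairSet n → Set
Symm E = ∀ u v → E u v ≡ E v u

Irrefl : ∀ {n} → PairSet n → Set
Irrefl E = ∀ u → E u u ≡ false

allPairs : ∀ n → List (Pair n)
allPairs n = cartesianProduct (allFin n) (allFin n)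

edgeList : ∀ {n} → PairSet n → List (Pair n)
edgeList {n} E = filterᵇ (λ (u , v) → (toℕ u <ᵇ toℕ v) ∧ E u v) (allPairs n)

∈-edgeList⁺ : ∀ {n} {E : PairSet n} {u v} → toℕ u ℕ.< toℕ v → T (E u v) → (u , v) ∈ edgeList E
∈-edgeList⁺ {u = u} {v} lt t = Memₚ.∈-filter⁺ _ (Memₚ.∈-cartesianProduct⁺ (Memₚ.∈-allFin u) (Memₚ.∈-allFin v)) (T∧⁺ (ℕₚ.<⇒<ᵇ lt) t)

∈-edgeList⁻ : ∀ {n} {E : PairSet n} {e} → e ∈ edgeList E → InSet E e × toℕ (proj₁ e) ℕ.< toℕ (proj₂ e)
∈-edgeList⁻ {n} {E} {u , v} m with Memₚ.∈-filter⁻ _ {xs = allPairs n} m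
... | _ , t = T∧ʳ {toℕ u <ᵇ toℕ v} t , ℕₚ.<ᵇ⇒< _ _ (T∧ˡ t)

edgeList-unique : ∀ {n} (E : PairSet n) → Unique (edgeList E)
edgeList-unique {n} E = Uniqueₚ.filter⁺ _ (Uniqueₚ.cartesianProduct⁺ (Uniqueₚ.allFin⁺ n) (Uniqueₚ.allFin⁺ n))

edgeList-InSet : ∀ {n} (E : PairSet n) → All (InSet E) (edgeList E)
edgeList-InSet E = All.tabulate (λ m → proj₁ (∈-edgeList⁻ m))

Covers : ∀ {n} → List (Pair n) → PairSet n → Set
Covers L E = ∀ u v → T (E u v) → (u , v) ∈ L ⊎ (v , u) ∈ L

edgeList-covers : ∀ {n} {E : PairSet n} → Symm E → Irrefl E → Covers (edgeList E) E
edgeList-covers {E = E} sy ir u v t with ℕₚ.<-cmp (toℕ u) (toℕ v)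
... | tri< lt _ _ = inj₁ (∈-edgeList⁺ lt t)
... | tri> _ _ gt = inj₂ (∈-edgeList⁺ gt (subst T (sy u v) t))
... | tri≈ _ e _ with Finₚ.toℕ-injective e
...   | refl = ⊥-elim (≡⇒¬T (ir u) t)

filterᵇ-⊆ : ∀ {A : Set} {P Q : A → Bool} → (∀ a → T (P a) → T (Q a)) → ∀ L → filterᵇ P L ⊆ filterᵇ Q L
filterᵇ-⊆ h [] = []
filterᵇ-⊆ {P = P} {Q} h (a ∷ L) with P a | Q a | h a
... | true | true | _ = refl ∷ filterᵇ-⊆ h L
... | true | false | f = ⊥-elim (f tt)
... | false | true | _ = a ∷ʳ filterᵇ-⊆ h L
... | false | false | _ = filterᵇ-⊆ h L

edgeList-⊆ : ∀ {n} {E F : PairSet n} → (∀ u v → T (E u v) → T (F u v)) → edgeList E ⊆ edgeList F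
edgeList-⊆ {n} h = filterᵇ-⊆ (λ (u , v) t → T∧⁺ (T∧ˡ t) (h u v (T∧ʳ {toℕ u <ᵇ toℕ v} t))) (allPairs n)

length-filterᵇ-tabulate : ∀ {A : Set} {n} (P : A → Bool) (g : Fin n → A) → length (filterᵇ P (tabulate g)) ≡ countF (P ∘ g)
length-filterᵇ-tabulate {n = zero} P g = refl
length-filterᵇ-tabulate {n = suc n} P g with P (g zero)
... | true = cong suc (length-filterᵇ-tabulate P (g ∘ suc))
... | false = length-filterᵇ-tabulate P (g ∘ suc)

length-filterᵇ-map : ∀ {A B : Set} (P : B → Bool) (f : A → B) ys → length (filterᵇ P (map f ys)) ≡ length (filterᵇ (P ∘ f) ys)
length-filterᵇ-map P f [] = refl
length-filterᵇ-map P f (y ∷ ys) with P (f y)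
... | true = cong suc (length-filterᵇ-map P f ys)
... | false = length-filterᵇ-map P f ys

length-filterᵇ-product : ∀ {A B : Set} {n} (P : A × B → Bool) (g : Fin n → A) ys →
  length (filterᵇ P (cartesianProduct (tabulate g) ys)) ≡ sumℕ (λ i → length (filterᵇ (λ y → P (g i , y)) ys))
length-filterᵇ-product {n = zero} P g ys = refl
length-filterᵇ-product {n = suc n} P g ys = trans (cong length (Listₚ.filter-++ _ (map (g zero ,_) ys) _))
  (trans (Listₚ.length-++ (filterᵇ P (map (g zero ,_) ys)))
    (cong₂ ℕ._+_ (length-filterᵇ-map P (g zero ,_) ys) (length-filterᵇ-product P (g ∘ suc) ys)))

sumℕ-cong : ∀ {n} {f g : Fin n → ℕ} → (∀ i → f i ≡ g i) → sumℕ f ≡ sumℕ g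
sumℕ-cong {zero} h = refl
sumℕ-cong {suc n} h = cong₂ ℕ._+_ (h zero) (sumℕ-cong (h ∘ suc))

length-edgeList : ∀ {n} (E : PairSet n) → length (edgeList E) ≡ numPairs E
length-edgeList {n} E = trans (length-filterᵇ-product P id (allFin n)) (sumℕ-cong λ u → length-filterᵇ-tabulate (λ v → P (u , v)) id)
  where
  P : Pair n → Bool
  P (u , v) = (toℕ u <ᵇ toℕ v) ∧ E u v

unique-∈⇒≤ : ∀ {A : Set} {xs ys : List A} → Unique xs → (∀ {a} → a ∈ xs → a ∈ ys) → length xs ℕ.≤ length ys
unique-∈⇒≤ {xs = []} u h = z≤n
unique-∈⇒≤ {xs = x ∷ xs} (px AllPairs.∷ u) h with Memₚ.∈-∃++ (h (here refl))
... | as , bs , refl = subst (suc (length xs) ℕ.≤_) (sym (trans (Listₚ.length-++ as) (ℕₚ.+-suc (length as) (length bs))))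
  (s≤s (subst (length xs ℕ.≤_) (Listₚ.length-++ as) (unique-∈⇒≤ {ys = as ++ bs} u λ m → drop-x (λ e → All.lookup px m (sym e)) (Memₚ.∈-++⁻ as (h (there m))))))
  where
  drop-x : ∀ {a} → a ≢ x → a ∈ as ⊎ a ∈ (x ∷ bs) → a ∈ as ++ bs
  drop-x ne (inj₁ m) = Memₚ.∈-++⁺ˡ m
  drop-x ne (inj₂ (here e)) = ⊥-elim (ne e)
  drop-x ne (inj₂ (there m)) = Memₚ.∈-++⁺ʳ as m

canon : ∀ {n} → Pair n → Pair n
canon (u , v) = if toℕ u <ᵇ toℕ v then (u , v) else (v , u)

canon-< : ∀ {n} {u v : Fin n} → toℕ u ℕ.< toℕ v → canon (u , v) ≡ (u , v)
canon-< {u = u} {v} lt with toℕ u <ᵇ toℕ v | ℕₚ.<⇒<ᵇ lt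
... | true | _ = refl

canon-> : ∀ {n} {u v : Fin n} → toℕ v ℕ.< toℕ u → canon (u , v) ≡ (v , u)
canon-> {u = u} {v} lt with toℕ u <ᵇ toℕ v in e
... | true = ⊥-elim (ℕₚ.<-asym lt (ℕₚ.<ᵇ⇒< _ _ (≡⇒T e)))
... | false = refl

covers⇒length≥ : ∀ {n} {E : PairSet n} {L} → Covers L E → numPairs E ℕ.≤ length L
covers⇒length≥ {E = E} {L} cov = subst₂ ℕ._≤_ (length-edgeList E) (Listₚ.length-map canon L)
  (unique-∈⇒≤ (edgeList-unique E) λ {(u , v)} m → in-canon m)
  where
  in-canon : ∀ {u v} → (u , v) ∈ edgeList E → (u , v) ∈ map canon L
  in-canon {u} {v} m with ∈-edgeList⁻ {E = E} m
  ... | t , lt with cov u v t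
  ...   | inj₁ mL = subst (_∈ map canon L) (canon-< lt) (Memₚ.∈-map⁺ canon mL)
  ...   | inj₂ mL = subst (_∈ map canon L) (canon-> lt) (Memₚ.∈-map⁺ canon mL)

span-either : ∀ {n} {p : Placement n} {L u v} → (u , v) ∈ L ⊎ (v , u) ∈ L → SpanAt p L (u , v)
span-either (inj₁ m) = span-∈ m
span-either {p = p} {u = u} {v} (inj₂ m) = span-cong (λ i → row-swap p v u i) (span-∈ m)

span-swap : ∀ {n} {p : Placement n} {L u v} → SpanAt p L (u , v) → SpanAt p L (v , u)
span-swap {p = p} {u = u} {v} = span-cong (row-swap p u v)

hasRank-build : ∀ {n} {E : PairSet n} {L} → All (InSet E) L → Independent L →
  (∀ q → IndepAt q L → ∀ {u v} → T (E u v) → SpanAt q L (u , v)) → HasRank E (length L)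
hasRank-build {E = E} {L} L⊂E h sp = (L , L⊂E , to-IndepList L h , refl) , upper
  where
  upper : ∀ M → All (InSet E) M → IndepList M → length M ℕ.≤ length L
  upper M M⊂E hM with generic (L ∷ M ∷ []) (h ∷ from-IndepList M hM ∷ [])
  ... | q , liL ∷ liM ∷ [] = steinitz liM (λ m → sp q liL (All.lookup M⊂E m))

hasRank-span : ∀ {n} {E : PairSet n} {r L} → HasRank E r → All (InSet E) L → length L ≡ r →
  ∀ {q} → IndepAt q L → ∀ {u v} → T (E u v) → SpanAt q L (u , v)
hasRank-span {E = E} {r} {L} (_ , upper) L⊂E refl {q} li {u} {v} t with extend? search-coord li (u , v)
... | inj₁ sp = sp
... | inj₂ li′ = ⊥-elim (ℕₚ.<-irrefl refl (upper ((u , v) ∷ L) (t ∷ L⊂E) (to-IndepList ((u , v) ∷ L) (independent q li′))))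

hasRank-unique : ∀ {n} {E : PairSet n} {r s} → HasRank E r → HasRank E s → r ≡ s
hasRank-unique ((L , iL , hL , refl) , upL) ((M , iM , hM , refl) , upM) = ℕₚ.≤-antisym (upM L iL hL) (upL M iM hM)

hasRank-cong : ∀ {n} {E F : PairSet n} {r} → (∀ u v → E u v ≡ F u v) → HasRank E r → HasRank F r
hasRank-cong {E = E} {F} h ((L , iL , hL , eL) , up) = (L , All.map (λ {(u , v)} t → subst T (h u v) t) iL , hL , eL) ,
  λ M iM → up M (All.map (λ {(u , v)} t → subst T (sym (h u v)) t) iM)

covering-rank : ∀ {n} {E : PairSet n} {L} → All (InSet E) L → Independent L → Covers L E → HasRank E (length L)
covering-rank L⊂E h cov = hasRank-build L⊂E h (λ q li t → span-either (cov _ _ t))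

covering-numPairs : ∀ {n} {E : PairSet n} {L} → Symm E → Irrefl E → All (InSet E) L → Independent L → Covers L E → numPairs E ≡ length L
covering-numPairs {E = E} {L} sy ir L⊂E (independent p li) cov = ℕₚ.≤-antisym (covers⇒length≥ cov)
  (subst (length L ℕ.≤_) (length-edgeList E)
    (steinitz li (λ m → span-either {p = p} (edgeList-covers sy ir _ _ (All.lookup L⊂E m)))))

covering-indepPairs : ∀ {n} {E : PairSet n} {L} → Symm E → Irrefl E → All (InSet E) L → Independent L → Covers L E → IndepPairs E
covering-indepPairs sy ir L⊂E h cov = subst (HasRank _) (sym (covering-numPairs sy ir L⊂E h cov)) (covering-rank L⊂E h cov)

indepPairs⇒edgeList : ∀ {n} {E : PairSet n} → Symm E → Irrefl E → IndepPairs E → Independent (edgeList E)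
indepPairs⇒edgeList {E = E} sy ir ((L , L⊂E , hL , len) , _) with from-IndepList L hL
... | independent p li = independent p (indep-of-length search-coord li
  (λ m → span-either (edgeList-covers sy ir _ _ (All.lookup L⊂E m))) (ℕₚ.≤-reflexive (trans (length-edgeList E) (sym len))))

edgeList⇒indepPairs : ∀ {n} {E : PairSet n} → Symm E → Irrefl E → Independent (edgeList E) → IndepPairs E
edgeList⇒indepPairs {E = E} sy ir h = covering-indepPairs sy ir (edgeList-InSet E) h (edgeList-covers sy ir)

indepPairs-⊆ : ∀ {n} {E F : PairSet n} → Symm E → Irrefl E → Symm F → Irrefl F → (∀ u v → T (E u v) → T (F u v)) →
  IndepPairs F → IndepPairs E
indepPairs-⊆ syE irE syF irF h indF = edgeList⇒indepPairs syE irE (independent-⊆ (edgeList-⊆ h) (indepPairs⇒edgeList syF irF indF))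

Image : ∀ {m n} → (Fin m → Fin n) → PairSet m → PairSet n → Set
Image f E F = ∀ z w → (T (F z w) → ∃ λ x → ∃ λ y → f x ≡ z × f y ≡ w × T (E x y)) ×
                      (∀ x y → f x ≡ z → f y ≡ w → T (E x y) → T (F z w))

image-InSet : ∀ {m n} {f : Fin m → Fin n} {E F L} → Image f E F → All (InSet E) L → All (InSet F) (map (map² f) L)
image-InSet im iL = Allₚ.map⁺ (All.map (λ {(x , y)} t → proj₂ (im _ _) x y refl refl t) iL)

preimage-list : ∀ {m n} {f : Fin m → Fin n} {E F} → Image f E F → ∀ {M} → All (InSet F) M →
  ∃ λ L → All (InSet E) L × map (map² f) L ≡ M
preimage-list im [] = [] , [] , refl
preimage-list im {(z , w) ∷ M} (t ∷ ts) with proj₁ (im z w) t | preimage-list im ts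
... | x , y , refl , refl , e | L , iL , refl = (x , y) ∷ L , e ∷ iL , refl

hasRank-image : ∀ {m n} {f : Fin m → Fin n} {E F r} → Injective _≡_ _≡_ f → Image f E F → HasRank E r → HasRank F r
hasRank-image {f = f} {E} {F} inj im ((L , iL , hL , len) , up) =
  (map (map² f) L , image-InSet {f = f} {E} {F} im iL , to-IndepList (map (map² f) L) (independent-embed inj (from-IndepList L hL)) , trans (Listₚ.length-map (map² f) L) len) , upper
  where
  upper : ∀ M → All (InSet F) M → IndepList M → length M ℕ.≤ _
  upper M iM hM with preimage-list {f = f} {E} {F} im iM
  ... | L , iL , refl = subst (ℕ._≤ _) (sym (Listₚ.length-map (map² f) L)) (up L iL (to-IndepList L (independent-fold f (from-IndepList (map (map² f) L) hM))))

-- Covers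

anyF⁺ : ∀ {n} {f : Fin n → Bool} i → T (f i) → T (anyF f)
anyF⁺ zero t = T∨⁺ˡ t
anyF⁺ {f = f} (suc i) t = T∨⁺ʳ {f zero} (anyF⁺ i t)

anyF⁻ : ∀ {n} (f : Fin n → Bool) → T (anyF f) → ∃ λ i → T (f i)
anyF⁻ {suc n} f t with T∨⁻ {f zero} t
... | inj₁ t₀ = zero , t₀
... | inj₂ t₁ with anyF⁻ (f ∘ suc) t₁
...   | i , ti = suc i , ti

allF⁺ : ∀ {n} {f : Fin n → Bool} → (∀ i → T (f i)) → T (allF f)
allF⁺ {zero} h = tt
allF⁺ {suc n} h = T∧⁺ (h zero) (allF⁺ (h ∘ suc))

allF⁻ : ∀ {n} (f : Fin n → Bool) → T (allF f) → ∀ i → T (f i)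
allF⁻ f t zero = T∧ˡ t
allF⁻ f t (suc i) = allF⁻ (f ∘ suc) (T∧ʳ {f zero} t) i

==⁺ : ∀ {n} {x y : Fin n} → x ≡ y → T (x == y)
==⁺ {x = x} {y} e with x ≟ y
... | yes _ = tt
... | no ne = ne e

==⁻ : ∀ {n} {x y : Fin n} → T (x == y) → x ≡ y
==⁻ {x = x} {y} t with x ≟ y
... | yes e = e

not==⁺ : ∀ {n} {x y : Fin n} → x ≢ y → T (not (x == y))
not==⁺ {x = x} {y} ne with x ≟ y
... | yes e = ne e
... | no _ = tt

not==⁻ : ∀ {n} {x y : Fin n} → T (not (x == y)) → x ≢ y
not==⁻ {x = x} {y} t with x ≟ y
... | no ne = ne

xnor⁺ : ∀ {a b} → a ≡ b → T (not (a xor b))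
xnor⁺ {true} refl = tt
xnor⁺ {false} refl = tt

xnor⁻ : ∀ {a b} → T (not (a xor b)) → a ≡ b
xnor⁻ {true} {true} _ = refl
xnor⁻ {false} {false} _ = refl

pairOf⁺ : ∀ {n} {u v w : Fin n} → w ≡ u ⊎ w ≡ v → T (pairOf u v w)
pairOf⁺ {u = u} {v} {w} (inj₁ e) = T∨⁺ˡ {w == u} (==⁺ e)
pairOf⁺ {u = u} {v} {w} (inj₂ e) = T∨⁺ʳ {w == u} (==⁺ e)

pairOf⁻ : ∀ {n} {u v w : Fin n} → T (pairOf u v w) → w ≡ u ⊎ w ≡ v
pairOf⁻ {u = u} {v} {w} t with T∨⁻ {w == u} t
... | inj₁ t₀ = inj₁ (==⁻ t₀)
... | inj₂ t₀ = inj₂ (==⁻ t₀)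

Meets : ∀ {n} → (Fin n → Bool) → (Fin n → Bool) → Fin n → Fin n → Set
Meets A B u v = ∀ w → inter A B w ≡ pairOf u v w

meets-intro : ∀ {n} {A B : Fin n → Bool} {u v} → T (A u) → T (A v) → T (B u) → T (B v) →
  (∀ w → T (A w) → T (B w) → w ≡ u ⊎ w ≡ v) → Meets A B u v
meets-intro {A = A} {B} {u} {v} Au Av Bu Bv h w = T-ext (λ t → pairOf⁺ (h w (T∧ˡ t) (T∧ʳ {A w} t)))
  (λ t → case pairOf⁻ {u = u} {v} {w} t of λ { (inj₁ refl) → T∧⁺ Au Bu ; (inj₂ refl) → T∧⁺ Av Bv })

module _ {n} {A B : Fin n → Bool} {u v} (m : Meets A B u v) where
  meets-u : T (A u) × T (B u)
  meets-u = let t = subst T (sym (m u)) (pairOf⁺ {u = u} {v} (inj₁ refl)) in T∧ˡ t , T∧ʳ {A u} t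
  meets-v : T (A v) × T (B v)
  meets-v = let t = subst T (sym (m v)) (pairOf⁺ {u = u} {v} (inj₂ refl)) in T∧ˡ t , T∧ʳ {A v} t
  meets-only : ∀ {w} → T (A w) → T (B w) → w ≡ u ⊎ w ≡ v
  meets-only {w} a b = pairOf⁻ (subst T (m w) (T∧⁺ a b))
  meets-comm : Meets B A u v
  meets-comm w = trans (Boolₚ.∧-comm (B w) (A w)) (m w)

record IsShared {n} (𝒳 : Cover n) (u v : Fin n) : Set where
  constructor isShared
  field
    u≢v : u ≢ v
    i j : Fin (k 𝒳)
    i≢j : i ≢ j
    meets : Meets (X 𝒳 i) (X 𝒳 j) u v

shared⁺ : ∀ {n} {𝒳 : Cover n} {u v} → IsShared 𝒳 u v → T (Shared 𝒳 u v)
shared⁺ {𝒳 = 𝒳} (isShared u≢v i j i≢j m) = T∧⁺ (not==⁺ u≢v) (anyF⁺ i (anyF⁺ j (T∧⁺ (not==⁺ i≢j) (allF⁺ (λ w → xnor⁺ (m w))))))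

shared⁻ : ∀ {n} {𝒳 : Cover n} {u v} → T (Shared 𝒳 u v) → IsShared 𝒳 u v
shared⁻ {𝒳 = 𝒳} {u} {v} t with anyF⁻ _ (T∧ʳ {not (u == v)} t)
... | i , ti with anyF⁻ _ ti
...   | j , tj = isShared (not==⁻ (T∧ˡ t)) i j (not==⁻ (T∧ˡ tj)) (λ w → xnor⁻ (allF⁻ _ (T∧ʳ {not (i == j)} tj) w))

shared-sym : ∀ {n} (𝒳 : Cover n) → Symm (Shared 𝒳)
shared-sym 𝒳 u v = T-ext (flip-shared u v) (flip-shared v u)
  where
  flip-shared : ∀ u v → T (Shared 𝒳 u v) → T (Shared 𝒳 v u)
  flip-shared u v t with shared⁻ {𝒳 = 𝒳} t
  ... | isShared ne i j i≢j m = shared⁺ {𝒳 = 𝒳} (isShared (ne ∘ sym) i j i≢j (λ w → trans (m w) (Boolₚ.∨-comm (w == u) (w == v))))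

shared-irr : ∀ {n} (𝒳 : Cover n) → Irrefl (Shared 𝒳)
shared-irr 𝒳 u = ¬T⇒≡ λ t → IsShared.u≢v (shared⁻ {𝒳 = 𝒳} t) refl

count≤ : ∀ {n} (A : Fin n → Bool) ys → (∀ w → T (A w) → w ∈ ys) → countF A ℕ.≤ length ys
count≤ {n} A ys h = subst (ℕ._≤ length ys) (length-filterᵇ-tabulate A id)
  (unique-∈⇒≤ (Uniqueₚ.filter⁺ _ (Uniqueₚ.allFin⁺ n)) (λ {w} m → h w (proj₂ (Memₚ.∈-filter⁻ _ {xs = allFin n} m))))

count≥ : ∀ {n} (A : Fin n → Bool) {ys} → Unique ys → All (T ∘ A) ys → length ys ℕ.≤ countF A
count≥ {n} A {ys} u h = subst (length ys ℕ.≤_) (length-filterᵇ-tabulate A id)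
  (unique-∈⇒≤ u (λ {w} m → Memₚ.∈-filter⁺ _ (Memₚ.∈-allFin w) (All.lookup h m)))

count≤2⇒pair : ∀ {n} (A : Fin n → Bool) → countF A ℕ.≤ 2 → ∀ {u v} → u ≢ v → T (A u) → T (A v) → ∀ w → T (A w) → w ≡ u ⊎ w ≡ v
count≤2⇒pair A le {u} {v} u≢v Au Av w Aw with w ≟ u | w ≟ v
... | yes e | _ = inj₁ e
... | no _ | yes e = inj₂ e
... | no w≢u | no w≢v = ⊥-elim (ℕₚ.<⇒≱ (count≥ A {w ∷ u ∷ v ∷ []}
  ((w≢u ∷ w≢v ∷ []) AllPairs.∷ (u≢v ∷ []) AllPairs.∷ [] AllPairs.∷ AllPairs.[]) (Aw ∷ Au ∷ Av ∷ [])) le)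

thin⇒meets : ∀ {n} {A B : Fin n → Bool} → countF (inter A B) ℕ.≤ 2 → ∀ {u v} → u ≢ v →
  T (A u) → T (A v) → T (B u) → T (B v) → Meets A B u v
thin⇒meets {A = A} {B} le u≢v Au Av Bu Bv =
  meets-intro {A = A} {B} Au Av Bu Bv (λ w Aw Bw → count≤2⇒pair (inter A B) le u≢v (T∧⁺ Au Bu) (T∧⁺ Av Bv) w (T∧⁺ Aw Bw))

-- Integer sums, and the inclusion-exclusion formula as a sum over clusters:
-- Σ_{e ∈ P} (d(e) - 1) = Σᵢ |P[Xᵢ]| - |P|.

[_]ᵢ : Bool → ℤ
[ b ]ᵢ = if b then 1ℤ else 0ℤ

sumℤ-cong : ∀ {n} {f g : Fin n → ℤ} → (∀ i → f i ≡ g i) → sumℤ f ≡ sumℤ g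
sumℤ-cong {zero} h = refl
sumℤ-cong {suc n} h = cong₂ ℤ._+_ (h zero) (sumℤ-cong (h ∘ suc))

sumℤ-minus : ∀ {n} (f g : Fin n → ℤ) → sumℤ (λ i → f i ℤ.- g i) ≡ sumℤ f ℤ.- sumℤ g
sumℤ-minus {zero} f g = refl
sumℤ-minus {suc n} f g = trans (cong (λ s → f zero ℤ.- g zero ℤ.+ s) (sumℤ-minus (f ∘ suc) (g ∘ suc)))
  (alg (f zero) (g zero) (sumℤ (f ∘ suc)) (sumℤ (g ∘ suc)))
  where
  open ℤSolver.+-*-Solver
  alg : ∀ a b c d → a ℤ.- b ℤ.+ (c ℤ.- d) ≡ a ℤ.+ c ℤ.- (b ℤ.+ d)
  alg = solve 4 (λ a b c d → a :- b :+ (c :- d) := a :+ c :- (b :+ d)) refl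

sumℤ-+ : ∀ {n} (f g : Fin n → ℤ) → sumℤ (λ i → f i ℤ.+ g i) ≡ sumℤ f ℤ.+ sumℤ g
sumℤ-+ {zero} f g = refl
sumℤ-+ {suc n} f g = trans (cong (λ s → f zero ℤ.+ g zero ℤ.+ s) (sumℤ-+ (f ∘ suc) (g ∘ suc)))
  (alg (f zero) (g zero) (sumℤ (f ∘ suc)) (sumℤ (g ∘ suc)))
  where
  open ℤSolver.+-*-Solver
  alg : ∀ a b c d → a ℤ.+ b ℤ.+ (c ℤ.+ d) ≡ a ℤ.+ c ℤ.+ (b ℤ.+ d)
  alg = solve 4 (λ a b c d → a :+ b :+ (c :+ d) := a :+ c :+ (b :+ d)) refl

sumℤ-0 : ∀ {n} → sumℤ {n} (λ _ → 0ℤ) ≡ 0ℤ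
sumℤ-0 {zero} = refl
sumℤ-0 {suc n} = trans (ℤₚ.+-identityˡ _) (sumℤ-0 {n})

sumℤ-swap : ∀ {k l} (f : Fin k → Fin l → ℤ) → sumℤ (λ i → sumℤ (f i)) ≡ sumℤ (λ j → sumℤ (λ i → f i j))
sumℤ-swap {zero} {l} f = sym (sumℤ-0 {l})
sumℤ-swap {suc k} {l} f = trans (cong (λ s → sumℤ (f zero) ℤ.+ s) (sumℤ-swap (f ∘ suc)))
  (sym (sumℤ-+ {l} (f zero) (λ j → sumℤ (λ i → f (suc i) j))))

+sumℕ : ∀ {n} (f : Fin n → ℕ) → ℤ.+ sumℕ f ≡ sumℤ (λ i → ℤ.+ f i)
+sumℕ {zero} f = refl
+sumℕ {suc n} f = cong (λ s → ℤ.+ f zero ℤ.+ s) (+sumℕ (f ∘ suc))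

+countF : ∀ {n} (f : Fin n → Bool) → ℤ.+ countF f ≡ sumℤ (λ i → [ f i ]ᵢ)
+countF {zero} f = refl
+countF {suc n} f with f zero
... | true = cong (λ s → 1ℤ ℤ.+ s) (+countF (f ∘ suc))
... | false = trans (+countF (f ∘ suc)) (sym (ℤₚ.+-identityˡ _))

_<ᶠ_ : ∀ {n} → Fin n → Fin n → Bool
u <ᶠ v = toℕ u <ᵇ toℕ v

+numPairs : ∀ {n} (E : PairSet n) → ℤ.+ numPairs E ≡ sumℤ (λ u → sumℤ (λ v → [ (u <ᶠ v) ∧ E u v ]ᵢ))
+numPairs {n} E = trans (+sumℕ {n} _) (sumℤ-cong {n} λ u → +countF (λ v → (u <ᶠ v) ∧ E u v))

Within : ∀ {n} → (Fin n → Bool) → PairSet n → PairSet n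
Within A P u v = A u ∧ A v ∧ P u v

overcount : ∀ {n} (𝒳 : Cover n) (P : PairSet n) →
  sumPairs (λ u v → if P u v then ℤ.+ dcount 𝒳 u v ℤ.- 1ℤ else 0ℤ) ≡
  ℤ.+ sumℕ (λ i → numPairs (Within (X 𝒳 i) P)) ℤ.- ℤ.+ numPairs P
overcount {n} 𝒳 P = trans (sumℤ-cong λ u → trans (sumℤ-cong (pointwise u)) (sumℤ-minus {n} _ _))
  (trans (sumℤ-minus {n} _ _) (cong₂ ℤ._-_ clusters (sym (+numPairs P))))
  where
  C : Fin (k 𝒳) → Fin n → Fin n → ℤ
  C i u v = [ (u <ᶠ v) ∧ Within (X 𝒳 i) P u v ]ᵢ
  pointwise : ∀ u v → (if u <ᶠ v then (if P u v then ℤ.+ dcount 𝒳 u v ℤ.- 1ℤ else 0ℤ) else 0ℤ) ≡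
    sumℤ (λ i → C i u v) ℤ.- [ (u <ᶠ v) ∧ P u v ]ᵢ
  pointwise u v with u <ᶠ v | P u v
  ... | false | _ = cong (λ s → s ℤ.- 0ℤ) (sym (sumℤ-0 {k 𝒳}))
  ... | true | true = cong (λ s → s ℤ.- 1ℤ) (trans (+countF {k 𝒳} _)
    (sumℤ-cong {k 𝒳} (λ i → cong (λ b → [ X 𝒳 i u ∧ b ]ᵢ) (sym (Boolₚ.∧-identityʳ (X 𝒳 i v))))))
  ... | true | false = cong (λ s → s ℤ.- 0ℤ) (trans (sym (sumℤ-0 {k 𝒳})) (sumℤ-cong {k 𝒳} (λ i →
    cong [_]ᵢ (sym (trans (cong (X 𝒳 i u ∧_) (Boolₚ.∧-zeroʳ (X 𝒳 i v))) (Boolₚ.∧-zeroʳ (X 𝒳 i u)))))))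
  clusters : sumℤ (λ u → sumℤ (λ v → sumℤ (λ i → C i u v))) ≡ ℤ.+ sumℕ (λ i → numPairs (Within (X 𝒳 i) P))
  clusters = trans (sumℤ-cong (λ u → sumℤ-swap (λ v i → C i u v))) (trans (sumℤ-swap {n} {k 𝒳} _)
    (trans (sumℤ-cong {k 𝒳} (λ i → sym (+numPairs (Within (X 𝒳 i) P)))) (sym (+sumℕ {k 𝒳} _))))

Inside : ∀ {n} → Cover n → PairSet n
Inside 𝒳 u v = anyF (λ i → X 𝒳 i u ∧ X 𝒳 i v)

-- A 2-thin family of clusters that need not cover all edges, satisfying rank = IE for the
-- subgraph of the edges it does cover.
record PartialBase {n} (G : Graph n) (𝒳 : Cover n) : Set where
  field
    size≥2   : ∀ i → 2 ℕ.≤ countF (X 𝒳 i)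
    thin     : ∀ i j → i ≢ j → countF (inter (X 𝒳 i) (X 𝒳 j)) ℕ.≤ 2
    noSubset : ∀ i j → i ≢ j → ¬ (∀ w → T (X 𝒳 i w) → T (X 𝒳 j w))
    indep𝒳   : IndepCover 𝒳
    rs ss    : Fin (k 𝒳) → ℕ
    z        : ℕ
    rank-cluster : ∀ i → HasRank (Within (X 𝒳 i) (λ u v → adj G u v ∨ Shared 𝒳 u v)) (rs i)
    rank-shared  : ∀ i → HasRank (Within (X 𝒳 i) (Shared 𝒳)) (ss i)
    rank-inside  : HasRank (λ u v → adj G u v ∧ Inside 𝒳 u v) z
    count        : z ℕ.+ sumℕ ss ≡ sumℕ rs ℕ.+ numPairs (Shared 𝒳)

within-sym : ∀ {n} {A : Fin n → Bool} {P} → Symm P → Symm (Within A P)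
within-sym {A = A} {P} sy u v = T-ext (go u v) (go v u)
  where
  go : ∀ u v → T (Within A P u v) → T (Within A P v u)
  go u v t = T∧⁺ (T∧ˡ {A v} (T∧ʳ {A u} t)) (T∧⁺ (T∧ˡ {A u} t) (subst T (sy u v) (T∧ʳ {A v} (T∧ʳ {A u} t))))

within-irr : ∀ {n} {A : Fin n → Bool} {P} → Irrefl P → Irrefl (Within A P)
within-irr {A = A} {P} ir u = ¬T⇒≡ λ t → ≡⇒¬T (ir u) (T∧ʳ {A u} (T∧ʳ {A u} t))

inside-sym : ∀ {n} (𝒳 : Cover n) → Symm (Inside 𝒳)
inside-sym 𝒳 u v = T-ext (go u v) (go v u)
  where
  go : ∀ u v → T (Inside 𝒳 u v) → T (Inside 𝒳 v u)
  go u v t with anyF⁻ _ t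
  ... | i , ti = anyF⁺ i (T∧⁺ (T∧ʳ {X 𝒳 i u} ti) (T∧ˡ ti))

numPairs-split : ∀ {n} (E Q : PairSet n) → numPairs E ≡
  numPairs (λ u v → E u v ∧ Q u v) ℕ.+ length (edgeList (λ u v → E u v ∧ not (Q u v)))
numPairs-split {n} E Q = trans (sym (length-edgeList E)) (trans (go (allPairs n)) (cong (ℕ._+ length (filterᵇ R⁺ (allPairs n))) (length-edgeList (λ u v → E u v ∧ Q u v))))
  where
  E⁺ Q⁺ R⁺ : Pair n → Bool
  E⁺ (u , v) = (u <ᶠ v) ∧ E u v
  Q⁺ (u , v) = (u <ᶠ v) ∧ E u v ∧ Q u v
  R⁺ (u , v) = (u <ᶠ v) ∧ E u v ∧ not (Q u v)
  go : ∀ L → length (filterᵇ E⁺ L) ≡ length (filterᵇ Q⁺ L) ℕ.+ length (filterᵇ R⁺ L)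
  go [] = refl
  go ((u , v) ∷ L) with u <ᶠ v | E u v | Q u v
  ... | false | _ | _ = go L
  ... | true | false | _ = go L
  ... | true | true | true = cong suc (go L)
  ... | true | true | false = trans (cong suc (go L)) (sym (ℕₚ.+-suc _ _))

-- Two sides of a vertex split: the neighbours x of a with σ x = true go to the first copy.
record Half {n} (G : Graph n) (𝒳 : Cover n) (a b : Fin n) (σ : Fin n → Bool) : Set where
  Side : Fin (k 𝒳) → Bool → Set
  Side i s = ∃ λ x → T (X 𝒳 i x) × T (adj G a x) × σ x ≡ s
  field
    nonempty : ∀ s → ∃ λ x → T (adj G a x) × σ x ≡ s
    S1 : ∀ i u v → T (Shared 𝒳 u v) → adj G u v ≡ false → T (X 𝒳 i u) → T (X 𝒳 i v) → ¬ (Side i true × Side i false)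
    S2 : ∀ i j u → i ≢ j → u ≢ a → u ≢ b → adj G a u ≡ false → Meets (X 𝒳 i) (X 𝒳 j) a u → ∀ s → Side i s → Side j s

record Splittable {n} (G : Graph n) (𝒳 : Cover n) : Set where
  field
    a b     : Fin n
    σ τ     : Fin n → Bool
    nonedge : adj G a b ≡ false
    shared  : T (Shared 𝒳 a b)
    halfA   : Half G 𝒳 a b σ
    halfB   : Half G 𝒳 b a τ

adj-≢ : ∀ {n} (G : Graph n) {u v} → T (adj G u v) → u ≢ v
adj-≢ G t refl = ≡⇒¬T (irr G _) t

module Complete {n} (G : Graph n) (𝒳 : Cover n) (P : PartialBase G 𝒳) (indG : IndependentGraph G) where
  open PartialBase P

  Rest : PairSet n
  Rest u v = adj G u v ∧ not (Inside 𝒳 u v)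

  rest : List (Pair n)
  rest = edgeList Rest

  K M : ℕ
  K = k 𝒳
  M = length rest

  ends : Fin M → Pair n
  ends j = lookup rest j

  Y : Fin K ⊎ Fin M → Fin n → Bool
  Y (inj₁ i) = X 𝒳 i
  Y (inj₂ j) = pairOf (proj₁ (ends j)) (proj₂ (ends j))

  𝒳⁺ : Cover n
  𝒳⁺ = record { k = K ℕ.+ M ; X = λ i → Y (splitAt K i) }

  inside⁺ : ∀ i {u v} → T (X 𝒳 i u) → T (X 𝒳 i v) → T (Inside 𝒳 u v)
  inside⁺ i Xu Xv = anyF⁺ i (T∧⁺ Xu Xv)

  module _ (j : Fin M) where
    x y : Fin n
    x = proj₁ (ends j)
    y = proj₂ (ends j)

    ends-rest : T (Rest x y) × toℕ x ℕ.< toℕ y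
    ends-rest = ∈-edgeList⁻ {E = Rest} (Memₚ.∈-lookup {xs = rest} j)

    ends-adj : T (adj G x y)
    ends-adj = T∧ˡ (proj₁ ends-rest)

    ends-outside : ¬ T (Inside 𝒳 x y)
    ends-outside t with Inside 𝒳 x y | T∧ʳ {adj G x y} (proj₁ ends-rest)
    ... | true | ()

    ends-< : toℕ x ℕ.< toℕ y
    ends-< = proj₂ ends-rest

    ends-both : ∀ {u v} → u ≢ v → T (Y (inj₂ j) u) → T (Y (inj₂ j) v) → (u ≡ x × v ≡ y) ⊎ (u ≡ y × v ≡ x)
    ends-both {u} {v} u≢v tu tv with pairOf⁻ {u = x} {y} {u} tu | pairOf⁻ {u = x} {y} {v} tv
    ... | inj₁ refl | inj₁ e = ⊥-elim (u≢v (sym e))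
    ... | inj₁ e | inj₂ e′ = inj₁ (e , e′)
    ... | inj₂ e | inj₁ e′ = inj₂ (e , e′)
    ... | inj₂ refl | inj₂ e = ⊥-elim (u≢v (sym e))

    not-in-cluster : ∀ i {u v} → u ≢ v → T (Y (inj₂ j) u) → T (Y (inj₂ j) v) → ¬ (T (X 𝒳 i u) × T (X 𝒳 i v))
    not-in-cluster i u≢v tu tv (Xu , Xv) with ends-both u≢v tu tv
    ... | inj₁ (refl , refl) = ends-outside (inside⁺ i Xu Xv)
    ... | inj₂ (refl , refl) = ends-outside (inside⁺ i Xv Xu)

    Yx : T (Y (inj₂ j) x)
    Yx = pairOf⁺ {u = x} {y} (inj₁ refl)
    Yy : T (Y (inj₂ j) y)
    Yy = pairOf⁺ {u = x} {y} (inj₂ refl)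

    x≢y : x ≢ y
    x≢y = adj-≢ G ends-adj

  same-ends : ∀ j j′ {u v} → u ≢ v → T (Y (inj₂ j) u) → T (Y (inj₂ j) v) → T (Y (inj₂ j′) u) → T (Y (inj₂ j′) v) → j ≡ j′
  same-ends j j′ u≢v a b c d with ends-both j u≢v a b | ends-both j′ u≢v c d
  ... | inj₁ (e₁ , e₂) | inj₁ (e₃ , e₄) = lookup-injective (edgeList-unique Rest) (cong₂ _,_ (trans (sym e₁) e₃) (trans (sym e₂) e₄))
  ... | inj₂ (e₁ , e₂) | inj₂ (e₃ , e₄) = lookup-injective (edgeList-unique Rest) (cong₂ _,_ (trans (sym e₂) e₄) (trans (sym e₁) e₃))
  ... | inj₁ (refl , refl) | inj₂ (e₃ , e₄) = ⊥-elim (ℕₚ.<-asym (ends-< j) (subst₂ (λ s t → toℕ s ℕ.< toℕ t) (sym e₄) (sym e₃) (ends-< j′)))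
  ... | inj₂ (refl , refl) | inj₁ (e₃ , e₄) = ⊥-elim (ℕₚ.<-asym (ends-< j) (subst₂ (λ s t → toℕ s ℕ.< toℕ t) (sym e₃) (sym e₄) (ends-< j′)))

  Y-size : ∀ s → 2 ℕ.≤ countF (Y s)
  Y-size (inj₁ i) = size≥2 i
  Y-size (inj₂ j) = count≥ (Y (inj₂ j)) {x j ∷ y j ∷ []} ((x≢y j ∷ []) AllPairs.∷ [] AllPairs.∷ AllPairs.[]) (Yx j ∷ Yy j ∷ [])

  in-ends : ∀ j w → T (Y (inj₂ j) w) → w ∈ x j ∷ y j ∷ []
  in-ends j w t with pairOf⁻ {u = x j} {y j} {w} t
  ... | inj₁ e = here e
  ... | inj₂ e = there (here e)

  Y-thin : ∀ s t → s ≢ t → countF (inter (Y s) (Y t)) ℕ.≤ 2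
  Y-thin (inj₁ i) (inj₁ j) ne = thin i j (ne ∘ cong inj₁)
  Y-thin s (inj₂ j) ne = count≤ (inter (Y s) (Y (inj₂ j))) (x j ∷ y j ∷ []) (λ w t → in-ends j w (T∧ʳ {Y s w} t))
  Y-thin (inj₂ j) (inj₁ i) ne = count≤ (inter (Y (inj₂ j)) (X 𝒳 i)) (x j ∷ y j ∷ []) (λ w t → in-ends j w (T∧ˡ t))

  contains-ends : ∀ s j → (∀ w → T (Y s w) → T (Y (inj₂ j) w)) → T (Y s (x j)) × T (Y s (y j))
  contains-ends s j h = has (x j) (y j) (λ w t → pairOf⁻ {u = x j} {y j} {w} (h w t)) ,
                        has (y j) (x j) (λ w t → [ inj₂ , inj₁ ]′ (pairOf⁻ {u = x j} {y j} {w} (h w t)))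
    where
    has : ∀ u v → (∀ w → T (Y s w) → w ≡ u ⊎ w ≡ v) → T (Y s u)
    has u v h′ with Y s u in e
    ... | true = tt
    ... | false = ⊥-elim (ℕₚ.<⇒≱ (Y-size s) (count≤ (Y s) (v ∷ []) λ w t → case h′ w t of λ
            { (inj₁ refl) → ⊥-elim (≡⇒¬T e t) ; (inj₂ w≡v) → here w≡v }))

  Y-noSubset : ∀ s t → s ≢ t → ¬ (∀ w → T (Y s w) → T (Y t w))
  Y-noSubset (inj₁ i) (inj₁ j) ne = noSubset i j (ne ∘ cong inj₁)
  Y-noSubset (inj₂ j) (inj₁ i) ne h = not-in-cluster j i (x≢y j) (Yx j) (Yy j) (h (x j) (Yx j) , h (y j) (Yy j))
  Y-noSubset (inj₁ i) (inj₂ j) ne h = not-in-cluster j i (x≢y j) (Yx j) (Yy j) (contains-ends (inj₁ i) j h)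
  Y-noSubset (inj₂ i) (inj₂ j) ne h = let cx , cy = contains-ends (inj₂ i) j h in
    ne (cong inj₂ (same-ends i j (x≢y j) cx cy (Yx j) (Yy j)))

  Y-meets : ∀ s t → s ≢ t → ∀ {u v} → u ≢ v → Meets (Y s) (Y t) u v → ∃ λ i → ∃ λ j → s ≡ inj₁ i × t ≡ inj₁ j
  Y-meets (inj₁ i) (inj₁ j) ne u≢v m = i , j , refl , refl
  Y-meets (inj₂ j) (inj₁ i) ne u≢v m = ⊥-elim (not-in-cluster j i u≢v (proj₁ (meets-u {A = Y (inj₂ j)} {X 𝒳 i} m)) (proj₁ (meets-v {A = Y (inj₂ j)} {X 𝒳 i} m))
    (proj₂ (meets-u {A = Y (inj₂ j)} {X 𝒳 i} m) , proj₂ (meets-v {A = Y (inj₂ j)} {X 𝒳 i} m)))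
  Y-meets (inj₁ i) (inj₂ j) ne u≢v m = ⊥-elim (not-in-cluster j i u≢v (proj₂ (meets-u {A = X 𝒳 i} {Y (inj₂ j)} m)) (proj₂ (meets-v {A = X 𝒳 i} {Y (inj₂ j)} m))
    (proj₁ (meets-u {A = X 𝒳 i} {Y (inj₂ j)} m) , proj₁ (meets-v {A = X 𝒳 i} {Y (inj₂ j)} m)))
  Y-meets (inj₂ i) (inj₂ j) ne u≢v m = ⊥-elim (ne (cong inj₂ (same-ends i j u≢v
    (proj₁ (meets-u {A = Y (inj₂ i)} {Y (inj₂ j)} m)) (proj₁ (meets-v {A = Y (inj₂ i)} {Y (inj₂ j)} m))
    (proj₂ (meets-u {A = Y (inj₂ i)} {Y (inj₂ j)} m)) (proj₂ (meets-v {A = Y (inj₂ i)} {Y (inj₂ j)} m)))))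

  splitAt-≢ : ∀ {i j} → i ≢ j → splitAt K i ≢ splitAt K j
  splitAt-≢ {i} {j} ne e = ne (trans (sym (Finₚ.join-splitAt K M i)) (trans (cong (join K M) e) (Finₚ.join-splitAt K M j)))

  old : Fin K → Fin (K ℕ.+ M)
  old i = i ↑ˡ M

  old-≢ : ∀ {i j} → i ≢ j → old i ≢ old j
  old-≢ ne e = ne (Finₚ.↑ˡ-injective M _ _ e)

  X⁺-old : ∀ i w → X 𝒳⁺ (old i) w ≡ X 𝒳 i w
  X⁺-old i w = cong (λ s → Y s w) (Finₚ.splitAt-↑ˡ K i M)

  shared≡ : ∀ u v → Shared 𝒳⁺ u v ≡ Shared 𝒳 u v
  shared≡ u v = T-ext to from
    where
    to : T (Shared 𝒳⁺ u v) → T (Shared 𝒳 u v)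
    to t with shared⁻ {𝒳 = 𝒳⁺} t
    ... | isShared u≢v i j i≢j m with Y-meets (splitAt K i) (splitAt K j) (splitAt-≢ i≢j) u≢v m
    ...   | i′ , j′ , ei , ej = shared⁺ {𝒳 = 𝒳} (isShared u≢v i′ j′ (λ e → splitAt-≢ i≢j (trans ei (trans (cong inj₁ e) (sym ej))))
            (subst₂ (λ s t → Meets (Y s) (Y t) u v) ei ej m))
    from : T (Shared 𝒳 u v) → T (Shared 𝒳⁺ u v)
    from t with shared⁻ {𝒳 = 𝒳} t
    ... | isShared u≢v i j i≢j m = shared⁺ {𝒳 = 𝒳⁺} (isShared u≢v (old i) (old j) (old-≢ i≢j)
            (λ w → trans (cong₂ _∧_ (X⁺-old i w) (X⁺-old j w)) (m w)))

  shared-outside : ∀ j {u v} → T (Shared 𝒳 u v) → T (Y (inj₂ j) u) → T (Y (inj₂ j) v) → ⊥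
  shared-outside j t tu tv with shared⁻ {𝒳 = 𝒳} t
  ... | isShared u≢v i i′ _ m = not-in-cluster j i u≢v tu tv (proj₁ (meets-u {A = X 𝒳 i} {X 𝒳 i′} m) , proj₁ (meets-v {A = X 𝒳 i} {X 𝒳 i′} m))

  twoThin⁺ : TwoThin G 𝒳⁺
  twoThin⁺ = record
    { size≥2 = λ i → Y-size (splitAt K i)
    ; thin = λ i j ne → Y-thin (splitAt K i) (splitAt K j) (splitAt-≢ ne)
    ; noSubset = λ i j ne → Y-noSubset (splitAt K i) (splitAt K j) (splitAt-≢ ne)
    ; covers = cov }
    where
    new : ∀ {u v} j → T (Y (inj₂ j) u) → T (Y (inj₂ j) v) → ∃ λ i → T (X 𝒳⁺ i u) × T (X 𝒳⁺ i v)
    new {u} {v} j tu tv = K ↑ʳ j , subst (λ s → T (Y s u)) (sym (Finₚ.splitAt-↑ʳ K M j)) tu , subst (λ s → T (Y s v)) (sym (Finₚ.splitAt-↑ʳ K M j)) tv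
    cov : ∀ u v → T (adj G u v) → ∃ λ i → T (X 𝒳⁺ i u) × T (X 𝒳⁺ i v)
    cov u v t with Inside 𝒳 u v in e
    ... | true with anyF⁻ _ (≡⇒T e)
    ...   | i , ti = old i , subst T (sym (X⁺-old i u)) (T∧ˡ ti) , subst T (sym (X⁺-old i v)) (T∧ʳ {X 𝒳 i u} ti)
    cov u v t | false with edgeList-covers {E = Rest} rest-sym rest-irr u v (T∧⁺ t (subst (T ∘ not) (sym e) tt))
      where
      rest-sym : Symm Rest
      rest-sym u v = cong₂ (λ s t → s ∧ not t) (adj-sym G u v) (inside-sym 𝒳 u v)
      rest-irr : Irrefl Rest
      rest-irr u = cong (_∧ _) (irr G u)
    ... | inj₁ m = new (Any.index m) (pairOf⁺ {u = x _} {y _} (inj₁ (cong proj₁ (Anyₚ.lookup-index m)))) (pairOf⁺ {u = x _} {y _} (inj₂ (cong proj₂ (Anyₚ.lookup-index m))))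
    ... | inj₂ m = new (Any.index m) (pairOf⁺ {u = x _} {y _} (inj₂ (cong proj₂ (Anyₚ.lookup-index m)))) (pairOf⁺ {u = x _} {y _} (inj₁ (cong proj₁ (Anyₚ.lookup-index m))))

  Sh : PairSet n
  Sh = Shared 𝒳

  numPairs-cong : ∀ {E F : PairSet n} → (∀ u v → E u v ≡ F u v) → numPairs E ≡ numPairs F
  numPairs-cong {E} {F} h = trans (sym (length-edgeList E)) (trans (cong length (Listₚ.filter-≐ _ _
    ((λ {(u , v)} → subst (λ b → T ((u <ᶠ v) ∧ b)) (h u v)) , (λ {(u , v)} → subst (λ b → T ((u <ᶠ v) ∧ b)) (sym (h u v)))) (allPairs n))) (length-edgeList F))

  indep⁺ : IndepCover 𝒳⁺
  indep⁺ = subst (HasRank _) (numPairs-cong (λ u v → sym (shared≡ u v))) (hasRank-cong (λ u v → sym (shared≡ u v)) indep𝒳)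

  rs⁺ : Fin K ⊎ Fin M → ℕ
  rs⁺ (inj₁ i) = rs i
  rs⁺ (inj₂ j) = 1

  rank⁺ : ∀ s → HasRank (Within (Y s) (λ u v → adj G u v ∨ Sh u v)) (rs⁺ s)
  rank⁺ (inj₁ i) = rank-cluster i
  rank⁺ (inj₂ j) = covering-rank {L = (x j , y j) ∷ []} (T∧⁺ (Yx j) (T∧⁺ (Yy j) (T∨⁺ˡ (ends-adj j))) ∷ [])
    (clique-independent {ys = x j ∷ y j ∷ []} ((x≢y j ∷ []) AllPairs.∷ [] AllPairs.∷ AllPairs.[]) (s≤s (s≤s z≤n)))
    cov
    where
    cov : Covers ((x j , y j) ∷ []) (Within (Y (inj₂ j)) (λ u v → adj G u v ∨ Sh u v))
    cov u v t with T∧ˡ {Y (inj₂ j) u} t | T∧ʳ {Y (inj₂ j) u} t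
    ... | tu | t′ with ends-both j u≢v tu (T∧ˡ t′)
      where
      u≢v : u ≢ v
      u≢v with T∨⁻ {adj G u v} (T∧ʳ {Y (inj₂ j) v} t′)
      ... | inj₁ e = adj-≢ G e
      ... | inj₂ e = IsShared.u≢v (shared⁻ {𝒳 = 𝒳} e)
    ...   | inj₁ (refl , refl) = inj₁ (here refl)
    ...   | inj₂ (refl , refl) = inj₂ (here refl)

  ss⁺ : Fin K ⊎ Fin M → ℕ
  ss⁺ (inj₁ i) = ss i
  ss⁺ (inj₂ j) = 0

  shared⁺-count : ∀ s → numPairs (Within (Y s) Sh) ≡ ss⁺ s
  shared⁺-count (inj₁ i) = hasRank-unique {E = Within (X 𝒳 i) Sh}
    (indepPairs-⊆ (within-sym {A = X 𝒳 i} {Sh} (shared-sym 𝒳)) (within-irr {A = X 𝒳 i} {Sh} (shared-irr 𝒳)) (shared-sym 𝒳) (shared-irr 𝒳)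
      (λ u v t → T∧ʳ {X 𝒳 i v} (T∧ʳ {X 𝒳 i u} t)) indep𝒳) (rank-shared i)
  shared⁺-count (inj₂ j) = ℕₚ.n≤0⇒n≡0 (covers⇒length≥ {L = []} λ u v t → ⊥-elim (shared-outside j
    (T∧ʳ {Y (inj₂ j) v} (T∧ʳ {Y (inj₂ j) u} t)) (T∧ˡ t) (T∧ˡ (T∧ʳ {Y (inj₂ j) u} t))))

  sumℕ-splitAt : ∀ {a c} (f : Fin a ⊎ Fin c → ℕ) → sumℕ (λ i → f (splitAt a i)) ≡ sumℕ (f ∘ inj₁) ℕ.+ sumℕ (f ∘ inj₂)
  sumℕ-splitAt {zero} f = refl
  sumℕ-splitAt {suc a} {c} f = trans (cong (f (inj₁ zero) ℕ.+_) (trans (sumℕ-cong (λ i → step (splitAt a i))) (sumℕ-splitAt {a} {c} g)))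
    (sym (ℕₚ.+-assoc (f (inj₁ zero)) _ _))
    where
    g : Fin a ⊎ Fin c → ℕ
    g (inj₁ i) = f (inj₁ (suc i))
    g (inj₂ j) = f (inj₂ j)
    step : ∀ s → f (Data.Sum.map suc id s) ≡ g s
    step (inj₁ _) = refl
    step (inj₂ _) = refl

  sumℕ-const : ∀ m c → sumℕ {m} (λ _ → c) ≡ m ℕ.* c
  sumℕ-const zero c = refl
  sumℕ-const (suc m) c = cong (c ℕ.+_) (sumℕ-const m c)

  numPairs-G : numPairs (adj G) ≡ z ℕ.+ M
  numPairs-G = trans (numPairs-split (adj G) (Inside 𝒳)) (cong (ℕ._+ M) (hasRank-unique {E = AI}
    (indepPairs-⊆ (λ u v → cong₂ _∧_ (adj-sym G u v) (inside-sym 𝒳 u v)) (λ u → cong (_∧ _) (irr G u)) (adj-sym G) (irr G) (λ u v t → T∧ˡ t) indG) rank-inside))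
    where
    AI : PairSet n
    AI u v = adj G u v ∧ Inside 𝒳 u v

  IE⁺ : IEIs G 𝒳⁺ emptyPairs (ℤ.+ numPairs (adj G))
  IE⁺ = rs⁺ ∘ splitAt K , (λ i → hasRank-cong (λ u v → cong (λ s → X 𝒳⁺ i u ∧ X 𝒳⁺ i v ∧ (adj G u v ∨ s)) (no-empty u v)) (rank⁺ (splitAt K i))) ,
    trans (eq₀ (numPairs (adj G)) (sumℕ rs) M (sumℕ ss) (numPairs Sh) (trans (cong (ℕ._+ sumℕ ss) numPairs-G) eq₁))
      (cong₂ ℤ._-_ (trans (cong ℤ.+_ (sym (trans (sumℕ-splitAt rs⁺) (cong (sumℕ rs ℕ.+_) (trans (sumℕ-const M 1) (ℕₚ.*-identityʳ M)))))) (+sumℕ (rs⁺ ∘ splitAt K)))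
        (sym (trans (overcount 𝒳⁺ (λ u v → Shared 𝒳⁺ u v ∨ false)) (cong₂ (λ s t → ℤ.+ s ℤ.- ℤ.+ t)
          (trans (sumℕ-cong λ i → trans (numPairs-cong λ u v → cong (λ s → X 𝒳⁺ i u ∧ X 𝒳⁺ i v ∧ s) (sym (no-empty u v))) (shared⁺-count (splitAt K i)))
            (trans (sumℕ-splitAt ss⁺) (trans (cong (sumℕ ss ℕ.+_) (trans (sumℕ-const M 0) (ℕₚ.*-zeroʳ M))) (ℕₚ.+-identityʳ _))))
          (numPairs-cong λ u v → sym (no-empty u v))))))
    where
    no-empty : ∀ u v → Sh u v ≡ Shared 𝒳⁺ u v ∨ false
    no-empty u v = trans (sym (shared≡ u v)) (sym (Boolₚ.∨-identityʳ _))
    eq₁ : z ℕ.+ M ℕ.+ sumℕ ss ≡ sumℕ rs ℕ.+ M ℕ.+ numPairs Sh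
    eq₁ = trans (trans (ℕₚ.+-assoc z M _) (trans (cong (z ℕ.+_) (ℕₚ.+-comm M _)) (sym (ℕₚ.+-assoc z _ M))))
      (trans (cong (ℕ._+ M) count) (trans (ℕₚ.+-assoc (sumℕ rs) _ M) (trans (cong (sumℕ rs ℕ.+_) (ℕₚ.+-comm (numPairs Sh) M)) (sym (ℕₚ.+-assoc (sumℕ rs) M _)))))
    eq₀ : ∀ z r m s p → z ℕ.+ s ≡ r ℕ.+ m ℕ.+ p → ℤ.+ z ≡ ℤ.+ (r ℕ.+ m) ℤ.- (ℤ.+ s ℤ.- ℤ.+ p)
    eq₀ z r m s p e = trans (alg (ℤ.+ z) (ℤ.+ s)) (trans (cong (ℤ._- ℤ.+ s) (cong ℤ.+_ e)) (alg₂ (ℤ.+ (r ℕ.+ m)) (ℤ.+ s) (ℤ.+ p)))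
      where
      open ℤSolver.+-*-Solver
      alg : ∀ z s → z ≡ z ℤ.+ s ℤ.- s
      alg = solve 2 (λ z s → z := z :+ s :- s) refl
      alg₂ : ∀ r s p → r ℤ.+ p ℤ.- s ≡ r ℤ.- (s ℤ.- p)
      alg₂ = solve 3 (λ r s p → r :+ p :- s := r :- (s :- p)) refl

  base⁺ : BaseWith G 𝒳⁺
  base⁺ = record { indepG = indG ; twoThin = twoThin⁺ ; indep𝒳 = indep⁺ ; rank=IE = numPairs (adj G) , indG , IE⁺ }

  half⁺ : ∀ {a b σ} → T (Shared 𝒳 a b) → Half G 𝒳 a b σ → Half G 𝒳⁺ a b σ
  half⁺ {a} {b} {σ} ab h = record { nonempty = H.nonempty ; S1 = λ i → s1 (splitAt K i) ; S2 = s2 }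
    where
    module H = Half h
    Side⁺ : Fin K ⊎ Fin M → Bool → Set
    Side⁺ c s = ∃ λ x → T (Y c x) × T (adj G a x) × σ x ≡ s
    s1 : ∀ c u v → T (Shared 𝒳⁺ u v) → adj G u v ≡ false → T (Y c u) → T (Y c v) → ¬ (Side⁺ c true × Side⁺ c false)
    s1 (inj₁ i) u v t ne = H.S1 i u v (subst T (shared≡ u v) t) ne
    s1 (inj₂ j) u v t ne tu tv = ⊥-elim (shared-outside j (subst T (shared≡ u v) t) tu tv)
    s2 : ∀ i j u → i ≢ j → u ≢ a → u ≢ b → adj G a u ≡ false → Meets (X 𝒳⁺ i) (X 𝒳⁺ j) a u → ∀ s → Side⁺ (splitAt K i) s → Side⁺ (splitAt K j) s
    s2 i j u i≢j u≢a u≢b ne m s side with Y-meets (splitAt K i) (splitAt K j) (splitAt-≢ i≢j) (u≢a ∘ sym) m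
    ... | i′ , j′ , ei , ej = subst (λ c → Side⁺ c s) (sym ej) (H.S2 i′ j′ u (λ e → splitAt-≢ i≢j (trans ei (trans (cong inj₁ e) (sym ej))))
            u≢a u≢b ne (subst₂ (λ s t → Meets (Y s) (Y t) a u) ei ej m) s (subst (λ c → Side⁺ c s) ei side))

  splittable⁺ : Splittable G 𝒳 → Splittable G 𝒳⁺
  splittable⁺ S = record { a = S.a ; b = S.b ; σ = S.σ ; τ = S.τ ; nonedge = S.nonedge ; shared = subst T (sym (shared≡ S.a S.b)) S.shared
    ; halfA = half⁺ S.shared S.halfA ; halfB = half⁺ (subst T (shared-sym 𝒳 S.a S.b) S.shared) S.halfB }
    where module S = Splittable S

==-refl : ∀ {n} (x : Fin n) → (x == x) ≡ true
==-refl x = T⇒≡ (==⁺ {x = x} refl)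

==-≢ : ∀ {n} {x y : Fin n} → x ≢ y → (x == y) ≡ false
==-≢ ne = ¬T⇒≡ (λ t → ne (==⁻ t))

-- From the two-sided description of a safe split to an actual split graph on two more
-- vertices: a₁, b₁ reuse a, b, and a₂ = 0, b₂ = 1.
module _ {n} {G : Graph n} {𝒳 : Cover n} (S : Splittable G 𝒳) where
  open Splittable S
  private
    module A = Half halfA
    module B = Half halfB

    a≢b : a ≢ b
    a≢b = IsShared.u≢v (shared⁻ {𝒳 = 𝒳} shared)

    base : Fin (suc (suc n)) → Fin n
    base zero = a
    base (suc zero) = b
    base (suc (suc x)) = x

    ok : Fin (suc (suc n)) → Fin n → Bool
    ok zero x = not (σ x)
    ok (suc zero) x = not (τ x)
    ok (suc (suc y)) x = (not (y == a) ∨ σ x) ∧ (not (y == b) ∨ τ x)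

    Gs : Graph (suc (suc n))
    Gs = record
      { adj = λ w z → adj G (base w) (base z) ∧ ok w (base z) ∧ ok z (base w)
      ; sym = λ w z → cong₂ _∧_ (adj-sym G (base w) (base z)) (Boolₚ.∧-comm (ok w (base z)) (ok z (base w)))
      ; irr = λ w → cong (_∧ (ok w (base w) ∧ ok w (base w))) (irr G (base w)) }

    φ : Fin n → Fin (suc (suc n))
    φ x = suc (suc x)

    ok-old : ∀ {y} x → y ≢ a → y ≢ b → ok (φ y) x ≡ true
    ok-old x y≢a y≢b rewrite ==-≢ y≢a | ==-≢ y≢b = refl

    ok-a : ∀ x → ok (φ a) x ≡ σ x
    ok-a x rewrite ==-refl a | ==-≢ a≢b = Boolₚ.∧-identityʳ (σ x)

    ok-b : ∀ x → ok (φ b) x ≡ τ x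
    ok-b x rewrite ==-refl b | ==-≢ (a≢b ∘ sym) = refl

    Oldᵃᵇ : Fin n → Set
    Oldᵃᵇ x = x ≢ a × x ≢ b

    adj-a1 : ∀ {x} → Oldᵃᵇ x → adj Gs (φ a) (φ x) ≡ adj G a x ∧ σ x
    adj-a1 {x} (p , q) = cong (adj G a x ∧_) (trans (cong₂ _∧_ (ok-a x) (ok-old a p q)) (Boolₚ.∧-identityʳ (σ x)))
    adj-a2 : ∀ {x} → Oldᵃᵇ x → adj Gs zero (φ x) ≡ adj G a x ∧ not (σ x)
    adj-a2 {x} (p , q) = cong (adj G a x ∧_) (trans (cong (not (σ x) ∧_) (ok-old a p q)) (Boolₚ.∧-identityʳ (not (σ x))))
    adj-b1 : ∀ {x} → Oldᵃᵇ x → adj Gs (φ b) (φ x) ≡ adj G b x ∧ τ x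
    adj-b1 {x} (p , q) = cong (adj G b x ∧_) (trans (cong₂ _∧_ (ok-b x) (ok-old b p q)) (Boolₚ.∧-identityʳ (τ x)))
    adj-b2 : ∀ {x} → Oldᵃᵇ x → adj Gs (suc zero) (φ x) ≡ adj G b x ∧ not (τ x)
    adj-b2 {x} (p , q) = cong (adj G b x ∧_) (trans (cong (not (τ x) ∧_) (ok-old b p q)) (Boolₚ.∧-identityʳ (not (τ x))))

    split-∨ : ∀ e s → (e ∧ s) ∨ (e ∧ not s) ≡ e
    split-∨ true true = refl
    split-∨ true false = refl
    split-∨ false _ = refl
    split-∧ : ∀ e s → (e ∧ s) ∧ (e ∧ not s) ≡ false
    split-∧ true true = refl
    split-∧ true false = refl
    split-∧ false _ = refl

    not-T : ∀ {s} → T (not s) → s ≡ false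
    not-T {false} _ = refl
    not-F : ∀ {s} → s ≡ false → T (not s)
    not-F refl = tt

    nbrA : ∀ {x} → T (adj G a x) → Oldᵃᵇ x
    nbrA t = (λ { refl → ≡⇒¬T (irr G a) t }) , (λ { refl → ≡⇒¬T nonedge t })
    nbrB : ∀ {x} → T (adj G b x) → Oldᵃᵇ x
    nbrB t = (λ { refl → ≡⇒¬T nonedge (subst T (adj-sym G b a) t) }) , (λ { refl → ≡⇒¬T (irr G b) t })

    φ-inj : ∀ {x y} → φ x ≡ φ y → x ≡ y
    φ-inj refl = refl

    New : Fin (suc (suc n)) → Set
    New y = y ≡ φ a ⊎ y ≡ zero ⊎ y ≡ φ b ⊎ y ≡ suc zero

    new-base : ∀ {y} → New y → base y ≡ a ⊎ base y ≡ b
    new-base (inj₁ refl) = inj₁ refl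
    new-base (inj₂ (inj₁ refl)) = inj₁ refl
    new-base (inj₂ (inj₂ (inj₁ refl))) = inj₂ refl
    new-base (inj₂ (inj₂ (inj₂ refl))) = inj₂ refl

    new-nonadj : ∀ {u v} → u ≡ a ⊎ u ≡ b → v ≡ a ⊎ v ≡ b → adj G u v ≡ false
    new-nonadj (inj₁ refl) (inj₁ refl) = irr G a
    new-nonadj (inj₁ refl) (inj₂ refl) = nonedge
    new-nonadj (inj₂ refl) (inj₁ refl) = trans (adj-sym G b a) nonedge
    new-nonadj (inj₂ refl) (inj₂ refl) = irr G b

    nonedgeSplit : NonedgeSplit G a b Gs φ (φ a) zero (φ b) (suc zero)
    nonedgeSplit = record
      { a≢b = a≢b ; nonedge = nonedge
      ; a1≢a2 = λ () ; a1≢b1 = a≢b ∘ φ-inj ; a1≢b2 = λ () ; a2≢b1 = λ () ; a2≢b2 = λ () ; b1≢b2 = λ ()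
      ; φ-inj = λ x y _ _ → φ-inj
      ; φ-old = λ { x (p , q) (inj₁ e) → p (φ-inj e) ; x (p , q) (inj₂ (inj₂ (inj₁ e))) → q (φ-inj e) }
      ; onto = onto
      ; adjOld = λ x y (p , q) (r , s) → trans (cong₂ (λ u v → adj G x y ∧ u ∧ v) (ok-old y p q) (ok-old x r s)) (Boolₚ.∧-identityʳ _)
      ; adjNew = λ y z ny nz → cong (_∧ (ok y (base z) ∧ ok z (base y))) (new-nonadj (new-base ny) (new-base nz))
      ; unionA = λ x o → trans (cong₂ _∨_ (adj-a1 o) (adj-a2 o)) (split-∨ (adj G a x) (σ x))
      ; disjA = λ x o → trans (cong₂ _∧_ (adj-a1 o) (adj-a2 o)) (split-∧ (adj G a x) (σ x))
      ; nonempA1 = let x , t , s = A.nonempty true in x , nbrA t , subst T (sym (adj-a1 (nbrA t))) (T∧⁺ t (≡⇒T s))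
      ; nonempA2 = let x , t , s = A.nonempty false in x , nbrA t , subst T (sym (adj-a2 (nbrA t))) (T∧⁺ t (not-F s))
      ; unionB = λ x o → trans (cong₂ _∨_ (adj-b1 o) (adj-b2 o)) (split-∨ (adj G b x) (τ x))
      ; disjB = λ x o → trans (cong₂ _∧_ (adj-b1 o) (adj-b2 o)) (split-∧ (adj G b x) (τ x))
      ; nonempB1 = let x , t , s = B.nonempty true in x , nbrB t , subst T (sym (adj-b1 (nbrB t))) (T∧⁺ t (≡⇒T s))
      ; nonempB2 = let x , t , s = B.nonempty false in x , nbrB t , subst T (sym (adj-b2 (nbrB t))) (T∧⁺ t (not-F s)) }
      where
      onto : ∀ y → New y ⊎ ∃ λ x → Oldᵃᵇ x × φ x ≡ y
      onto zero = inj₁ (inj₂ (inj₁ refl))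
      onto (suc zero) = inj₁ (inj₂ (inj₂ (inj₂ refl)))
      onto (suc (suc x)) with x ≟ a | x ≟ b
      ... | yes refl | _ = inj₁ (inj₁ refl)
      ... | no _ | yes refl = inj₁ (inj₂ (inj₂ (inj₁ refl)))
      ... | no p | no q = inj₂ (x , (p , q) , refl)

    X′ : Fin (k 𝒳) → Fin (suc (suc n)) → Set
    X′ = InSplit G 𝒳 a b Gs φ (φ a) zero (φ b) (suc zero)

    from-a1 : ∀ {i} → X′ i (φ a) → A.Side i true
    from-a1 (inj₁ (x , p , _ , _ , e)) = ⊥-elim (p (φ-inj e))
    from-a1 (inj₂ (_ , x , p , q , Xx , t)) = let t′ = subst T (adj-a1 (p , q)) t in x , Xx , T∧ˡ t′ , T⇒≡ (T∧ʳ {adj G a x} t′)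
    from-a2 : ∀ {i} → X′ i zero → A.Side i false
    from-a2 (inj₂ (_ , x , p , q , Xx , t)) = let t′ = subst T (adj-a2 (p , q)) t in x , Xx , T∧ˡ t′ , not-T (T∧ʳ {adj G a x} t′)
    from-b1 : ∀ {i} → X′ i (φ b) → B.Side i true
    from-b1 (inj₁ (x , _ , q , _ , e)) = ⊥-elim (q (φ-inj e))
    from-b1 (inj₂ (_ , x , p , q , Xx , t)) = let t′ = subst T (adj-b1 (p , q)) t in x , Xx , T∧ˡ t′ , T⇒≡ (T∧ʳ {adj G b x} t′)
    from-b2 : ∀ {i} → X′ i (suc zero) → B.Side i false
    from-b2 (inj₂ (_ , x , p , q , Xx , t)) = let t′ = subst T (adj-b2 (p , q)) t in x , Xx , T∧ˡ t′ , not-T (T∧ʳ {adj G b x} t′)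

    to-a1 : ∀ {i} → A.Side i true → X′ i (φ a)
    to-a1 (x , Xx , t , s) = let o = nbrA t in inj₂ (inj₁ refl , x , proj₁ o , proj₂ o , Xx , subst T (sym (adj-a1 o)) (T∧⁺ t (≡⇒T s)))
    to-a2 : ∀ {i} → A.Side i false → X′ i zero
    to-a2 (x , Xx , t , s) = let o = nbrA t in inj₂ (inj₂ (inj₁ refl) , x , proj₁ o , proj₂ o , Xx , subst T (sym (adj-a2 o)) (T∧⁺ t (not-F s)))
    to-b1 : ∀ {i} → B.Side i true → X′ i (φ b)
    to-b1 (x , Xx , t , s) = let o = nbrB t in inj₂ (inj₂ (inj₂ (inj₁ refl)) , x , proj₁ o , proj₂ o , Xx , subst T (sym (adj-b1 o)) (T∧⁺ t (≡⇒T s)))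
    to-b2 : ∀ {i} → B.Side i false → X′ i (suc zero)
    to-b2 (x , Xx , t , s) = let o = nbrB t in inj₂ (inj₂ (inj₂ (inj₂ refl)) , x , proj₁ o , proj₂ o , Xx , subst T (sym (adj-b2 o)) (T∧⁺ t (not-F s)))

    flip-meets : ∀ {i j u v} → Meets (X 𝒳 i) (X 𝒳 j) u v → Meets (X 𝒳 j) (X 𝒳 i) u v
    flip-meets {i} {j} = meets-comm {A = X 𝒳 i} {X 𝒳 j}

  splittable⇒safeSplit : HasSafeSplit G 𝒳
  splittable⇒safeSplit = a , b , nonedge , shared , suc (suc n) , Gs , φ , φ a , zero , φ b , suc zero , record
    { split = nonedgeSplit
    ; shared = shared
    ; S1 = λ i u v s ne Xu Xv → (λ (p , q) → A.S1 i u v s ne Xu Xv (from-a1 p , from-a2 q)) , (λ (p , q) → B.S1 i u v s ne Xu Xv (from-b1 p , from-b2 q))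
    ; S2a = λ { i j u i≢j p q ne m w (inj₁ refl) → (λ s → to-a1 (A.S2 i j u i≢j p q ne m true (from-a1 s))) , (λ s → to-a1 (A.S2 j i u (i≢j ∘ sym) p q ne (flip-meets m) true (from-a1 s)))
              ; i j u i≢j p q ne m w (inj₂ refl) → (λ s → to-a2 (A.S2 i j u i≢j p q ne m false (from-a2 s))) , (λ s → to-a2 (A.S2 j i u (i≢j ∘ sym) p q ne (flip-meets m) false (from-a2 s))) }
    ; S2b = λ { i j u i≢j p q ne m w (inj₁ refl) → (λ s → to-b1 (B.S2 i j u i≢j p q ne m true (from-b1 s))) , (λ s → to-b1 (B.S2 j i u (i≢j ∘ sym) p q ne (flip-meets m) true (from-b1 s)))
              ; i j u i≢j p q ne m w (inj₂ refl) → (λ s → to-b2 (B.S2 i j u i≢j p q ne m false (from-b2 s))) , (λ s → to-b2 (B.S2 j i u (i≢j ∘ sym) p q ne (flip-meets m) false (from-b2 s))) } }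

module _ {n m} {G : Graph n} {𝒳 : Cover n} {a b} {Gs : Graph m} {φ} {a1 a2 b1 b2}
         (S : SafeSplit G 𝒳 a b Gs φ a1 a2 b1 b2) where
  open SafeSplit S
  open NonedgeSplit split

  private
    side-a1 : Fin n → Bool
    side-a1 x = adj Gs a1 (φ x)
    side-b1 : Fin n → Bool
    side-b1 x = adj Gs b1 (φ x)

    second : ∀ {p q e} → (p ∨ q) ≡ e → T e → p ≡ false → T q
    second refl t refl = t

    not-first : ∀ {p q} → (p ∧ q) ≡ false → T q → p ≡ false
    not-first {true} e t = ⊥-elim (≡⇒¬T e t)
    not-first {false} e t = refl

    neighbour-a : ∀ {x} → T (adj G a x) → Old x
    neighbour-a t = (λ { refl → ≡⇒¬T (irr G a) t }) , (λ { refl → ≡⇒¬T nonedge t })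
    neighbour-b : ∀ {x} → T (adj G b x) → Old x
    neighbour-b t = (λ { refl → ≡⇒¬T nonedge (subst T (adj-sym G b a) t) }) , (λ { refl → ≡⇒¬T (irr G b) t })

    sideA : Fin (k 𝒳) → Bool → Set
    sideA i s = ∃ λ x → T (X 𝒳 i x) × T (adj G a x) × side-a1 x ≡ s
    sideB : Fin (k 𝒳) → Bool → Set
    sideB i s = ∃ λ x → T (X 𝒳 i x) × T (adj G b x) × side-b1 x ≡ s

    copyA : Bool → Fin m
    copyA true = a1
    copyA false = a2
    copyB : Bool → Fin m
    copyB true = b1
    copyB false = b2

    toA : ∀ {i} s → sideA i s → X' i (copyA s)
    toA true (x , Xx , t , e) = inj₂ (inj₁ refl , x , proj₁ (neighbour-a t) , proj₂ (neighbour-a t) , Xx , ≡⇒T e)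
    toA false (x , Xx , t , e) = inj₂ (inj₂ (inj₁ refl) , x , proj₁ (neighbour-a t) , proj₂ (neighbour-a t) , Xx , second (unionA x (neighbour-a t)) t e)
    toB : ∀ {i} s → sideB i s → X' i (copyB s)
    toB true (x , Xx , t , e) = inj₂ (inj₂ (inj₂ (inj₁ refl)) , x , proj₁ (neighbour-b t) , proj₂ (neighbour-b t) , Xx , ≡⇒T e)
    toB false (x , Xx , t , e) = inj₂ (inj₂ (inj₂ (inj₂ refl)) , x , proj₁ (neighbour-b t) , proj₂ (neighbour-b t) , Xx , second (unionB x (neighbour-b t)) t e)

    fromA : ∀ {i} s → X' i (copyA s) → sideA i s
    fromA true (inj₁ (x , p , q , _ , e)) = ⊥-elim (φ-old x (p , q) (inj₁ e))
    fromA true (inj₂ (_ , x , p , q , Xx , t)) = x , Xx , subst T (unionA x (p , q)) (T∨⁺ˡ t) , T⇒≡ t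
    fromA false (inj₁ (x , p , q , _ , e)) = ⊥-elim (φ-old x (p , q) (inj₂ (inj₁ e)))
    fromA false (inj₂ (_ , x , p , q , Xx , t)) = x , Xx , subst T (unionA x (p , q)) (T∨⁺ʳ {adj Gs a1 (φ x)} t) , not-first (disjA x (p , q)) t
    fromB : ∀ {i} s → X' i (copyB s) → sideB i s
    fromB true (inj₁ (x , p , q , _ , e)) = ⊥-elim (φ-old x (p , q) (inj₂ (inj₂ (inj₁ e))))
    fromB true (inj₂ (_ , x , p , q , Xx , t)) = x , Xx , subst T (unionB x (p , q)) (T∨⁺ˡ t) , T⇒≡ t
    fromB false (inj₁ (x , p , q , _ , e)) = ⊥-elim (φ-old x (p , q) (inj₂ (inj₂ (inj₂ e))))
    fromB false (inj₂ (_ , x , p , q , Xx , t)) = x , Xx , subst T (unionB x (p , q)) (T∨⁺ʳ {adj Gs b1 (φ x)} t) , not-first (disjB x (p , q)) t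

    isA : ∀ s → copyA s ≡ a1 ⊎ copyA s ≡ a2
    isA true = inj₁ refl
    isA false = inj₂ refl
    isB : ∀ s → copyB s ≡ b1 ⊎ copyB s ≡ b2
    isB true = inj₁ refl
    isB false = inj₂ refl

  halfA-of-safeSplit : Half G 𝒳 a b (λ x → adj Gs a1 (φ x))
  halfA-of-safeSplit = record
    { nonempty = λ { true → let x , o , t = nonempA1 in x , subst T (unionA x o) (T∨⁺ˡ t) , T⇒≡ t
                   ; false → let x , o , t = nonempA2 in x , subst T (unionA x o) (T∨⁺ʳ {adj Gs a1 (φ x)} t) , not-first (disjA x o) t }
    ; S1 = λ i u v s ne Xu Xv (p , q) → proj₁ (S1 i u v s ne Xu Xv) (toA true p , toA false q)
    ; S2 = λ i j u i≢j p q ne m s side → fromA s (proj₁ (S2a i j u i≢j p q ne m (copyA s) (isA s)) (toA s side)) }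

  halfB-of-safeSplit : Half G 𝒳 b a (λ x → adj Gs b1 (φ x))
  halfB-of-safeSplit = record
    { nonempty = λ { true → let x , o , t = nonempB1 in x , subst T (unionB x o) (T∨⁺ˡ t) , T⇒≡ t
                   ; false → let x , o , t = nonempB2 in x , subst T (unionB x o) (T∨⁺ʳ {adj Gs b1 (φ x)} t) , not-first (disjB x o) t }
    ; S1 = λ i u v s ne Xu Xv (p , q) → proj₂ (S1 i u v s ne Xu Xv) (toB true p , toB false q)
    ; S2 = λ i j u i≢j p q ne m s side → fromB s (proj₁ (S2b i j u i≢j p q ne m (copyB s) (isB s)) (toB s side)) }

  safeSplit⇒splittable : Splittable G 𝒳
  safeSplit⇒splittable = record { nonedge = nonedge ; shared = shared ; halfA = halfA-of-safeSplit ; halfB = halfB-of-safeSplit }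

complete-safeBase : ∀ {n} {G : Graph n} {𝒳} → PartialBase G 𝒳 → IndependentGraph G → Splittable G 𝒳 → SafeBase G
complete-safeBase {G = G} {𝒳} P ind S = 𝒳⁺ , base⁺ , splittable⇒safeSplit (splittable⁺ S)
  where open Complete G 𝒳 P ind

adj-or-shared-sym : ∀ {n} (G : Graph n) 𝒳 → Symm (λ u v → adj G u v ∨ Shared 𝒳 u v)
adj-or-shared-sym G 𝒳 u v = cong₂ _∨_ (adj-sym G u v) (shared-sym 𝒳 u v)

module _ {n} {G : Graph n} {𝒳 : Cover n} (B : BaseWith G 𝒳) where
  open BaseWith B

  opaque
    base⇒partial : PartialBase G 𝒳
    base⇒partial with rank=IE
    ... | r , rankG , rs , rank-cl , eq = record
      { size≥2 = TwoThin.size≥2 twoThin ; thin = TwoThin.thin twoThin ; noSubset = TwoThin.noSubset twoThin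
      ; indep𝒳 = indep𝒳 ; rs = rs ; ss = λ i → numPairs (Within (X 𝒳 i) (Shared 𝒳)) ; z = r
      ; rank-cluster = λ i → hasRank-cong (λ u v → cong (λ s → X 𝒳 i u ∧ X 𝒳 i v ∧ (adj G u v ∨ s)) (Boolₚ.∨-identityʳ (Shared 𝒳 u v))) (rank-cl i)
      ; rank-shared = λ i → indepPairs-⊆ (within-sym {A = X 𝒳 i} {Shared 𝒳} (shared-sym 𝒳)) (within-irr {A = X 𝒳 i} {Shared 𝒳} (shared-irr 𝒳)) (shared-sym 𝒳) (shared-irr 𝒳)
          (λ u v t → T∧ʳ {X 𝒳 i v} (T∧ʳ {X 𝒳 i u} t)) indep𝒳
      ; rank-inside = hasRank-cong (λ u v → T-ext (λ t → T∧⁺ t (inside t)) T∧ˡ) rankG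
      ; count = ℤₚ.+-injective (move (ℤ.+ r) (ℤ.+ sumℕ rs) (ℤ.+ sumℕ (λ i → numPairs (Within (X 𝒳 i) (Shared 𝒳)))) (ℤ.+ numPairs (Shared 𝒳)) (trans eq (cong₂ ℤ._-_ (sym (+sumℕ {k 𝒳} rs)) IE))) }
      where
      inside : ∀ {u v} → T (adj G u v) → T (Inside 𝒳 u v)
      inside {u} {v} t = let i , Xu , Xv = TwoThin.covers twoThin u v t in anyF⁺ i (T∧⁺ Xu Xv)
      K : ℕ
      K = k 𝒳
      IE : sumPairs (λ u v → if Shared 𝒳 u v ∨ false then ℤ.+ dcount 𝒳 u v ℤ.- 1ℤ else 0ℤ) ≡
        ℤ.+ sumℕ (λ i → numPairs (Within (X 𝒳 i) (Shared 𝒳))) ℤ.- ℤ.+ numPairs (Shared 𝒳)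
      IE = trans (sumℤ-cong {n} λ u → sumℤ-cong {n} λ v → cong (λ b → if u <ᶠ v then (if b then ℤ.+ dcount 𝒳 u v ℤ.- 1ℤ else 0ℤ) else 0ℤ) (Boolₚ.∨-identityʳ (Shared 𝒳 u v)))
        (overcount 𝒳 (Shared 𝒳))
      move : ∀ z r s p → z ≡ r ℤ.- (s ℤ.- p) → z ℤ.+ s ≡ r ℤ.+ p
      move z r s p refl = solve 3 (λ r s p → r :- (s :- p) :+ s := r :+ p) refl r s p
        where open ℤSolver.+-*-Solver

-- Transport along an embedding onto an induced subgraph

module Push {n N} {G : Graph n} {G′ : Graph N} {f : Fin n → Fin N} (inj : Injective _≡_ _≡_ f)
            (induced : ∀ x y → adj G′ (f x) (f y) ≡ adj G x y) (𝒳 : Cover n) where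

  image : (Fin n → Bool) → Fin N → Bool
  image A z = anyF (λ x → (f x == z) ∧ A x)

  image⁺ : ∀ {A x} → T (A x) → T (image A (f x))
  image⁺ {A} {x} t = anyF⁺ x (T∧⁺ (==⁺ refl) t)

  image⁻ : ∀ {A z} → T (image A z) → ∃ λ x → f x ≡ z × T (A x)
  image⁻ {A} {z} t with anyF⁻ _ t
  ... | x , tx = x , ==⁻ (T∧ˡ tx) , T∧ʳ {f x == z} tx

  image-f : ∀ A x → image A (f x) ≡ A x
  image-f A x = T-ext (λ t → case image⁻ {A} t of λ { (y , e , Ay) → subst (T ∘ A) (inj e) Ay }) (image⁺ {A})

  𝒳′ : Cover N
  𝒳′ = record { k = k 𝒳 ; X = λ i → image (X 𝒳 i) }

  members : (Fin n → Bool) → List (Fin n)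
  members A = filterᵇ A (allFin n)

  length-members : ∀ A → length (map f (members A)) ≡ countF A
  length-members A = trans (Listₚ.length-map f (members A)) (length-filterᵇ-tabulate A id)

  count-image≥ : ∀ A → countF A ℕ.≤ countF (image A)
  count-image≥ A = subst (ℕ._≤ countF (image A)) (length-members A)
    (count≥ (image A) (Uniqueₚ.map⁺ inj (Uniqueₚ.filter⁺ _ (Uniqueₚ.allFin⁺ n)))
      (Allₚ.map⁺ (All.tabulate (λ m → image⁺ {A} (proj₂ (Memₚ.∈-filter⁻ _ {xs = allFin n} m))))))

  image-inter : ∀ A B w → T (inter (image A) (image B) w) → w ∈ map f (members (inter A B))
  image-inter A B w t with image⁻ {A} {w} (T∧ˡ t)
  ... | x , refl , Ax = Memₚ.∈-map⁺ f (Memₚ.∈-filter⁺ _ (Memₚ.∈-allFin x) (T∧⁺ Ax (subst T (image-f B x) (T∧ʳ {image A (f x)} t))))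

  meets-image : ∀ {A B u v} → Meets A B u v → Meets (image A) (image B) (f u) (f v)
  meets-image {A} {B} {u} {v} m = meets-intro {A = image A} {image B} (image⁺ {A} (proj₁ mu)) (image⁺ {A} (proj₁ mv)) (image⁺ {B} (proj₂ mu)) (image⁺ {B} (proj₂ mv))
    λ w tA tB → only w (image⁻ {A} tA) tB
    where
    mu : T (A u) × T (B u)
    mu = meets-u {A = A} {B} m
    mv : T (A v) × T (B v)
    mv = meets-v {A = A} {B} m
    only : ∀ w → (∃ λ x → f x ≡ w × T (A x)) → T (image B w) → w ≡ f u ⊎ w ≡ f v
    only _ (x , refl , Ax) tB = Data.Sum.map (cong f) (cong f) (meets-only {A = A} {B} m Ax (subst T (image-f B x) tB))

  meets-preimage : ∀ {A B u v} → Meets (image A) (image B) (f u) (f v) → Meets A B u v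
  meets-preimage {A} {B} {u} {v} m w = trans (cong₂ _∧_ (sym (image-f A w)) (sym (image-f B w))) (trans (m (f w)) (cong₂ _∨_ (inj-== w u) (inj-== w v)))
    where
    inj-== : ∀ x y → (f x == f y) ≡ (x == y)
    inj-== x y = T-ext (λ t → ==⁺ (inj (==⁻ t))) (λ t → ==⁺ (cong f (==⁻ t)))

  shared′ : Image f (Shared 𝒳) (Shared 𝒳′)
  shared′ z w = to , from
    where
    to : T (Shared 𝒳′ z w) → ∃ λ x → ∃ λ y → f x ≡ z × f y ≡ w × T (Shared 𝒳 x y)
    to t with shared⁻ {𝒳 = 𝒳′} t
    ... | isShared ne i j i≢j m with image⁻ {X 𝒳 i} (proj₁ (meets-u {A = X 𝒳′ i} {X 𝒳′ j} m)) | image⁻ {X 𝒳 i} (proj₁ (meets-v {A = X 𝒳′ i} {X 𝒳′ j} m))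
    ...   | x , refl , _ | y , refl , _ = x , y , refl , refl , shared⁺ {𝒳 = 𝒳} (isShared (ne ∘ cong f) i j i≢j (meets-preimage {X 𝒳 i} {X 𝒳 j} m))
    from : ∀ x y → f x ≡ z → f y ≡ w → T (Shared 𝒳 x y) → T (Shared 𝒳′ z w)
    from x y refl refl t with shared⁻ {𝒳 = 𝒳} t
    ... | isShared ne i j i≢j m = shared⁺ {𝒳 = 𝒳′} (isShared (ne ∘ inj) i j i≢j (meets-image {X 𝒳 i} {X 𝒳 j} m))

  shared-f : ∀ {x y} → T (Shared 𝒳′ (f x) (f y)) → T (Shared 𝒳 x y)
  shared-f {x} {y} t with proj₁ (shared′ (f x) (f y)) t
  ... | x′ , y′ , e , e′ , t′ = subst₂ (λ u v → T (Shared 𝒳 u v)) (inj e) (inj e′) t′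

  within-image : ∀ A {P P′} → (∀ {x y} → T (P′ (f x) (f y)) → T (P x y)) → (∀ {x y} → T (P x y) → T (P′ (f x) (f y))) → Image f (Within A P) (Within (image A) P′)
  within-image A {P} {P′} to from z w = to′ , from′
    where
    to′ : T (Within (image A) P′ z w) → ∃ λ x → ∃ λ y → f x ≡ z × f y ≡ w × T (Within A P x y)
    to′ t with image⁻ {A} (T∧ˡ t) | image⁻ {A} (T∧ˡ (T∧ʳ {image A z} t))
    ... | x , refl , Ax | y , refl , Ay = x , y , refl , refl , T∧⁺ Ax (T∧⁺ Ay (to (T∧ʳ {image A w} (T∧ʳ {image A z} t))))
    from′ : ∀ x y → f x ≡ z → f y ≡ w → T (Within A P x y) → T (Within (image A) P′ z w)
    from′ x y refl refl t = T∧⁺ (image⁺ {A} (T∧ˡ t)) (T∧⁺ (image⁺ {A} (T∧ˡ (T∧ʳ {A x} t))) (from (T∧ʳ {A y} (T∧ʳ {A x} t))))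

  inside-image : Image f (λ u v → adj G u v ∧ Inside 𝒳 u v) (λ u v → adj G′ u v ∧ Inside 𝒳′ u v)
  inside-image z w = to , from
    where
    to : T (adj G′ z w ∧ Inside 𝒳′ z w) → ∃ λ x → ∃ λ y → f x ≡ z × f y ≡ w × T (adj G x y ∧ Inside 𝒳 x y)
    to t with anyF⁻ _ (T∧ʳ {adj G′ z w} t)
    ... | i , ti with image⁻ {X 𝒳 i} (T∧ˡ ti) | image⁻ {X 𝒳 i} (T∧ʳ {image (X 𝒳 i) z} ti)
    ...   | x , refl , Xx | y , refl , Xy = x , y , refl , refl , T∧⁺ (subst T (induced x y) (T∧ˡ t)) (anyF⁺ i (T∧⁺ Xx Xy))
    from : ∀ x y → f x ≡ z → f y ≡ w → T (adj G x y ∧ Inside 𝒳 x y) → T (adj G′ z w ∧ Inside 𝒳′ z w)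
    from x y refl refl t with anyF⁻ _ (T∧ʳ {adj G x y} t)
    ... | i , ti = T∧⁺ (subst T (sym (induced x y)) (T∧ˡ t)) (anyF⁺ i (T∧⁺ (image⁺ {X 𝒳 i} (T∧ˡ ti)) (image⁺ {X 𝒳 i} (T∧ʳ {X 𝒳 i x} ti))))

  module _ (P : PartialBase G 𝒳) where
    open PartialBase P

    private
      S-list : List (Pair N)
      S-list = map (map² f) (edgeList (Shared 𝒳))
      S-in : All (InSet (Shared 𝒳′)) S-list
      S-in = image-InSet {f = f} {Shared 𝒳} {Shared 𝒳′} shared′ (edgeList-InSet (Shared 𝒳))
      S-ind : Independent S-list
      S-ind = independent-embed inj (indepPairs⇒edgeList (shared-sym 𝒳) (shared-irr 𝒳) indep𝒳)
      S-cov : Covers S-list (Shared 𝒳′)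
      S-cov z w t with proj₁ (shared′ z w) t
      ... | x , y , refl , refl , t′ = Data.Sum.map (Memₚ.∈-map⁺ (map² f)) (Memₚ.∈-map⁺ (map² f)) (edgeList-covers (shared-sym 𝒳) (shared-irr 𝒳) x y t′)

    push-partial : PartialBase G′ 𝒳′
    push-partial = record
      { size≥2 = λ i → ℕₚ.≤-trans (size≥2 i) (count-image≥ (X 𝒳 i))
      ; thin = λ i j ne → ℕₚ.≤-trans (count≤ (inter (X 𝒳′ i) (X 𝒳′ j)) _ (image-inter (X 𝒳 i) (X 𝒳 j)))
                 (subst (ℕ._≤ 2) (sym (length-members (inter (X 𝒳 i) (X 𝒳 j)))) (thin i j ne))
      ; noSubset = λ i j ne h → noSubset i j ne (λ x t → subst T (image-f (X 𝒳 j) x) (h (f x) (image⁺ {X 𝒳 i} t)))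
      ; indep𝒳 = covering-indepPairs (shared-sym 𝒳′) (shared-irr 𝒳′) S-in S-ind S-cov
      ; rs = rs ; ss = ss ; z = z
      ; rank-cluster = λ i → hasRank-image inj (within-image (X 𝒳 i) {λ u v → adj G u v ∨ Shared 𝒳 u v} {λ u v → adj G′ u v ∨ Shared 𝒳′ u v}
          (λ {x} {y} t → [ (λ t → T∨⁺ˡ (subst T (induced x y) t)) , (λ t → T∨⁺ʳ {adj G x y} (shared-f t)) ]′ (T∨⁻ {adj G′ (f x) (f y)} t))
          (λ {x} {y} t → [ (λ t → T∨⁺ˡ (subst T (sym (induced x y)) t)) , (λ t → T∨⁺ʳ {adj G′ (f x) (f y)} (proj₂ (shared′ _ _) x y refl refl t)) ]′ (T∨⁻ {adj G x y} t)))
          (rank-cluster i)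
      ; rank-shared = λ i → hasRank-image inj (within-image (X 𝒳 i) {Shared 𝒳} {Shared 𝒳′} shared-f (λ {x} {y} t → proj₂ (shared′ _ _) x y refl refl t)) (rank-shared i)
      ; rank-inside = hasRank-image inj inside-image rank-inside
      ; count = trans count (cong (sumℕ rs ℕ.+_) (sym (trans (covering-numPairs (shared-sym 𝒳′) (shared-irr 𝒳′) S-in S-ind S-cov)
          (trans (Listₚ.length-map (map² f) (edgeList (Shared 𝒳))) (length-edgeList (Shared 𝒳)))))) }

  push-half : ∀ {a b σ} → Half G 𝒳 a b σ → Half G′ 𝒳′ (f a) (f b) (image σ)
  push-half {a} {b} {σ} h = record
    { nonempty = λ s → let x , t , e = H.nonempty s in f x , subst T (sym (induced a x)) t , trans (image-f σ x) e
    ; S1 = s1 ; S2 = s2 }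
    where
    module H = Half h
    Side′ : Fin (k 𝒳) → Bool → Set
    Side′ i s = ∃ λ z → T (X 𝒳′ i z) × T (adj G′ (f a) z) × image σ z ≡ s
    down : ∀ {i s} → Side′ i s → H.Side i s
    down {i} (z , tz , t , e) with image⁻ {X 𝒳 i} tz
    ... | x , refl , Xx = x , Xx , subst T (induced a x) t , trans (sym (image-f σ x)) e
    up : ∀ {i s} → H.Side i s → Side′ i s
    up {i} (x , Xx , t , e) = f x , image⁺ {X 𝒳 i} Xx , subst T (sym (induced a x)) t , trans (image-f σ x) e
    s1 : ∀ i u v → T (Shared 𝒳′ u v) → adj G′ u v ≡ false → T (X 𝒳′ i u) → T (X 𝒳′ i v) → ¬ (Side′ i true × Side′ i false)
    s1 i u v t ne tu tv (p , q) with image⁻ {X 𝒳 i} tu | image⁻ {X 𝒳 i} tv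
    ... | x , refl , Xx | y , refl , Xy = H.S1 i x y (shared-f t) (trans (sym (induced x y)) ne) Xx Xy (down p , down q)
    s2 : ∀ i j u → i ≢ j → u ≢ f a → u ≢ f b → adj G′ (f a) u ≡ false → Meets (X 𝒳′ i) (X 𝒳′ j) (f a) u → ∀ s → Side′ i s → Side′ j s
    s2 i j u i≢j u≢a u≢b ne m s side with image⁻ {X 𝒳 i} (proj₁ (meets-v {A = X 𝒳′ i} {X 𝒳′ j} m))
    ... | x , refl , Xx = up (H.S2 i j x i≢j (u≢a ∘ cong f) (u≢b ∘ cong f) (trans (sym (induced a x)) ne) (meets-preimage {X 𝒳 i} {X 𝒳 j} m) s (down side))

  push-splittable : Splittable G 𝒳 → Splittable G′ 𝒳′
  push-splittable S = record { nonedge = trans (induced S.a S.b) S.nonedge ; shared = proj₂ (shared′ _ _) S.a S.b refl refl S.shared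
    ; halfA = push-half S.halfA ; halfB = push-half S.halfB }
    where module S = Splittable S

safeBase⇒splittable : ∀ {n} {G : Graph n} {𝒳} → HasSafeSplit G 𝒳 → Splittable G 𝒳
safeBase⇒splittable (a , b , _ , _ , m , Gs , φ , a1 , a2 , b1 , b2 , S) = safeSplit⇒splittable S

induced-safeBase : ∀ {n N} {G : Graph n} {G′ : Graph N} {f : Fin n → Fin N} → Injective _≡_ _≡_ f →
  (∀ x y → adj G′ (f x) (f y) ≡ adj G x y) → IndependentGraph G′ → SafeBase G → SafeBase G′
induced-safeBase {G′ = G′} inj induced ind (𝒳 , B , S) =
  complete-safeBase {𝒳 = 𝒳′} (push-partial (base⇒partial B)) ind (push-splittable (safeBase⇒splittable S))
  where open Push {G′ = G′} inj induced 𝒳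

henneberg1-safeBase : ∀ {n N} (G : Graph n) → SafeBase G → (G′ : Graph N) (f : Fin n → Fin N) (w : Fin N) →
  Henneberg1 G G′ f w → SafeBase G′
henneberg1-safeBase G base@(𝒳 , B , _) G′ f w H with Henneberg1.nbrs H
... | x₁ , x₂ , x₃ , x₁≢x₂ , x₁≢x₃ , x₂≢x₃ , nbr = induced-safeBase f-inj adjOld
  (covering-indepPairs {L = L} (adj-sym G′) (irr G′) L-in L-ind L-cov) base
  where
  open Henneberg1 H
  xs : List (Fin _)
  xs = f x₁ ∷ f x₂ ∷ f x₃ ∷ []
  EL : List (Pair _)
  EL = map (map² f) (edgeList (adj G))
  L : List (Pair _)
  L = map (w ,_) xs ++ EL
  w-in : ∀ {z} → z ∈ xs → T (adj G′ w z)
  w-in (here e) = proj₂ (nbr _) (inj₁ e)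
  w-in (there (here e)) = proj₂ (nbr _) (inj₂ (inj₁ e))
  w-in (there (there (here e))) = proj₂ (nbr _) (inj₂ (inj₂ e))
  w-out : ∀ {z} → T (adj G′ w z) → z ∈ xs
  w-out t with proj₁ (nbr _) t
  ... | inj₁ e = here e
  ... | inj₂ (inj₁ e) = there (here e)
  ... | inj₂ (inj₂ e) = there (there (here e))
  L-in : All (InSet (adj G′)) L
  L-in = Allₚ.++⁺ (Allₚ.map⁺ (All.tabulate w-in)) (Allₚ.map⁺ (All.map (λ {(x , y)} t → subst T (sym (adjOld x y)) t) (edgeList-InSet (adj G))))
  L-ind : Independent L
  L-ind = henneberg (((f≢w x₁ ∘ sym) ∷ (f≢w x₂ ∘ sym) ∷ (f≢w x₃ ∘ sym) ∷ []) AllPairs.∷ ((x₁≢x₂ ∘ f-inj) ∷ (x₁≢x₃ ∘ f-inj) ∷ []) AllPairs.∷ ((x₂≢x₃ ∘ f-inj) ∷ []) AllPairs.∷ [] AllPairs.∷ AllPairs.[])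
    ℕₚ.≤-refl (Allₚ.map⁺ (All.tabulate (λ {(x , y)} _ → f≢w x , f≢w y)))
    (independent-embed f-inj (indepPairs⇒edgeList (adj-sym G) (irr G) (BaseWith.indepG B)))
  L-cov : Covers L (adj G′)
  L-cov u v t with onto u | onto v
  ... | inj₂ refl | _ = inj₁ (Memₚ.∈-++⁺ˡ (Memₚ.∈-map⁺ (w ,_) (w-out t)))
  ... | inj₁ _ | inj₂ refl = inj₂ (Memₚ.∈-++⁺ˡ (Memₚ.∈-map⁺ (w ,_) (w-out (subst T (adj-sym G′ u w) t))))
  ... | inj₁ (x , refl) | inj₁ (y , refl) = Data.Sum.map inL inL (edgeList-covers (adj-sym G) (irr G) x y (subst T (adjOld x y) t))
    where
    inL : ∀ {e} → e ∈ edgeList (adj G) → map² f e ∈ L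
    inL m = Memₚ.∈-++⁺ʳ (map (w ,_) xs) (Memₚ.∈-map⁺ (map² f) m)

-- Equilibrium loads

cross : (Fin 3 → ℚ) → (Fin 3 → ℚ) → Fin 3 → ℚ
cross b c 0f = b 1f * c 2f - b 2f * c 1f
cross b c 1f = b 2f * c 0f - b 0f * c 2f
cross b c 2f = b 0f * c 1f - b 1f * c 0f

det : (Fin 3 → ℚ) → (Fin 3 → ℚ) → (Fin 3 → ℚ) → ℚ
det a b c = a 0f * cross b c 0f + a 1f * cross b c 1f + a 2f * cross b c 2f

vec₃ : ∀ {A : Set} → A → A → A → Fin 3 → A
vec₃ a b c 0f = a
vec₃ a b c 1f = b
vec₃ a b c 2f = c

opaque
  unfolding _+_ isRing
  cofactor-diag : ∀ a₀ a₁ a₂ b₀ b₁ b₂ c₀ c₁ c₂ →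
    (b₁ * c₂ - b₂ * c₁) * a₀ + ((c₁ * a₂ - c₂ * a₁) * b₀ + ((a₁ * b₂ - a₂ * b₁) * c₀ + 0#)) ≡
    a₀ * (b₁ * c₂ - b₂ * c₁) + a₁ * (b₂ * c₀ - b₀ * c₂) + a₂ * (b₀ * c₁ - b₁ * c₀)
  cofactor-diag = solve-∀ ℚ-ring
  cofactor-off : ∀ a₀ a₁ b₀ b₁ c₀ c₁ →
    (b₁ * c₀ - b₀ * c₁) * a₀ + ((c₁ * a₀ - c₀ * a₁) * b₀ + ((a₁ * b₀ - a₀ * b₁) * c₀ + 0#)) ≡ 0#
  cofactor-off = solve-∀ ℚ-ring
  cofactor-off′ : ∀ a₀ a₁ b₀ b₁ c₀ c₁ →
    (b₀ * c₁ - b₁ * c₀) * a₀ + ((c₀ * a₁ - c₁ * a₀) * b₀ + ((a₀ * b₁ - a₁ * b₀) * c₀ + 0#)) ≡ 0#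
  cofactor-off′ = solve-∀ ℚ-ring
  rotate : ∀ a₀ a₁ a₂ b₀ b₁ b₂ c₀ c₁ c₂ →
    a₁ * (b₂ * c₀ - b₀ * c₂) + a₂ * (b₀ * c₁ - b₁ * c₀) + a₀ * (b₁ * c₂ - b₂ * c₁) ≡
    a₀ * (b₁ * c₂ - b₂ * c₁) + a₁ * (b₂ * c₀ - b₀ * c₂) + a₂ * (b₀ * c₁ - b₁ * c₀)
  rotate = solve-∀ ℚ-ring
  minor : ∀ a b a′ b′ c → b * a′ + ((- a) * b′ + (0# * c + 0#)) ≡ b * a′ - a * b′
  minor = solve-∀ ℚ-ring
  unit : ∀ a b c → 1# * a + (0# * b + (0# * c + 0#)) ≡ a
  unit = solve-∀ ℚ-ring
  flip-sub : ∀ x y → x - y ≡ 0# → y - x ≡ 0#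
  flip-sub x y e = trans (l x y) (cong -_ e)
    where l : ∀ x y → y - x ≡ - (x - y)
          l = solve-∀ ℚ-ring
  neg-neg : ∀ a → - (- a) ≡ a
  neg-neg = solve-∀ ℚ-ring
  neg-0 : - 0# ≡ 0#
  neg-0 = refl
  same : ∀ a b → b * a - a * b ≡ 0#
  same = solve-∀ ℚ-ring

LI⇒det≢0 : (v : Fin 3 → Fin 3 → ℚ) → LI v → det (v 0f) (v 1f) (v 2f) ≢ 0#
LI⇒det≢0 v li det≡0 = 1≢0 (li (vec₃ 1# 0# 0#) (λ i → trans (unit _ _ _) (a≡0 i)) 0f)
  where
  a b c : Fin 3 → ℚ
  a = v 0f
  b = v 1f
  c = v 2f
  cof : ∀ i → Fin 3 → ℚ
  cof i = vec₃ (cross b c i) (cross c a i) (cross a b i)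
  rel : ∀ i j → comb v (cof i) j ≡ 0#
  rel 0f 0f = trans (cofactor-diag (a 0f) (a 1f) (a 2f) (b 0f) (b 1f) (b 2f) (c 0f) (c 1f) (c 2f)) det≡0
  rel 1f 1f = trans (cofactor-diag (a 1f) (a 2f) (a 0f) (b 1f) (b 2f) (b 0f) (c 1f) (c 2f) (c 0f))
    (trans (rotate (a 0f) (a 1f) (a 2f) (b 0f) (b 1f) (b 2f) (c 0f) (c 1f) (c 2f)) det≡0)
  rel 2f 2f = trans (cofactor-diag (a 2f) (a 0f) (a 1f) (b 2f) (b 0f) (b 1f) (c 2f) (c 0f) (c 1f))
    (trans (rotate (a 1f) (a 2f) (a 0f) (b 1f) (b 2f) (b 0f) (c 1f) (c 2f) (c 0f))
    (trans (rotate (a 0f) (a 1f) (a 2f) (b 0f) (b 1f) (b 2f) (c 0f) (c 1f) (c 2f)) det≡0))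
  rel 0f 1f = cofactor-off′ (a 1f) (a 2f) (b 1f) (b 2f) (c 1f) (c 2f)
  rel 0f 2f = cofactor-off (a 2f) (a 1f) (b 2f) (b 1f) (c 2f) (c 1f)
  rel 1f 0f = cofactor-off (a 0f) (a 2f) (b 0f) (b 2f) (c 0f) (c 2f)
  rel 1f 2f = cofactor-off′ (a 2f) (a 0f) (b 2f) (b 0f) (c 2f) (c 0f)
  rel 2f 0f = cofactor-off′ (a 0f) (a 1f) (b 0f) (b 1f) (c 0f) (c 1f)
  rel 2f 1f = cofactor-off (a 1f) (a 0f) (b 1f) (b 0f) (c 1f) (c 0f)
  a×b≡0 : ∀ i → cross a b i ≡ 0#
  a×b≡0 i = li (cof i) (rel i) 2f
  minors : ∀ i j → b i * a j - a i * b j ≡ 0#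
  minors 0f 0f = same _ _
  minors 1f 1f = same _ _
  minors 2f 2f = same _ _
  minors 0f 1f = trans (cong (_- a 0f * b 1f) (*-comm (b 0f) (a 1f))) (flip-sub _ _ (a×b≡0 2f))
  minors 1f 0f = trans (cong (_- a 1f * b 0f) (*-comm (b 1f) (a 0f))) (a×b≡0 2f)
  minors 1f 2f = trans (cong (_- a 1f * b 2f) (*-comm (b 1f) (a 2f))) (flip-sub _ _ (a×b≡0 0f))
  minors 2f 1f = trans (cong (_- a 2f * b 1f) (*-comm (b 2f) (a 1f))) (a×b≡0 0f)
  minors 2f 0f = trans (cong (_- a 2f * b 0f) (*-comm (b 2f) (a 0f))) (flip-sub _ _ (a×b≡0 1f))
  minors 0f 2f = trans (cong (_- a 0f * b 2f) (*-comm (b 0f) (a 2f))) (a×b≡0 1f)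
  a≡0 : ∀ i → a i ≡ 0#
  a≡0 i = trans (sym (neg-neg (a i))) (trans (cong -_ (li (vec₃ (b i) (- a i) 0#) (λ j → trans (minor (a i) (b i) (a j) (b j) (c j)) (minors i j)) 1f)) neg-0)

adjoin : ∀ {A I : Set} → (A → I → ℚ) → (I → ℚ) → Maybe A → I → ℚ
adjoin r v (just a) = r a
adjoin r v nothing = v

three-span : ∀ {A : Set} {r : A → Fin 3 → ℚ} {x y z} → Indep r (x ∷ y ∷ z ∷ []) → ∀ v → InSpan r (x ∷ y ∷ z ∷ []) v
three-span {r = r} {x} {y} {z} li v with extend? {r = adjoin r v} search-Fin {just x ∷ just y ∷ just z ∷ []} (indep-map just (λ _ _ → refl) li) nothing
... | inj₁ sp = span-unmap just (λ _ _ → refl) sp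
... | inj₂ li₄ = ⊥-elim (ℕₚ.<⇒≱ ℕₚ.≤-refl (LI-dim (adjoin r v ∘ lookup (nothing ∷ just x ∷ just y ∷ just z ∷ [])) (indep li₄)))

sumOver : ∀ {n} → List (Fin n) → (Fin n → ℚ) → ℚ
sumOver [] f = 0#
sumOver (y ∷ ys) f = f y + sumOver ys f

∑-support : ∀ {n} {ys : List (Fin n)} → Unique ys → (f : Fin n → ℚ) → (∀ w → ¬ (w ∈ ys) → f w ≡ 0#) → ∑ f ≡ sumOver ys f
∑-support {ys = []} u f h = ∑-0 (λ w → h w λ ())
∑-support {n} {ys = y ∷ ys} (y∉ AllPairs.∷ u) f h = trans (∑-cong split)
  (trans (∑-lin {n} 1# (λ w → δ y w * f w) g) (trans (cong (λ s → 1# * s + ∑ g) (∑-δ y f)) (trans (cong (_+ ∑ g) (*-identityˡ (f y)))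
    (cong (f y +_) (trans (∑-support u g g-off) (agree ys y∉))))))
  where
  g : Fin n → ℚ
  g w = if w == y then 0# else f w
  split : ∀ w → f w ≡ 1# * (δ y w * f w) + g w
  split w with w ≟ y
  ... | yes _ = sym (trans (+-identityʳ _) (trans (*-identityˡ _) (*-identityˡ (f w))))
  ... | no _ = sym (trans (cong (λ s → 1# * s + f w) (zeroˡ (f w))) (trans (cong (_+ f w) (zeroʳ 1#)) (+-identityˡ (f w))))
  g-off : ∀ w → ¬ (w ∈ ys) → g w ≡ 0#
  g-off w w∉ with w ≟ y
  ... | yes _ = refl
  ... | no ne = h w λ { (here e) → ne e ; (there m) → w∉ m }
  agree : ∀ zs → All (y ≢_) zs → sumOver zs g ≡ sumOver zs f
  agree [] [] = refl
  agree (z ∷ zs) (ne ∷ nes) = cong₂ _+_ g≡f (agree zs nes)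
    where
    g≡f : g z ≡ f z
    g≡f with z ≟ y
    ... | yes e = ⊥-elim (ne (sym e))
    ... | no _ = refl

moment : ∀ {n} → Placement n → Fin n → Fin 3 → Fin 3 → (Fin n × Fin 3 → ℚ) → Fin n → ℚ
moment q o c d v w = (q w c - q o c) * v (w , d) - (q w d - q o d) * v (w , c)

record Equilibrium {n} (q : Placement n) (v : Fin n × Fin 3 → ℚ) : Set where
  field
    force  : ∀ c → ∑ (λ w → v (w , c)) ≡ 0#
    torque : ∀ o c d → ∑ (moment q o c d v) ≡ 0#

general-lists : ∀ {n} → List (Fin n) → List (List (Pair n))
general-lists [] = []
general-lists (y ∷ ys) = clique (y ∷ take 3 ys) ∷ general-lists ys

module _ {n} (q : Placement n) where
  private
    opaque
      unfolding _+_ isRing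
      t₁ : ∀ D a b → D * (a - b) ≡ D * (a * 1#) + (- D) * (b * 1#)
      t₁ = solve-∀ ℚ-ring
      t₂ : ∀ D → D * 1# + (- D) * 1# ≡ 0#
      t₂ = solve-∀ ℚ-ring
      m₁ : ∀ g h D E a b → g * (E * (a - b)) - h * (D * (a - b)) ≡ 1# * (a * (g * E - h * D)) + (- 1#) * (b * (g * E - h * D))
      m₁ = solve-∀ ℚ-ring
      m₂ : ∀ uc ud vc vd oc od → 1# * ((uc - oc) * (ud - vd) - (ud - od) * (uc - vc)) + (- 1#) * ((vc - oc) * (ud - vd) - (vd - od) * (uc - vc)) ≡ 0#
      m₂ = solve-∀ ℚ-ring
      l₁ : ∀ g h x a b c d → g * (x * a + b) - h * (x * c + d) ≡ x * (g * a - h * c) + (g * b - h * d)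
      l₁ = solve-∀ ℚ-ring
      l₂ : ∀ x → x * 0# + 0# ≡ 0#
      l₂ = solve-∀ ℚ-ring
      z₁ : ∀ g h → g * 0# - h * 0# ≡ 0#
      z₁ = solve-∀ ℚ-ring

  equil-0 : ∀ {v} → (∀ i → v i ≡ 0#) → Equilibrium q v
  equil-0 {v} z = record
    { force = λ c → ∑-0 (λ w → z (w , c))
    ; torque = λ o c d → ∑-0 (λ w → trans (cong₂ (λ a b → (q w c - q o c) * a - (q w d - q o d) * b) (z (w , d)) (z (w , c))) (z₁ _ _)) }

  equil-row : ∀ e → Equilibrium q (row q e)
  equil-row (u , v) = record
    { force = λ c → trans (∑-cong (λ w → t₁ (D c) (δ u w) (δ v w))) (trans (∑-lin {n} (D c) _ _)
        (trans (cong₂ (λ a b → D c * a + b) (∑-δ u (λ _ → 1#)) (trans (∑-* {n} (- D c) _) (cong ((- D c) *_) (∑-δ v (λ _ → 1#))))) (t₂ (D c))))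
    ; torque = λ o c d → trans (∑-cong (λ w → m₁ (q w c - q o c) (q w d - q o d) (D c) (D d) (δ u w) (δ v w))) (trans (∑-lin {n} 1# _ _)
        (trans (cong₂ (λ a b → 1# * a + b) (∑-δ u (h o c d)) (trans (∑-* {n} (- 1#) _) (cong ((- 1#) *_) (∑-δ v (h o c d)))))
          (m₂ (q u c) (q u d) (q v c) (q v d) (q o c) (q o d)))) }
    where
    D : Fin 3 → ℚ
    D c = q u c - q v c
    h : Fin n → Fin 3 → Fin 3 → Fin n → ℚ
    h o c d w = (q w c - q o c) * D d - (q w d - q o d) * D c

  equil-lin : ∀ {v w} x → Equilibrium q v → Equilibrium q w → Equilibrium q (λ i → x * v i + w i)
  equil-lin {v} {w} x ev ew = record
    { force = λ c → trans (∑-lin {n} x _ _) (trans (cong₂ (λ a b → x * a + b) (V.force c) (W.force c)) (l₂ x))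
    ; torque = λ o c d → trans (∑-cong (λ z → l₁ (q z c - q o c) (q z d - q o d) x (v (z , d)) (w (z , d)) (v (z , c)) (w (z , c))))
        (trans (∑-lin {n} x _ _) (trans (cong₂ (λ a b → x * a + b) (V.torque o c d) (W.torque o c d)) (l₂ x))) }
    where
    module V = Equilibrium ev
    module W = Equilibrium ew

  equil-cong : ∀ {v w} → (∀ i → v i ≡ w i) → Equilibrium q v → Equilibrium q w
  equil-cong {v} {w} e ev = record
    { force = λ c → trans (∑-cong (λ z → sym (e (z , c)))) (V.force c)
    ; torque = λ o c d → trans (∑-cong (λ z → cong₂ (λ a b → (q z c - q o c) * a - (q z d - q o d) * b) (sym (e (z , d))) (sym (e (z , c))))) (V.torque o c d) }
    where module V = Equilibrium ev

  equil-span : ∀ L {v} → InSpan (row q) L v → Equilibrium q v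
  equil-span [] sp = equil-0 (span-nil sp)
  equil-span (e ∷ L) sp with span-cons⁻ sp
  ... | x , w , sw , eq = equil-cong (λ i → sym (eq i)) (equil-lin x (equil-row e) (equil-span L sw))

  Supported : List (Fin n) → (Fin n × Fin 3 → ℚ) → Set
  Supported ys v = ∀ w c → ¬ (w ∈ ys) → v (w , c) ≡ 0#

  private
    opaque
      unfolding _+_ isRing
      f₁ : ∀ a → a + 0# ≡ 0# → a ≡ 0#
      f₁ a e = trans (sym (+-identityʳ a)) e
      -- y and a only: the moment about a
      p₁ : ∀ dc dd vc vd ac ad F G → (dc * vd - dd * vc) + (((ac - ac) * F - (ad - ad) * G) + 0#) ≡ 0# → dc * vd ≡ vc * dd
      p₁ dc dd vc vd ac ad F G e = trans (l dc dd vc vd ac ad F G) (trans (cong (_+ vc * dd) e) (+-identityˡ _))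
        where l : ∀ dc dd vc vd ac ad F G → dc * vd ≡ (dc * vd - dd * vc) + (((ac - ac) * F - (ad - ad) * G) + 0#) + vc * dd
              l = solve-∀ ℚ-ring
      s₁ : ∀ s dc vd → s * dc ≡ 1# → dc * vd * s ≡ vd
      s₁ s dc vd e = trans (l s dc vd) (trans (cong (_* vd) e) (*-identityˡ vd))
        where l : ∀ s dc vd → dc * vd * s ≡ s * dc * vd
              l = solve-∀ ℚ-ring
      s₂ : ∀ s vc dd → vc * dd * s ≡ (s * vc) * dd + 0#
      s₂ = solve-∀ ℚ-ring
      p₂ : ∀ yc yd ac ad bc bd vc vd uc ud F G →
        ((yc - ac) * vd - (yd - ad) * vc) + (((ac - ac) * F - (ad - ad) * G) + (((bc - ac) * ud - (bd - ad) * uc) + 0#)) ≡ 0# →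
        ((yc - ac) * vd - (yd - ad) * vc) + (((yc - ac) - (yc - bc)) * ud - ((yd - ad) - (yd - bd)) * uc) ≡ 0#
      p₂ yc yd ac ad bc bd vc vd uc ud F G e = trans (l yc yd ac ad bc bd vc vd uc ud F G) e
        where l : ∀ yc yd ac ad bc bd vc vd uc ud F G →
                ((yc - ac) * vd - (yd - ad) * vc) + (((yc - ac) - (yc - bc)) * ud - ((yd - ad) - (yd - bd)) * uc) ≡
                ((yc - ac) * vd - (yd - ad) * vc) + (((ac - ac) * F - (ad - ad) * G) + (((bc - ac) * ud - (bd - ad) * uc) + 0#))
              l = solve-∀ ℚ-ring
      p₃ : ∀ d₀ d₁ d₂ e₀ e₁ e₂ v₀ v₁ v₂ u₀ u₁ u₂ →
        v₀ * (d₁ * e₂ - d₂ * e₁) + v₁ * (d₂ * e₀ - d₀ * e₂) + v₂ * (d₀ * e₁ - d₁ * e₀) ≡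
        (d₀ - e₀) * ((d₁ * v₂ - d₂ * v₁) + ((d₁ - e₁) * u₂ - (d₂ - e₂) * u₁)) +
        ((d₁ - e₁) * ((d₂ * v₀ - d₀ * v₂) + ((d₂ - e₂) * u₀ - (d₀ - e₀) * u₂)) +
         (d₂ - e₂) * ((d₀ * v₁ - d₁ * v₀) + ((d₀ - e₀) * u₁ - (d₁ - e₁) * u₀)))
      p₃ = solve-∀ ℚ-ring
      p₄ : ∀ {x y z a b c} → x ≡ 0# → y ≡ 0# → z ≡ 0# → a * x + (b * y + c * z) ≡ 0#
      p₄ {a = a} {b} {c} refl refl refl = l a b c
        where l : ∀ a b c → a * 0# + (b * 0# + c * 0#) ≡ 0#
              l = solve-∀ ℚ-ring
      k₁ : ∀ a → (- 1#) * a + a ≡ 0#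
      k₁ = solve-∀ ℚ-ring
      k₂ : ∀ u v → v ≡ 1# * u + ((- 1#) * u + v)
      k₂ = solve-∀ ℚ-ring
      k₃ : ∀ x d → x * (d * (0# - 0#)) ≡ 0#
      k₃ = solve-∀ ℚ-ring
      k₄ : (- 1#) * 0# + 0# ≡ 0#
      k₄ = refl

  -- The force of an equilibrium load at a vertex y of its support lies in the span of the
  -- directions towards at most three other vertices of the support.
  module _ {y : Fin n} {v : Fin n × Fin 3 → ℚ} (eq : Equilibrium q v) where
    open Equilibrium eq
    private
      at-y : Fin 3 → ℚ
      at-y c = v (y , c)

    force-span₁ : Supported (y ∷ []) v → InSpan (dir q y) [] at-y
    force-span₁ sup = span-0 λ c → f₁ _ (trans (sym (∑-support ([] AllPairs.∷ AllPairs.[]) _ (λ w w∉ → sup w c w∉))) (force c))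

    moment-off : ∀ {ys} → Supported ys v → ∀ o c d w → ¬ (w ∈ ys) → moment q o c d v w ≡ 0#
    moment-off sup o c d w w∉ = trans (cong₂ (λ a b → (q w c - q o c) * a - (q w d - q o d) * b) (sup w d w∉) (sup w c w∉)) (z₁ _ _)

    force-span₂ : ∀ {a} → y ≢ a → Indep (dir q y) (a ∷ []) → Supported (y ∷ a ∷ []) v → InSpan (dir q y) (a ∷ []) at-y
    force-span₂ {a} y≢a li sup with search-Fin (dir q y a)
    ... | inj₂ z = ⊥-elim (indep-head li (span-0 z))
    ... | inj₁ (c , ne) with inverse (dir q y a c) ne
    ...   | s , sd = span-cons⁺ (s * v (y , c)) (span-0 (λ _ → refl)) λ d → trans (sym (s₁ s (dir q y a c) (v (y , d)) sd))
              (trans (cong (_* s) (p₁ _ _ (v (y , c)) (v (y , d)) (q a c) (q a d) (v (a , d)) (v (a , c))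
                (trans (sym (∑-support ((y≢a ∷ []) AllPairs.∷ [] AllPairs.∷ AllPairs.[]) _ (moment-off sup a c d))) (torque a c d))))
                (s₂ s (v (y , c)) (dir q y a d)))

    force-span₃ : ∀ {a b} → y ≢ a → y ≢ b → a ≢ b → Indep (dir q y) (a ∷ b ∷ []) → Supported (y ∷ a ∷ b ∷ []) v →
      InSpan (dir q y) (a ∷ b ∷ []) at-y
    force-span₃ {a} {b} y≢a y≢b a≢b li sup with extend? {r = adjoin (dir q y) at-y} search-Fin {just a ∷ just b ∷ []} (indep-map just (λ _ _ → refl) li) nothing
    ... | inj₁ sp = span-unmap just (λ _ _ → refl) sp
    ... | inj₂ li₃ = ⊥-elim (LI⇒det≢0 (adjoin (dir q y) at-y ∘ lookup (nothing ∷ just a ∷ just b ∷ [])) (indep li₃) (trans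
            (p₃ (dir q y a 0f) (dir q y a 1f) (dir q y a 2f) (dir q y b 0f) (dir q y b 1f) (dir q y b 2f)
              (at-y 0f) (at-y 1f) (at-y 2f) (v (b , 0f)) (v (b , 1f)) (v (b , 2f)))
            (p₄ (mom 1f 2f) (mom 2f 0f) (mom 0f 1f))))
      where
      mom : ∀ c d → (dir q y a c * at-y d - dir q y a d * at-y c) + ((dir q y a c - dir q y b c) * v (b , d) - (dir q y a d - dir q y b d) * v (b , c)) ≡ 0#
      mom c d = p₂ (q y c) (q y d) (q a c) (q a d) (q b c) (q b d) (at-y c) (at-y d) (v (b , c)) (v (b , d)) (v (a , d)) (v (a , c))
        (trans (sym (∑-support ((y≢a ∷ y≢b ∷ []) AllPairs.∷ (a≢b ∷ []) AllPairs.∷ [] AllPairs.∷ AllPairs.[]) _ (moment-off sup a c d))) (torque a c d))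

  data General : List (Fin n) → Set where
    [] : General []
    _∷_ : ∀ {y ys} → IndepAt q (clique (y ∷ take 3 ys)) → General ys → General (y ∷ ys)

  take-⊆ : ∀ m (ys : List (Fin n)) → ∀ {z} → z ∈ take m ys → z ∈ ys
  take-⊆ (suc m) (y ∷ ys) (here e) = here e
  take-⊆ (suc m) (y ∷ ys) (there z) = there (take-⊆ m ys z)

  clear : ∀ {y : Fin n} {zs} {v : Fin n × Fin 3 → ℚ} → All (_≢ y) zs → InSpan (dir q y) zs (λ c → v (y , c)) →
    ∃ λ u → InSpan (row q) (map (y ,_) zs) u × (∀ c → u (y , c) ≡ v (y , c)) × Supported (y ∷ zs) u
  clear {y} {zs} {v} zs≢y (inSpan (x , e)) = u , span-map {r = λ z → row q (y , z)} (y ,_) (λ _ _ → refl) (inSpan (x , λ i → refl)) ,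
    (λ c → trans (∑-cong (λ j → cong (x j *_) (at-y j c))) (sym (e c))) , off
    where
    u : Fin n × Fin 3 → ℚ
    u = comb (λ j → row q (y , lookup zs j)) x
    at-y : ∀ j c → row q (y , lookup zs j) (y , c) ≡ dir q y (lookup zs j) c
    at-y j c = trans (cong₂ (λ a b → dir q y (lookup zs j) c * (a - b)) (δ-≡ y) (δ-≢ (λ e → All.lookup zs≢y (Memₚ.∈-lookup j) (sym e)))) (row-at _ _)
    off : Supported (y ∷ zs) u
    off w c w∉ = ∑-0 (λ j → trans (cong₂ (λ a b → x j * (dir q y (lookup zs j) c * (a - b)))
      (δ-≢ (λ e → w∉ (here e))) (δ-≢ (λ e → w∉ (there (subst (_∈ zs) (sym e) (Memₚ.∈-lookup j)))))) (k₃ (x j) _))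

  equilibrium⇒clique-span : ∀ ys → Unique ys → General ys → ∀ {v} → Equilibrium q v → Supported ys v → InSpan (row q) (clique ys) v
  equilibrium⇒clique-span [] _ _ eq sup = span-0 λ { (w , c) → sup w c λ () }
  equilibrium⇒clique-span (y ∷ ys) (y∉ AllPairs.∷ u) (K ∷ gen) {v} eq sup with clear {y} {take 3 ys} {v} zs≢y (at-y ys (y∉ AllPairs.∷ u) (clique⇒dir q K) sup)
    where
    zs≢y : All (_≢ y) (take 3 ys)
    zs≢y = All.tabulate (λ m e → All.lookup y∉ (take-⊆ 3 ys m) (sym e))
    at-y : ∀ ys → Unique (y ∷ ys) → Indep (dir q y) (take 3 ys) → Supported (y ∷ ys) v → InSpan (dir q y) (take 3 ys) (λ c → v (y , c))
    at-y [] _ _ sup = force-span₁ eq sup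
    at-y (a ∷ []) ((p ∷ []) AllPairs.∷ _) li sup = force-span₂ eq p li sup
    at-y (a ∷ b ∷ []) ((p ∷ p′ ∷ []) AllPairs.∷ (p″ ∷ []) AllPairs.∷ _) li sup = force-span₃ eq p p′ p″ li sup
    at-y (a ∷ b ∷ c ∷ ys) _ li sup = three-span li _
  ... | w , w-span , w-y , w-sup = span-cong (λ i → sym (k₂ (w i) (v i)))
    (span-lin 1# (span-mono (λ m → Memₚ.∈-++⁺ˡ (sub m)) w-span) (span-mono (Memₚ.∈-++⁺ʳ (map (y ,_) ys))
      (equilibrium⇒clique-span ys u gen (equil-lin (- 1#) (equil-span (map (y ,_) (take 3 ys)) w-span) eq) rest-sup)))
    where
    sub : ∀ {e} → e ∈ map (y ,_) (take 3 ys) → e ∈ map (y ,_) ys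
    sub m with Memₚ.∈-map⁻ (y ,_) m
    ... | z , mz , refl = Memₚ.∈-map⁺ (y ,_) (take-⊆ 3 ys mz)
    rest-sup : Supported ys (λ i → (- 1#) * w i + v i)
    rest-sup z c z∉ with z ≟ y
    ... | yes refl = trans (cong (λ a → (- 1#) * a + v (y , c)) (w-y c)) (k₁ (v (y , c)))
    ... | no z≢y = trans (cong₂ (λ a b → (- 1#) * a + b) (w-sup z c λ { (here e) → z≢y e ; (there m) → z∉ (take-⊆ 3 ys m) })
                                                        (sup z c λ { (here e) → z≢y e ; (there m) → z∉ m })) k₄

  general : ∀ ys → All (IndepAt q) (general-lists ys) → General ys
  general [] [] = []
  general (y ∷ ys) (K ∷ Ks) = K ∷ general ys Ks

general-lists-independent : ∀ {n} (ys : List (Fin n)) → Unique ys → All Independent (general-lists ys)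
general-lists-independent [] _ = []
general-lists-independent (y ∷ ys) u@(_ AllPairs.∷ u′) = clique-independent (Uniqueₚ.take⁺ 4 u) (s≤s (subst (ℕ._≤ 3) (sym (Listₚ.length-take 3 ys)) (ℕₚ.m⊓n≤m 3 _)))
  ∷ general-lists-independent ys u′

-- Gluing along a clique: a load resolved by both sides is an equilibrium load on the clique,
-- hence resolved by the clique edges, which are independent of the remaining edges of the
-- second graph.
module _ {n₁ n₂ N} {c : ℕ} {G₁ : Graph n₁} {G₂ : Graph n₂} {G′ : Graph N} {f₁ : Fin n₁ → Fin N} {f₂ : Fin n₂ → Fin N}
         (S : KSum c G₁ G₂ G′ f₁ f₂) where
  open KSum S
  open UnionVia union using (onto; edges⇒; ⇒edges)

  private
    clique-map : ∀ {x y x′ y′} → f₁ x ≡ f₂ x′ → f₁ y ≡ f₂ y′ → T (adj G₂ x′ y′) → T (adj G₁ x y)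
    clique-map {x} {y} {x′} {y′} ex ey t with meet x x′ ex | meet y y′ ey
    ... | s , refl , refl | t′ , refl , refl = clique₁ s t′ (λ { refl → ≡⇒¬T (irr G₂ (ι₂ s)) t })

    induced : ∀ x y → adj G′ (f₁ x) (f₁ y) ≡ adj G₁ x y
    induced x y = T-ext to (λ t → ⇒edges _ _ (inj₁ (x , y , refl , refl , t)))
      where
      to : T (adj G′ (f₁ x) (f₁ y)) → T (adj G₁ x y)
      to t with edges⇒ _ _ t
      ... | inj₁ (x′ , y′ , ex , ey , t′) = subst₂ (λ u v → T (adj G₁ u v)) (inj₁′ ex) (inj₁′ ey) t′
        where inj₁′ : ∀ {x y} → f₁ x ≡ f₁ y → x ≡ y
              inj₁′ = UnionVia.inj₁ union
      ... | inj₂ (x′ , y′ , ex , ey , t′) = clique-map (sym ex) (sym ey) t′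

    f₁-inj : Injective _≡_ _≡_ f₁
    f₁-inj = UnionVia.inj₁ union
    f₂-inj : Injective _≡_ _≡_ f₂
    f₂-inj = UnionVia.inj₂ union

    InClique : PairSet n₂
    InClique u v = anyF (λ t → ι₂ t == u) ∧ anyF (λ t → ι₂ t == v)

    EC ER E₂ : List (Pair n₂)
    EC = edgeList (λ u v → adj G₂ u v ∧ InClique u v)
    ER = edgeList (λ u v → adj G₂ u v ∧ not (InClique u v))
    E₂ = edgeList (adj G₂)

    E₁ : List (Pair n₁)
    E₁ = edgeList (adj G₁)

    ys : List (Fin N)
    ys = map (f₁ ∘ ι₁) (allFin c)

    ys-unique : Unique ys
    ys-unique = Uniqueₚ.map⁺ (ι₁-inj ∘ f₁-inj) (Uniqueₚ.allFin⁺ c)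

    E₂-split : ∀ {e} → e ∈ E₂ → e ∈ EC ++ ER
    E₂-split {u , v} m with ∈-edgeList⁻ {E = adj G₂} m
    ... | t , lt with InClique u v in e
    ...   | true = Memₚ.∈-++⁺ˡ (∈-edgeList⁺ lt (T∧⁺ t (≡⇒T e)))
    ...   | false = Memₚ.∈-++⁺ʳ EC (∈-edgeList⁺ lt (T∧⁺ t (subst (T ∘ not) (sym e) tt)))

    E₂-length : length (EC ++ ER) ≡ length E₂
    E₂-length = trans (Listₚ.length-++ EC) (trans (cong (ℕ._+ length ER) (length-edgeList (λ u v → adj G₂ u v ∧ InClique u v)))
      (trans (sym (numPairs-split (adj G₂) InClique)) (sym (length-edgeList (adj G₂)))))

    L₁ LC LR L : List (Pair N)
    L₁ = map (map² f₁) E₁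
    LC = map (map² f₂) EC
    LR = map (map² f₂) ER
    L = LR ++ L₁

    module _ (q : Placement N) (li₁ : IndepAt q L₁) (li₂ : IndepAt q (map (map² f₂) E₂)) (gen : General q ys) where
      liCR : IndepAt q (LC ++ LR)
      liCR = subst (IndepAt q) (Listₚ.map-++ (map² f₂) EC ER) (indep-embed f₂-inj q
        (indep-of-length search-coord (indep-fold f₂ q li₂) (λ m → span-∈ (E₂-split m)) (ℕₚ.≤-reflexive E₂-length)))

      off-image : ∀ {n} {f : Fin n → Fin N} (M : List (Pair n)) {v} → InSpan (row q) (map (map² f) M) v →
        ∀ w c → (∀ x → f x ≢ w) → v (w , c) ≡ 0#
      off-image [] sp w c _ = span-nil sp (w , c)
      off-image {f = f} ((x , y) ∷ M) sp w c w∉ with span-cons⁻ sp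
      ... | a , u , su , e = trans (e (w , c)) (trans (cong₂ (λ s t → a * s + t)
        (trans (cong₂ (λ s t → (q (f x) c - q (f y) c) * (s - t)) (δ-≢ (w∉ x ∘ sym)) (δ-≢ (w∉ y ∘ sym))) (row-off _ _)) (off-image M su w c w∉))
        (trans (cong (_+ 0#) (zeroʳ a)) (+-identityˡ 0#)))

      disjoint : ∀ v → InSpan (row q) LR v → InSpan (row q) L₁ v → ∀ i → v i ≡ 0#
      disjoint v sR s₁ = indep⇒span-disjoint LC liCR (span-trans {L = clique ys} on-clique
          (equilibrium⇒clique-span q ys ys-unique gen (equil-span q L₁ s₁) support)) sR
        where
        support : Supported q ys v
        support w c w∉ with onto w
        ... | inj₂ (y , refl) = off-image E₁ s₁ (f₂ y) c λ x e → case meet x y e of λ { (t , refl , refl) → w∉ (subst (_∈ ys) (glued t) (Memₚ.∈-map⁺ (f₁ ∘ ι₁) (Memₚ.∈-allFin t))) }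
        ... | inj₁ (x , refl) = off-image ER sR (f₁ x) c λ y e → case meet x y (sym e) of λ { (t , refl , refl) → w∉ (Memₚ.∈-map⁺ (f₁ ∘ ι₁) (Memₚ.∈-allFin t)) }
        clique-pair : ∀ {zs : List (Fin N)} {e} → e ∈ clique zs → Unique zs → proj₁ e ∈ zs × proj₂ e ∈ zs × proj₁ e ≢ proj₂ e
        clique-pair {z ∷ zs} m (z∉ AllPairs.∷ u) with Memₚ.∈-++⁻ (map (z ,_) zs) m
        ... | inj₁ mz with Memₚ.∈-map⁻ (z ,_) mz
        ...   | z′ , mz′ , refl = here refl , there mz′ , All.lookup z∉ mz′
        clique-pair {z ∷ zs} m (z∉ AllPairs.∷ u) | inj₂ mr with clique-pair mr u
        ... | p , p′ , ne = there p , there p′ , ne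
        on-clique : ∀ {e} → e ∈ clique ys → SpanAt q LC e
        on-clique {u , v} m with clique-pair m ys-unique
        ... | mu , mv , u≢v with Memₚ.∈-map⁻ (f₁ ∘ ι₁) mu | Memₚ.∈-map⁻ (f₁ ∘ ι₁) mv
        ...   | s , _ , refl | t , _ , refl = subst₂ (λ a b → SpanAt q LC (a , b)) (sym (glued s)) (sym (glued t))
                (span-either (Data.Sum.map (Memₚ.∈-map⁺ (map² f₂)) (Memₚ.∈-map⁺ (map² f₂)) (edgeList-covers cl-sym cl-irr (ι₂ s) (ι₂ t)
                  (T∧⁺ (clique₂ s t (λ e → u≢v (cong (f₁ ∘ ι₁) e))) (T∧⁺ (anyF⁺ s (==⁺ refl)) (anyF⁺ t (==⁺ refl)))))))
          where
          cl-sym : Symm (λ u v → adj G₂ u v ∧ InClique u v)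
          cl-sym u v = cong₂ _∧_ (adj-sym G₂ u v) (Boolₚ.∧-comm (anyF (λ t → ι₂ t == u)) _)
          cl-irr : Irrefl (λ u v → adj G₂ u v ∧ InClique u v)
          cl-irr u = cong (_∧ InClique u u) (irr G₂ u)

      L-indepAt : IndepAt q L
      L-indepAt = span-disjoint⇒indep LR (indep-⊆ (Subₚ.++⁺ˡ LC ⊆-refl) liCR) li₁ disjoint

    L-in : All (InSet (adj G′)) L
    L-in = Allₚ.++⁺ (Allₚ.map⁺ (All.map (λ {(x , y)} t → ⇒edges _ _ (inj₂ (x , y , refl , refl , T∧ˡ t))) (edgeList-InSet (λ u v → adj G₂ u v ∧ not (InClique u v)))))
                     (Allₚ.map⁺ (All.map (λ {(x , y)} t → ⇒edges _ _ (inj₁ (x , y , refl , refl , t))) (edgeList-InSet (adj G₁))))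

    L-covers : Covers L (adj G′)
    L-covers z w t with edges⇒ z w t
    ... | inj₁ (x , y , refl , refl , t₁) = Data.Sum.map in₁ in₁ (edgeList-covers (adj-sym G₁) (irr G₁) x y t₁)
      where in₁ : ∀ {e} → e ∈ E₁ → map² f₁ e ∈ L
            in₁ m = Memₚ.∈-++⁺ʳ LR (Memₚ.∈-map⁺ (map² f₁) m)
    ... | inj₂ (x , y , refl , refl , t₂) with InClique x y in e
    ...   | false = Data.Sum.map in₂ in₂ (edgeList-covers rest-sym rest-irr x y (T∧⁺ t₂ (subst (T ∘ not) (sym e) tt)))
      where in₂ : ∀ {e} → e ∈ ER → map² f₂ e ∈ L
            in₂ m = Memₚ.∈-++⁺ˡ (Memₚ.∈-map⁺ (map² f₂) m)
            rest-sym : Symm (λ u v → adj G₂ u v ∧ not (InClique u v))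
            rest-sym u v = cong₂ (λ a b → a ∧ not b) (adj-sym G₂ u v) (Boolₚ.∧-comm (anyF (λ t → ι₂ t == u)) _)
            rest-irr : Irrefl (λ u v → adj G₂ u v ∧ not (InClique u v))
            rest-irr u = cong (_∧ not (InClique u u)) (irr G₂ u)
    ...   | true with anyF⁻ _ (T∧ˡ (≡⇒T e)) | anyF⁻ _ (T∧ʳ {anyF (λ t → ι₂ t == x)} (≡⇒T e))
    ...     | s , es | s′ , es′ with ==⁻ {x = ι₂ s} {x} es | ==⁻ {x = ι₂ s′} {y} es′
    ...       | refl | refl = subst₂ (λ a b → (a , b) ∈ L ⊎ (b , a) ∈ L) (glued s) (glued s′)
                (Data.Sum.map in₁ in₁ (edgeList-covers (adj-sym G₁) (irr G₁) (ι₁ s) (ι₁ s′) (clique-map (glued s) (glued s′) t₂)))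
      where in₁ : ∀ {e} → e ∈ E₁ → map² f₁ e ∈ L
            in₁ m = Memₚ.∈-++⁺ʳ LR (Memₚ.∈-map⁺ (map² f₁) m)

  kSum-independent : IndependentGraph G₁ → IndependentGraph G₂ → IndependentGraph G′
  kSum-independent ind₁ ind₂ = covering-indepPairs (adj-sym G′) (irr G′) L-in ind L-covers
    where
    ind : Independent L
    ind with generic (L₁ ∷ map (map² f₂) E₂ ∷ general-lists ys)
      (independent-embed f₁-inj (indepPairs⇒edgeList (adj-sym G₁) (irr G₁) ind₁) ∷
       independent-embed f₂-inj (indepPairs⇒edgeList (adj-sym G₂) (irr G₂) ind₂) ∷ general-lists-independent ys ys-unique)
    ... | q , li₁ ∷ li₂ ∷ gen = independent q (L-indepAt q li₁ li₂ (general q ys gen))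

  kSum-safeBase : SafeBase G₁ → IndependentGraph G₂ → SafeBase G′
  kSum-safeBase base@(_ , B , _) ind₂ = induced-safeBase f₁-inj induced (kSum-independent (BaseWith.indepG B) ind₂) base

-- Triangular integer certificates of independence: the functional paired with each edge
-- is nonzero on its row and vanishes on the rows of all later edges.

Functional : ℕ → Set
Functional n = List (ℤ × Fin n × Fin 3)

evalℤ : ∀ {n} → Functional n → (Fin n × Fin 3 → ℤ) → ℤ
evalℤ [] v = 0ℤ
evalℤ ((a , i) ∷ F) v = a ℤ.* v i ℤ.+ evalℤ F v

δℤ : ∀ {n} → Fin n → Fin n → ℤ
δℤ u w = if w == u then 1ℤ else 0ℤ

rowℤ : ∀ {n} → (Fin n → Fin 3 → ℤ) → Pair n → Fin n × Fin 3 → ℤ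
rowℤ p (u , v) (w , c) = (p u c ℤ.- p v c) ℤ.* (δℤ u w ℤ.- δℤ v w)

Certificate : ℕ → Set
Certificate n = List (Pair n × Functional n)

edgesOf : ∀ {n} → Certificate n → List (Pair n)
edgesOf = map proj₁

Valid : ∀ {n} → (Fin n → Fin 3 → ℤ) → Certificate n → Set
Valid p [] = ⊤
Valid p ((e , F) ∷ r) = evalℤ F (rowℤ p e) ≢ 0ℤ × All (λ e′ → evalℤ F (rowℤ p e′) ≡ 0ℤ) (edgesOf r) × Valid p r

valid? : ∀ {n} p (r : Certificate n) → Dec (Valid p r)
valid? p [] = yes tt
valid? p ((e , F) ∷ r) = nonzero ×-dec (vanishes ×-dec valid? p r)
  where
  nonzero : Dec (evalℤ F (rowℤ p e) ≢ 0ℤ)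
  nonzero = ¬? (evalℤ F (rowℤ p e) ℤ.≟ 0ℤ)
  vanishes : Dec (All (λ e′ → evalℤ F (rowℤ p e′) ≡ 0ℤ) (edgesOf r))
  vanishes = All.all? (λ e′ → evalℤ F (rowℤ p e′) ℤ.≟ 0ℤ) (edgesOf r)

fromℤ : ℤ → ℚ
fromℤ i = ℚ.mkℚ i 0 (Coprime.sym (Coprime.1-coprimeTo _))

opaque
  unfolding _+_ isRing

  fromℤ-0 : fromℤ 0ℤ ≡ 0#
  fromℤ-0 = refl

  fromℤ-1 : fromℤ 1ℤ ≡ 1#
  fromℤ-1 = refl

  fromℤ-+ : ∀ i j → fromℤ (i ℤ.+ j) ≡ fromℤ i + fromℤ j
  fromℤ-+ i j = ℚₚ.toℚᵘ-injective (ℚᵘₚ.≃-sym (ℚᵘₚ.≃-trans (ℚₚ.toℚᵘ-homo-+ (fromℤ i) (fromℤ j))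
    (ℚᵘ.*≡* (cong (ℤ._* 1ℤ) (cong₂ ℤ._+_ (ℤₚ.*-identityʳ i) (ℤₚ.*-identityʳ j))))))

  fromℤ-* : ∀ i j → fromℤ (i ℤ.* j) ≡ fromℤ i * fromℤ j
  fromℤ-* i j = ℚₚ.toℚᵘ-injective (ℚᵘₚ.≃-sym (ℚᵘₚ.≃-trans (ℚₚ.toℚᵘ-homo-* (fromℤ i) (fromℤ j)) (ℚᵘ.*≡* refl)))

  fromℤ-neg : ∀ i → fromℤ (ℤ.- i) ≡ - fromℤ i
  fromℤ-neg i = ℚₚ.toℚᵘ-injective (ℚᵘₚ.≃-sym (ℚᵘₚ.≃-trans (ℚₚ.toℚᵘ-homo‿- (fromℤ i)) (ℚᵘ.*≡* refl)))

  fromℤ-≢0 : ∀ {i} → i ≢ 0ℤ → fromℤ i ≢ 0#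
  fromℤ-≢0 ne e = ne (cong ℚ.↥_ e)

fromℤ-minus : ∀ i j → fromℤ (i ℤ.- j) ≡ fromℤ i - fromℤ j
fromℤ-minus i j = trans (fromℤ-+ i (ℤ.- j)) (cong (fromℤ i +_) (fromℤ-neg j))

evalℚ : ∀ {n} → Functional n → (Fin n × Fin 3 → ℚ) → ⊤ → ℚ
evalℚ [] v _ = 0#
evalℚ ((a , i) ∷ F) v t = fromℤ a * v i + evalℚ F v t

evalℚ-linear : ∀ {n} (F : Functional n) → Linear (evalℚ F)
evalℚ-linear F = record { resp = λ e _ → resp F e ; lin = λ x v w _ → lin F x v w }
  where
  opaque
    unfolding _+_ isRing
    l₀ : ∀ x → 0# ≡ x * 0# + 0#
    l₀ = solve-∀ ℚ-ring
    l₁ : ∀ a x v w s t → a * (x * v + w) + (x * s + t) ≡ x * (a * v + s) + (a * w + t)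
    l₁ = solve-∀ ℚ-ring
  resp : ∀ F {v w} → (∀ i → v i ≡ w i) → evalℚ F v tt ≡ evalℚ F w tt
  resp [] e = refl
  resp ((a , i) ∷ F) e = cong₂ (λ s t → fromℤ a * s + t) (e i) (resp F e)
  lin : ∀ F x v w → evalℚ F (λ i → x * v i + w i) tt ≡ x * evalℚ F v tt + evalℚ F w tt
  lin [] x v w = l₀ x
  lin ((a , i) ∷ F) x v w = trans (cong (fromℤ a * (x * v i + w i) +_) (lin F x v w)) (l₁ (fromℤ a) x (v i) (w i) (evalℚ F v tt) (evalℚ F w tt))

certified : ∀ {n} p (r : Certificate n) → Valid p r → IndepAt (λ x c → fromℤ (p x c)) (edgesOf r)
certified p [] _ = indep-[]
certified {n} p ((e , F) ∷ r) (ne , vanish , valid) = indep-cons bad (certified p r valid)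
  where
  q : Placement n
  q x c = fromℤ (p x c)
  δ-from : ∀ (u w : Fin n) → fromℤ (δℤ u w) ≡ δ u w
  δ-from u w with w == u
  ... | true = fromℤ-1
  ... | false = fromℤ-0
  row-from : ∀ e i → fromℤ (rowℤ p e i) ≡ row q e i
  row-from (u , v) (w , c) = trans (fromℤ-* _ _) (cong₂ _*_ (fromℤ-minus _ _) (trans (fromℤ-minus _ _) (cong₂ _-_ (δ-from u w) (δ-from v w))))
  eval-from : ∀ F e → fromℤ (evalℤ F (rowℤ p e)) ≡ evalℚ F (row q e) tt
  eval-from [] e = fromℤ-0
  eval-from ((a , i) ∷ F) e = trans (fromℤ-+ _ _) (cong₂ _+_ (trans (fromℤ-* a _) (cong (fromℤ a *_) (row-from e i))) (eval-from F e))
  bad : ¬ InSpan (row q) (edgesOf r) (row q e)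
  bad sp = fromℤ-≢0 ne (trans (eval-from F e) (span-nil {r = λ (_ : ⊥) (_ : ⊤) → 0#}
    (span-trans {s = λ (_ : ⊥) _ → 0#} {T = []} (λ {e′} m → span-0 (λ _ → trans (sym (eval-from F e′)) (trans (cong fromℤ (All.lookup vanish m)) fromℤ-0)))
      (span-image (evalℚ-linear F) sp)) tt))

-- The double butterfly with the pairs a₁b₂, a₂b₁ added is the bipyramid with apexes u, v over
-- the hexagon c, a₁, b₂, c′, a₂, b₁, placed as an affinely regular hexagon in the plane.
bipyramid : Certificate 8
bipyramid =
  ((6f , 0f) , (ℤ.+ 1 , 5f , 2f) ∷ (ℤ.-[1+ 0 ] , 4f , 2f) ∷ (ℤ.-[1+ 2 ] , 3f , 0f) ∷ (ℤ.+ 1 , 4f , 1f) ∷ (ℤ.+ 1 , 5f , 1f) ∷ (ℤ.-[1+ 0 ] , 6f , 1f) ∷ (ℤ.+ 2 , 3f , 1f) ∷ (ℤ.+ 1 , 6f , 0f) ∷ (ℤ.+ 5 , 0f , 1f) ∷ (ℤ.-[1+ 0 ] , 7f , 0f) ∷ (ℤ.-[1+ 2 ] , 0f , 0f) ∷ [])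
  ∷ ((0f , 3f) , (ℤ.-[1+ 0 ] , 0f , 0f) ∷ (ℤ.+ 1 , 0f , 1f) ∷ [])
  ∷ ((3f , 7f) , (ℤ.-[1+ 0 ] , 3f , 0f) ∷ [])
  ∷ ((7f , 2f) , (ℤ.-[1+ 0 ] , 7f , 1f) ∷ [])
  ∷ ((2f , 1f) , (ℤ.+ 1 , 2f , 0f) ∷ (ℤ.-[1+ 0 ] , 2f , 1f) ∷ [])
  ∷ ((1f , 6f) , (ℤ.+ 1 , 1f , 0f) ∷ [])
  ∷ ((4f , 6f) , (ℤ.+ 1 , 6f , 0f) ∷ (ℤ.-[1+ 0 ] , 6f , 2f) ∷ [])
  ∷ ((4f , 0f) , (ℤ.+ 1 , 0f , 0f) ∷ (ℤ.-[1+ 0 ] , 0f , 2f) ∷ [])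
  ∷ ((4f , 3f) , (ℤ.+ 1 , 3f , 1f) ∷ (ℤ.-[1+ 0 ] , 3f , 2f) ∷ [])
  ∷ ((4f , 7f) , (ℤ.-[1+ 0 ] , 7f , 0f) ∷ (ℤ.-[1+ 0 ] , 7f , 2f) ∷ [])
  ∷ ((4f , 2f) , (ℤ.-[1+ 0 ] , 2f , 0f) ∷ (ℤ.-[1+ 0 ] , 2f , 2f) ∷ [])
  ∷ ((4f , 1f) , (ℤ.-[1+ 0 ] , 1f , 1f) ∷ (ℤ.-[1+ 0 ] , 1f , 2f) ∷ [])
  ∷ ((5f , 6f) , (ℤ.+ 1 , 6f , 2f) ∷ [])
  ∷ ((5f , 0f) , (ℤ.+ 1 , 0f , 2f) ∷ [])
  ∷ ((5f , 3f) , (ℤ.+ 1 , 3f , 2f) ∷ [])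
  ∷ ((5f , 7f) , (ℤ.+ 1 , 7f , 2f) ∷ [])
  ∷ ((5f , 2f) , (ℤ.+ 1 , 2f , 2f) ∷ [])
  ∷ ((5f , 1f) , (ℤ.+ 1 , 1f , 2f) ∷ [])
  ∷ []

bipyramid-independent : Independent (edgesOf bipyramid)
bipyramid-independent = independent _ (certified p bipyramid (toWitness {a? = valid? p bipyramid} tt))
  where
  p : Fin 8 → Fin 3 → ℤ
  p 0f = vec₃ 1ℤ 1ℤ 0ℤ
  p 1f = vec₃ 0ℤ ℤ.-1ℤ 0ℤ
  p 2f = vec₃ ℤ.-1ℤ ℤ.-1ℤ 0ℤ
  p 3f = vec₃ 0ℤ 1ℤ 0ℤ
  p 4f = vec₃ 0ℤ 0ℤ 1ℤ
  p 5f = vec₃ 0ℤ 0ℤ ℤ.-1ℤ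
  p 6f = vec₃ 1ℤ 0ℤ 0ℤ
  p 7f = vec₃ ℤ.-1ℤ 0ℤ 0ℤ

-- Frames and the inclusion-exclusion bound

record Frame {n} (E P : PairSet n) (r : ℕ) : Set where
  field
    T̂     : List (Pair n)
    T̂⊂E   : All (InSet E) T̂
    indep : Independent (T̂ ++ edgeList P)
    size  : length T̂ ℕ.+ numPairs P ≡ r

opaque
  frame : ∀ {n} {E P : PairSet n} {r} → (∀ u v → T (P u v) → T (E u v)) → Independent (edgeList P) → HasRank E r → Frame E P r
  frame {E = E} {P} {r} P⊂E hP hE@((L , L⊂E , hL , refl) , upper) with generic (L ∷ edgeList P ∷ []) (from-IndepList L hL ∷ hP ∷ [])
  ... | p , liL ∷ liP ∷ [] with extend search-coord L liP
  ...   | B , B⊆L , liB , sp , _ = record { T̂ = B ; T̂⊂E = B⊂E ; indep = independent p liB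
    ; size = trans (cong (length B ℕ.+_) (sym (length-edgeList P))) (trans (sym (Listₚ.length-++ B)) (ℕₚ.≤-antisym
        (upper (B ++ edgeList P) (Allₚ.++⁺ B⊂E (All.map (λ {(u , v)} → P⊂E u v) (edgeList-InSet P))) (to-IndepList (B ++ edgeList P) (independent p liB)))
        (steinitz liL sp))) }
    where
    B⊂E : All (InSet E) B
    B⊂E = Subₚ.All-resp-⊆ B⊆L L⊂E

frame-span : ∀ {n} {E P : PairSet n} {r} → (∀ u v → T (P u v) → T (E u v)) → HasRank E r → (F : Frame E P r) →
  ∀ {q} → IndepAt q (Frame.T̂ F ++ edgeList P) → ∀ {u v} → T (E u v) → SpanAt q (Frame.T̂ F ++ edgeList P) (u , v)
frame-span {P = P} P⊂E hE F = hasRank-span hE (Allₚ.++⁺ T̂⊂E (All.map (λ {(u , v)} → P⊂E u v) (edgeList-InSet P)))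
  (trans (Listₚ.length-++ T̂) (trans (cong (length T̂ ℕ.+_) (length-edgeList P)) size))
  where open Frame F

within-⊂ : ∀ {n} (A : Fin n → Bool) {P Q : PairSet n} → (∀ u v → T (P u v) → T (Q u v)) → ∀ u v → T (Within A P u v) → T (Within A Q u v)
within-⊂ A {P} h u v t = T∧⁺ {A u} (T∧ˡ t) (T∧⁺ {A v} (T∧ˡ (T∧ʳ {A u} t)) (h u v (T∧ʳ {A v} (T∧ʳ {A u} t))))

within⁺ : ∀ {n} (A : Fin n → Bool) (P : PairSet n) {u v} → T (A u) → T (A v) → T (P u v) → T (Within A P u v)
within⁺ A P Au Av t = T∧⁺ Au (T∧⁺ Av t)

within⇒ : ∀ {n} (A : Fin n → Bool) {P : PairSet n} → ∀ u v → T (Within A P u v) → T (P u v)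
within⇒ A u v t = T∧ʳ {A v} (T∧ʳ {A u} t)

concatF : ∀ {A : Set} {k} → (Fin k → List A) → List A
concatF f = concat (tabulate f)

∈-concatF : ∀ {A : Set} {k} (f : Fin k → List A) i {a} → a ∈ f i → a ∈ concatF f
∈-concatF f i m = Memₚ.∈-concat⁺′ m (Memₚ.∈-tabulate⁺ i)

length-concatF : ∀ {A : Set} {k} (f : Fin k → List A) → length (concatF f) ≡ sumℕ (λ i → length (f i))
length-concatF {k = zero} f = refl
length-concatF {k = suc k} f = trans (Listₚ.length-++ (f zero)) (cong (length (f zero) ℕ.+_) (length-concatF (f ∘ suc)))

sumℕ-+ : ∀ {k} (f g : Fin k → ℕ) → sumℕ (λ i → f i ℕ.+ g i) ≡ sumℕ f ℕ.+ sumℕ g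
sumℕ-+ {zero} f g = refl
sumℕ-+ {suc k} f g = trans (cong (f zero ℕ.+ g zero ℕ.+_) (sumℕ-+ (f ∘ suc) (g ∘ suc)))
  (interchange (f zero) (g zero) (sumℕ (f ∘ suc)) (sumℕ (g ∘ suc)))
  where
  open ℕSolver.+-*-Solver
  interchange : ∀ a b c d → a ℕ.+ b ℕ.+ (c ℕ.+ d) ≡ a ℕ.+ c ℕ.+ (b ℕ.+ d)
  interchange = solve 4 (λ a b c d → a :+ b :+ (c :+ d) := a :+ c :+ (b :+ d)) refl

IE-bound : ∀ {n} (𝒳 : Cover n) (A P : PairSet n) (rs : Fin (k 𝒳) → ℕ) →
  (∀ i → HasRank (Within (X 𝒳 i) (λ u v → A u v ∨ P u v)) (rs i)) → Independent (edgeList P) →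
  ∀ {L} → Independent L → All (λ (u , v) → ∃ λ i → T (Within (X 𝒳 i) (λ u v → A u v ∨ P u v) u v)) L →
  length L ℕ.+ sumℕ (λ i → numPairs (Within (X 𝒳 i) P)) ℕ.≤ sumℕ rs ℕ.+ numPairs P
IE-bound {n} 𝒳 A P rs hrs hP {L} hL L⊂ = bound (generic (L ∷ tabulate bases) (hL ∷ Allₚ.tabulate⁺ (λ i → Frame.indep (fr i))))
  where
  E : Fin (k 𝒳) → PairSet n
  E i = Within (X 𝒳 i) (λ u v → A u v ∨ P u v)
  P⊂E : ∀ i u v → T (Within (X 𝒳 i) P u v) → T (E i u v)
  P⊂E i = within-⊂ (X 𝒳 i) {P} (λ u v → T∨⁺ʳ {A u v})
  fr : ∀ i → Frame (E i) (Within (X 𝒳 i) P) (rs i)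
  fr i = frame (P⊂E i) (independent-⊆ (edgeList-⊆ (within⇒ (X 𝒳 i) {P})) hP) (hrs i)
  bases : Fin (k 𝒳) → List (Pair n)
  bases i = Frame.T̂ (fr i) ++ edgeList (Within (X 𝒳 i) P)
  ss : Fin (k 𝒳) → ℕ
  ss i = numPairs (Within (X 𝒳 i) P)
  big : List (Pair n)
  big = concatF (λ i → Frame.T̂ (fr i)) ++ edgeList P
  in-big : ∀ i {e} → e ∈ Frame.T̂ (fr i) ++ edgeList (Within (X 𝒳 i) P) → e ∈ big
  in-big i m with Memₚ.∈-++⁻ (Frame.T̂ (fr i)) m
  ... | inj₁ mT = Memₚ.∈-++⁺ˡ (∈-concatF (λ i → Frame.T̂ (fr i)) i mT)
  ... | inj₂ mP = Memₚ.∈-++⁺ʳ (concatF (λ i → Frame.T̂ (fr i))) (let t , lt = ∈-edgeList⁻ {E = Within (X 𝒳 i) P} mP in ∈-edgeList⁺ lt (within⇒ (X 𝒳 i) {P} _ _ t))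
  total : length big ℕ.+ sumℕ ss ≡ sumℕ rs ℕ.+ numPairs P
  total = trans (cong (ℕ._+ sumℕ ss) (trans (Listₚ.length-++ (concatF (λ i → Frame.T̂ (fr i)))) (cong₂ ℕ._+_ (length-concatF (λ i → Frame.T̂ (fr i))) (length-edgeList P))))
    (trans (solve 3 (λ a b c → a :+ b :+ c := a :+ c :+ b) refl (sumℕ (λ i → length (Frame.T̂ (fr i)))) (numPairs P) (sumℕ ss))
      (cong (ℕ._+ numPairs P) (trans (sym (sumℕ-+ (λ i → length (Frame.T̂ (fr i))) ss)) (sumℕ-cong (λ i → Frame.size (fr i))))))
    where open ℕSolver.+-*-Solver
  bound : (∃ λ q → All (IndepAt q) (L ∷ tabulate bases)) → length L ℕ.+ sumℕ ss ℕ.≤ sumℕ rs ℕ.+ numPairs P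
  bound (q , liL ∷ libs) = subst (length L ℕ.+ sumℕ ss ℕ.≤_) total (ℕₚ.+-monoˡ-≤ (sumℕ ss) (steinitz liL λ m → in-span (All.lookup L⊂ m)))
    where
    in-span : ∀ {u v} → (∃ λ i → T (E i u v)) → SpanAt q big (u , v)
    in-span (i , t) = span-mono (in-big i) (frame-span (P⊂E i) (hrs i) (fr i) (Allₚ.tabulate⁻ libs i) t)

-- The ear

DB : Graph 8
DB = DoubleButterfly

dbStars : List (Star 8)
dbStars = (0f , 4f ∷ 5f ∷ 6f ∷ []) ∷ (1f , 4f ∷ 5f ∷ 6f ∷ []) ∷ (2f , 4f ∷ 5f ∷ 7f ∷ []) ∷ (3f , 4f ∷ 5f ∷ 7f ∷ [])
  ∷ (6f , 4f ∷ 5f ∷ []) ∷ (7f , 4f ∷ 5f ∷ []) ∷ []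

module _ {h} (gl : Fin h → Bool) where

  glue⁺ : ∀ {u v} → u ≢ v → T (gl u) → T (gl v) → T (allGluePairs gl u v)
  glue⁺ u≢v gu gv = T∧⁺ (not==⁺ u≢v) (T∧⁺ gu gv)

  glue⁻ : ∀ {u v} → T (allGluePairs gl u v) → u ≢ v × T (gl u) × T (gl v)
  glue⁻ {u} {v} t = not==⁻ {x = u} {v} (T∧ˡ t) , T∧ˡ t₁ , T∧ʳ {gl u} t₁
    where
    t₁ : T (gl u ∧ gl v)
    t₁ = T∧ʳ {not (u == v)} t

  glue-sym : Symm (allGluePairs gl)
  glue-sym u v = T-ext (go u v) (go v u)
    where
    go : ∀ u v → T (allGluePairs gl u v) → T (allGluePairs gl v u)
    go u v t = let ne , gu , gv = glue⁻ {u} {v} t in glue⁺ {v} {u} (ne ∘ sym) gv gu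

module _ {h} (𝒳 : Cover h) (gl : Fin h → Bool) where

  key⁺ : ∀ {u v} → u ≢ v → T (gl u) → T (gl v) → T (Inside 𝒳 u v) → T (KeyPairsEar 𝒳 gl u v)
  key⁺ u≢v gu gv i = T∧⁺ (not==⁺ u≢v) (T∧⁺ gu (T∧⁺ gv i))

  key⁻ : ∀ {u v} → T (KeyPairsEar 𝒳 gl u v) → u ≢ v × T (gl u) × T (gl v) × T (Inside 𝒳 u v)
  key⁻ {u} {v} t = not==⁻ {x = u} {v} (T∧ˡ t) , T∧ˡ t₁ , T∧ˡ (T∧ʳ {gl u} t₁) , T∧ʳ {gl v} (T∧ʳ {gl u} t₁)
    where
    t₁ : T (gl u ∧ gl v ∧ Inside 𝒳 u v)
    t₁ = T∧ʳ {not (u == v)} t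

  key-sym : Symm (KeyPairsEar 𝒳 gl)
  key-sym u v = T-ext (go u v) (go v u)
    where
    go : ∀ u v → T (KeyPairsEar 𝒳 gl u v) → T (KeyPairsEar 𝒳 gl v u)
    go u v t = let ne , gu , gv , i = key⁻ {u} {v} t in key⁺ {v} {u} (ne ∘ sym) gv gu (subst T (inside-sym 𝒳 u v) i)

module Ear (𝒳H : Cover 8) (C : SafeEarCover DB 𝒳H dbGlue) where
  open SafeEarCover C

  Key : PairSet 8
  Key = KeyPairsEar 𝒳H dbGlue

  private
    P : PairSet 8
    P u v = Shared 𝒳H u v ∨ Key u v

    irr-∨ : ∀ {Q : PairSet 8} → (∀ u v → T (Q u v) → u ≢ v) → Irrefl (λ u v → Shared 𝒳H u v ∨ Q u v)
    irr-∨ {Q} h u = ¬T⇒≡ λ t → [ (λ s → ≡⇒¬T (shared-irr 𝒳H u) s) , (λ s → h u u s refl) ]′ (T∨⁻ {Shared 𝒳H u u} t)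

    P-indep : Independent (edgeList P)
    P-indep = indepPairs⇒edgeList P-sym P-irr (indepPairs-⊆ P-sym P-irr F-sym F-irr P⊂F E2)
      where
      P-sym : Symm P
      P-sym u v = cong₂ _∨_ (shared-sym 𝒳H u v) (key-sym 𝒳H dbGlue u v)
      P-irr : Irrefl P
      P-irr = irr-∨ {Key} (λ u v t → proj₁ (key⁻ 𝒳H dbGlue {u} {v} t))
      F-sym : Symm (λ u v → Shared 𝒳H u v ∨ allGluePairs dbGlue u v)
      F-sym u v = cong₂ _∨_ (shared-sym 𝒳H u v) (glue-sym dbGlue u v)
      F-irr : Irrefl (λ u v → Shared 𝒳H u v ∨ allGluePairs dbGlue u v)
      F-irr = irr-∨ {allGluePairs dbGlue} (λ u v t → proj₁ (glue⁻ dbGlue {u} {v} t))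
      P⊂F : ∀ u v → T (P u v) → T (Shared 𝒳H u v ∨ allGluePairs dbGlue u v)
      P⊂F u v t with T∨⁻ {Shared 𝒳H u v} t
      ... | inj₁ s = T∨⁺ˡ s
      ... | inj₂ s = let ne , gu , gv , _ = key⁻ 𝒳H dbGlue {u} {v} s in T∨⁺ʳ {Shared 𝒳H u v} (glue⁺ dbGlue {u} {v} ne gu gv)

    in-cluster : ∀ {u v} → T (adj DB u v ∨ Key u v) → ∃ λ i → T (Within (X 𝒳H i) (λ u v → adj DB u v ∨ P u v) u v)
    in-cluster {u} {v} t with T∨⁻ {adj DB u v} t
    ... | inj₁ e = let i , Xu , Xv = TwoThin.covers twoThin u v e in i , within⁺ (X 𝒳H i) (λ u v → adj DB u v ∨ P u v) Xu Xv (T∨⁺ˡ e)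
    ... | inj₂ κ with anyF⁻ _ (proj₂ (proj₂ (proj₂ (key⁻ 𝒳H dbGlue {u} {v} κ))))
    ...   | i , ti = i , within⁺ (X 𝒳H i) (λ u v → adj DB u v ∨ P u v) {u} {v} (T∧ˡ ti) (T∧ʳ {X 𝒳H i u} ti) (T∨⁺ʳ {adj DB u v} (T∨⁺ʳ {Shared 𝒳H u v} κ))

  ear-rank : ∀ {L} → Independent L → All (InSet (λ u v → adj DB u v ∨ Key u v)) L → length L ℕ.≤ 17
  ear-rank {L} hL L⊂ with E3
  ... | r , z , hr@((M , M⊂ , _ , refl) , _) , (rs , hrs , z≡) , r≡ = ℕₚ.+-cancelʳ-≤ (sumℕ ss) (length L) 17
    (ℕₚ.≤-trans (IE-bound 𝒳H (adj DB) P rs hrs P-indep hL (All.map in-cluster L⊂))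
      (subst (ℕ._≤ 17 ℕ.+ sumℕ ss) (ℤₚ.+-injective (move (ℤ.+ length M) (ℤ.+ sumℕ rs) (ℤ.+ sumℕ ss) (ℤ.+ numPairs P) z r≡
          (trans z≡ (cong₂ ℤ._-_ (sym (+sumℕ {k 𝒳H} rs)) (overcount 𝒳H P)))))
        (ℕₚ.+-monoˡ-≤ (sumℕ ss) (s≤s M≤16))))
    where
    ss : Fin (k 𝒳H) → ℕ
    ss i = numPairs (Within (X 𝒳H i) P)
    M≤16 : length M ℕ.≤ 16
    M≤16 = subst (length M ℕ.≤_) (length-edgeList (adj DB)) (steinitz (Independent.indepAt (from-IndepList M (let _ , hM , _ = proj₂ (proj₁ hr) in hM)))
      (λ m → span-either (edgeList-covers (adj-sym DB) (irr DB) _ _ (All.lookup M⊂ m))))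
    move : ∀ r R s p z → r ≡ z ℤ.- 1ℤ → z ≡ R ℤ.- (s ℤ.- p) → 1ℤ ℤ.+ r ℤ.+ s ≡ R ℤ.+ p
    move r R s p z refl refl = solve 3 (λ R s p → con 1ℤ :+ (R :- (s :- p) :- con 1ℤ) :+ s := R :+ p) refl R s p
      where open ℤSolver.+-*-Solver

  private
    too-many : ∀ {κ₁ κ₂} {L : List (Pair 8)} → InSet Key κ₁ → InSet Key κ₂ → Independent L → length L ≡ 18 →
      All (λ e → T (uncurry dbAdj e) ⊎ e ≡ κ₁ ⊎ e ≡ κ₂ ⊎ e ≡ swap κ₁ ⊎ e ≡ swap κ₂) L → ⊥
    too-many {κ₁} {κ₂} {L} h₁ h₂ hL len L⊂ = ℕₚ.<⇒≱ ℕₚ.≤-refl (subst (ℕ._≤ 17) len (ear-rank hL (All.map ok L⊂)))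
      where
      ok : ∀ {e} → T (uncurry dbAdj e) ⊎ e ≡ κ₁ ⊎ e ≡ κ₂ ⊎ e ≡ swap κ₁ ⊎ e ≡ swap κ₂ → InSet (λ u v → adj DB u v ∨ Key u v) e
      ok {u , v} (inj₁ t) = T∨⁺ˡ t
      ok {u , v} (inj₂ (inj₁ refl)) = T∨⁺ʳ {adj DB u v} h₁
      ok {u , v} (inj₂ (inj₂ (inj₁ refl))) = T∨⁺ʳ {adj DB u v} h₂
      ok {u , v} (inj₂ (inj₂ (inj₂ (inj₁ refl)))) = T∨⁺ʳ {adj DB u v} (subst T (key-sym 𝒳H dbGlue v u) h₁)
      ok {u , v} (inj₂ (inj₂ (inj₂ (inj₂ refl)))) = T∨⁺ʳ {adj DB u v} (subst T (key-sym 𝒳H dbGlue v u) h₂)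

    infix 4 _≟ᵖ_
    _≟ᵖ_ : (e e′ : Pair 8) → Dec (e ≡ e′)
    _≟ᵖ_ = Productₚ.≡-dec _≟_ _≟_

    allowed? : ∀ κ₁ κ₂ e → Dec (T (uncurry dbAdj e) ⊎ e ≡ κ₁ ⊎ e ≡ κ₂ ⊎ e ≡ swap κ₁ ⊎ e ≡ swap κ₂)
    allowed? κ₁ κ₂ e = Boolₚ.T? (uncurry dbAdj e) ⊎-dec ((e ≟ᵖ κ₁) ⊎-dec ((e ≟ᵖ κ₂) ⊎-dec ((e ≟ᵖ swap κ₁) ⊎-dec (e ≟ᵖ swap κ₂))))

    degenerate-absurd : ∀ κ₁ κ₂ (r : List (Star 8)) → {T ⌊ degenerate? r [] ⌋} → {T ⌊ length (stars r []) ℕₚ.≟ 18 ⌋} →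
      {T ⌊ All.all? (allowed? κ₁ κ₂) (stars r []) ⌋} → InSet Key κ₁ → InSet Key κ₂ → ⊥
    degenerate-absurd κ₁ κ₂ r {d} {l} {a} h₁ h₂ = too-many h₁ h₂ (stars-independent r (toWitness d) []-independent) (toWitness l) (toWitness a)

  -- a₁ = 0, b₁ = 1, a₂ = 2, b₂ = 3: only a₁b₁ and a₂b₂ can both be key pairs.
  not-a₁b₁-a₁b₂ : T (Key 0f 1f) → T (Key 0f 3f) → ⊥
  not-a₁b₁-a₁b₂ = degenerate-absurd (0f , 1f) (0f , 3f) ((2f , 4f ∷ 5f ∷ 7f ∷ []) ∷ (7f , 3f ∷ 4f ∷ 5f ∷ []) ∷ (3f , 4f ∷ 5f ∷ 0f ∷ [])
    ∷ (4f , 0f ∷ 1f ∷ 6f ∷ []) ∷ (5f , 0f ∷ 1f ∷ 6f ∷ []) ∷ (6f , 0f ∷ 1f ∷ []) ∷ (0f , 1f ∷ []) ∷ [])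

  not-a₁b₁-a₂b₁ : T (Key 0f 1f) → T (Key 2f 1f) → ⊥
  not-a₁b₁-a₂b₁ = degenerate-absurd (0f , 1f) (2f , 1f) ((3f , 4f ∷ 5f ∷ 7f ∷ []) ∷ (7f , 2f ∷ 4f ∷ 5f ∷ []) ∷ (2f , 4f ∷ 5f ∷ 1f ∷ [])
    ∷ (4f , 0f ∷ 1f ∷ 6f ∷ []) ∷ (5f , 0f ∷ 1f ∷ 6f ∷ []) ∷ (6f , 0f ∷ 1f ∷ []) ∷ (0f , 1f ∷ []) ∷ [])

  not-a₂b₂-a₁b₂ : T (Key 2f 3f) → T (Key 0f 3f) → ⊥
  not-a₂b₂-a₁b₂ = degenerate-absurd (2f , 3f) (0f , 3f) ((1f , 4f ∷ 5f ∷ 6f ∷ []) ∷ (6f , 0f ∷ 4f ∷ 5f ∷ []) ∷ (0f , 4f ∷ 5f ∷ 3f ∷ [])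
    ∷ (4f , 2f ∷ 3f ∷ 7f ∷ []) ∷ (5f , 2f ∷ 3f ∷ 7f ∷ []) ∷ (7f , 2f ∷ 3f ∷ []) ∷ (2f , 3f ∷ []) ∷ [])

  not-a₂b₂-a₂b₁ : T (Key 2f 3f) → T (Key 2f 1f) → ⊥
  not-a₂b₂-a₂b₁ = degenerate-absurd (2f , 3f) (2f , 1f) ((0f , 4f ∷ 5f ∷ 6f ∷ []) ∷ (6f , 1f ∷ 4f ∷ 5f ∷ []) ∷ (1f , 4f ∷ 5f ∷ 2f ∷ [])
    ∷ (4f , 2f ∷ 3f ∷ 7f ∷ []) ∷ (5f , 2f ∷ 3f ∷ 7f ∷ []) ∷ (7f , 2f ∷ 3f ∷ []) ∷ (2f , 3f ∷ []) ∷ [])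

  not-a₁b₂-a₂b₁ : T (Key 0f 3f) → T (Key 2f 1f) → ⊥
  not-a₁b₂-a₂b₁ h₁ h₂ = too-many h₁ h₂ bipyramid-independent refl (toWitness {a? = All.all? (allowed? (0f , 3f) (2f , 1f)) (edgesOf bipyramid)} tt)

-- Lifting edges and independence through a nonedge-split

module Lift {n m} {G : Graph n} {a b} {Gs : Graph m} {φ : Fin n → Fin m} {a1 a2 b1 b2}
            (NS : NonedgeSplit G a b Gs φ a1 a2 b1 b2) where
  open NonedgeSplit NS

  σ τ : Fin n → Bool
  σ x = adj Gs a1 (φ x)
  τ x = adj Gs b1 (φ x)

  copyA copyB : Bool → Fin m
  copyA s = if s then a1 else a2
  copyB s = if s then b1 else b2

  vertex : Fin m → Fin m → Fin n → Fin m
  vertex p q x = if x == a then p else if x == b then q else φ x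

  vertex-a : ∀ p q → vertex p q a ≡ p
  vertex-a p q rewrite ==-refl a = refl
  vertex-b : ∀ p q → vertex p q b ≡ q
  vertex-b p q rewrite ==-≢ (a≢b ∘ sym) | ==-refl b = refl
  vertex-old : ∀ p q {x} → x ≢ a → x ≢ b → vertex p q x ≡ φ x
  vertex-old p q x≢a x≢b rewrite ==-≢ x≢a | ==-≢ x≢b = refl

  data View (x : Fin n) : Set where
    isA : x ≡ a → View x
    isB : x ≡ b → View x
    old : x ≢ a → x ≢ b → View x

  view : ∀ x → View x
  view x with x ≟ a | x ≟ b
  ... | yes e | _ = isA e
  ... | no _ | yes e = isB e
  ... | no p | no q = old p q

  -- The end over x of the edge of Gs lying over the edge xy of G.
  up : Fin n → Fin n → Fin m
  up x y = vertex (copyA (σ y)) (copyB (τ y)) x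

  lift : Pair n → Pair m
  lift (x , y) = up x y , up y x

  π : Fin m → Fin n
  π y with onto y
  ... | inj₁ (inj₁ _) = a
  ... | inj₁ (inj₂ (inj₁ _)) = a
  ... | inj₁ (inj₂ (inj₂ _)) = b
  ... | inj₂ (x , _) = x

  π-a1 : π a1 ≡ a
  π-a1 with onto a1
  ... | inj₁ (inj₁ _) = refl
  ... | inj₁ (inj₂ (inj₁ _)) = refl
  ... | inj₁ (inj₂ (inj₂ (inj₁ e))) = ⊥-elim (a1≢b1 e)
  ... | inj₁ (inj₂ (inj₂ (inj₂ e))) = ⊥-elim (a1≢b2 e)
  ... | inj₂ (x , o , e) = ⊥-elim (φ-old x o (inj₁ e))

  π-a2 : π a2 ≡ a
  π-a2 with onto a2
  ... | inj₁ (inj₁ _) = refl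
  ... | inj₁ (inj₂ (inj₁ _)) = refl
  ... | inj₁ (inj₂ (inj₂ (inj₁ e))) = ⊥-elim (a2≢b1 e)
  ... | inj₁ (inj₂ (inj₂ (inj₂ e))) = ⊥-elim (a2≢b2 e)
  ... | inj₂ (x , o , e) = ⊥-elim (φ-old x o (inj₂ (inj₁ e)))

  π-b1 : π b1 ≡ b
  π-b1 with onto b1
  ... | inj₁ (inj₁ e) = ⊥-elim (a1≢b1 (sym e))
  ... | inj₁ (inj₂ (inj₁ e)) = ⊥-elim (a2≢b1 (sym e))
  ... | inj₁ (inj₂ (inj₂ _)) = refl
  ... | inj₂ (x , o , e) = ⊥-elim (φ-old x o (inj₂ (inj₂ (inj₁ e))))

  π-b2 : π b2 ≡ b
  π-b2 with onto b2
  ... | inj₁ (inj₁ e) = ⊥-elim (a1≢b2 (sym e))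
  ... | inj₁ (inj₂ (inj₁ e)) = ⊥-elim (a2≢b2 (sym e))
  ... | inj₁ (inj₂ (inj₂ _)) = refl
  ... | inj₂ (x , o , e) = ⊥-elim (φ-old x o (inj₂ (inj₂ (inj₂ e))))

  π-φ : ∀ {x} → Old x → π (φ x) ≡ x
  π-φ {x} o with onto (φ x)
  ... | inj₁ (inj₁ e) = ⊥-elim (φ-old x o (inj₁ e))
  ... | inj₁ (inj₂ (inj₁ e)) = ⊥-elim (φ-old x o (inj₂ (inj₁ e)))
  ... | inj₁ (inj₂ (inj₂ e)) = ⊥-elim (φ-old x o (inj₂ (inj₂ e)))
  ... | inj₂ (y , o′ , e) = φ-inj y x o′ o e

  π-copyA : ∀ s → π (copyA s) ≡ a
  π-copyA true = π-a1
  π-copyA false = π-a2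
  π-copyB : ∀ s → π (copyB s) ≡ b
  π-copyB true = π-b1
  π-copyB false = π-b2

  π-up : ∀ x y → π (up x y) ≡ x
  π-up x y with view x
  ... | isA refl = trans (cong π (vertex-a _ _)) (π-copyA (σ y))
  ... | isB refl = trans (cong π (vertex-b _ _)) (π-copyB (τ y))
  ... | old p q = trans (cong π (vertex-old _ _ p q)) (π-φ (p , q))

  π-lift : ∀ e → map² π (lift e) ≡ e
  π-lift (x , y) = cong₂ _,_ (π-up x y) (π-up y x)

  nbr-a : ∀ {x} → T (adj G a x) → Old x
  nbr-a t = (λ { refl → ≡⇒¬T (irr G a) t }) , (λ { refl → ≡⇒¬T nonedge t })
  nbr-b : ∀ {x} → T (adj G b x) → Old x
  nbr-b t = (λ { refl → ≡⇒¬T nonedge (subst T (adj-sym G b a) t) }) , (λ { refl → ≡⇒¬T (irr G b) t })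

  private
    chosen : ∀ {y z : Fin m} {x e} (s : Bool) → s ≡ adj Gs y x → (s ∨ adj Gs z x) ≡ e → T e → T (adj Gs (if s then y else z) x)
    chosen true eq _ _ = ≡⇒T (sym eq)
    chosen false _ refl t = t

  chosen-a : ∀ {x} → T (adj G a x) → T (adj Gs (copyA (σ x)) (φ x))
  chosen-a {x} t = chosen (σ x) refl (unionA x (nbr-a t)) t
  chosen-b : ∀ {x} → T (adj G b x) → T (adj Gs (copyB (τ x)) (φ x))
  chosen-b {x} t = chosen (τ x) refl (unionB x (nbr-b t)) t

  up-a : ∀ y → up a y ≡ copyA (σ y)
  up-a y = vertex-a _ _
  up-b : ∀ y → up b y ≡ copyB (τ y)
  up-b y = vertex-b _ _
  up-old : ∀ {x} → Old x → ∀ y → up x y ≡ φ x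
  up-old (p , q) y = vertex-old _ _ p q

  flip-adj : ∀ {x y} → T (adj Gs x y) → T (adj Gs y x)
  flip-adj {x} {y} = subst T (adj-sym Gs x y)

  lift-adj : ∀ {x y} → T (adj G x y) → T (adj Gs (up x y) (up y x))
  lift-adj {x} {y} t with view x | view y
  ... | isA refl | _ = subst₂ (λ s t → T (adj Gs s t)) (sym (up-a y)) (sym (up-old (nbr-a t) a)) (chosen-a t)
  ... | isB refl | _ = subst₂ (λ s t → T (adj Gs s t)) (sym (up-b y)) (sym (up-old (nbr-b t) b)) (chosen-b t)
  ... | old _ _ | isA refl = subst₂ (λ s t → T (adj Gs s t)) (sym (up-old (nbr-a t′) a)) (sym (up-a x)) (flip-adj (chosen-a t′))
    where t′ : T (adj G a x)
          t′ = subst T (adj-sym G x a) t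
  ... | old _ _ | isB refl = subst₂ (λ s t → T (adj Gs s t)) (sym (up-old (nbr-b t′) b)) (sym (up-b x)) (flip-adj (chosen-b t′))
    where t′ : T (adj G b x)
          t′ = subst T (adj-sym G x b) t
  ... | old p q | old p′ q′ = subst₂ (λ s t → T (adj Gs s t)) (sym (up-old (p , q) y)) (sym (up-old (p′ , q′) x)) (subst T (sym (adjOld x y (p , q) (p′ , q′))) t)

  record Below (y z : Fin m) : Set where
    constructor below
    field
      x x′   : Fin n
      edge   : T (adj G x x′)
      up-x   : up x x′ ≡ y
      up-x′  : up x′ x ≡ z

  private
    swap-below : ∀ {y z} → Below y z → Below z y
    swap-below (below x x′ e p q) = below x′ x (subst T (adj-sym G x x′) e) q p

    new-below : ∀ {y x} → New y → Old x → T (adj Gs y (φ x)) → Below y (φ x)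
    new-below {x = x} (inj₁ refl) o t = below a x (subst T (unionA x o) (T∨⁺ˡ t)) (trans (up-a x) (cong copyA (T⇒≡ t))) (up-old o a)
    new-below {x = x} (inj₂ (inj₁ refl)) o t = below a x (subst T (unionA x o) (T∨⁺ʳ {σ x} t)) (trans (up-a x) (cong copyA (other (disjA x o) t))) (up-old o a)
      where other : ∀ {p q} → (p ∧ q) ≡ false → T q → p ≡ false
            other {true} e t = ⊥-elim (≡⇒¬T e t)
            other {false} e t = refl
    new-below {x = x} (inj₂ (inj₂ (inj₁ refl))) o t = below b x (subst T (unionB x o) (T∨⁺ˡ t)) (trans (up-b x) (cong copyB (T⇒≡ t))) (up-old o b)
    new-below {x = x} (inj₂ (inj₂ (inj₂ refl))) o t = below b x (subst T (unionB x o) (T∨⁺ʳ {τ x} t)) (trans (up-b x) (cong copyB (other (disjB x o) t))) (up-old o b)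
      where other : ∀ {p q} → (p ∧ q) ≡ false → T q → p ≡ false
            other {true} e t = ⊥-elim (≡⇒¬T e t)
            other {false} e t = refl

  edge-below : ∀ {y z} → T (adj Gs y z) → Below y z
  edge-below {y} {z} t with onto y | onto z
  ... | inj₁ ny | inj₁ nz = ⊥-elim (≡⇒¬T (adjNew y z ny nz) t)
  ... | inj₁ ny | inj₂ (x , o , refl) = new-below ny o t
  ... | inj₂ (x , o , refl) | inj₁ nz = swap-below (new-below nz o (flip-adj t))
  ... | inj₂ (x , o , refl) | inj₂ (x′ , o′ , refl) = below x x′ (subst T (adjOld x x′ o o′) t) (up-old o x′) (up-old o′ x)

  EL : List (Pair n)
  EL = edgeList (adj G)

  E^ : List (Pair m)
  E^ = map lift EL

  E^-InSet : All (InSet (adj Gs)) E^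
  E^-InSet = Allₚ.map⁺ (All.map (λ {(x , y)} t → lift-adj t) (edgeList-InSet (adj G)))

  E^-covers : Covers E^ (adj Gs)
  E^-covers y z t with edge-below t
  ... | below x x′ e refl refl = Data.Sum.map (Memₚ.∈-map⁺ lift) (Memₚ.∈-map⁺ lift) (edgeList-covers (adj-sym G) (irr G) x x′ e)

  π-E^ : map (map² π) E^ ≡ EL
  π-E^ = trans (sym (Listₚ.map-∘ EL)) (trans (Listₚ.map-cong π-lift EL) (Listₚ.map-id EL))

  length-E^ : length E^ ≡ numPairs (adj G)
  length-E^ = trans (Listₚ.length-map lift EL) (length-edgeList (adj G))

  E^-independent : IndependentGraph G → Independent E^
  E^-independent ind = independent-fold π (subst Independent (sym π-E^) (indepPairs⇒edgeList (adj-sym G) (irr G) ind))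

-- The rank bound for Gs with its key pairs

module _ {A I : Set} {r : A → I → ℚ} where

  indep-rearrange : Searchable I → ∀ {L M} → Indep r L → (∀ {a} → a ∈ L → a ∈ M) → length M ℕ.≤ length L → Indep r M
  indep-rearrange s li h = indep-of-length s li (λ m → span-∈ (h m))

  not-in-span-of-others : Searchable I → ∀ as {a bs} → Indep r (as ++ a ∷ bs) → ¬ InSpan r (as ++ bs) (r a)
  not-in-span-of-others s as {a} {bs} li = indep-head (indep-rearrange s {as ++ a ∷ bs} {a ∷ as ++ bs} li move
    (ℕₚ.≤-reflexive (trans (cong suc (Listₚ.length-++ as)) (trans (sym (ℕₚ.+-suc (length as) (length bs))) (sym (Listₚ.length-++ as))))))
    where
    move : ∀ {c} → c ∈ as ++ a ∷ bs → c ∈ a ∷ as ++ bs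
    move m with Memₚ.∈-++⁻ as m
    ... | inj₁ ma = there (Memₚ.∈-++⁺ˡ ma)
    ... | inj₂ (here e) = here e
    ... | inj₂ (there mb) = there (Memₚ.∈-++⁺ʳ as mb)

_≟ₑ_ : ∀ {n} (e e′ : Pair n) → Dec (e ≡ e′)
_≟ₑ_ = Productₚ.≡-dec _≟_ _≟_

either? : ∀ {n} (u v : Fin n) L → Dec ((u , v) ∈ L ⊎ (v , u) ∈ L)
either? u v L = Any.any? (λ e → (u , v) ≟ₑ e) L ⊎-dec Any.any? (λ e → (v , u) ≟ₑ e) L

edge-in-span⇒∈ : ∀ {n} {E : PairSet n} → Symm E → Irrefl E → ∀ {p} → IndepAt p (edgeList E) → ∀ {L} → All (InSet E) L →
  ∀ {u v} → T (E u v) → SpanAt p L (u , v) → (u , v) ∈ L ⊎ (v , u) ∈ L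
edge-in-span⇒∈ {n} {E} sy ir {p} li {L} L⊂E {u} {v} t sp with either? u v L
... | yes m = m
... | no none = ⊥-elim (absurd (edgeList-covers sy ir u v t))
  where
  rest : ∀ {as bs : List (Pair n)} {u′ v′} → edgeList E ≡ as ++ (u′ , v′) ∷ bs → (u′ , v′) ≡ (u , v) ⊎ (u′ , v′) ≡ (v , u) →
    ∀ {e} → e ∈ L → SpanAt p (as ++ bs) e
  rest {as} {bs} eq eq′ {x , y} m = span-either {L = as ++ bs} (Data.Sum.map (λ mE → drop mE (λ e → none-of eq′ (inj₁ e) m)) (λ mE → drop mE (λ e → none-of eq′ (inj₂ (cong swap e)) m))
      (edgeList-covers sy ir x y (All.lookup L⊂E m)))
    where
    none-of : ∀ {u′ v′} → (u′ , v′) ≡ (u , v) ⊎ (u′ , v′) ≡ (v , u) → (x , y) ≡ (u′ , v′) ⊎ (x , y) ≡ (v′ , u′) → (x , y) ∈ L → ⊥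
    none-of (inj₁ refl) (inj₁ refl) m = none (inj₁ m)
    none-of (inj₁ refl) (inj₂ refl) m = none (inj₂ m)
    none-of (inj₂ refl) (inj₁ refl) m = none (inj₂ m)
    none-of (inj₂ refl) (inj₂ refl) m = none (inj₁ m)
    drop : ∀ {e} → e ∈ edgeList E → e ≢ _ → e ∈ as ++ bs
    drop mE ne with Memₚ.∈-++⁻ as (subst (_ ∈_) eq mE)
    ... | inj₁ ma = Memₚ.∈-++⁺ˡ ma
    ... | inj₂ (here e) = ⊥-elim (ne e)
    ... | inj₂ (there mb) = Memₚ.∈-++⁺ʳ as mb
  contra : ∀ {u′ v′} → (u′ , v′) ∈ edgeList E → (u′ , v′) ≡ (u , v) ⊎ (u′ , v′) ≡ (v , u) → SpanAt p L (u′ , v′) → ⊥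
  contra {u′} {v′} m eq′ sp′ with Memₚ.∈-∃++ m
  ... | as , bs , eq = not-in-span-of-others search-coord as (subst (IndepAt p) eq li) (span-trans (rest {as} {bs} eq eq′) sp′)
  absurd : (u , v) ∈ edgeList E ⊎ (v , u) ∈ edgeList E → ⊥
  absurd (inj₁ m) = contra m (inj₁ refl) sp
  absurd (inj₂ m) = contra m (inj₂ refl) (span-swap sp)

not⁻ : ∀ {c} → T (not c) → ¬ T c
not⁻ {false} _ ()

span-push : ∀ {m n} (f : Fin m → Fin n) q {L e} → SpanAt (q ∘ f) L e → SpanAt q (map (map² f) L) (map² f e)
span-push f q {L} {e} sp = span-cong (push-row f q e) (span-map (map² f) (push-row f q) (span-image (push-linear f) sp))

choose-list : ∀ {A B : Set} {Q : A → B → Set} (L : List A) → (∀ {a} → a ∈ L → ∃ (Q a)) →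
  ∃ λ M → length M ≡ length L × (∀ {a} → a ∈ L → ∃ λ b → b ∈ M × Q a b)
choose-list [] h = [] , refl , λ ()
choose-list (a ∷ L) h with h (here refl) | choose-list L (h ∘ there)
... | b , q | M , len , h′ = b ∷ M , cong suc len , λ
  { (here refl) → b , here refl , q
  ; (there m) → let b′ , mb , q′ = h′ m in b′ , there mb , q′ }

length-filterᵇ-not : ∀ {A : Set} (P : A → Bool) L → length (filterᵇ P L) ℕ.+ length (filterᵇ (not ∘ P) L) ≡ length L
length-filterᵇ-not P [] = refl
length-filterᵇ-not P (a ∷ L) with P a
... | true = cong suc (length-filterᵇ-not P L)
... | false = trans (ℕₚ.+-suc _ _) (cong suc (length-filterᵇ-not P L))

module Bound {n m} {G : Graph n} {𝒳 : Cover n} {a b} {Gs : Graph m} {φ : Fin n → Fin m} {a1 a2 b1 b2}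
             (B : BaseWith G 𝒳) (S : SafeSplit G 𝒳 a b Gs φ a1 a2 b1 b2) where
  open SafeSplit S using (split; shared)
  open NonedgeSplit split
  open Lift split
  open BaseWith B
  open PartialBase (base⇒partial B) using (rs; ss; z; rank-cluster; rank-shared; rank-inside; count)

  module HA = Half (halfA-of-safeSplit S)
  module HB = Half (halfB-of-safeSplit S)

  Sh : PairSet n
  Sh = Shared 𝒳

  SA SB : Fin (k 𝒳) → Bool → Bool
  SA i s = anyF (λ x → X 𝒳 i x ∧ adj G a x ∧ not (σ x xor s))
  SB i s = anyF (λ x → X 𝒳 i x ∧ adj G b x ∧ not (τ x xor s))

  SA⁺ : ∀ {i s} → HA.Side i s → T (SA i s)
  SA⁺ (x , Xx , t , e) = anyF⁺ x (T∧⁺ Xx (T∧⁺ t (xnor⁺ e)))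
  SA⁻ : ∀ {i s} → T (SA i s) → HA.Side i s
  SA⁻ {i} t = let x , tx = anyF⁻ _ t in x , T∧ˡ tx , T∧ˡ (T∧ʳ {X 𝒳 i x} tx) , xnor⁻ (T∧ʳ {adj G a x} (T∧ʳ {X 𝒳 i x} tx))
  SB⁺ : ∀ {i s} → HB.Side i s → T (SB i s)
  SB⁺ (x , Xx , t , e) = anyF⁺ x (T∧⁺ Xx (T∧⁺ t (xnor⁺ e)))
  SB⁻ : ∀ {i s} → T (SB i s) → HB.Side i s
  SB⁻ {i} t = let x , tx = anyF⁻ _ t in x , T∧ˡ tx , T∧ˡ (T∧ʳ {X 𝒳 i x} tx) , xnor⁻ (T∧ʳ {adj G b x} (T∧ʳ {X 𝒳 i x} tx))

  key : Bool → Bool → Bool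
  key s t = anyF (λ i → X 𝒳 i a ∧ X 𝒳 i b ∧ SA i s ∧ SB i t)

  keyPair : Bool × Bool → Pair m
  keyPair (s , t) = copyA s , copyB t

  ifKey : Bool → Bool → List (Pair m)
  ifKey s t = if key s t then keyPair (s , t) ∷ [] else []

  Kt : List (Pair m)
  Kt = ifKey true true ++ (ifKey true false ++ (ifKey false true ++ ifKey false false))

  key-∈ : ∀ s t → T (key s t) → keyPair (s , t) ∈ Kt
  key-∈ s t h = place s t (mine (key s t) h)
    where
    mine : ∀ c → T c → keyPair (s , t) ∈ (if c then keyPair (s , t) ∷ [] else [])
    mine true _ = here refl
    place : ∀ s t {e} → e ∈ ifKey s t → e ∈ Kt
    place true true m = Memₚ.∈-++⁺ˡ m
    place true false m = Memₚ.∈-++⁺ʳ (ifKey true true) (Memₚ.∈-++⁺ˡ m)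
    place false true m = Memₚ.∈-++⁺ʳ (ifKey true true) (Memₚ.∈-++⁺ʳ (ifKey true false) (Memₚ.∈-++⁺ˡ m))
    place false false m = Memₚ.∈-++⁺ʳ (ifKey true true) (Memₚ.∈-++⁺ʳ (ifKey true false) (Memₚ.∈-++⁺ʳ (ifKey false true) m))

  -- Clusters meeting no neighbour of a (of b) are attached to a spare copy A₀ of a (B₀ of b)
  -- instead; as A₀ and B₀ have degree at most three, this does not affect the count.
  emb : Fin m → Fin (suc (suc m))
  emb y = suc (suc y)

  A₀ B₀ : Fin (suc (suc m))
  A₀ = zero
  B₀ = suc zero

  label : Fin (suc (suc m)) → Fin m → Fin m → (Bool → Bool) → Fin (suc (suc m))
  label spare p q s = if s true then emb p else if s false then emb q else spare

  labA labB : Fin (k 𝒳) → Fin (suc (suc m))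
  labA i = label A₀ a1 a2 (SA i)
  labB i = label B₀ b1 b2 (SB i)

  data Label (spare : Fin (suc (suc m))) (c : Bool → Fin m) (s : Bool → Bool) (l : Fin (suc (suc m))) : Set where
    none : l ≡ spare → Label spare c s l
    side : ∀ t → T (s t) → l ≡ emb (c t) → Label spare c s l

  labA-view : ∀ i → Label A₀ copyA (SA i) (labA i)
  labA-view i with SA i true in e₁ | SA i false in e₂
  ... | true | _ = side true (≡⇒T e₁) refl
  ... | false | true = side false (≡⇒T e₂) refl
  ... | false | false = none refl
  labB-view : ∀ i → Label B₀ copyB (SB i) (labB i)
  labB-view i with SB i true in e₁ | SB i false in e₂
  ... | true | _ = side true (≡⇒T e₁) refl
  ... | false | true = side false (≡⇒T e₂) refl
  ... | false | false = none refl

  label-side : ∀ {spare p q} (s : Bool → Bool) t → T (s t) → ¬ (T (s true) × T (s false)) → label spare p q s ≡ emb (if t then p else q)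
  label-side s true h not-both with s true | h
  ... | true | _ = refl
  label-side s false h not-both with s true | s false | h | not-both
  ... | true | true | _ | nb = ⊥-elim (nb (tt , tt))
  ... | false | true | _ | _ = refl

  lam : Fin (k 𝒳) → Fin n → Fin (suc (suc m))
  lam i x = if x == a then labA i else if x == b then labB i else emb (φ x)

  lam-a : ∀ i → lam i a ≡ labA i
  lam-a i rewrite ==-refl a = refl
  lam-b : ∀ i → lam i b ≡ labB i
  lam-b i rewrite ==-≢ (a≢b ∘ sym) | ==-refl b = refl
  lam-old : ∀ i {x} → x ≢ a → x ≢ b → lam i x ≡ emb (φ x)
  lam-old i x≢a x≢b rewrite ==-≢ x≢a | ==-≢ x≢b = refl

  emb-inj : ∀ {x y} → emb x ≡ emb y → x ≡ y
  emb-inj refl = refl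

  π̂ : Fin (suc (suc m)) → Fin n
  π̂ zero = a
  π̂ (suc zero) = b
  π̂ (suc (suc y)) = π y

  π̂-lam : ∀ i x → π̂ (lam i x) ≡ x
  π̂-lam i x with view x
  ... | old p q = trans (cong π̂ (lam-old i p q)) (π-φ (p , q))
  ... | isA refl with labA-view i
  ...   | none e = cong π̂ (trans (lam-a i) e)
  ...   | side t _ e = trans (cong π̂ (trans (lam-a i) e)) (π-copyA t)
  π̂-lam i x | isB refl with labB-view i
  ...   | none e = cong π̂ (trans (lam-b i) e)
  ...   | side t _ e = trans (cong π̂ (trans (lam-b i) e)) (π-copyB t)

  lam-inj : ∀ i → Injective _≡_ _≡_ (lam i)
  lam-inj i {x} {y} e = trans (sym (π̂-lam i x)) (trans (cong π̂ e) (π̂-lam i y))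

  active : Fin (k 𝒳) → Bool
  active i = anyF (λ u → anyF (λ v → Sh u v ∧ not (adj G u v) ∧ X 𝒳 i u ∧ X 𝒳 i v))

  active⁺ : ∀ i {u v} → T (Sh u v) → adj G u v ≡ false → T (X 𝒳 i u) → T (X 𝒳 i v) → T (active i)
  active⁺ i {u} {v} s ne Xu Xv = anyF⁺ u (anyF⁺ v (T∧⁺ s (T∧⁺ (subst (T ∘ not) (sym ne) tt) (T∧⁺ Xu Xv))))

  active-one-sided : ∀ {i} → T (active i) → ¬ (T (SA i true) × T (SA i false)) × ¬ (T (SB i true) × T (SB i false))
  active-one-sided {i} t with anyF⁻ _ t
  ... | u , tu with anyF⁻ _ tu
  ...   | v , tv = (λ (p , q) → HA.S1 i u v s ne Xu Xv (SA⁻ p , SA⁻ q)) , (λ (p , q) → HB.S1 i u v s ne Xu Xv (SB⁻ p , SB⁻ q))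
    where
    s : T (Sh u v)
    s = T∧ˡ tv
    t₁ : T (not (adj G u v) ∧ X 𝒳 i u ∧ X 𝒳 i v)
    t₁ = T∧ʳ {Sh u v} tv
    ne : adj G u v ≡ false
    ne with adj G u v | T∧ˡ {not (adj G u v)} t₁
    ... | false | _ = refl
    t₂ : T (X 𝒳 i u ∧ X 𝒳 i v)
    t₂ = T∧ʳ {not (adj G u v)} t₁
    Xu : T (X 𝒳 i u)
    Xu = T∧ˡ t₂
    Xv : T (X 𝒳 i v)
    Xv = T∧ʳ {X 𝒳 i u} t₂

  lam-edge : ∀ {i x y} → T (active i) → T (X 𝒳 i y) → T (adj G x y) → lam i x ≡ emb (up x y)
  lam-edge {i} {x} {y} act Xy t with view x
  ... | old p q = trans (lam-old i p q) (cong emb (sym (up-old (p , q) y)))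
  ... | isA refl = trans (lam-a i) (trans (label-side (SA i) (σ y) (SA⁺ (y , Xy , t , refl)) (proj₁ (active-one-sided act))) (cong emb (sym (up-a y))))
  ... | isB refl = trans (lam-b i) (trans (label-side (SB i) (τ y) (SB⁺ (y , Xy , t , refl)) (proj₂ (active-one-sided act))) (cong emb (sym (up-b y))))

  label-cong : ∀ {spare p q} (s s′ : Bool → Bool) → (∀ t → s t ≡ s′ t) → label spare p q s ≡ label spare p q s′
  label-cong s s′ h rewrite h true | h false = refl

  AB : Fin n → Fin n → Set
  AB x y = (x ≡ a × y ≡ b) ⊎ (x ≡ b × y ≡ a)

  lam-shared : ∀ {i j x y} → x ≢ y → ¬ AB x y → adj G x y ≡ false → T (X 𝒳 i x) → T (X 𝒳 i y) → T (X 𝒳 j x) → T (X 𝒳 j y) → lam i x ≡ lam j x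
  lam-shared {i} {j} {x} {y} x≢y nab ne Xix Xiy Xjx Xjy with i ≟ j
  ... | yes refl = refl
  ... | no i≢j with view x
  ...   | old p q = trans (lam-old i p q) (sym (lam-old j p q))
  ...   | isA refl = trans (lam-a i) (trans (label-cong (SA i) (SA j) (λ t → T-ext
            (λ h → SA⁺ (HA.S2 i j y i≢j (x≢y ∘ sym) (λ e → nab (inj₁ (refl , e))) ne (meet i j i≢j Xix Xiy Xjx Xjy) t (SA⁻ h)))
            (λ h → SA⁺ (HA.S2 j i y (i≢j ∘ sym) (x≢y ∘ sym) (λ e → nab (inj₁ (refl , e))) ne (meet j i (i≢j ∘ sym) Xjx Xjy Xix Xiy) t (SA⁻ h))))) (sym (lam-a j)))
    where meet : ∀ i j → i ≢ j → T (X 𝒳 i a) → T (X 𝒳 i y) → T (X 𝒳 j a) → T (X 𝒳 j y) → Meets (X 𝒳 i) (X 𝒳 j) a y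
          meet i j i≢j p q r s = thin⇒meets {A = X 𝒳 i} {X 𝒳 j} (TwoThin.thin twoThin i j i≢j) x≢y p q r s
  ...   | isB refl = trans (lam-b i) (trans (label-cong (SB i) (SB j) (λ t → T-ext
            (λ h → SB⁺ (HB.S2 i j y i≢j (x≢y ∘ sym) (λ e → nab (inj₂ (refl , e))) ne (meet i j i≢j Xix Xiy Xjx Xjy) t (SB⁻ h)))
            (λ h → SB⁺ (HB.S2 j i y (i≢j ∘ sym) (x≢y ∘ sym) (λ e → nab (inj₂ (refl , e))) ne (meet j i (i≢j ∘ sym) Xjx Xjy Xix Xiy) t (SB⁻ h))))) (sym (lam-b j)))
    where meet : ∀ i j → i ≢ j → T (X 𝒳 i b) → T (X 𝒳 i y) → T (X 𝒳 j b) → T (X 𝒳 j y) → Meets (X 𝒳 i) (X 𝒳 j) b y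
          meet i j i≢j p q r s = thin⇒meets {A = X 𝒳 i} {X 𝒳 j} (TwoThin.thin twoThin i j i≢j) x≢y p q r s

  E : Fin (k 𝒳) → PairSet n
  E i = Within (X 𝒳 i) (λ u v → adj G u v ∨ Sh u v)

  Pᵢ : Fin (k 𝒳) → PairSet n
  Pᵢ i = Within (X 𝒳 i) Sh

  Pᵢ⊂E : ∀ i u v → T (Pᵢ i u v) → T (E i u v)
  Pᵢ⊂E i = within-⊂ (X 𝒳 i) {Sh} (λ u v → T∨⁺ʳ {adj G u v})

  Sh-independent : Independent (edgeList Sh)
  Sh-independent = indepPairs⇒edgeList (shared-sym 𝒳) (shared-irr 𝒳) indep𝒳

  opaque
   fr : ∀ i → Frame (E i) (Pᵢ i) (rs i)
   fr i = frame (Pᵢ⊂E i) (independent-⊆ (edgeList-⊆ (within⇒ (X 𝒳 i) {Sh})) Sh-independent) (rank-cluster i)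

  T̂ : Fin (k 𝒳) → List (Pair n)
  T̂ i = Frame.T̂ (fr i)

  lifted : Fin (k 𝒳) → List (Pair (suc (suc m)))
  lifted i = if active i then map (map² (lam i)) (T̂ i) else map (map² emb ∘ lift) (T̂ i)

  length-lifted : ∀ i → length (lifted i) ≡ length (T̂ i)
  length-lifted i with active i
  ... | true = Listₚ.length-map _ (T̂ i)
  ... | false = Listₚ.length-map _ (T̂ i)

  isAB : Pair n → Bool
  isAB (x , y) = ((x == a) ∧ (y == b)) ∨ ((x == b) ∧ (y == a))

  isAB⁻ : ∀ {x y} → T (isAB (x , y)) → AB x y
  isAB⁻ {x} {y} t with T∨⁻ {(x == a) ∧ (y == b)} t
  ... | inj₁ h = inj₁ (==⁻ (T∧ˡ h) , ==⁻ (T∧ʳ {x == a} h))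
  ... | inj₂ h = inj₂ (==⁻ (T∧ˡ h) , ==⁻ (T∧ʳ {x == b} h))

  isAB⁺ : ∀ {x y} → AB x y → T (isAB (x , y))
  isAB⁺ {x} {y} (inj₁ (p , q)) = T∨⁺ˡ {(x == a) ∧ (y == b)} (T∧⁺ (==⁺ p) (==⁺ q))
  isAB⁺ {x} {y} (inj₂ (p , q)) = T∨⁺ʳ {(x == a) ∧ (y == b)} (T∧⁺ (==⁺ p) (==⁺ q))

  Sh′ : List (Pair n)
  Sh′ = filterᵇ (not ∘ isAB) (edgeList Sh)

  length-Sh′ : suc (length Sh′) ℕ.≤ numPairs Sh
  length-Sh′ = subst (suc (length Sh′) ℕ.≤_) (trans (length-filterᵇ-not isAB (edgeList Sh)) (length-edgeList Sh)) (ℕₚ.+-monoˡ-≤ (length Sh′) nonempty)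
    where
    positive : ∀ {A : Set} {x : A} {L} → x ∈ L → 1 ℕ.≤ length L
    positive (here _) = s≤s z≤n
    positive (there _) = s≤s z≤n
    nonempty : 1 ℕ.≤ length (filterᵇ isAB (edgeList Sh))
    nonempty with edgeList-covers (shared-sym 𝒳) (shared-irr 𝒳) a b shared
    ... | inj₁ mem = positive (Memₚ.∈-filter⁺ _ mem (isAB⁺ (inj₁ (refl , refl))))
    ... | inj₂ mem = positive (Memₚ.∈-filter⁺ _ mem (isAB⁺ (inj₂ (refl , refl))))

  Lifts : Pair n → Pair (suc (suc m)) → Set
  Lifts (x , y) ê = (T (adj G x y) → map² emb (lift (x , y)) ≡ ê) ×
    (∀ i → T (active i) → T (X 𝒳 i x) → T (X 𝒳 i y) → map² (lam i) (x , y) ≡ ê)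

  common-lift : ∀ {e} → e ∈ Sh′ → ∃ (Lifts e)
  common-lift {x , y} mem with Memₚ.∈-filter⁻ _ {xs = edgeList Sh} mem
  ... | mS , nab with shared⁻ {𝒳 = 𝒳} (proj₁ (∈-edgeList⁻ {E = Sh} mS)) | adj G x y in e
  ...   | isShared x≢y i j i≢j ms | true = map² emb (lift (x , y)) , (λ _ → refl) , λ i act Xx Xy →
          cong₂ _,_ (lam-edge act Xy (≡⇒T e)) (lam-edge act Xx (subst T (adj-sym G x y) (≡⇒T e)))
  ...   | isShared x≢y i₀ j i≢j ms | false = map² (lam i₀) (x , y) , (λ ()) , λ i act Xx Xy →
          cong₂ _,_ (lam-shared x≢y not-AB e Xx Xy X₀x X₀y) (lam-shared (x≢y ∘ sym) (not-AB ∘ swap-AB) (trans (adj-sym G y x) e) Xy Xx X₀y X₀x)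
    where
    X₀x : T (X 𝒳 i₀ x)
    X₀x = proj₁ (meets-u {A = X 𝒳 i₀} {X 𝒳 j} ms)
    X₀y : T (X 𝒳 i₀ y)
    X₀y = proj₁ (meets-v {A = X 𝒳 i₀} {X 𝒳 j} ms)
    not-AB : ¬ AB x y
    not-AB h = not⁻ nab (isAB⁺ h)
    swap-AB : AB y x → AB x y
    swap-AB (inj₁ (p , q)) = inj₂ (q , p)
    swap-AB (inj₂ (p , q)) = inj₁ (q , p)

  opaque
    chosen-lifts : ∃ λ M → length M ≡ length Sh′ × (∀ {e} → e ∈ Sh′ → ∃ λ ê → ê ∈ M × Lifts e ê)
    chosen-lifts = choose-list Sh′ common-lift

  P̂ : List (Pair (suc (suc m)))
  P̂ = proj₁ chosen-lifts

  spareStars : List (Star (suc (suc m)))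
  spareStars = (A₀ , B₀ ∷ emb b1 ∷ emb b2 ∷ []) ∷ (B₀ , emb a1 ∷ emb a2 ∷ []) ∷ []

  Z : List (Pair (suc (suc m)))
  Z = stars spareStars []

  keys : List (Pair (suc (suc m)))
  keys = map (map² emb) Kt

  big : List (Pair (suc (suc m)))
  big = (concatF lifted ++ P̂) ++ (Z ++ keys)

  in-lifted : ∀ i {e} → e ∈ lifted i → e ∈ big
  in-lifted i mem = Memₚ.∈-++⁺ˡ (Memₚ.∈-++⁺ˡ (∈-concatF lifted i mem))
  in-P̂ : ∀ {e} → e ∈ P̂ → e ∈ big
  in-P̂ mem = Memₚ.∈-++⁺ˡ (Memₚ.∈-++⁺ʳ (concatF lifted) mem)
  in-Z : ∀ {e} → e ∈ Z → e ∈ big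
  in-Z mem = Memₚ.∈-++⁺ʳ (concatF lifted ++ P̂) (Memₚ.∈-++⁺ˡ mem)
  in-keys : ∀ {e} → e ∈ Kt → map² emb e ∈ big
  in-keys mem = Memₚ.∈-++⁺ʳ (concatF lifted ++ P̂) (Memₚ.∈-++⁺ʳ Z (Memₚ.∈-map⁺ (map² emb) mem))

  EitherIn : List (Pair (suc (suc m))) → Pair (suc (suc m)) → Set
  EitherIn L (u , v) = (u , v) ∈ L ⊎ (v , u) ∈ L

  ab-in-big : ∀ i → T (X 𝒳 i a) → T (X 𝒳 i b) → EitherIn big (labA i , labB i)
  ab-in-big i Xa Xb = by-label (labA-view i) (labB-view i)
    where
    by-label : ∀ {l l′} → Label A₀ copyA (SA i) l → Label B₀ copyB (SB i) l′ → EitherIn big (l , l′)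
    by-label (none refl) (none refl) = inj₁ (in-Z (here refl))
    by-label (none refl) (side true _ refl) = inj₁ (in-Z (there (here refl)))
    by-label (none refl) (side false _ refl) = inj₁ (in-Z (there (there (here refl))))
    by-label (side true _ refl) (none refl) = inj₂ (in-Z (there (there (there (here refl)))))
    by-label (side false _ refl) (none refl) = inj₂ (in-Z (there (there (there (there (here refl))))))
    by-label (side s hs refl) (side t ht refl) = inj₁ (in-keys (key-∈ s t (anyF⁺ i (T∧⁺ Xa (T∧⁺ Xb (T∧⁺ hs ht))))))

  in-Sh′ : ∀ {x y} → (x , y) ∈ edgeList Sh → isAB (x , y) ≡ false → (x , y) ∈ Sh′
  in-Sh′ mS e = Memₚ.∈-filter⁺ (Boolₚ.T? ∘ not ∘ isAB) mS (subst (T ∘ not) (sym e) tt)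

  in-Sh : ∀ i {x y} → (x , y) ∈ edgeList (Pᵢ i) → (x , y) ∈ edgeList Sh × T (X 𝒳 i x) × T (X 𝒳 i y)
  in-Sh i {x} {y} mP = let t , lt = ∈-edgeList⁻ {E = Pᵢ i} mP in
    ∈-edgeList⁺ {E = Sh} lt (within⇒ (X 𝒳 i) {Sh} x y t) , T∧ˡ t , T∧ˡ (T∧ʳ {X 𝒳 i x} t)

  lifts-in-big : ∀ {x y} → (x , y) ∈ edgeList Sh → isAB (x , y) ≡ false → ∃ λ ê → ê ∈ big × Lifts (x , y) ê
  lifts-in-big mS e = let ê , mê , l = proj₂ (proj₂ chosen-lifts) (in-Sh′ mS e) in ê , in-P̂ mê , l

  lifted-active : ∀ i → T (active i) → ∀ {e} → e ∈ T̂ i → map² (lam i) e ∈ lifted i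
  lifted-active i act mT with active i | act
  ... | true | _ = Memₚ.∈-map⁺ (map² (lam i)) mT

  lifted-passive : ∀ i → active i ≡ false → ∀ {e} → e ∈ T̂ i → map² emb (lift e) ∈ lifted i
  lifted-passive i pas mT with active i | pas
  ... | false | _ = Memₚ.∈-map⁺ (map² emb ∘ lift) mT

  shared-in-big : ∀ i → T (active i) → ∀ {x y} → (x , y) ∈ edgeList Sh × T (X 𝒳 i x) × T (X 𝒳 i y) → ∀ c → isAB (x , y) ≡ c →
    EitherIn big (lam i x , lam i y)
  shared-in-big i act (mS , Xx , Xy) false e = let ê , mê , _ , l = lifts-in-big mS e in inj₁ (subst (_∈ big) (sym (l i act Xx Xy)) mê)
  shared-in-big i act {x} {y} (mS , Xx , Xy) true e = by-ab (isAB⁻ {x} {y} (≡⇒T e))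
    where
    by-ab : AB x y → EitherIn big (lam i x , lam i y)
    by-ab (inj₁ (refl , refl)) = subst₂ (λ u v → EitherIn big (u , v)) (sym (lam-a i)) (sym (lam-b i)) (ab-in-big i Xx Xy)
    by-ab (inj₂ (refl , refl)) = subst₂ (λ u v → EitherIn big (u , v)) (sym (lam-b i)) (sym (lam-a i)) (Data.Sum.swap (ab-in-big i Xy Xx))

  base-in-big : ∀ i → T (active i) → ∀ {x y} → (x , y) ∈ T̂ i ++ edgeList (Pᵢ i) → EitherIn big (lam i x , lam i y)
  base-in-big i act mem = [ (λ mT → inj₁ (in-lifted i (lifted-active i act mT))) , (λ mP → shared-in-big i act (in-Sh i mP) _ refl) ]′ (Memₚ.∈-++⁻ (T̂ i) mem)

  passive-edges : ∀ i → active i ≡ false → ∀ u v → T (E i u v) → T (adj G u v)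
  passive-edges i pas u v t with adj G u v in e
  ... | true = tt
  ... | false = ⊥-elim (≡⇒¬T pas (active⁺ i (T∧ʳ {X 𝒳 i v} (T∧ʳ {X 𝒳 i u} t)) e (T∧ˡ t) (T∧ˡ (T∧ʳ {X 𝒳 i u} t))))

  passive-in-base : ∀ i → active i ≡ false → ∀ {x y} → T (E i x y) → (x , y) ∈ T̂ i ++ edgeList (Pᵢ i) ⊎ (y , x) ∈ T̂ i ++ edgeList (Pᵢ i)
  passive-in-base i pas {x} {y} t with generic (edgeList (adj G) ∷ (T̂ i ++ edgeList (Pᵢ i)) ∷ []) (indepPairs⇒edgeList (adj-sym G) (irr G) indepG ∷ Frame.indep (fr i) ∷ [])
  ... | p , liE ∷ liB ∷ [] = edge-in-span⇒∈ (adj-sym G) (irr G) liE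
      (Allₚ.++⁺ (All.map (λ {(u , v)} → passive-edges i pas u v) (Frame.T̂⊂E (fr i))) (All.map (λ {(u , v)} h → passive-edges i pas u v (Pᵢ⊂E i u v h)) (edgeList-InSet (Pᵢ i))))
      (passive-edges i pas x y t) (frame-span (Pᵢ⊂E i) (rank-cluster i) (fr i) liB t)

  edge-not-ab : ∀ {x y} → T (adj G x y) → isAB (x , y) ≡ false
  edge-not-ab {x} {y} t = ¬T⇒≡ λ h → by-ab (isAB⁻ {x} {y} h) t
    where
    by-ab : AB x y → ¬ T (adj G x y)
    by-ab (inj₁ (refl , refl)) = ≡⇒¬T nonedge
    by-ab (inj₂ (refl , refl)) t = ≡⇒¬T nonedge (subst T (adj-sym G b a) t)

  passive-in-big : ∀ i → active i ≡ false → ∀ {x y} → T (adj G x y) → (x , y) ∈ T̂ i ++ edgeList (Pᵢ i) → map² emb (lift (x , y)) ∈ big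
  passive-in-big i pas t mem = [ (λ mT → in-lifted i (lifted-passive i pas mT)) ,
    (λ mP → let ê , mê , l , _ = lifts-in-big (proj₁ (in-Sh i mP)) (edge-not-ab t) in subst (_∈ big) (sym (l t)) mê) ]′ (Memₚ.∈-++⁻ (T̂ i) mem)

  edge-in-span : ∀ {q} → (∀ i → IndepAt q (map (map² (lam i)) (T̂ i ++ edgeList (Pᵢ i)))) → ∀ {x y} → T (adj G x y) → SpanAt q big (map² emb (lift (x , y)))
  edge-in-span {q} li {x} {y} t with TwoThin.covers twoThin x y t
  ... | i , Xx , Xy = by-activity (active i) refl
    where
    xy∈E : T (E i x y)
    xy∈E = within⁺ (X 𝒳 i) (λ u v → adj G u v ∨ Sh u v) Xx Xy (T∨⁺ˡ t)
    by-activity : ∀ c → active i ≡ c → SpanAt q big (map² emb (lift (x , y)))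
    by-activity true act = subst₂ (λ u v → SpanAt q big (u , v)) (lam-edge (≡⇒T act) Xy t) (lam-edge (≡⇒T act) Xx (subst T (adj-sym G x y) t))
      (span-trans {L = map (map² (lam i)) (T̂ i ++ edgeList (Pᵢ i))} from-base (span-push (lam i) q (frame-span (Pᵢ⊂E i) (rank-cluster i) (fr i) (indep-fold (lam i) q (li i)) xy∈E)))
      where
      from-base : ∀ {e} → e ∈ map (map² (lam i)) (T̂ i ++ edgeList (Pᵢ i)) → SpanAt q big e
      from-base me with Memₚ.∈-map⁻ (map² (lam i)) me
      ... | (u , v) , muv , refl = span-either (base-in-big i (≡⇒T act) muv)
    by-activity false pas with passive-in-base i pas xy∈E
    ... | inj₁ mem = span-∈ (passive-in-big i pas t mem)
    ... | inj₂ mem = span-either (inj₂ (passive-in-big i pas (subst T (adj-sym G x y) t) mem))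

  count-G : numPairs (adj G) ≡ sumℕ (λ i → length (T̂ i)) ℕ.+ numPairs Sh
  count-G = ℕₚ.+-cancelʳ-≡ (sumℕ ss) (numPairs (adj G)) (sumℕ (λ i → length (T̂ i)) ℕ.+ numPairs Sh) (trans (cong (ℕ._+ sumℕ ss) (hasRank-unique {E = adj G} indepG rank-G))
    (trans count (trans (cong (ℕ._+ numPairs Sh) (trans (sumℕ-cong (λ i → trans (sym (Frame.size (fr i))) (cong (length (T̂ i) ℕ.+_) (ss≡ i))))
      (sumℕ-+ (λ i → length (T̂ i)) ss))) (solve 3 (λ x y w → x :+ y :+ w := x :+ w :+ y) refl (sumℕ (λ i → length (T̂ i))) (sumℕ ss) (numPairs Sh)))))
    where
    open ℕSolver.+-*-Solver
    rank-G : HasRank (adj G) z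
    rank-G = hasRank-cong (λ u v → T-ext (T∧ˡ {adj G u v}) (λ t → T∧⁺ t (let i , Xu , Xv = TwoThin.covers twoThin u v t in anyF⁺ i (T∧⁺ Xu Xv)))) rank-inside
    ss≡ : ∀ i → numPairs (Pᵢ i) ≡ ss i
    ss≡ i = hasRank-unique {E = Pᵢ i} (indepPairs-⊆ (within-sym {A = X 𝒳 i} {Sh} (shared-sym 𝒳)) (within-irr {A = X 𝒳 i} {Sh} (shared-irr 𝒳)) (shared-sym 𝒳) (shared-irr 𝒳)
      (within⇒ (X 𝒳 i) {Sh}) indep𝒳) (rank-shared i)

  rank-bound : ∀ {L} → Independent L → All (λ e → InSet (adj Gs) e ⊎ e ∈ Kt ⊎ swap e ∈ Kt) L → suc (length L) ℕ.≤ numPairs (adj G) ℕ.+ length Kt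
  rank-bound {L} hL L⊂ = bound (generic (L^ ∷ tabulate bases) (L^-independent ∷ Allₚ.tabulate⁺ (λ i → independent-embed (lam-inj i) (Frame.indep (fr i)))))
    where
    L^ : List (Pair (suc (suc m)))
    L^ = stars spareStars (map (map² emb) L)
    bases : Fin (k 𝒳) → List (Pair (suc (suc m)))
    bases i = map (map² (lam i)) (T̂ i ++ edgeList (Pᵢ i))
    L^-independent : Independent L^
    L^-independent = stars-independent spareStars
      ( ((λ ()) ∷ (λ ()) ∷ (λ ()) ∷ []) AllPairs.∷ ((λ ()) ∷ (λ ()) ∷ []) AllPairs.∷ ((b1≢b2 ∘ emb-inj) ∷ []) AllPairs.∷ [] AllPairs.∷ AllPairs.[]
      , ℕₚ.≤-refl , (((λ ()) , λ ()) ∷ ((λ ()) , λ ()) ∷ Allₚ.map⁺ (All.tabulate (λ _ → (λ ()) , λ ())))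
      , ((λ ()) ∷ (λ ()) ∷ []) AllPairs.∷ ((a1≢a2 ∘ emb-inj) ∷ []) AllPairs.∷ [] AllPairs.∷ AllPairs.[]
      , s≤s (s≤s z≤n) , Allₚ.map⁺ (All.tabulate (λ _ → (λ ()) , λ ()))
      , tt)
      (independent-embed emb-inj hL)
    bound : (∃ λ q → All (IndepAt q) (L^ ∷ tabulate bases)) → suc (length L) ℕ.≤ numPairs (adj G) ℕ.+ length Kt
    bound (q , liL ∷ libs) = ℕₚ.+-cancelˡ-≤ 5 (suc (length L)) (numPairs (adj G) ℕ.+ length Kt)
      (subst₂ ℕ._≤_ (cong (6 ℕ.+_) (Listₚ.length-map (map² emb) L)) refl
        (ℕₚ.≤-trans (s≤s (steinitz liL in-span)) (ℕₚ.≤-trans (ℕₚ.≤-reflexive len) (ℕₚ.≤-trans (ℕₚ.+-monoˡ-≤ (5 ℕ.+ length Kt) (ℕₚ.+-monoʳ-≤ (sumℕ (λ i → length (T̂ i))) length-Sh′))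
          (ℕₚ.≤-reflexive (trans (cong (ℕ._+ (5 ℕ.+ length Kt)) (sym count-G)) (solve 2 (λ x y → x :+ (con 5 :+ y) := con 5 :+ (x :+ y)) refl (numPairs (adj G)) (length Kt))))))))
      where
      open ℕSolver.+-*-Solver
      in-span : ∀ {e} → e ∈ L^ → SpanAt q big e
      in-span (here e) = span-∈ (in-Z (here e))
      in-span (there (here e)) = span-∈ (in-Z (there (here e)))
      in-span (there (there (here e))) = span-∈ (in-Z (there (there (here e))))
      in-span (there (there (there (here e)))) = span-∈ (in-Z (there (there (there (here e)))))
      in-span (there (there (there (there (here e))))) = span-∈ (in-Z (there (there (there (there (here e))))))
      in-span (there (there (there (there (there mem))))) with Memₚ.∈-map⁻ (map² emb) mem
      ... | (y , w) , myw , refl with All.lookup L⊂ myw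
      ...   | inj₂ (inj₁ mK) = span-∈ (in-keys mK)
      ...   | inj₂ (inj₂ mK) = span-either (inj₂ (in-keys mK))
      ...   | inj₁ t with edge-below t
      ...     | below x x′ e refl refl = edge-in-span (Allₚ.tabulate⁻ libs) e
      len : suc (length big) ≡ sumℕ (λ i → length (T̂ i)) ℕ.+ suc (length Sh′) ℕ.+ (5 ℕ.+ length Kt)
      len = trans (cong suc (trans (Listₚ.length-++ (concatF lifted ++ P̂)) (cong₂ ℕ._+_
          (trans (Listₚ.length-++ (concatF lifted)) (cong₂ ℕ._+_ (trans (length-concatF lifted) (sumℕ-cong length-lifted)) (proj₁ (proj₂ chosen-lifts))))
          (cong (5 ℕ.+_) (Listₚ.length-map (map² emb) Kt)))))
        (solve 3 (λ x y w → con 1 :+ (x :+ y :+ w) := x :+ (con 1 :+ y) :+ w) refl (sumℕ (λ i → length (T̂ i))) (length Sh′) (5 ℕ.+ length Kt))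

-- The glued graph is independent: fold it onto G with one wing attached.

stars-indepAt : ∀ {n} (q : Placement n) r {L} → Degenerate r L → All (λ (w , xs) → IndepAt q (clique (w ∷ xs))) r →
  IndepAt q L → IndepAt q (stars r L)
stars-indepAt q [] _ [] li = li
stars-indepAt q ((w , xs) ∷ r) (w≢ AllPairs.∷ _ , _ , avoid , d) (K ∷ Ks) li =
  star-extend q K (All.map (λ ne e → ne (sym e)) w≢) avoid (stars-indepAt q r d Ks li)

db-degenerate : Degenerate dbStars []
db-degenerate = toWitness {a? = degenerate? dbStars []} tt

DB-list : List (Pair 8)
DB-list = stars dbStars []

db-covers : Covers DB-list (adj DB)
db-covers u v = toWitness {a? = Finₚ.all? λ u → Finₚ.all? λ v → Boolₚ.T? (adj DB u v) →-dec either? u v DB-list} tt u v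

db-in : All (InSet (adj DB)) DB-list
db-in = toWitness {a? = All.all? (λ (u , v) → Boolₚ.T? (adj DB u v)) DB-list} tt

db-glue-nonadj : ∀ x y → T (dbGlue x) → T (dbGlue y) → ¬ T (adj DB x y)
db-glue-nonadj = toWitness {a? = Finₚ.all? λ x → Finₚ.all? λ y → Boolₚ.T? (dbGlue x) →-dec (Boolₚ.T? (dbGlue y) →-dec ¬? (Boolₚ.T? (adj DB x y)))} tt

module Glued {n m N} {G : Graph n} {a b} {Gs : Graph m} {φ : Fin n → Fin m} {a1 a2 b1 b2} {G′ : Graph N}
             {ψ : Fin m → Fin N} {χ : Fin 8 → Fin N} (indG : IndependentGraph G)
             (NS : NonedgeSplit G a b Gs φ a1 a2 b1 b2) (D : GlueDB Gs a1 a2 b1 b2 G′ ψ χ) where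
  open Lift NS
  open NonedgeSplit NS using (a≢b; adjNew)
  open GlueDB D
  open UnionVia union using (edges⇒; ⇒edges)

  ψ-inj : Injective _≡_ _≡_ ψ
  ψ-inj = UnionVia.inj₁ union
  χ-inj : Injective _≡_ _≡_ χ
  χ-inj = UnionVia.inj₂ union

  glue : Fin 8 → Fin m
  glue = glueMap a1 b1 a2 b2

  base : Fin n → Fin (suc (suc (suc n)))
  base x = suc (suc (suc x))

  ĉ û v̂ : Fin (suc (suc (suc n)))
  ĉ = 0f
  û = 1f
  v̂ = 2f

  tab : Fin 8 → Fin (suc (suc (suc n)))
  tab 0f = base a
  tab 1f = base b
  tab 2f = base a
  tab 3f = base b
  tab 4f = û
  tab 5f = v̂
  tab 6f = ĉ
  tab 7f = ĉ

  tab-glue : ∀ y → T (dbGlue y) → tab y ≡ base (π (glue y))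
  tab-glue 0f _ = cong base (sym π-a1)
  tab-glue 1f _ = cong base (sym π-b1)
  tab-glue 2f _ = cong base (sym π-a2)
  tab-glue 3f _ = cong base (sym π-b2)
  tab-glue 4f ()
  tab-glue 5f ()
  tab-glue 6f ()
  tab-glue 7f ()

  Π : Fin N → Fin (suc (suc (suc n)))
  Π z with UnionVia.onto union z
  ... | inj₁ (y , _) = base (π y)
  ... | inj₂ (y , _) = tab y

  Π-ψ : ∀ y → Π (ψ y) ≡ base (π y)
  Π-ψ y with UnionVia.onto union (ψ y)
  ... | inj₁ (y′ , e) = cong (base ∘ π) (ψ-inj e)
  ... | inj₂ (y′ , e) with meet y y′ (sym e)
  ...   | g , refl = tab-glue y′ g

  Π-χ : ∀ y → Π (χ y) ≡ tab y
  Π-χ y with UnionVia.onto union (χ y)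
  ... | inj₂ (y′ , e) = cong tab (χ-inj e)
  ... | inj₁ (y′ , e) with meet y′ y e
  ...   | g , refl = sym (tab-glue y g)

  wingStars : List (Star (suc (suc (suc n))))
  wingStars = (û , base a ∷ base b ∷ ĉ ∷ []) ∷ (v̂ , base a ∷ base b ∷ ĉ ∷ []) ∷ (ĉ , base a ∷ base b ∷ []) ∷ []

  wing EB : List (Pair (suc (suc (suc n))))
  wing = stars wingStars []
  EB = map (map² base) EL

  base-inj : Injective _≡_ _≡_ base
  base-inj refl = refl

  a≢b′ : base a ≢ base b
  a≢b′ e = a≢b (base-inj e)

  wing-degenerate : Degenerate wingStars EB
  wing-degenerate =
    ((λ ()) ∷ (λ ()) ∷ (λ ()) ∷ []) AllPairs.∷ (a≢b′ ∷ (λ ()) ∷ []) AllPairs.∷ ((λ ()) ∷ []) AllPairs.∷ [] AllPairs.∷ AllPairs.[] , ℕₚ.≤-refl ,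
    ((λ ()) , λ ()) ∷ ((λ ()) , λ ()) ∷ ((λ ()) , λ ()) ∷ ((λ ()) , λ ()) ∷ ((λ ()) , λ ()) ∷ Allₚ.map⁺ (All.tabulate (λ _ → (λ ()) , λ ())) ,
    ((λ ()) ∷ (λ ()) ∷ (λ ()) ∷ []) AllPairs.∷ (a≢b′ ∷ (λ ()) ∷ []) AllPairs.∷ ((λ ()) ∷ []) AllPairs.∷ [] AllPairs.∷ AllPairs.[] , ℕₚ.≤-refl ,
    ((λ ()) , λ ()) ∷ ((λ ()) , λ ()) ∷ Allₚ.map⁺ (All.tabulate (λ _ → (λ ()) , λ ())) ,
    ((λ ()) ∷ (λ ()) ∷ []) AllPairs.∷ (a≢b′ ∷ []) AllPairs.∷ [] AllPairs.∷ AllPairs.[] , s≤s (s≤s z≤n) ,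
    Allₚ.map⁺ (All.tabulate (λ _ → (λ ()) , λ ())) , tt

  wing-cliques : List (List (Pair (suc (suc (suc n)))))
  wing-cliques = map (λ (w , xs) → clique (w ∷ xs)) wingStars

  db-cliques : List (List (Pair (suc (suc (suc n)))))
  db-cliques = map (λ (w , xs) → clique (tab w ∷ map tab xs)) dbStars

  wing-cliques-independent : All Independent wing-cliques
  wing-cliques-independent = let u₁ , _ , _ , u₂ , _ , _ , u₃ , _ = wing-degenerate in
    clique-independent u₁ ℕₚ.≤-refl ∷ clique-independent u₂ ℕₚ.≤-refl ∷ clique-independent u₃ (s≤s (s≤s (s≤s z≤n))) ∷ []

  db-cliques-independent : All Independent db-cliques
  db-cliques-independent = big a ∷ big b ∷ big a ∷ big b ∷ small ∷ small ∷ []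
    where
    big : ∀ x → Independent (clique (base x ∷ û ∷ v̂ ∷ ĉ ∷ []))
    big x = clique-independent (((λ ()) ∷ (λ ()) ∷ (λ ()) ∷ []) AllPairs.∷ ((λ ()) ∷ (λ ()) ∷ []) AllPairs.∷ ((λ ()) ∷ []) AllPairs.∷ [] AllPairs.∷ AllPairs.[]) ℕₚ.≤-refl
    small : Independent (clique (ĉ ∷ û ∷ v̂ ∷ []))
    small = clique-independent (((λ ()) ∷ (λ ()) ∷ []) AllPairs.∷ ((λ ()) ∷ []) AllPairs.∷ [] AllPairs.∷ AllPairs.[]) (s≤s (s≤s (s≤s z≤n)))

  GL : List (Pair N)
  GL = map (map² ψ) E^ ++ map (map² χ) DB-list

  folded-wing : All (λ (u , v) → (tab u , tab v) ∈ wing ⊎ (tab v , tab u) ∈ wing) DB-list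
  folded-wing = inj₂ m₀ ∷ inj₂ m₃ ∷ inj₂ m₆ ∷ inj₂ m₁ ∷ inj₂ m₄ ∷ inj₂ m₇ ∷ inj₂ m₀ ∷ inj₂ m₃ ∷ inj₂ m₆ ∷ inj₂ m₁ ∷ inj₂ m₄ ∷ inj₂ m₇
    ∷ inj₂ m₂ ∷ inj₂ m₅ ∷ inj₂ m₂ ∷ inj₂ m₅ ∷ []
    where
    m₀ : (û , base a) ∈ wing
    m₀ = here refl
    m₁ : (û , base b) ∈ wing
    m₁ = there (here refl)
    m₂ : (û , ĉ) ∈ wing
    m₂ = there (there (here refl))
    m₃ : (v̂ , base a) ∈ wing
    m₃ = there (there (there (here refl)))
    m₄ : (v̂ , base b) ∈ wing
    m₄ = there (there (there (there (here refl))))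
    m₅ : (v̂ , ĉ) ∈ wing
    m₅ = there (there (there (there (there (here refl)))))
    m₆ : (ĉ , base a) ∈ wing
    m₆ = there (there (there (there (there (there (here refl))))))
    m₇ : (ĉ , base b) ∈ wing
    m₇ = there (there (there (there (there (there (there (here refl)))))))

  GL-indepAt : ∀ p → IndepAt p EB → All (IndepAt p) wing-cliques → All (IndepAt p) db-cliques → IndepAt (p ∘ Π) GL
  GL-indepAt p liE liW liD = indep-modulo (push-linear Π) {row (p ∘ Π)} {row p} (map² Π) (map (map² ψ) E^) {map (map² χ) DB-list} {wing}
    (λ {e} _ → push-row Π p e) folds
    (subst (λ M → IndepAt p (M ++ wing)) (sym fold-E) (indep-rearrange search-coord {stars wingStars EB} {EB ++ wing} wing-indep to (ℕₚ.≤-reflexive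
      (trans (Listₚ.length-++ EB) (ℕₚ.+-comm (length EB) 8)))))
    (indep-embed χ-inj (p ∘ Π) (indep-resp (row-resp (λ x → cong p (sym (Π-χ x)))) (stars-indepAt (p ∘ tab) dbStars db-degenerate (db-at liD) indep-[])))
    where
    fold-E : map (map² Π) (map (map² ψ) E^) ≡ EB
    fold-E = trans (sym (Listₚ.map-∘ E^)) (trans (Listₚ.map-cong (λ (u , v) → cong₂ _,_ (Π-ψ u) (Π-ψ v)) E^) (trans (Listₚ.map-∘ E^) (cong (map (map² base)) π-E^)))
    wing-indep : IndepAt p (stars wingStars EB)
    wing-indep = stars-indepAt p wingStars wing-degenerate (Allₚ.map⁻ liW) liE
    to : ∀ {e} → e ∈ wing ++ EB → e ∈ EB ++ wing
    to m = [ Memₚ.∈-++⁺ʳ EB , Memₚ.∈-++⁺ˡ ]′ (Memₚ.∈-++⁻ wing m)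
    folds : ∀ {e} → e ∈ map (map² χ) DB-list → InSpan (row p) wing (push Π (row (p ∘ Π) e))
    folds m with Memₚ.∈-map⁻ (map² χ) m
    ... | (u , v) , mD , refl = span-cong (λ i → sym (push-row Π p (χ u , χ v) i))
      (subst₂ (λ x y → SpanAt p wing (x , y)) (sym (Π-χ u)) (sym (Π-χ v)) (span-either {L = wing} (All.lookup folded-wing mD)))
    db-at : All (IndepAt p) db-cliques → All (λ (w , xs) → IndepAt (p ∘ tab) (clique (w ∷ xs))) dbStars
    db-at (k₁ ∷ k₂ ∷ k₃ ∷ k₄ ∷ k₅ ∷ k₆ ∷ []) = indep-fold tab p k₁ ∷ indep-fold tab p k₂ ∷ indep-fold tab p k₃ ∷ indep-fold tab p k₄ ∷ indep-fold tab p k₅ ∷ indep-fold tab p k₆ ∷ []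

  GL-independent : Independent GL
  GL-independent = from-generic (generic (EB ∷ wing-cliques ++ db-cliques)
      (independent-embed base-inj (indepPairs⇒edgeList (adj-sym G) (irr G) indG) ∷ Allₚ.++⁺ wing-cliques-independent db-cliques-independent))
    where
    from-generic : (∃ λ p → All (IndepAt p) (EB ∷ wing-cliques ++ db-cliques)) → Independent GL
    from-generic (p , liE ∷ lis) = independent (p ∘ Π) (GL-indepAt p liE (Allₚ.++⁻ˡ wing-cliques lis) (Allₚ.++⁻ʳ wing-cliques lis))

  GL-in : All (InSet (adj G′)) GL
  GL-in = Allₚ.++⁺ (Allₚ.map⁺ (All.map (λ {(x , y)} t → ⇒edges _ _ (inj₁ (x , y , refl , refl , t))) E^-InSet))
                    (Allₚ.map⁺ (All.map (λ {(x , y)} t → ⇒edges _ _ (inj₂ (x , y , refl , refl , t))) db-in))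

  GL-covers : Covers GL (adj G′)
  GL-covers z w t with edges⇒ z w t
  ... | inj₁ (x , y , refl , refl , t₁) = Data.Sum.map in₁ in₁ (E^-covers x y t₁)
    where in₁ : ∀ {e} → e ∈ E^ → map² ψ e ∈ GL
          in₁ m = Memₚ.∈-++⁺ˡ (Memₚ.∈-map⁺ (map² ψ) m)
  ... | inj₂ (x , y , refl , refl , t₂) = Data.Sum.map in₂ in₂ (db-covers x y t₂)
    where in₂ : ∀ {e} → e ∈ DB-list → map² χ e ∈ GL
          in₂ m = Memₚ.∈-++⁺ʳ (map (map² ψ) E^) (Memₚ.∈-map⁺ (map² χ) m)

  glued-independent : IndependentGraph G′
  glued-independent = covering-indepPairs (adj-sym G′) (irr G′) GL-in GL-independent GL-covers

  new-glue : ∀ y → T (dbGlue y) → NonedgeSplit.New NS (glue y)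
  new-glue 0f _ = inj₁ refl
  new-glue 1f _ = inj₂ (inj₂ (inj₁ refl))
  new-glue 2f _ = inj₂ (inj₁ refl)
  new-glue 3f _ = inj₂ (inj₂ (inj₂ refl))
  new-glue 4f ()
  new-glue 5f ()
  new-glue 6f ()
  new-glue 7f ()

  adj-ψ : ∀ {x y} → T (adj G′ (ψ x) (ψ y)) → T (adj Gs x y)
  adj-ψ {x} {y} t with edges⇒ _ _ t
  ... | inj₁ (x′ , y′ , ex , ey , t′) = subst₂ (λ u v → T (adj Gs u v)) (ψ-inj ex) (ψ-inj ey) t′
  ... | inj₂ (x′ , y′ , ex , ey , t′) = ⊥-elim (db-glue-nonadj x′ y′ (proj₁ (meet x x′ (sym ex))) (proj₁ (meet y y′ (sym ey))) t′)

  adj-χ : ∀ {x y} → T (adj G′ (χ x) (χ y)) → T (adj DB x y)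
  adj-χ {x} {y} t with edges⇒ _ _ t
  ... | inj₂ (x′ , y′ , ex , ey , t′) = subst₂ (λ u v → T (dbAdj u v)) (χ-inj ex) (χ-inj ey) t′
  ... | inj₁ (x′ , y′ , ex , ey , t′) with meet x′ x ex | meet y′ y ey
  ...   | gx , refl | gy , refl = ⊥-elim (≡⇒¬T (adjNew (glue x) (glue y) (new-glue x gx) (new-glue y gy)) t′)

-- The cover of the glued graph: all of Gs is one cluster, the others are clusters of the ear.
-- Everything that does not involve the rank of Gs is checked on the ear alone.

module _ {h} (H : Graph h) (gl : Fin h → Bool) (hub : Fin h) where

  clusters : ∀ {K} → (Fin K → Fin h → Bool) → Fin (suc K) → Fin h → Bool
  clusters c zero = gl
  clusters c (suc j) = c j

  earCover : ∀ {K} → (Fin K → Fin h → Bool) → Cover h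
  earCover {K} c = record { k = suc K ; X = clusters c }

  EarInside : ∀ {K} → (Fin K → Fin h → Bool) → PairSet h
  EarInside c u v = adj H u v ∧ Inside (earCover c) u v

  EarCluster : ∀ {K} (c : Fin K → Fin h → Bool) → Fin K → PairSet h
  EarCluster c j = Within (c j) (λ u v → adj H u v ∨ Shared (earCover c) u v)

  -- excess stands for the rank of Gs with its key pairs minus |E(Gs)|; i₀j₀ is the key pair to split,
  -- its copies on the ear side being adjacent to hub.
  record Checks {K} (c : Fin K → Fin h → Bool) (ranks : Fin K → ℕ) (excess : ℕ) (keys : List (Pair h)) (i₀ j₀ : Fin h) : Set where
    constructor checks
    private
      C : Fin (suc K) → Fin h → Bool
      C = clusters c
      Sh : PairSet h
      Sh = Shared (earCover c)
    field
      size≥2   : ∀ i → 2 ℕ.≤ countF (C i)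
      thin     : ∀ i j → i ≢ j → countF (inter (C i) (C j)) ℕ.≤ 2
      noSubset : ∀ i j → i ≢ j → ∃ λ w → T (C i w) × ¬ T (C j w)
      keys-in  : All (λ (u , v) → T (Sh u v) × T (gl u) × T (gl v)) keys
      keys-all : ∀ u v → T (Sh u v) → T (gl u) → T (gl v) → (u , v) ∈ keys ⊎ (v , u) ∈ keys
      keys-len : length keys ≡ suc excess
      hinge    : T (Sh i₀ j₀) × (T (gl i₀) × T (gl j₀)) × (T (adj H i₀ hub) × T (adj H j₀ hub)) × ¬ T (gl hub)
      only-j₀  : ∀ u → T (Sh i₀ u) → u ≡ j₀
      only-i₀  : ∀ u → T (Sh j₀ u) → u ≡ i₀
      counts   : numPairs (EarInside c) ℕ.+ sumℕ (λ i → numPairs (Within (C i) Sh)) ≡ (excess ℕ.+ sumℕ ranks) ℕ.+ numPairs Sh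

  checks? : ∀ {K} (c : Fin K → Fin h → Bool) ranks excess keys i₀ j₀ → Dec (Checks c ranks excess keys i₀ j₀)
  checks? {K} c ranks excess keys i₀ j₀ = map′ (λ (a₁ , a₂ , a₃ , a₄ , a₅ , a₆ , a₇ , a₈ , a₉ , a₁₀) → checks a₁ a₂ a₃ a₄ a₅ a₆ a₇ a₈ a₉ a₁₀)
      (λ (checks a₁ a₂ a₃ a₄ a₅ a₆ a₇ a₈ a₉ a₁₀) → a₁ , a₂ , a₃ , a₄ , a₅ , a₆ , a₇ , a₈ , a₉ , a₁₀)
    (d₁ ×-dec (d₂ ×-dec (d₃ ×-dec (d₄ ×-dec (d₅ ×-dec (d₆ ×-dec (d₇ ×-dec (d₈ ×-dec (d₉ ×-dec d₁₀)))))))))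
    where
    C : Fin (suc K) → Fin h → Bool
    C = clusters c
    Sh : PairSet h
    Sh = Shared (earCover c)
    d₁ : Dec (∀ i → 2 ℕ.≤ countF (C i))
    d₁ = Finₚ.all? λ i → 2 ℕₚ.≤? countF (C i)
    d₂ : Dec (∀ i j → i ≢ j → countF (inter (C i) (C j)) ℕ.≤ 2)
    d₂ = Finₚ.all? λ i → Finₚ.all? λ j → ¬? (i ≟ j) →-dec (countF (inter (C i) (C j)) ℕₚ.≤? 2)
    d₃ : Dec (∀ i j → i ≢ j → ∃ λ w → T (C i w) × ¬ T (C j w))
    d₃ = Finₚ.all? λ i → Finₚ.all? λ j → ¬? (i ≟ j) →-dec Finₚ.any? λ w → Boolₚ.T? (C i w) ×-dec ¬? (Boolₚ.T? (C j w))
    d₄ : Dec (All (λ (u , v) → T (Sh u v) × T (gl u) × T (gl v)) keys)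
    d₄ = All.all? (λ (u , v) → Boolₚ.T? (Sh u v) ×-dec (Boolₚ.T? (gl u) ×-dec Boolₚ.T? (gl v))) keys
    d₅ : Dec (∀ u v → T (Sh u v) → T (gl u) → T (gl v) → (u , v) ∈ keys ⊎ (v , u) ∈ keys)
    d₅ = Finₚ.all? λ u → Finₚ.all? λ v → Boolₚ.T? (Sh u v) →-dec (Boolₚ.T? (gl u) →-dec (Boolₚ.T? (gl v) →-dec either? u v keys))
    d₆ : Dec (length keys ≡ suc excess)
    d₆ = length keys ℕₚ.≟ suc excess
    d₇ : Dec (T (Sh i₀ j₀) × (T (gl i₀) × T (gl j₀)) × (T (adj H i₀ hub) × T (adj H j₀ hub)) × ¬ T (gl hub))
    d₇ = Boolₚ.T? (Sh i₀ j₀) ×-dec ((Boolₚ.T? (gl i₀) ×-dec Boolₚ.T? (gl j₀)) ×-dec ((Boolₚ.T? (adj H i₀ hub) ×-dec Boolₚ.T? (adj H j₀ hub)) ×-dec ¬? (Boolₚ.T? (gl hub))))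
    d₈ : Dec (∀ u → T (Sh i₀ u) → u ≡ j₀)
    d₈ = Finₚ.all? λ u → Boolₚ.T? (Sh i₀ u) →-dec (u ≟ j₀)
    d₉ : Dec (∀ u → T (Sh j₀ u) → u ≡ i₀)
    d₉ = Finₚ.all? λ u → Boolₚ.T? (Sh j₀ u) →-dec (u ≟ i₀)
    d₁₀ : Dec (numPairs (EarInside c) ℕ.+ sumℕ (λ i → numPairs (Within (C i) Sh)) ≡ (excess ℕ.+ sumℕ ranks) ℕ.+ numPairs Sh)
    d₁₀ = _ ℕₚ.≟ _

  record Skeleton : Set where
    field
      K      : ℕ
      c      : Fin K → Fin h → Bool
      ranks  : Fin K → ℕ
      excess : ℕ
      keys   : List (Pair h)
      i₀ j₀  : Fin h
      checked : Checks c ranks excess keys i₀ j₀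
      shared-independent : Independent (edgeList (Shared (earCover c)))
      hasRanks : ∀ j → HasRank (EarCluster c j) (ranks j)

-- Five points of ℚ³ are affinely dependent.
K₅-dependent : ∀ {n} (q : Placement n) {v w x y z} → ¬ IndepAt q (clique (v ∷ w ∷ x ∷ y ∷ z ∷ []))
K₅-dependent q {v} {w} {x} {y} {z} li = ℕₚ.<⇒≱ ℕₚ.≤-refl (LI-dim affine λ a eqs → affinely-independent q vs li a
    (trans (∑-cong (λ e → sym (trans (*-comm (a e) 1#) (*-identityˡ (a e))))) (eqs zero)) (λ c → eqs (suc c)))
  where
  vs : List (Fin _)
  vs = v ∷ w ∷ x ∷ y ∷ z ∷ []
  affine : Fin 5 → Fin 4 → ℚ
  affine e zero = 1#
  affine e (suc c) = q (lookup vs e) c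

K₅-stars : ∀ {n} → Fin n → Fin n → Fin n → Fin n → Fin n → List (Star n)
K₅-stars v w x y z = (v , x ∷ y ∷ z ∷ []) ∷ (w , x ∷ y ∷ z ∷ []) ∷ (x , y ∷ z ∷ []) ∷ (y , z ∷ []) ∷ []

K₅-rank : ∀ {n} {E : PairSet n} v w x y z → Degenerate (K₅-stars v w x y z) [] →
  All (InSet E) (stars (K₅-stars v w x y z) []) → Covers (clique (v ∷ w ∷ x ∷ y ∷ z ∷ [])) E → HasRank E 9
K₅-rank {n} {E} v w x y z d L⊂E cov = hasRank-build L⊂E (stars-independent (K₅-stars v w x y z) d []-independent) spans
  where
  L : List (Pair n)
  L = stars (K₅-stars v w x y z) []
  spans : ∀ q → IndepAt q L → ∀ {s t} → T (E s t) → SpanAt q L (s , t)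
  spans q li {s} {t} h = [ from-clique , (λ m → span-swap (from-clique m)) ]′ (cov s t h)
    where
    vw : SpanAt q L (v , w)
    vw with extend? search-coord li (v , w)
    ... | inj₁ sp = sp
    ... | inj₂ li′ = ⊥-elim (K₅-dependent q li′)
    from-clique : ∀ {e} → e ∈ clique (v ∷ w ∷ x ∷ y ∷ z ∷ []) → SpanAt q L e
    from-clique (here refl) = vw
    from-clique (there m) = span-∈ m

oneOf : ∀ {n} → List (Fin n) → Fin n → Bool
oneOf [] x = false
oneOf (y ∷ ys) x = (x == y) ∨ oneOf ys x

-- The cover used for a single key pair ij (4 is u).
module _ (i j : Fin 8) where
  triangle : Fin 1 → Fin 8 → Bool
  triangle _ = oneOf (i ∷ j ∷ 4f ∷ [])

  triangle-skeleton : {T ⌊ checks? DB dbGlue 4f triangle (λ _ → 3) 0 ((i , j) ∷ []) i j ⌋} →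
    {r₁ r₂ : List (Star 8)} → {T ⌊ degenerate? r₁ [] ⌋} → {T ⌊ degenerate? r₂ [] ⌋} →
    edgeList (Shared (earCover DB dbGlue 4f triangle)) ≡ stars r₁ [] → edgeList (EarCluster DB dbGlue 4f triangle 0f) ≡ stars r₂ [] →
    length (stars r₂ []) ≡ 3 → Skeleton DB dbGlue 4f
  triangle-skeleton {ok} {r₁} {r₂} {d₁} {d₂} e₁ e₂ len = record
    { c = triangle ; checked = toWitness ok
    ; shared-independent = subst Independent (sym e₁) (stars-independent r₁ (toWitness d₁) []-independent)
    ; hasRanks = λ { 0f → subst (HasRank _) (trans (sym (length-edgeList (EarCluster DB dbGlue 4f triangle 0f))) (trans (cong length e₂) len))
        (edgeList⇒indepPairs (within-sym {A = triangle 0f} {P} (adj-or-shared-sym DB (earCover DB dbGlue 4f triangle))) (within-irr {A = triangle 0f} {P} P-irr)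
          (subst Independent (sym e₂) (stars-independent r₂ (toWitness d₂) []-independent))) } }
    where
    P : PairSet 8
    P u v = adj DB u v ∨ Shared (earCover DB dbGlue 4f triangle) u v
    P-irr : Irrefl P
    P-irr u = cong₂ _∨_ (irr DB u) (shared-irr (earCover DB dbGlue 4f triangle) u)

skeleton₁₁ skeleton₁₂ skeleton₂₁ skeleton₂₂ : Skeleton DB dbGlue 4f
skeleton₁₁ = triangle-skeleton 0f 1f {r₁ = (0f , 1f ∷ []) ∷ []} {(0f , 1f ∷ 4f ∷ []) ∷ (1f , 4f ∷ []) ∷ []} refl refl refl
skeleton₁₂ = triangle-skeleton 0f 3f {r₁ = (0f , 3f ∷ []) ∷ []} {(0f , 3f ∷ 4f ∷ []) ∷ (3f , 4f ∷ []) ∷ []} refl refl refl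
skeleton₂₁ = triangle-skeleton 2f 1f {r₁ = (1f , 2f ∷ []) ∷ []} {(1f , 2f ∷ 4f ∷ []) ∷ (2f , 4f ∷ []) ∷ []} refl refl refl
skeleton₂₂ = triangle-skeleton 2f 3f {r₁ = (2f , 3f ∷ []) ∷ []} {(2f , 3f ∷ 4f ∷ []) ∷ (3f , 4f ∷ []) ∷ []} refl refl refl

-- The cover used for the key pairs a₁b₁ and a₂b₂.
wings : Fin 2 → Fin 8 → Bool
wings 0f = oneOf (0f ∷ 1f ∷ 4f ∷ 5f ∷ 6f ∷ [])
wings 1f = oneOf (2f ∷ 3f ∷ 4f ∷ 5f ∷ 7f ∷ [])

wings-skeleton : Skeleton DB dbGlue 4f
wings-skeleton = record
  { c = wings ; ranks = λ _ → 9 ; excess = 1 ; keys = (0f , 1f) ∷ (2f , 3f) ∷ [] ; i₀ = 0f ; j₀ = 1f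
  ; checked = toWitness {a? = checks? DB dbGlue 4f wings (λ _ → 9) 1 ((0f , 1f) ∷ (2f , 3f) ∷ []) 0f 1f} tt
  ; shared-independent = stars-independent ((0f , 1f ∷ []) ∷ (2f , 3f ∷ []) ∷ (4f , 5f ∷ []) ∷ []) (toWitness {a? = degenerate? ((0f , 1f ∷ []) ∷ (2f , 3f ∷ []) ∷ (4f , 5f ∷ []) ∷ []) []} tt) []-independent
  ; hasRanks = λ { 0f → wing-rank 0f 1f 4f 5f 6f 0f ; 1f → wing-rank 2f 3f 4f 5f 7f 1f } }
  where
  wing-rank : ∀ v w x y z (j : Fin 2) → {T ⌊ degenerate? (K₅-stars v w x y z) [] ⌋} →
    {T ⌊ All.all? (λ (s , t) → Boolₚ.T? (EarCluster DB dbGlue 4f wings j s t)) (stars (K₅-stars v w x y z) []) ⌋} →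
    {T ⌊ Finₚ.all? (λ s → Finₚ.all? (λ t → Boolₚ.T? (EarCluster DB dbGlue 4f wings j s t) →-dec either? s t (clique (v ∷ w ∷ x ∷ y ∷ z ∷ [])))) ⌋} →
    HasRank (EarCluster DB dbGlue 4f wings j) 9
  wing-rank v w x y z j {d} {i} {cov} = K₅-rank v w x y z (toWitness d) (toWitness i) (toWitness cov)

module GluedCover {h m N} {H : Graph h} {gl : Fin h → Bool} {hub : Fin h} (Sk : Skeleton H gl hub)
  {Gs : Graph m} {G′ : Graph N} {ψ : Fin m → Fin N} {χ : Fin h → Fin N} (glue : Fin h → Fin m)
  (ψ-inj : Injective _≡_ _≡_ ψ) (χ-inj : Injective _≡_ _≡_ χ)
  (identify : ∀ y → T (gl y) → ψ (glue y) ≡ χ y) (meet : ∀ x y → ψ x ≡ χ y → T (gl y) × x ≡ glue y)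
  (ψ-adj : ∀ {x y} → T (adj Gs x y) → T (adj G′ (ψ x) (ψ y))) (adj-ψ : ∀ {x y} → T (adj G′ (ψ x) (ψ y)) → T (adj Gs x y))
  (χ-adj : ∀ {x y} → T (adj H x y) → T (adj G′ (χ x) (χ y))) (adj-χ : ∀ {x y} → T (adj G′ (χ x) (χ y)) → T (adj H x y))
  (glue-nonadj : ∀ x y → T (gl x) → T (gl y) → ¬ T (adj H x y))
  (glue-neighbour : ∀ y → T (gl y) → ∃ λ x → T (adj Gs (glue y) x))
  {E^ : List (Pair m)} (E^-InSet : All (InSet (adj Gs)) E^) (E^-covers : Covers E^ (adj Gs))
  (GL-independent : Independent (map (map² ψ) E^ ++ map (map² χ) (edgeList (adj H))))
  (Kt : List (Pair m))
  (rank-bound : ∀ {L} → Independent L → All (λ e → InSet (adj Gs) e ⊎ e ∈ Kt ⊎ swap e ∈ Kt) L → suc (length L) ℕ.≤ length E^ ℕ.+ length Kt)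
  where
  open Skeleton Sk
  open Checks checked

  C : Fin (suc K) → Fin h → Bool
  C = clusters H gl hub c

  𝒞 : Cover h
  𝒞 = earCover H gl hub c

  Y : Fin (suc K) → Fin N → Bool
  Y zero z = anyF (λ y → ψ y == z)
  Y (suc j) z = anyF (λ x → (χ x == z) ∧ c j x)

  𝒴 : Cover N
  𝒴 = record { k = suc K ; X = Y }

  Y-ψ : ∀ y → T (Y zero (ψ y))
  Y-ψ y = anyF⁺ y (==⁺ refl)

  ψ-Y : ∀ {z} → T (Y zero z) → ∃ λ y → ψ y ≡ z
  ψ-Y t = let y , e = anyF⁻ _ t in y , ==⁻ e

  χ-Y : ∀ j {z} → T (Y (suc j) z) → ∃ λ x → χ x ≡ z × T (c j x)
  χ-Y j {z} t = let x , e = anyF⁻ _ t in x , ==⁻ (T∧ˡ e) , T∧ʳ {χ x == z} e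

  C⇒Y : ∀ i x → T (C i x) → T (Y i (χ x))
  C⇒Y zero x g = subst (T ∘ Y zero) (identify x g) (Y-ψ (glue x))
  C⇒Y (suc j) x t = anyF⁺ x (T∧⁺ (==⁺ refl) t)

  Y⇒C : ∀ i x → T (Y i (χ x)) → T (C i x)
  Y⇒C zero x t = let y , e = ψ-Y t in proj₁ (meet y x e)
  Y⇒C (suc j) x t = let x′ , e , cx = χ-Y j t in subst (T ∘ c j) (χ-inj e) cx

  common : ∀ i j → i ≢ j → ∀ {z} → T (Y i z) → T (Y j z) → ∃ λ x → χ x ≡ z × T (C i x) × T (C j x)
  common zero zero ne _ _ = ⊥-elim (ne refl)
  common (suc i) j ne ti tj with χ-Y i ti
  ... | x , refl , cx = x , refl , cx , Y⇒C j x tj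
  common zero (suc j) ne ti tj with χ-Y j tj
  ... | x , refl , cx = x , refl , Y⇒C zero x ti , cx

  members : (Fin h → Bool) → List (Fin h)
  members A = filterᵇ A (allFin h)

  length-members : ∀ A → length (map χ (members A)) ≡ countF A
  length-members A = trans (Listₚ.length-map χ (members A)) (length-filterᵇ-tabulate A id)

  member⁻ : ∀ A {x} → x ∈ members A → T (A x)
  member⁻ A m = proj₂ (Memₚ.∈-filter⁻ (Boolₚ.T? ∘ A) {xs = allFin h} m)

  member⁺ : ∀ A {x} → T (A x) → x ∈ members A
  member⁺ A {x} t = Memₚ.∈-filter⁺ (Boolₚ.T? ∘ A) (Memₚ.∈-allFin x) t

  Y-size : ∀ i → 2 ℕ.≤ countF (Y i)
  Y-size i = ℕₚ.≤-trans (size≥2 i) (subst (ℕ._≤ countF (Y i)) (length-members (C i))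
    (count≥ (Y i) (Uniqueₚ.map⁺ χ-inj (Uniqueₚ.filter⁺ (Boolₚ.T? ∘ C i) (Uniqueₚ.allFin⁺ h))) (Allₚ.map⁺ (All.tabulate (λ m → C⇒Y i _ (member⁻ (C i) m))))))

  Y-thin : ∀ i j → i ≢ j → countF (inter (Y i) (Y j)) ℕ.≤ 2
  Y-thin i j ne = ℕₚ.≤-trans (count≤ (inter (Y i) (Y j)) (map χ (members (inter (C i) (C j)))) listed) (subst (ℕ._≤ 2) (sym (length-members (inter (C i) (C j)))) (thin i j ne))
    where
    listed : ∀ w → T (inter (Y i) (Y j) w) → w ∈ map χ (members (inter (C i) (C j)))
    listed w t with common i j ne (T∧ˡ t) (T∧ʳ {Y i w} t)
    ... | x , refl , ci , cj = Memₚ.∈-map⁺ χ (member⁺ (inter (C i) (C j)) (T∧⁺ ci cj))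

  Y-noSubset : ∀ i j → i ≢ j → ¬ (∀ w → T (Y i w) → T (Y j w))
  Y-noSubset i j ne h = let w , ci , ncj = noSubset i j ne in ncj (Y⇒C j w (h (χ w) (C⇒Y i w ci)))

  isShared-Y : ∀ {x y} → IsShared 𝒞 x y → IsShared 𝒴 (χ x) (χ y)
  isShared-Y {x} {y} (isShared x≢y i j i≢j ms) = isShared (x≢y ∘ χ-inj) i j i≢j
    (meets-intro {A = Y i} {Y j} (C⇒Y i x (proj₁ mx)) (C⇒Y i y (proj₁ my)) (C⇒Y j x (proj₂ mx)) (C⇒Y j y (proj₂ my))
      λ v vi vj → only (common i j i≢j vi vj))
    where
    mx : T (C i x) × T (C j x)
    mx = meets-u {A = C i} {C j} ms
    my : T (C i y) × T (C j y)
    my = meets-v {A = C i} {C j} ms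
    only : ∀ {v} → (∃ λ u → χ u ≡ v × T (C i u) × T (C j u)) → v ≡ χ x ⊎ v ≡ χ y
    only (u , refl , ui , uj) = Data.Sum.map (cong χ) (cong χ) (meets-only {A = C i} {C j} ms ui uj)

  isShared-C : ∀ {z w} → IsShared 𝒴 z w → ∃ λ x → ∃ λ y → χ x ≡ z × χ y ≡ w × IsShared 𝒞 x y
  isShared-C {z} {w} (isShared z≢w i j i≢j ms) = pull (common i j i≢j (proj₁ mz) (proj₂ mz)) (common i j i≢j (proj₁ mw) (proj₂ mw))
    where
    mz : T (Y i z) × T (Y j z)
    mz = meets-u {A = Y i} {Y j} ms
    mw : T (Y i w) × T (Y j w)
    mw = meets-v {A = Y i} {Y j} ms
    pull : (∃ λ x → χ x ≡ z × T (C i x) × T (C j x)) → (∃ λ y → χ y ≡ w × T (C i y) × T (C j y)) →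
      ∃ λ x → ∃ λ y → χ x ≡ z × χ y ≡ w × IsShared 𝒞 x y
    pull (x , ex , ix , jx) (y , ey , iy , jy) = x , y , ex , ey , isShared (λ e → z≢w (trans (sym ex) (trans (cong χ e) ey))) i j i≢j
      (meets-intro {A = C i} {C j} ix iy jx jy λ v vi vj → Data.Sum.map (λ e → χ-inj (trans e (sym ex))) (λ e → χ-inj (trans e (sym ey)))
        (meets-only {A = Y i} {Y j} ms (C⇒Y i v vi) (C⇒Y j v vj)))

  shared-image : Image χ (Shared 𝒞) (Shared 𝒴)
  shared-image z w = (λ t → let x , y , ex , ey , s = isShared-C (shared⁻ {𝒳 = 𝒴} t) in x , y , ex , ey , shared⁺ {𝒳 = 𝒞} s) , from
    where
    from : ∀ x y → χ x ≡ z → χ y ≡ w → T (Shared 𝒞 x y) → T (Shared 𝒴 z w)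
    from x y refl refl t = shared⁺ {𝒳 = 𝒴} (isShared-Y (shared⁻ {𝒳 = 𝒞} t))

  shared-χ : ∀ {x y} → T (Shared 𝒴 (χ x) (χ y)) → T (Shared 𝒞 x y)
  shared-χ {x} {y} t = let x′ , y′ , e , e′ , t′ = proj₁ (shared-image (χ x) (χ y)) t in subst₂ (λ u v → T (Shared 𝒞 u v)) (χ-inj e) (χ-inj e′) t′

  χ-shared : ∀ {x y} → T (Shared 𝒞 x y) → T (Shared 𝒴 (χ x) (χ y))
  χ-shared {x} {y} t = proj₂ (shared-image (χ x) (χ y)) x y refl refl t

  shared-list : List (Pair N)
  shared-list = map (map² χ) (edgeList (Shared 𝒞))

  shared-list-in : All (InSet (Shared 𝒴)) shared-list
  shared-list-in = image-InSet {f = χ} {Shared 𝒞} {Shared 𝒴} shared-image (edgeList-InSet (Shared 𝒞))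

  shared-list-independent : Independent shared-list
  shared-list-independent = independent-embed χ-inj shared-independent

  shared-list-covers : Covers shared-list (Shared 𝒴)
  shared-list-covers z w t = covers (proj₁ (shared-image z w) t)
    where
    covers : (∃ λ x → ∃ λ y → χ x ≡ z × χ y ≡ w × T (Shared 𝒞 x y)) → (z , w) ∈ shared-list ⊎ (w , z) ∈ shared-list
    covers (x , y , refl , refl , t′) = Data.Sum.map (Memₚ.∈-map⁺ (map² χ)) (Memₚ.∈-map⁺ (map² χ)) (edgeList-covers (shared-sym 𝒞) (shared-irr 𝒞) x y t′)

  within-shared-image : ∀ i → Image χ (Within (C i) (Shared 𝒞)) (Within (Y i) (Shared 𝒴))
  within-shared-image i z w = to , from
    where
    pull : T (Y i z) → T (Y i w) → (∃ λ x → ∃ λ y → χ x ≡ z × χ y ≡ w × T (Shared 𝒞 x y)) → ∃ λ x → ∃ λ y → χ x ≡ z × χ y ≡ w × T (Within (C i) (Shared 𝒞) x y)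
    pull Yz Yw (x , y , refl , refl , t) = x , y , refl , refl , within⁺ (C i) (Shared 𝒞) (Y⇒C i x Yz) (Y⇒C i y Yw) t
    to : T (Within (Y i) (Shared 𝒴) z w) → ∃ λ x → ∃ λ y → χ x ≡ z × χ y ≡ w × T (Within (C i) (Shared 𝒞) x y)
    to t = pull (T∧ˡ t) (T∧ˡ (T∧ʳ {Y i z} t)) (proj₁ (shared-image z w) (within⇒ (Y i) {Shared 𝒴} z w t))
    from : ∀ x y → χ x ≡ z → χ y ≡ w → T (Within (C i) (Shared 𝒞) x y) → T (Within (Y i) (Shared 𝒴) z w)
    from x y refl refl t = within⁺ (Y i) (Shared 𝒴) (C⇒Y i x (T∧ˡ t)) (C⇒Y i y (T∧ˡ (T∧ʳ {C i x} t))) (χ-shared (within⇒ (C i) {Shared 𝒞} x y t))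

  cluster-image : ∀ j → Image χ (EarCluster H gl hub c j) (Within (Y (suc j)) (λ u v → adj G′ u v ∨ Shared 𝒴 u v))
  cluster-image j z w = to , from
    where
    A : PairSet N
    A u v = adj G′ u v ∨ Shared 𝒴 u v
    A₈ : PairSet h
    A₈ u v = adj H u v ∨ Shared 𝒞 u v
    to : T (Within (Y (suc j)) A z w) → ∃ λ x → ∃ λ y → χ x ≡ z × χ y ≡ w × T (EarCluster H gl hub c j x y)
    to t = pull (χ-Y j {z} (T∧ˡ t)) (χ-Y j {w} (T∧ˡ (T∧ʳ {Y (suc j) z} t))) (within⇒ (Y (suc j)) {A} z w t)
      where
      pull : (∃ λ x → χ x ≡ z × T (c j x)) → (∃ λ y → χ y ≡ w × T (c j y)) → T (A z w) → ∃ λ x → ∃ λ y → χ x ≡ z × χ y ≡ w × T (EarCluster H gl hub c j x y)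
      pull (x , refl , cx) (y , refl , cy) t′ = x , y , refl , refl , within⁺ (c j) A₈ cx cy
          ([ (λ e → T∨⁺ˡ (adj-χ e)) , (λ s → T∨⁺ʳ {adj H x y} (shared-χ s)) ]′ (T∨⁻ {adj G′ (χ x) (χ y)} t′))
    from : ∀ x y → χ x ≡ z → χ y ≡ w → T (EarCluster H gl hub c j x y) → T (Within (Y (suc j)) A z w)
    from x y refl refl t = within⁺ (Y (suc j)) A (C⇒Y (suc j) x (T∧ˡ t)) (C⇒Y (suc j) y (T∧ˡ (T∧ʳ {c j x} t)))
      ([ (λ e → T∨⁺ˡ (χ-adj e)) , (λ s → T∨⁺ʳ {adj G′ (χ x) (χ y)} (χ-shared s)) ]′ (T∨⁻ {adj H x y} (within⇒ (c j) {A₈} x y t)))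

  inside-list : List (Pair N)
  inside-list = map (map² ψ) E^ ++ map (map² χ) (edgeList (EarInside H gl hub c))

  inside-independent : Independent inside-list
  inside-independent = independent-⊆ (Subₚ.++⁺ (⊆-refl {x = map (map² ψ) E^}) (Subₚ.map⁺ (map² χ) (edgeList-⊆ {E = EarInside H gl hub c} {adj H} (λ u v t → T∧ˡ t)))) GL-independent

  inside-in : All (InSet (λ u v → adj G′ u v ∧ Inside 𝒴 u v)) inside-list
  inside-in = Allₚ.++⁺ (Allₚ.map⁺ (All.map (λ {(x , y)} t → T∧⁺ (ψ-adj t) (anyF⁺ {f = λ i → Y i (ψ x) ∧ Y i (ψ y)} zero (T∧⁺ (Y-ψ x) (Y-ψ y)))) E^-InSet))
    (Allₚ.map⁺ (All.map (λ {(x , y)} t → T∧⁺ (χ-adj (T∧ˡ t)) (inside x y (anyF⁻ (λ i → C i x ∧ C i y) (T∧ʳ {adj H x y} t)))) (edgeList-InSet (EarInside H gl hub c))))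
    where
    inside : ∀ x y → (∃ λ i → T (C i x ∧ C i y)) → T (Inside 𝒴 (χ x) (χ y))
    inside x y (i , t) = anyF⁺ {f = λ i → Y i (χ x) ∧ Y i (χ y)} i (T∧⁺ (C⇒Y i x (T∧ˡ t)) (C⇒Y i y (T∧ʳ {C i x} t)))

  inside-covers : Covers inside-list (λ u v → adj G′ u v ∧ Inside 𝒴 u v)
  inside-covers z w t = by-cluster (anyF⁻ (λ i → Y i z ∧ Y i w) (T∧ʳ {adj G′ z w} t))
    where
    by-cluster : (∃ λ i → T (Y i z ∧ Y i w)) → (z , w) ∈ inside-list ⊎ (w , z) ∈ inside-list
    in₁ : ∀ {e} → e ∈ E^ → map² ψ e ∈ inside-list
    in₁ mem = Memₚ.∈-++⁺ˡ (Memₚ.∈-map⁺ (map² ψ) mem)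
    in₂ : ∀ {e} → e ∈ edgeList (EarInside H gl hub c) → map² χ e ∈ inside-list
    in₂ mem = Memₚ.∈-++⁺ʳ (map (map² ψ) E^) (Memₚ.∈-map⁺ (map² χ) mem)
    ear-sym : Symm (EarInside H gl hub c)
    ear-sym u v = cong₂ _∧_ (adj-sym H u v) (inside-sym 𝒞 u v)
    ear-irr : Irrefl (EarInside H gl hub c)
    ear-irr u = cong (_∧ Inside 𝒞 u u) (irr H u)
    old : (∃ λ x → ψ x ≡ z) → (∃ λ y → ψ y ≡ w) → T (adj G′ z w) → (z , w) ∈ inside-list ⊎ (w , z) ∈ inside-list
    old (x , refl) (y , refl) e = Data.Sum.map in₁ in₁ (E^-covers x y (adj-ψ e))
    new : ∀ j → (∃ λ x → χ x ≡ z × T (c j x)) → (∃ λ y → χ y ≡ w × T (c j y)) → T (adj G′ z w) → (z , w) ∈ inside-list ⊎ (w , z) ∈ inside-list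
    new j (x , refl , cx) (y , refl , cy) e = Data.Sum.map in₂ in₂ (edgeList-covers ear-sym ear-irr x y
      (T∧⁺ (adj-χ e) (anyF⁺ {f = λ i → C i x ∧ C i y} (suc j) (T∧⁺ cx cy))))
    by-cluster (zero , ti) = old (ψ-Y {z} (T∧ˡ ti)) (ψ-Y {w} (T∧ʳ {Y zero z} ti)) (T∧ˡ t)
    by-cluster (suc j , ti) = new j (χ-Y j {z} (T∧ˡ ti)) (χ-Y j {w} (T∧ʳ {Y (suc j) z} ti)) (T∧ˡ t)

  Y₀ : PairSet N
  Y₀ = Within (Y zero) (λ u v → adj G′ u v ∨ Shared 𝒴 u v)

  module _ (Kt≡ : Kt ≡ map (map² glue) keys) (W : List (Pair m)) (W⊂ : All (λ e → InSet (adj Gs) e ⊎ e ∈ Kt) W)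
           (hW : Independent W) (length-W : length W ≡ length E^ ℕ.+ excess) where

    shared-keys : ∀ {u v} → (u , v) ∈ Kt → T (Shared 𝒴 (ψ u) (ψ v))
    shared-keys {u} {v} mem = from (Memₚ.∈-map⁻ (map² glue) (subst (_ ∈_) Kt≡ mem))
      where
      from : (∃ λ e → e ∈ keys × (u , v) ≡ map² glue e) → T (Shared 𝒴 (ψ u) (ψ v))
      from ((x , y) , mxy , refl) = let s , gx , gy = All.lookup keys-in mxy in
        subst₂ (λ u v → T (Shared 𝒴 u v)) (sym (identify x gx)) (sym (identify y gy)) (χ-shared s)

    keys-shared : ∀ {u v} → T (Shared 𝒴 (ψ u) (ψ v)) → (u , v) ∈ Kt ⊎ (v , u) ∈ Kt
    keys-shared {u} {v} t = let x , y , ex , ey , s = proj₁ (shared-image (ψ u) (ψ v)) t in glued s (meet u x (sym ex)) (meet v y (sym ey))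
      where
      in-Kt : ∀ {e} → e ∈ keys → map² glue e ∈ Kt
      in-Kt mem = subst (_ ∈_) (sym Kt≡) (Memₚ.∈-map⁺ (map² glue) mem)
      glued : ∀ {x y} → T (Shared 𝒞 x y) → T (gl x) × u ≡ glue x → T (gl y) × v ≡ glue y → (u , v) ∈ Kt ⊎ (v , u) ∈ Kt
      glued {x} {y} s (gx , refl) (gy , refl) = Data.Sum.map in-Kt in-Kt (keys-all x y s gx gy)

    Keyed : Pair m → Set
    Keyed e = InSet (adj Gs) e ⊎ e ∈ Kt ⊎ swap e ∈ Kt

    keyed : ∀ {z w} → T (Y₀ z w) → ∃ λ e → Keyed e × map² ψ e ≡ (z , w)
    keyed {z} {w} t = pull (ψ-Y {z} (T∧ˡ t)) (ψ-Y {w} (T∧ˡ (T∧ʳ {Y zero z} t))) (within⇒ (Y zero) {λ u v → adj G′ u v ∨ Shared 𝒴 u v} z w t)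
      where
      pull : (∃ λ u → ψ u ≡ z) → (∃ λ v → ψ v ≡ w) → T (adj G′ z w ∨ Shared 𝒴 z w) → ∃ λ e → Keyed e × map² ψ e ≡ (z , w)
      pull (u , refl) (v , refl) t′ = (u , v) , Data.Sum.map adj-ψ keys-shared (T∨⁻ {adj G′ (ψ u) (ψ v)} t′) , refl

    preimage : ∀ {M} → All (InSet Y₀) M → ∃ λ L → All Keyed L × map (map² ψ) L ≡ M
    preimage [] = [] , [] , refl
    preimage (t ∷ ts) = let e , ke , eq = keyed t ; L , kL , eqs = preimage ts in e ∷ L , ke ∷ kL , cong₂ _∷_ eq eqs

    rank-Y₀ : HasRank Y₀ (length E^ ℕ.+ excess)
    rank-Y₀ = (map (map² ψ) W , Allₚ.map⁺ (All.map in-Y₀ W⊂) , to-IndepList (map (map² ψ) W) (independent-embed ψ-inj hW) , trans (Listₚ.length-map (map² ψ) W) length-W) , upper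
      where
      in-Y₀ : ∀ {e} → InSet (adj Gs) e ⊎ e ∈ Kt → InSet Y₀ (map² ψ e)
      in-Y₀ {u , v} h = within⁺ (Y zero) (λ u v → adj G′ u v ∨ Shared 𝒴 u v) (Y-ψ u) (Y-ψ v)
        ([ (λ t → T∨⁺ˡ (ψ-adj t)) , (λ mem → T∨⁺ʳ {adj G′ (ψ u) (ψ v)} (shared-keys mem)) ]′ h)
      upper : ∀ M → All (InSet Y₀) M → IndepList M → length M ℕ.≤ length E^ ℕ.+ excess
      upper M M⊂ hM = let L , kL , eq = preimage M⊂ in pulled L kL eq hM
        where
        pulled : ∀ {M} L → All Keyed L → map (map² ψ) L ≡ M → IndepList M → length M ℕ.≤ length E^ ℕ.+ excess
        pulled L kL refl hM = subst (ℕ._≤ length E^ ℕ.+ excess) (sym (Listₚ.length-map (map² ψ) L))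
            (ℕₚ.≤-pred (subst (suc (length L) ℕ.≤_) (trans (cong (λ l → length E^ ℕ.+ l) (trans (cong length Kt≡) (trans (Listₚ.length-map (map² glue) keys) keys-len))) (ℕₚ.+-suc _ _))
              (rank-bound (independent-fold ψ (from-IndepList (map (map² ψ) L) hM)) kL)))

    partial : PartialBase G′ 𝒴
    partial = record
      { size≥2 = Y-size ; thin = Y-thin ; noSubset = Y-noSubset
      ; indep𝒳 = covering-indepPairs (shared-sym 𝒴) (shared-irr 𝒴) shared-list-in shared-list-independent shared-list-covers
      ; rs = rs ; ss = λ i → numPairs (Within (C i) (Shared 𝒞)) ; z = length inside-list
      ; rank-cluster = λ { zero → rank-Y₀ ; (suc j) → hasRank-image χ-inj (cluster-image j) (hasRanks j) }
      ; rank-shared = λ i → hasRank-image χ-inj (within-shared-image i) (indepPairs-⊆ (within-sym {A = C i} {Shared 𝒞} (shared-sym 𝒞)) (within-irr {A = C i} {Shared 𝒞} (shared-irr 𝒞))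
          (shared-sym 𝒞) (shared-irr 𝒞) (within⇒ (C i) {Shared 𝒞}) (edgeList⇒indepPairs (shared-sym 𝒞) (shared-irr 𝒞) shared-independent))
      ; rank-inside = covering-rank inside-in inside-independent inside-covers
      ; count = total }
      where
      rs : Fin (suc K) → ℕ
      rs zero = length E^ ℕ.+ excess
      rs (suc j) = ranks j
      ss₈ : ℕ
      ss₈ = sumℕ (λ i → numPairs (Within (C i) (Shared 𝒞)))
      total : length inside-list ℕ.+ ss₈ ≡ sumℕ rs ℕ.+ numPairs (Shared 𝒴)
      total = trans (cong (ℕ._+ ss₈) (trans (Listₚ.length-++ (map (map² ψ) E^)) (cong₂ ℕ._+_ (Listₚ.length-map (map² ψ) E^)
          (trans (Listₚ.length-map (map² χ) (edgeList (EarInside H gl hub c))) (length-edgeList (EarInside H gl hub c))))))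
        (arith (length E^) (numPairs (EarInside H gl hub c)) ss₈ excess (sumℕ ranks) (numPairs (Shared 𝒞)) (numPairs (Shared 𝒴)) counts
          (trans (covering-numPairs (shared-sym 𝒴) (shared-irr 𝒴) shared-list-in shared-list-independent shared-list-covers)
            (trans (Listₚ.length-map (map² χ) (edgeList (Shared 𝒞))) (length-edgeList (Shared 𝒞)))))
        where
        arith : ∀ e i s x r p p′ → i ℕ.+ s ≡ (x ℕ.+ r) ℕ.+ p → p′ ≡ p → e ℕ.+ i ℕ.+ s ≡ (e ℕ.+ x ℕ.+ r) ℕ.+ p′
        arith e i s x r p p′ eq refl = trans (ℕₚ.+-assoc e i s) (trans (cong (e ℕ.+_) eq)
          (solve 4 (λ e x r p → e :+ (x :+ r :+ p) := (e :+ x :+ r) :+ p) refl e x r p))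
          where open ℕSolver.+-*-Solver

    hinge-half : ∀ i j → T (gl i) → T (adj H i hub) → (∀ u → T (Shared 𝒞 i u) → u ≡ j) → Half G′ 𝒴 (χ i) (χ j) (Y zero)
    hinge-half i j gi i4 only = record
      { nonempty = λ { true → let x , t = glue-neighbour i gi in ψ x , subst (λ z → T (adj G′ z (ψ x))) (identify i gi) (ψ-adj t) , T⇒≡ (Y-ψ x)
                     ; false → χ hub , χ-adj i4 , ¬T⇒≡ (λ t → proj₂ (proj₂ (proj₂ hinge)) (Y⇒C zero hub t)) }
      ; S1 = λ { zero u v _ _ _ _ (_ , (z , Yz , _ , e)) → ≡⇒¬T e Yz
               ; (suc l) u v _ _ _ _ ((z , Cz , t , e) , _) → one-sided l Cz t (≡⇒T e) }
      ; S2 = λ l l′ u l≢l′ u≢i u≢j _ ms → ⊥-elim (not-shared l≢l′ u≢i u≢j ms) }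
      where
      one-sided : ∀ l {z} → T (Y (suc l) z) → T (adj G′ (χ i) z) → T (Y zero z) → ⊥
      one-sided l tz t Yz = at (χ-Y l tz) t Yz
        where
        at : ∀ {z} → (∃ λ x → χ x ≡ z × T (c l x)) → T (adj G′ (χ i) z) → T (Y zero z) → ⊥
        at (x , refl , _) t Yz = glue-nonadj i x gi (Y⇒C zero x Yz) (adj-χ t)
      not-shared : ∀ {l l′ u} → l ≢ l′ → u ≢ χ i → u ≢ χ j → Meets (Y l) (Y l′) (χ i) u → ⊥
      not-shared {l} {l′} {u} l≢l′ u≢i u≢j ms = let x , y , ex , ey , s = proj₁ (shared-image (χ i) u) (shared⁺ {𝒳 = 𝒴} (isShared (u≢i ∘ sym) l l′ l≢l′ ms)) in
        u≢j (trans (sym ey) (cong χ (only y (subst (λ x → T (Shared 𝒞 x y)) (χ-inj ex) s))))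

    hinge-splittable : Splittable G′ 𝒴
    hinge-splittable = let s , (gi , gj) , (i4 , j4) , _ = hinge in record
      { a = χ i₀ ; b = χ j₀ ; σ = Y zero ; τ = Y zero
      ; nonedge = ¬T⇒≡ (λ t → glue-nonadj i₀ j₀ gi gj (adj-χ t))
      ; shared = χ-shared s
      ; halfA = hinge-half i₀ j₀ gi i4 only-j₀
      ; halfB = hinge-half j₀ i₀ gj j4 only-i₀ }

    skeleton-safeBase : IndependentGraph G′ → SafeBase G′
    skeleton-safeBase ind = complete-safeBase partial ind hinge-splittable

module GluedBase {n m N} {G : Graph n} {𝒳 : Cover n} {a b} {Gs : Graph m} {φ : Fin n → Fin m} {a1 a2 b1 b2} {G′ : Graph N}
             {ψ : Fin m → Fin N} {χ : Fin 8 → Fin N} (B : BaseWith G 𝒳) (S : SafeSplit G 𝒳 a b Gs φ a1 a2 b1 b2)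
             (D : GlueDB Gs a1 a2 b1 b2 G′ ψ χ) where
  open SafeSplit S using (split)
  open BaseWith B using (indepG)
  open Lift split
  open Bound B S using (Kt; key; key-∈; keyPair; rank-bound)
  open Glued indepG split D
  open GlueDB D
  open UnionVia union using (⇒edges)

  glue-neighbour : ∀ y → T (dbGlue y) → ∃ λ x → T (adj Gs (glue y) x)
  glue-neighbour 0f _ = let x , _ , t = NonedgeSplit.nonempA1 split in φ x , t
  glue-neighbour 1f _ = let x , _ , t = NonedgeSplit.nonempB1 split in φ x , t
  glue-neighbour 2f _ = let x , _ , t = NonedgeSplit.nonempA2 split in φ x , t
  glue-neighbour 3f _ = let x , _ , t = NonedgeSplit.nonempB2 split in φ x , t
  glue-neighbour 4f ()
  glue-neighbour 5f ()
  glue-neighbour 6f ()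
  glue-neighbour 7f ()

  GL₂-independent : Independent (map (map² ψ) E^ ++ map (map² χ) (edgeList (adj DB)))
  GL₂-independent = rearranged GL-independent
    where
    GL₂ : List (Pair N)
    GL₂ = map (map² ψ) E^ ++ map (map² χ) (edgeList (adj DB))
    rearranged : Independent GL → Independent GL₂
    rearranged (independent p li) = independent p (indep-of-length search-coord {GL} {GL₂} li covered (ℕₚ.≤-reflexive
      (trans (Listₚ.length-++ (map (map² ψ) E^)) (sym (Listₚ.length-++ (map (map² ψ) E^))))))
      where
      covered : ∀ {e} → e ∈ GL → SpanAt p GL₂ e
      covered m with Memₚ.∈-++⁻ (map (map² ψ) E^) m
      ... | inj₁ mE = span-∈ (Memₚ.∈-++⁺ˡ mE)
      ... | inj₂ mD with Memₚ.∈-map⁻ (map² χ) mD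
      ...   | (u , v) , muv , refl = span-either {L = GL₂} (Data.Sum.map in-GL₂ in-GL₂ (edgeList-covers (adj-sym DB) (irr DB) u v (All.lookup db-in muv)))
        where in-GL₂ : ∀ {e} → e ∈ edgeList (adj DB) → map² χ e ∈ GL₂
              in-GL₂ m = Memₚ.∈-++⁺ʳ (map (map² ψ) E^) (Memₚ.∈-map⁺ (map² χ) m)

  rank-bound′ : ∀ {L} → Independent L → All (λ e → InSet (adj Gs) e ⊎ e ∈ Kt ⊎ swap e ∈ Kt) L → suc (length L) ℕ.≤ length E^ ℕ.+ length Kt
  rank-bound′ {L} h L⊂ = subst (λ e → suc (length L) ℕ.≤ e ℕ.+ length Kt) (sym length-E^) (rank-bound h L⊂)

  module WithSkeleton (Sk : Skeleton DB dbGlue 4f) = GluedCover Sk {Gs = Gs} {G′} {ψ} {χ} glue ψ-inj χ-inj identify meet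
    (λ {x} {y} t → ⇒edges _ _ (inj₁ (x , y , refl , refl , t))) adj-ψ (λ {x} {y} t → ⇒edges _ _ (inj₂ (x , y , refl , refl , t))) (λ {x} {y} → adj-χ {x} {y}) db-glue-nonadj glue-neighbour
    E^-InSet E^-covers GL₂-independent Kt rank-bound′

  -- Folding a₁b₁ and a₂b₂ onto ab shows that they cannot both be spanned by the edges of Gs.
  one-key-free : Independent ((a1 , b1) ∷ E^) ⊎ Independent ((a2 , b2) ∷ E^)
  one-key-free = at-generic (generic (EL ∷ clique (a ∷ b ∷ []) ∷ []) (indepPairs⇒edgeList (adj-sym G) (irr G) indepG ∷
      clique-independent ((a≢b ∷ []) AllPairs.∷ [] AllPairs.∷ AllPairs.[]) (s≤s (s≤s z≤n)) ∷ []))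
    where
    a≢b : a ≢ b
    a≢b = NonedgeSplit.a≢b split
    at-generic : (∃ λ p → All (IndepAt p) (EL ∷ clique (a ∷ b ∷ []) ∷ [])) → Independent ((a1 , b1) ∷ E^) ⊎ Independent ((a2 , b2) ∷ E^)
    at-generic (p , liE ∷ liab ∷ []) = decide (extend? search-coord liE^ (a1 , b1)) (extend? search-coord liE^ (a2 , b2))
      where
      q : Placement m
      q = p ∘ π
      liπ : IndepAt p (map (map² π) E^)
      liπ = subst (IndepAt p) (sym π-E^) liE
      liE^ : IndepAt q E^
      liE^ = indep-fold π p liπ
      folded : Indep (push π ∘ row q) E^
      folded = indep-unmap (map² π) (push-row π p) liπ
      difference : Fin m × Fin 3 → ℚ
      difference i = (- 1#) * row q (a2 , b2) i + row q (a1 , b1) i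
      opaque
        unfolding _+_ isRing
        cancel : ∀ x → (- 1#) * x + x ≡ 0#
        cancel = solve-∀ ℚ-ring
        at-a1 : ∀ x y e → (- 1#) * (e * (0# - 0#)) + (x - y) * (1# - 0#) ≡ x - y
        at-a1 = solve-∀ ℚ-ring
      same-push : ∀ j → push π (row q (a1 , b1)) j ≡ push π (row q (a2 , b2)) j
      same-push j = trans (push-row π p (a1 , b1) j) (trans (cong₂ (λ u v → row p (u , v) j) (trans π-a1 (sym π-a2)) (trans π-b1 (sym π-b2))) (sym (push-row π p (a2 , b2) j)))
      push-difference : ∀ j → push π difference j ≡ 0#
      push-difference j = trans (Linear.lin (push-linear π) (- 1#) (row q (a2 , b2)) (row q (a1 , b1)) j)
        (trans (cong ((- 1#) * push π (row q (a2 , b2)) j +_) (same-push j)) (cancel (push π (row q (a2 , b2)) j)))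
      span-kernel : ∀ {v} → InSpan (row q) E^ v → (∀ j → push π v j ≡ 0#) → ∀ i → v i ≡ 0#
      span-kernel {v} (inSpan (x , e)) z i = trans (e i) (∑-0 (λ l → trans (cong (_* row q (lookup E^ l) i) (x≡0 l)) (zeroˡ _)))
        where
        x≡0 : ∀ l → x l ≡ 0#
        x≡0 = indep folded x (λ j → trans (sym (Linear.map-comb (push-linear π) (row q ∘ lookup E^) x j)) (trans (sym (Linear.resp (push-linear π) e j)) (z j)))
      decide : SpanAt q E^ (a1 , b1) ⊎ IndepAt q ((a1 , b1) ∷ E^) → SpanAt q E^ (a2 , b2) ⊎ IndepAt q ((a2 , b2) ∷ E^) →
        Independent ((a1 , b1) ∷ E^) ⊎ Independent ((a2 , b2) ∷ E^)
      decide (inj₂ li) _ = inj₁ (independent q li)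
      decide (inj₁ _) (inj₂ li) = inj₂ (independent q li)
      decide (inj₁ s₁) (inj₁ s₂) = ⊥-elim (indep-head liab (span-0 λ { (w , c) → trans (cong (_* (δ a w - δ b w)) (pa≡pb c)) (zeroˡ _) }))
        where
        open NonedgeSplit split using (a1≢a2; a1≢b1; a1≢b2)
        diff≡0 : ∀ i → difference i ≡ 0#
        diff≡0 = span-kernel (span-lin (- 1#) s₂ s₁) push-difference
        pa≡pb : ∀ c → p a c - p b c ≡ 0#
        pa≡pb c = trans (cong₂ (λ x y → p x c - p y c) (sym π-a1) (sym π-b1)) (trans (sym (at-a1 (q a1 c) (q b1 c) (q a2 c - q b2 c)))
          (trans (sym (cong₂ (λ s t → (- 1#) * s + t)
            (cong₂ (λ s t → (q a2 c - q b2 c) * (s - t)) (δ-≢ a1≢a2) (δ-≢ a1≢b2))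
            (cong₂ (λ s t → (q a1 c - q b1 c) * (s - t)) (δ-≡ a1) (δ-≢ a1≢b1)))) (diff≡0 (a1 , c))))

  module WithEar (𝒳H : Cover 8) (C : SafeEarCover DoubleButterfly 𝒳H dbGlue)
    (corresponds : ∀ x y → T (dbGlue x) → T (dbGlue y) → KeyPairSplit G 𝒳 a b Gs φ a1 a2 b1 b2 (glue x) (glue y) → T (KeyPairsEar 𝒳H dbGlue x y)) where
    open Ear 𝒳H C
    open SafeSplit S using (S1; shared)

    ifPair : Bool → Bool → Bool → List (Pair m)
    ifPair c s t = if c then keyPair (s , t) ∷ [] else []

    Kt-cases : ∀ {k₁ k₂ k₃ k₄} → key true true ≡ k₁ → key true false ≡ k₂ → key false true ≡ k₃ → key false false ≡ k₄ →
      Kt ≡ ifPair k₁ true true ++ (ifPair k₂ true false ++ (ifPair k₃ false true ++ ifPair k₄ false false))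
    Kt-cases refl refl refl refl = refl

    key-split : ∀ s t → T (key s t) → KeyPairSplit G 𝒳 a b Gs φ a1 a2 b1 b2 (copyA s) (copyB t)
    key-split s t h with anyF⁻ _ h
    ... | i , ti = copies-≢ s t , inj₁ (i , ((copyA s , copyB t , φ x , copies-≢ s t , (λ e → φ-old x x-old (newA s (sym e))) , (λ e → φ-old x x-old (newB t (sym e))) , inA , inB ,
            inj₁ (x , proj₁ x-old , proj₂ x-old , proj₁ (proj₂ sideA) , refl)) , S1 i a b shared nonedge Xa Xb) , inA , inB)
      where
      open NonedgeSplit split
      Xa : T (X 𝒳 i a)
      Xa = T∧ˡ ti
      t₁ : T (X 𝒳 i b ∧ Bound.SA B S i s ∧ Bound.SB B S i t)
      t₁ = T∧ʳ {X 𝒳 i a} ti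
      Xb : T (X 𝒳 i b)
      Xb = T∧ˡ t₁
      sideA : Bound.HA.Side B S i s
      sideA = Bound.SA⁻ B S (T∧ˡ (T∧ʳ {X 𝒳 i b} t₁))
      sideB : Bound.HB.Side B S i t
      sideB = Bound.SB⁻ B S (T∧ʳ {Bound.SA B S i s} (T∧ʳ {X 𝒳 i b} t₁))
      x : Fin n
      x = proj₁ sideA
      x-old : Old x
      x-old = nbr-a (proj₁ (proj₂ (proj₂ sideA)))
      newA : ∀ s {y} → y ≡ copyA s → New y
      newA true e = inj₁ e
      newA false e = inj₂ (inj₁ e)
      newB : ∀ t {y} → y ≡ copyB t → New y
      newB true e = inj₂ (inj₂ (inj₁ e))
      newB false e = inj₂ (inj₂ (inj₂ e))
      copies-≢ : ∀ s t → copyA s ≢ copyB t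
      copies-≢ true true = a1≢b1
      copies-≢ true false = a1≢b2
      copies-≢ false true = a2≢b1
      copies-≢ false false = a2≢b2
      inA : InSplit G 𝒳 a b Gs φ a1 a2 b1 b2 i (copyA s)
      inA with sideA
      ... | y , Xy , ay , refl = inj₂ (newA (σ y) refl , y , proj₁ (nbr-a ay) , proj₂ (nbr-a ay) , Xy , chosen-a ay)
      inB : InSplit G 𝒳 a b Gs φ a1 a2 b1 b2 i (copyB t)
      inB with sideB
      ... | y , Xy , by , refl = inj₂ (newB (τ y) refl , y , proj₁ (nbr-b by) , proj₂ (nbr-b by) , Xy , chosen-b by)

    ear₁₁ : key true true ≡ true → T (Key 0f 1f)
    ear₁₁ e = corresponds 0f 1f tt tt (key-split true true (≡⇒T e))
    ear₁₂ : key true false ≡ true → T (Key 0f 3f)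
    ear₁₂ e = corresponds 0f 3f tt tt (key-split true false (≡⇒T e))
    ear₂₁ : key false true ≡ true → T (Key 2f 1f)
    ear₂₁ e = corresponds 2f 1f tt tt (key-split false true (≡⇒T e))
    ear₂₂ : key false false ≡ true → T (Key 2f 3f)
    ear₂₂ e = corresponds 2f 3f tt tt (key-split false false (≡⇒T e))

    from-one-key : (Sk : Skeleton DB dbGlue 4f) → Skeleton.excess Sk ≡ 0 → Kt ≡ map (map² glue) (Skeleton.keys Sk) → SafeBase G′
    from-one-key Sk no-excess Kt≡ = WithSkeleton.skeleton-safeBase Sk Kt≡ E^ (All.map inj₁ E^-InSet) (E^-independent indepG)
      (trans (sym (ℕₚ.+-identityʳ _)) (cong (length E^ ℕ.+_) (sym no-excess))) glued-independent

    from-two-keys : Kt ≡ map (map² glue) (Skeleton.keys wings-skeleton) → SafeBase G′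
    from-two-keys Kt≡ = [ (λ h → build (a1 , b1) (here refl) h) , (λ h → build (a2 , b2) (there (here refl)) h) ]′ one-key-free
      where
      build : ∀ e → e ∈ map (map² glue) (Skeleton.keys wings-skeleton) → Independent (e ∷ E^) → SafeBase G′
      build e mem h = WithSkeleton.skeleton-safeBase wings-skeleton Kt≡ (e ∷ E^) (inj₂ (subst (e ∈_) (sym Kt≡) mem) ∷ All.map inj₁ E^-InSet) h
        (ℕₚ.+-comm 1 (length E^)) glued-independent

    no-keys : Kt ≡ [] → SafeBase G′
    no-keys Kt≡ = ⊥-elim (ℕₚ.<⇒≱ (rank-bound (E^-independent indepG) (All.map inj₁ E^-InSet))
      (ℕₚ.≤-reflexive (trans (cong (λ L → numPairs (adj G) ℕ.+ length L) Kt≡) (trans (ℕₚ.+-identityʳ _) (sym length-E^)))))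

    by-keys : ∀ k₁ k₂ k₃ k₄ → key true true ≡ k₁ → key true false ≡ k₂ → key false true ≡ k₃ → key false false ≡ k₄ → SafeBase G′
    by-keys true true _ _ e₁ e₂ e₃ e₄ = ⊥-elim (not-a₁b₁-a₁b₂ (ear₁₁ e₁) (ear₁₂ e₂))
    by-keys true false true _ e₁ e₂ e₃ e₄ = ⊥-elim (not-a₁b₁-a₂b₁ (ear₁₁ e₁) (ear₂₁ e₃))
    by-keys true false false true e₁ e₂ e₃ e₄ = from-two-keys (Kt-cases e₁ e₂ e₃ e₄)
    by-keys true false false false e₁ e₂ e₃ e₄ = from-one-key skeleton₁₁ refl (Kt-cases e₁ e₂ e₃ e₄)
    by-keys false true true _ e₁ e₂ e₃ e₄ = ⊥-elim (not-a₁b₂-a₂b₁ (ear₁₂ e₂) (ear₂₁ e₃))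
    by-keys false true false true e₁ e₂ e₃ e₄ = ⊥-elim (not-a₂b₂-a₁b₂ (ear₂₂ e₄) (ear₁₂ e₂))
    by-keys false true false false e₁ e₂ e₃ e₄ = from-one-key skeleton₁₂ refl (Kt-cases e₁ e₂ e₃ e₄)
    by-keys false false true true e₁ e₂ e₃ e₄ = ⊥-elim (not-a₂b₂-a₂b₁ (ear₂₂ e₄) (ear₂₁ e₃))
    by-keys false false true false e₁ e₂ e₃ e₄ = from-one-key skeleton₂₁ refl (Kt-cases e₁ e₂ e₃ e₄)
    by-keys false false false true e₁ e₂ e₃ e₄ = from-one-key skeleton₂₂ refl (Kt-cases e₁ e₂ e₃ e₄)
    by-keys false false false false e₁ e₂ e₃ e₄ = no-keys (Kt-cases e₁ e₂ e₃ e₄)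

    glued-safeBase : SafeBase G′
    glued-safeBase = by-keys _ _ _ _ refl refl refl refl

theorem7 : (∀ {n m N : ℕ} (G : Graph n) (𝒳 : Cover n) → BaseWith G 𝒳 →
    (a b : Fin n) (Gs : Graph m) (φ : Fin n → Fin m) (a1 a2 b1 b2 : Fin m) →
    SafeSplit G 𝒳 a b Gs φ a1 a2 b1 b2 →
    (𝒳H : Cover 8) → SafeEarCover DoubleButterfly 𝒳H dbGlue →
    (∀ x y → T (dbGlue x) → T (dbGlue y) →
    (KeyPairSplit G 𝒳 a b Gs φ a1 a2 b1 b2 (glueMap a1 b1 a2 b2 x) (glueMap a1 b1 a2 b2 y) →
    T (KeyPairsEar 𝒳H dbGlue x y)) ×
    (T (KeyPairsEar 𝒳H dbGlue x y) →
    KeyPairSplit G 𝒳 a b Gs φ a1 a2 b1 b2 (glueMap a1 b1 a2 b2 x) (glueMap a1 b1 a2 b2 y))) →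
    (G' : Graph N) (ψ : Fin m → Fin N) (χ : Fin 8 → Fin N) →
    GlueDB Gs a1 a2 b1 b2 G' ψ χ →
    SafeBase G') ×
    (∀ {n₁ n₂ N : ℕ} (k : ℕ) (G₁ : Graph n₁) (G₂ : Graph n₂) →
    SafeBase G₁ → IndependentGraph G₂ →
    (G' : Graph N) (f₁ : Fin n₁ → Fin N) (f₂ : Fin n₂ → Fin N) →
    KSum k G₁ G₂ G' f₁ f₂ →
    SafeBase G') ×
    (∀ {n N : ℕ} (G : Graph n) → SafeBase G →
    (G' : Graph N) (f : Fin n → Fin N) (w : Fin N) →
    Henneberg1 G G' f w →
    SafeBase G')
theorem7 =
  (λ G 𝒳 B a b Gs φ a1 a2 b1 b2 S 𝒳H C corresponds G′ ψ χ D →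
    GluedBase.WithEar.glued-safeBase B S D 𝒳H C (λ x y gx gy → proj₁ (corresponds x y gx gy))) ,
  (λ k G₁ G₂ base ind G′ f₁ f₂ S → kSum-safeBase S base ind) ,
  (λ G base G′ f w H → henneberg1-safeBase G base G′ f w H)
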